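{- There are no repeated values in the sequence $\{\mathrm{Tr}\,T_2(2k,\mathrm{SL}_2(\mathbb{Z}))\}_{k\geq 2}$ (indexed by integers $k \ge 2$), except for $0$, which occurs only trivially, when $k<6$ or $k=7$. That is: (1) if $k\neq k'$ are integers with $k,k'\ge 2$ and $\mathrm{Tr}\,T_2(2k,\mathrm{SL}_2(\mathbb{Z}))=\mathrm{Tr}\,T_2(2k',\mathrm{SL}_2(\mathbb{Z}))$, then this common value is $0$; and (2) for an integer $k\ge 2$, $\mathrm{Tr}\,T_2(2k,\mathrm{SL}_2(\mathbb{Z}))=0$ if and only if $k<6$ or $k=7$.
   Context: For an integer $k\geq 2$, $\mathrm{Tr}\,T_2(2k,\mathrm{SL}_2(\mathbb{Z}))$ denotes the trace of the Hecke operator $T_2$ acting on the complex vector space $\mathcal{S}_{2k}(\mathrm{SL}_2(\mathbb{Z}))$ of cusp forms of weight $2k$ and level one. Here $T_2$ has the standard normalization: if $f=\sum_{n\ge1}c(n)q^n$, then $T_2f=\sum_{n\ge1}\left(c(2n)+2^{2k-1}c(n/2)\right)q^n$, with $c(n/2)=0$ for $n$ odd. The trace on the zero space is $0$; for $k\ge 2$, $\mathcal{S}_{2k}(\mathrm{SL}_2(\mathbb{Z}))=0$ precisely when $k<6$ or $k=7$. -}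

module Defs where

open import Algebra.Bundles using (RawRing)
import Algebra.Definitions.RawSemiring as RawSemiringDefs
open import Data.Fin.Base using (Fin; toℕ)
open import Data.Integer.Base as ℤ using (ℤ; +_; 1ℤ)
open import Data.Nat.Base as ℕ using (ℕ; suc; _!)
open import Data.Nat.Divisibility using (_∣?_; divides)
import Data.Nat.Properties as ℕₚ
open import Data.Product.Base using (Σ; ∃; _×_; _,_; proj₁; proj₂)
open import Data.Rational.Base as ℚ using (ℚ; 0ℚ; 1ℚ; ½)
import Data.Rational.Properties as ℚₚ
open import Data.Rational.Solver using (module +-*-Solver)
open import Data.Vec.Functional using (Vector)
open import Function.Base using (_∘_)
open import Level using (0ℓ)
open import Relation.Binary.PropositionalEquality
  using (_≡_; refl; sym; trans; cong; cong₂; subst)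
open import Relation.Nullary using (¬_; yes; no)

Eventually : (ℕ → Set) → Set
Eventually P = ∃ λ N → ∀ n → N ℕ.≤ n → P n

IsCauchy : (ℕ → ℚ) → Set
IsCauchy x = ∀ ε → 0ℚ ℚ.< ε →
  ∃ λ N → ∀ m n → N ℕ.≤ m → N ℕ.≤ n → ℚ.∣ x m ℚ.- x n ∣ ℚ.< ε

record ℝ : Set where
  constructor mkℝ
  field
    seq    : ℕ → ℚ
    cauchy : IsCauchy seq

open ℝ public

private
  half-pos : ∀ {ε} → 0ℚ ℚ.< ε → 0ℚ ℚ.< ½ ℚ.* ε
  half-pos {ε} ε>0 =
    subst (ℚ._< ½ ℚ.* ε) (ℚₚ.*-zeroʳ ½) (ℚₚ.*-monoʳ-<-pos ½ ε>0)

  half+half : ∀ ε → ½ ℚ.* ε ℚ.+ ½ ℚ.* ε ≡ ε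
  half+half = solve 1 (λ e → con ½ :* e :+ con ½ :* e := e) refl
    where open +-*-Solver

  const-cauchy : ∀ q → IsCauchy (λ _ → q)
  const-cauchy q ε ε>0 =
    0 , λ _ _ _ _ → subst (λ r → ℚ.∣ r ∣ ℚ.< ε) (sym (ℚₚ.+-inverseʳ q)) ε>0

  neg-cauchy : ∀ x → IsCauchy (λ n → ℚ.- seq x n)
  neg-cauchy x ε ε>0 with cauchy x ε ε>0
  ... | N , h = N , λ m n N≤m N≤n →
    subst (ℚ._< ε)
      (trans (sym (ℚₚ.∣-p∣≡∣p∣ (seq x m ℚ.- seq x n)))
             (cong ℚ.∣_∣ (eq (seq x m) (seq x n))))
      (h m n N≤m N≤n)
    where
    open +-*-Solver
    eq : ∀ a b → ℚ.- (a ℚ.- b) ≡ ℚ.- a ℚ.- (ℚ.- b)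
    eq = solve 2 (λ a b → :- (a :- b) := :- a :- (:- b)) refl

  add-cauchy : ∀ x y → IsCauchy (λ n → seq x n ℚ.+ seq y n)
  add-cauchy x y ε ε>0
    with cauchy x (½ ℚ.* ε) (half-pos ε>0) | cauchy y (½ ℚ.* ε) (half-pos ε>0)
  ... | M , hx | N , hy = M ℕ.⊔ N , λ m n p q → begin-strict
    ℚ.∣ (seq x m ℚ.+ seq y m) ℚ.- (seq x n ℚ.+ seq y n) ∣
      ≡⟨ cong ℚ.∣_∣ (eq (seq x m) (seq y m) (seq x n) (seq y n)) ⟩
    ℚ.∣ (seq x m ℚ.- seq x n) ℚ.+ (seq y m ℚ.- seq y n) ∣
      ≤⟨ ℚₚ.∣p+q∣≤∣p∣+∣q∣ (seq x m ℚ.- seq x n) (seq y m ℚ.- seq y n) ⟩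
    ℚ.∣ seq x m ℚ.- seq x n ∣ ℚ.+ ℚ.∣ seq y m ℚ.- seq y n ∣
      <⟨ ℚₚ.+-mono-< (hx m n (ℕₚ.m⊔n≤o⇒m≤o M N p) (ℕₚ.m⊔n≤o⇒m≤o M N q))
                     (hy m n (ℕₚ.m⊔n≤o⇒n≤o M N p) (ℕₚ.m⊔n≤o⇒n≤o M N q)) ⟩
    ½ ℚ.* ε ℚ.+ ½ ℚ.* ε
      ≡⟨ half+half ε ⟩
    ε ∎
    where
    open ℚₚ.≤-Reasoning
    open +-*-Solver
    eq : ∀ a b c d →
         (a ℚ.+ b) ℚ.- (c ℚ.+ d) ≡ (a ℚ.- c) ℚ.+ (b ℚ.- d)
    eq = solve 4 (λ a b c d → (a :+ b) :- (c :+ d) := (a :- c) :+ (b :- d)) refl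

  bounded : ∀ x → ∃ λ B → 0ℚ ℚ.< B × Eventually (λ n → ℚ.∣ seq x n ∣ ℚ.≤ B)
  bounded x with cauchy x 1ℚ (ℚₚ.positive⁻¹ 1ℚ)
  ... | N , h = 1ℚ ℚ.+ ℚ.∣ seq x N ∣ , pos , N , bound
    where
    open ℚₚ.≤-Reasoning
    open +-*-Solver
    eq : ∀ a b → a ≡ (a ℚ.- b) ℚ.+ b
    eq = solve 2 (λ a b → a := (a :- b) :+ b) refl
    pos : 0ℚ ℚ.< 1ℚ ℚ.+ ℚ.∣ seq x N ∣
    pos = ℚₚ.+-mono-<-≤ (ℚₚ.positive⁻¹ 1ℚ) (ℚₚ.0≤∣p∣ (seq x N))
    bound : ∀ n → N ℕ.≤ n → ℚ.∣ seq x n ∣ ℚ.≤ 1ℚ ℚ.+ ℚ.∣ seq x N ∣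
    bound n N≤n = begin
      ℚ.∣ seq x n ∣
        ≡⟨ cong ℚ.∣_∣ (eq (seq x n) (seq x N)) ⟩
      ℚ.∣ (seq x n ℚ.- seq x N) ℚ.+ seq x N ∣
        ≤⟨ ℚₚ.∣p+q∣≤∣p∣+∣q∣ (seq x n ℚ.- seq x N) (seq x N) ⟩
      ℚ.∣ seq x n ℚ.- seq x N ∣ ℚ.+ ℚ.∣ seq x N ∣
        ≤⟨ ℚₚ.+-monoˡ-≤ ℚ.∣ seq x N ∣ (ℚₚ.<⇒≤ (h n N N≤n ℕₚ.≤-refl)) ⟩
      1ℚ ℚ.+ ℚ.∣ seq x N ∣ ∎

  divide : ∀ {B δ} → 0ℚ ℚ.< B → 0ℚ ℚ.< δ → ∃ λ η → 0ℚ ℚ.< η × B ℚ.* η ≡ δ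
  divide {B} {δ} B>0 δ>0 = B⁻¹ ℚ.* δ , η>0 , eq
    where
    instance
      posB = ℚ.positive B>0
      nzB  = ℚₚ.pos⇒nonZero B
    B⁻¹ = ℚ.1/ B
    η>0 : 0ℚ ℚ.< B⁻¹ ℚ.* δ
    η>0 = subst (ℚ._< B⁻¹ ℚ.* δ) (ℚₚ.*-zeroʳ B⁻¹)
            (ℚₚ.*-monoʳ-<-pos B⁻¹ {{ℚₚ.1/pos⇒pos B}} δ>0)
    eq : B ℚ.* (B⁻¹ ℚ.* δ) ≡ δ
    eq = trans (sym (ℚₚ.*-assoc B B⁻¹ δ))
           (trans (cong (ℚ._* δ) (ℚₚ.*-inverseʳ B)) (ℚₚ.*-identityˡ δ))

  mul-bound : ∀ {a b B η} → 0ℚ ℚ.< B → 0ℚ ℚ.< η →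
              ℚ.∣ a ∣ ℚ.≤ B → ℚ.∣ b ∣ ℚ.< η → ℚ.∣ a ℚ.* b ∣ ℚ.< B ℚ.* η
  mul-bound {a} {b} {B} {η} B>0 η>0 a≤B b<η = begin-strict
    ℚ.∣ a ℚ.* b ∣         ≡⟨ ℚₚ.∣p*q∣≡∣p∣*∣q∣ a b ⟩
    ℚ.∣ a ∣ ℚ.* ℚ.∣ b ∣   ≤⟨ ℚₚ.*-monoʳ-≤-nonNeg ℚ.∣ b ∣
                               {{ℚ.nonNegative (ℚₚ.0≤∣p∣ b)}} a≤B ⟩
    B ℚ.* ℚ.∣ b ∣         <⟨ ℚₚ.*-monoʳ-<-pos B {{ℚ.positive B>0}} b<η ⟩
    B ℚ.* η               ∎
    where open ℚₚ.≤-Reasoning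

  mul-close : ∀ a b c d {A B η θ} →
              0ℚ ℚ.< A → 0ℚ ℚ.< η → 0ℚ ℚ.< B → 0ℚ ℚ.< θ →
              ℚ.∣ a ∣ ℚ.≤ A → ℚ.∣ b ℚ.- d ∣ ℚ.< η →
              ℚ.∣ d ∣ ℚ.≤ B → ℚ.∣ a ℚ.- c ∣ ℚ.< θ →
              ℚ.∣ a ℚ.* b ℚ.- c ℚ.* d ∣ ℚ.< A ℚ.* η ℚ.+ B ℚ.* θ
  mul-close a b c d {A} {B} {η} {θ} A>0 η>0 B>0 θ>0 ha hbd hd hac = begin-strict
    ℚ.∣ a ℚ.* b ℚ.- c ℚ.* d ∣
      ≡⟨ cong ℚ.∣_∣ (eq a b c d) ⟩
    ℚ.∣ a ℚ.* (b ℚ.- d) ℚ.+ d ℚ.* (a ℚ.- c) ∣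
      ≤⟨ ℚₚ.∣p+q∣≤∣p∣+∣q∣ (a ℚ.* (b ℚ.- d)) (d ℚ.* (a ℚ.- c)) ⟩
    ℚ.∣ a ℚ.* (b ℚ.- d) ∣ ℚ.+ ℚ.∣ d ℚ.* (a ℚ.- c) ∣
      <⟨ ℚₚ.+-mono-< (mul-bound {a} {b ℚ.- d} A>0 η>0 ha hbd)
                     (mul-bound {d} {a ℚ.- c} B>0 θ>0 hd hac) ⟩
    A ℚ.* η ℚ.+ B ℚ.* θ ∎
    where
    open ℚₚ.≤-Reasoning
    open +-*-Solver
    eq : ∀ a b c d →
         a ℚ.* b ℚ.- c ℚ.* d ≡ a ℚ.* (b ℚ.- d) ℚ.+ d ℚ.* (a ℚ.- c)
    eq = solve 4 (λ a b c d →
           a :* b :- c :* d := a :* (b :- d) :+ d :* (a :- c)) refl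

  mul-cauchy : ∀ x y → IsCauchy (λ n → seq x n ℚ.* seq y n)
  mul-cauchy x y ε ε>0 =
    let A , A>0 , K , hA = bounded x
        B , B>0 , L , hB = bounded y
        η , η>0 , Aη = divide A>0 (half-pos ε>0)
        θ , θ>0 , Bθ = divide B>0 (half-pos ε>0)
        N , hy = cauchy y η η>0
        M , hx = cauchy x θ θ>0
        total : A ℚ.* η ℚ.+ B ℚ.* θ ≡ ε
        total = trans (cong₂ ℚ._+_ Aη Bθ) (half+half ε)
    in (K ℕ.⊔ L) ℕ.⊔ (N ℕ.⊔ M) , λ m n p q →
    let KL≤m = ℕₚ.m⊔n≤o⇒m≤o (K ℕ.⊔ L) (N ℕ.⊔ M) p
        KL≤n = ℕₚ.m⊔n≤o⇒m≤o (K ℕ.⊔ L) (N ℕ.⊔ M) q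
        NM≤m = ℕₚ.m⊔n≤o⇒n≤o (K ℕ.⊔ L) (N ℕ.⊔ M) p
        NM≤n = ℕₚ.m⊔n≤o⇒n≤o (K ℕ.⊔ L) (N ℕ.⊔ M) q
    in subst (ℚ.∣ seq x m ℚ.* seq y m ℚ.- seq x n ℚ.* seq y n ∣ ℚ.<_) total
         (mul-close (seq x m) (seq y m) (seq x n) (seq y n) A>0 η>0 B>0 θ>0
           (hA m (ℕₚ.m⊔n≤o⇒m≤o K L KL≤m))
           (hy m n (ℕₚ.m⊔n≤o⇒m≤o N M NM≤m) (ℕₚ.m⊔n≤o⇒m≤o N M NM≤n))
           (hB n (ℕₚ.m⊔n≤o⇒n≤o K L KL≤n))
           (hx m n (ℕₚ.m⊔n≤o⇒n≤o N M NM≤m) (ℕₚ.m⊔n≤o⇒n≤o N M NM≤n)))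

-- Opaque only for type-checking speed: otherwise normalising types that
-- mention these operations unfolds the Cauchy proofs.
opaque
  infixl 7 _*ℝ_
  infixl 6 _+ℝ_
  infix  8 -ℝ_

  fromℚ : ℚ → ℝ
  fromℚ q = mkℝ (λ _ → q) (const-cauchy q)

  _+ℝ_ : ℝ → ℝ → ℝ
  x +ℝ y = mkℝ (λ n → seq x n ℚ.+ seq y n) (add-cauchy x y)

  _*ℝ_ : ℝ → ℝ → ℝ
  x *ℝ y = mkℝ (λ n → seq x n ℚ.* seq y n) (mul-cauchy x y)

  -ℝ_ : ℝ → ℝ
  -ℝ x = mkℝ (λ n → ℚ.- seq x n) (neg-cauchy x)

infix 4 _≈ℝ_

record _≈ℝ_ (x y : ℝ) : Set where
  field
    close : ∀ ε → 0ℚ ℚ.< ε → Eventually λ n → ℚ.∣ seq x n ℚ.- seq y n ∣ ℚ.< ε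

ℝ-rawRing : RawRing 0ℓ 0ℓ
ℝ-rawRing = record
  { Carrier = ℝ
  ; _≈_     = _≈ℝ_
  ; _+_     = _+ℝ_
  ; _*_     = _*ℝ_
  ; -_      = -ℝ_
  ; 0#      = fromℚ 0ℚ
  ; 1#      = fromℚ 1ℚ
  }

module R where
  open RawRing ℝ-rawRing public
  open RawSemiringDefs rawSemiring public using (sum)

  infix 4 _<_ _≤_
  infixl 6 _-_

  _-_ : ℝ → ℝ → ℝ
  x - y = x + (- y)

  record _<_ (x y : ℝ) : Set where
    field
      gap       : ℚ
      gap>0     : 0ℚ ℚ.< gap
      separated : Eventually λ n → seq x n ℚ.+ gap ℚ.< seq y n

  _≤_ : ℝ → ℝ → Set
  x ≤ y = ¬ (y < x)

  ConvergesTo : (ℕ → ℝ) → ℝ → Set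
  ConvergesTo s ℓ = ∀ ε → 0ℚ ℚ.< ε → Eventually λ n →
    - fromℚ ε < s n - ℓ × s n - ℓ < fromℚ ε

  HasSum : (ℕ → ℝ) → ℝ → Set
  HasSum a = ConvergesTo (λ n → sum {n} (a ∘ toℕ))

  -- Leibniz: π = Σ 4 (-1)ⁿ / (2n + 1).
  IsPi : ℝ → Set
  IsPi = HasSum λ n → fromℚ ((ℤ.- 1ℤ) ℤ.^ n ℤ.* + 4 ℚ./ suc (2 ℕ.* n))

record ℂ : Set where
  constructor mkℂ
  field
    re im : ℝ

open ℂ public

ℂ-rawRing : RawRing 0ℓ 0ℓ
ℂ-rawRing = record
  { Carrier = ℂ
  ; _≈_     = λ z w → re z R.≈ re w × im z R.≈ im w
  ; _+_     = λ z w → mkℂ (re z R.+ re w) (im z R.+ im w)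
  ; _*_     = λ z w → mkℂ (re z R.* re w R.- im z R.* im w)
                          (re z R.* im w R.+ im z R.* re w)
  ; -_      = λ z → mkℂ (R.- re z) (R.- im z)
  ; 0#      = mkℂ R.0# R.0#
  ; 1#      = mkℂ R.1# R.0#
  }

open RawRing ℂ-rawRing public
  using (_≈_; _+_; _*_; -_; 0#; 1#)
open RawSemiringDefs (RawRing.rawSemiring ℂ-rawRing) public
  using (_^_; sum)

infixl 6 _-_

_-_ : ℂ → ℂ → ℂ
z - w = z + (- w)

ofℝ : ℝ → ℂ
ofℝ x = mkℂ x R.0#

ofℚ : ℚ → ℂ
ofℚ q = ofℝ (fromℚ q)

ofℤ : ℤ → ℂ
ofℤ a = ofℚ (a ℚ./ 1)

𝕚 : ℂ
𝕚 = mkℂ R.0# R.1#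

∣_∣² : ℂ → ℝ
∣ z ∣² = re z R.* re z R.+ im z R.* im z

HasSum : (ℕ → ℂ) → ℂ → Set
HasSum a s = R.HasSum (re ∘ a) (re s) × R.HasSum (im ∘ a) (im s)

IsExp : ℂ → ℂ → Set
IsExp z = HasSum λ n → ofℚ ((+ 1 ℚ./ (n !)) {{n ℕₚ.!≢0}}) * z ^ n

ℍ : Set
ℍ = Σ ℂ λ z → R.0# R.< im z

-- q = exp (2πiz), as a relation: exp is given by its power series.
IsNome : ℍ → ℂ → Set
IsNome (z , _) q = ∃ λ π → R.IsPi π × IsExp (ofℤ (+ 2) * ofℝ π * 𝕚 * z) q

HasDerivativeAt : (ℍ → ℂ) → ℍ → ℂ → Set
HasDerivativeAt f z D = ∀ ε → 0ℚ ℚ.< ε → ∃ λ δ → 0ℚ ℚ.< δ ×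
  (∀ w → let h = proj₁ w - proj₁ z in
     ∣ h ∣² R.< fromℚ (δ ℚ.* δ) →
     ∣ f w - f z - D * h ∣² R.≤ fromℚ (ε ℚ.* ε) R.* ∣ h ∣²)

IsHolomorphic : (ℍ → ℂ) → Set
IsHolomorphic f = ∀ z → ∃ (HasDerivativeAt f z)

record SL₂ℤ : Set where
  field
    a b c d : ℤ
    det≡1   : a ℤ.* d ℤ.- b ℤ.* c ≡ 1ℤ

denom : SL₂ℤ → ℍ → ℂ
denom γ (z , _) = ofℤ c * z + ofℤ d
  where open SL₂ℤ γ

-- w = γz, in the form (cz + d) w = az + b, which needs no complex division.
IsImage : SL₂ℤ → ℍ → ℍ → Set
IsImage γ z w = denom γ z * proj₁ w ≈ ofℤ a * proj₁ z + ofℤ b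
  where open SL₂ℤ γ

-- Holomorphy at the cusp is expansion: a q-series with no negative powers that
-- converges on all of ℍ.  Given that, vanishing at the cusp is cuspidal.
record CuspForm (weight : ℕ) : Set where
  field
    fun         : ℍ → ℂ
    coeff       : ℕ → ℂ
    holomorphic : IsHolomorphic fun
    modular     : ∀ γ z w → IsImage γ z w →
                  fun w ≈ denom γ z ^ weight * fun z
    expansion   : ∀ z q → IsNome z q → HasSum (λ n → coeff n * q ^ n) (fun z)
    cuspidal    : coeff 0 ≈ 0#

open CuspForm public using (fun; coeff)

-- c (n / 2), read as 0 when n is odd
atHalf : (ℕ → ℂ) → ℕ → ℂ
atHalf c n with 2 ∣? n
... | yes (divides m _) = c m
... | no  _             = 0#

module _ {weight : ℕ} where

  linComb : ∀ {d} → Vector ℂ d → Vector (CuspForm weight) d → ℍ → ℂ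
  linComb a f z = sum λ i → a i * fun (f i) z

  IsBasis : ∀ {d} → Vector (CuspForm weight) d → Set
  IsBasis {d} f = LinearlyIndependent × Spanning
    where
    LinearlyIndependent : Set
    LinearlyIndependent =
      ∀ (a : Vector ℂ d) → (∀ z → linComb a f z ≈ 0#) → ∀ i → a i ≈ 0#

    Spanning : Set
    Spanning = ∀ (g : CuspForm weight) →
      ∃ λ (a : Vector ℂ d) → ∀ z → fun g z ≈ linComb a f z

  -- g = T₂ f
  IsT₂ : CuspForm weight → CuspForm weight → Set
  IsT₂ f g = ∀ n → coeff g n ≈
    coeff f (2 ℕ.* n) + ofℤ (+ 2) ^ (weight ℕ.∸ 1) * atHalf (coeff f) n

  -- T₂ fⱼ = Σᵢ Aᵢⱼ fᵢ for every j
  IsMatrixOfT₂ : ∀ {d} → Vector (CuspForm weight) d → (Fin d → Fin d → ℂ) → Set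
  IsMatrixOfT₂ f A = ∀ j → ∃ λ (g : CuspForm weight) →
    IsT₂ (f j) g × (∀ z → fun g z ≈ linComb (λ i → A i j) f z)

IsTraceT₂ : ℕ → ℂ → Set
IsTraceT₂ weight t =
  ∃ λ d → ∃ λ (f : Vector (CuspForm weight) d) → ∃ λ (A : Fin d → Fin d → ℂ) →
  IsBasis f × IsMatrixOfT₂ f A × t ≈ sum (λ i → A i i)

-- The forms of level 2 are C[P,p]; U_2 and the Fricke involution act on them explicitly, and U_2 + 2^(k-1) W extends T_2, so
-- Tr T_2(2k) = -1 - u(2k-1) + e_k 2^(k-1) with u(n) = u(n-1) - 2 u(n-2) and e_k = 1, -1, 0 for k = 0, 1, other mod 4.
-- A repetition at k and k' then forces k = k' mod 96 (modulo 2^8 193) and k = k' by 7-adic descent.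
module Submission where
open import Data.Nat.Base as ℕ using (ℕ;⌊_/2⌋) renaming (zero to z0;suc to sC)
import Data.Nat.Properties as ℕₚ
open import Data.Integer.Base as ℤ using (ℤ;+_;1ℤ;0ℤ)
import Data.Integer.Properties as ℤₚ
open import Data.Product.Base using (∃;_×_;_,_) renaming (proj₁ to pF;proj₂ to pS)
open import Data.Sum.Base using (_⊎_) renaming (inj₁ to iL;inj₂ to iR)
open import Data.Unit.Base using (tt)
open import Data.Empty using (⊥;⊥-elim)
open import Algebra.Bundles using (CommutativeRing;RawRing;Semiring)
open import Relation.Binary.PropositionalEquality as ≡ using (_≡_;_≢_;cong₂) renaming (subst to sB;cong to cO)
infixr 6 _=~_ _=!_
infix 5 !=_
data Path{a} {A : Set a}(x z : A): Set a where
 _=!_ : ∀ {y}-> x ≡ y -> y ≡ z -> Path x z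
 _=~_ : ∀ {y}-> x ≡ y -> Path y z -> Path x z
!=_ : ∀ {a} {A : Set a} {x z : A}-> Path x z -> x ≡ z
!=(p =! q)= ≡.trans p q
!=(p =~ q)= ≡.trans p(!= q)
infixr 5 _≤~_
_≤~_ : ∀ {x y z}-> x ℕ.≤ y -> y ℕ.≤ z -> x ℕ.≤ z
_≤~_ = ℕₚ.≤-trans
open ≡ using () renaming (refl to Re;sym to sy;trans to qT)
open import Data.Nat.Base using () renaming (_+_ to _+n_;_*_ to _*n_;s≤s to ss;_≤_ to _≤n_;_∸_ to _-n_;z≤n to zn;_<_ to _<n_;_^_ to _^n_;s≤s⁻¹ to sL)
open ℕₚ using () renaming (≤-reflexive to ri;m⊔n≤o⇒n≤o to md;≤-refl to Rf;m+[n∸m]≡n to mm;m⊔n≤o⇒m≤o to Mm;m≤m+n to me;+-identityʳ to Iy;+-suc to su;n≤1+n to N1;+-assoc to As;+-comm to Cm;m≤n⇒m≤1+n to m1;≤ᵇ⇒≤ to xb;*-identityʳ to ik;*-assoc to Ao;<-≤-trans to Ta;*-distribˡ-+ to Di;*-monoʳ-≤ to mr;suc-injective to st;≤-total to tu;n<1+n to Nn;+-monoˡ-≤ to mA;+-monoʳ-≤ to mB;*-comm to cJ;≤-<-trans to tA;+-mono-≤ to mC;*-suc to sQ;*-monoʳ-< to mD;m≤n⊔m to mE;allUpTo? to aU;m≤n+m to mG;m≤n⇒m<n∨m≡n to mH;m<1+n⇒m<n∨m≡n to M1;^-distribˡ-+-* to dR;+-cancelʳ-≡ to cZ;*-identityˡ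 to b7;+-mono-<-≤ to mJ;+-monoʳ-< to mM;m≤m⊔n to mN;m∸n≤m to mO;0≢1+n to gM;1+n≢0 to gN;<-trans to tZ;<-cmp to qB;m∸n+n≡m to qC;*-distribʳ-+ to qD;*-cancelˡ-≤ to qE;*-monoˡ-≤ to qF;*-mono-≤ to qG;^-monoˡ-≤ to qH;<-≤-connex to qI;m<n⇒0<n∸m to qJ;⌈n/2⌉-mono to qM;⌊n/2⌋-mono to qN;m*n≡1⇒n≡1 to qO;≤-pred to qQ)
open import Data.Integer.Base using () renaming (_-_ to _-z_;-_ to -z_;_*_ to _*z_;_+_ to _+z_;_^_ to _^z_;≢-nonZero to NZ)
open ℤₚ using () renaming (*-identityʳ to ih;*-zeroʳ to Ze;^-distribˡ-+-* to Ds;+-identityʳ to iu;neg-distrib-+ to Nd;+-assoc to au;abs-* to a4;i-j≡0⇒i≡j to Ij;pos-* to pP;neg-distribʳ-* to a5;neg-distribˡ-* to a6;neg-involutive to a7;+-inverseʳ to b9;*-comm to jI;≤-<-trans to t8;≤-refl to rK;<-≤-trans to t9;*-monoˡ-≤-nonNeg to MN;*-assoc to qz;*-cancelˡ-≡ to qA;+-*-commutativeRing to CR;i*j≡0⇒i≡0∨j≡0 to qK;*-zeroˡ to zt;+-identityˡ to qL;∣-i∣≡∣i∣ to qP)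
module Q where
 open import Data.Rational.Base public using (ℚ;0ℚ;1ℚ;½;_+_;_*_;-_;_-_;_≤_;_<_;∣_∣;_/_;1/_;mkℚ;toℚᵘ;positive;nonNegative;*≤*;*<*)
 open import Data.Rational.Properties public
 open ≡ using (refl;sym;trans;module ≡-Reasoning)
 import Data.Rational.Unnormalised.Base as ℚᵘ
 import Data.Rational.Unnormalised.Properties as ℚᵘₚ
 open import Relation.Nullary using (¬_;yes;no;contradiction)
 open import Data.Rational.Solver public using (module +-*-Solver)
 open +-*-Solver
 import Algebra.Definitions.RawSemiring as RS
 import Algebra.Properties.Semiring.Exp as SE
 import Algebra.Properties.CommutativeSemiring.Exp as CSE
 open RS (Semiring.rawSemiring (CommutativeRing.semiring +-*-commutativeRing)) public using (_^_)
 open SE (CommutativeRing.semiring +-*-commutativeRing) public using () renaming (^-homo-* to ^-+;^-assocʳ to ^-*)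
 open CSE (CommutativeRing.commutativeSemiring +-*-commutativeRing) public using () renaming (^-distrib-* to di)
 lN : ∀ {p}-> 0ℚ ≤ p -> Data.Rational.Base.NonNegative p
 lN h = nonNegative h
 bc : ∀ {p q}r -> 0ℚ ≤ r -> q ≡ p + r -> p ≤ q
 bc{p}r h refl = sB(_≤ p + r)(+-identityʳ p)(+-monoʳ-≤ p h)
 bg : ∀ {p q}r -> 0ℚ < r -> q ≡ p + r -> p < q
 bg{p}r h refl = sB(_< p + r)(+-identityʳ p)(+-monoʳ-< p h)
 0≤+ : ∀ {p q}-> 0ℚ ≤ p -> 0ℚ ≤ q -> 0ℚ ≤ p + q
 0≤+{p} {q}hp hq = ≤-trans hp(bc q hq refl)
 0<+ : ∀ {p q}-> 0ℚ < p -> 0ℚ ≤ q -> 0ℚ < p + q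
 0<+{p} {q}hp hq = <-≤-trans hp(bc q hq refl)
 mt : ∀ {p q r s}-> 0ℚ ≤ p -> 0ℚ ≤ r -> p ≤ q -> r ≤ s -> p * r ≤ q * s
 mt{p} {q} {r} {s}hp hr pq rs =
  ≤-trans(*-monoʳ-≤-nonNeg r{{lN hr}}pq)(*-monoˡ-≤-nonNeg q{{lN(≤-trans hp pq)}}rs)
 Mn : ∀ {p q r}-> 0ℚ ≤ r -> p ≤ q -> r * p ≤ r * q
 Mn{r = r}hr = *-monoˡ-≤-nonNeg r{{lN hr}}
 mc : ∀ {p q r}-> 0ℚ ≤ r -> p ≤ q -> p * r ≤ q * r
 mc{r = r}hr = *-monoʳ-≤-nonNeg r{{lN hr}}
 0≤* : ∀ {p q}-> 0ℚ ≤ p -> 0ℚ ≤ q -> 0ℚ ≤ p * q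
 0≤*{p} {q}hp hq = sB(_≤ p * q)(*-zeroˡ 0ℚ)(mt ≤-refl ≤-refl hp hq)
 0<* : ∀ {p q}-> 0ℚ < p -> 0ℚ < q -> 0ℚ < p * q
 0<*{p} {q}hp hq = sB(_< p * q)(*-zeroʳ p)(*-monoʳ-<-pos p{{positive hp}}hq)
 <-*ʳ : ∀ {p q r}-> 0ℚ < r -> p < q -> r * p < r * q
 <-*ʳ{r = r}hr = *-monoʳ-<-pos r{{positive hr}}
 p≤q⇒0≤q-p : ∀ {p q}-> p ≤ q -> 0ℚ ≤ q - p
 p≤q⇒0≤q-p{p} {q}h = sB(_≤ q - p)(+-inverseʳ p)(+-monoˡ-≤(- p)h)
 Pq : ∀ {p q}-> p < q -> 0ℚ < q - p
 Pq{p} {q}h = sB(_< q - p)(+-inverseʳ p)(+-monoˡ-<(- p)h)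
 0≤q-p⇒p≤q : ∀ {p q}-> 0ℚ ≤ q - p -> p ≤ q
 0≤q-p⇒p≤q{p} {q}h = bc(q - p)h(solve 2(\ q p -> q := p :+(q :- p))refl q p)
 0≤sq : ∀ p -> 0ℚ ≤ p * p
 0≤sq p with ≤-total 0ℚ p
 ... | iL h = 0≤* h h
 ... | iR h = sB(0ℚ ≤_)(solve 1(\ p ->(:- p):*(:- p):= p :* p)refl p)(0≤* hg hg)
  where hg = neg-antimono-≤ h
 Sn : ∀ {x y}-> 0ℚ ≤ y -> x * x ≤ y * y -> x ≤ y
 Sn{x} {y}hy h with x ≤? y
 ... | yes p = p
 ... | no ¬p = contradiction(<-≤-trans yx h)(<-irrefl refl)
  where
  Yx = ≰⇒> ¬p
  yx : y * y < x * x
  yx = ≤-<-trans(Mn hy(<⇒≤ Yx))(*-monoˡ-<-pos x{{positive(≤-<-trans hy Yx)}}Yx)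
 Sq : ∀ {x y}-> 0ℚ ≤ x -> x ≤ y -> x * x ≤ y * y
 Sq h xy = mt h h xy xy
 opaque
  inv : ∀ p -> 0ℚ < p -> ℚ
  inv p h =(1/ p) {{pos⇒nonZero p{{positive h}}}}
  I0 : ∀ {p}(h : 0ℚ < p)-> 0ℚ < inv p h
  I0{p}h = positive⁻¹(inv p h) {{1/pos⇒pos p{{positive h}}}}
  ic : ∀ {p}(h : 0ℚ < p)-> p * inv p h ≡ 1ℚ
  ic{p}h = *-inverseʳ p{{pos⇒nonZero p{{positive h}}}}
  ip : ∀ {p}(h : 0ℚ < p)-> inv p h * p ≡ 1ℚ
  ip{p}h = *-inverseˡ p{{pos⇒nonZero p{{positive h}}}}
 *-cancelˡ : ∀ {p q r}-> 0ℚ < r -> r * p ≤ r * q -> p ≤ q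
 *-cancelˡ{r = r}h = *-cancelˡ-≤-pos r{{positive h}}
 cP : ∀ {p q pv qa}-> p ≡ pv -> q ≡ qa -> pv ≤ qa -> p ≤ q
 cP refl refl h = h
 cT : ∀ {p q pv qa : ℚ}-> p ≡ pv -> q ≡ qa -> pv < qa -> p < q
 cT refl refl h = h
 Hl : ∀ {p}-> 0ℚ < p -> 0ℚ < ½ * p
 Hl h = 0<*(positive⁻¹ ½)h
 opaque
  ι : ℕ -> ℚ
  ι n = + n / 1
  Sc : ∀ n -> ι(sC n)≡ 1ℚ + ι n
  Sc n = toℚᵘ-injective
   (ℚᵘₚ.≃-trans(toℚᵘ-fromℚᵘ(ℚᵘ.mkℚᵘ(+ sC n)0))
   (ℚᵘₚ.≃-trans(ℚᵘ.*≡*(cO(\ x -> x *z + 1)(sym(cO(\ x -> + 1 +z x)(ih(+ n))))))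
   (ℚᵘₚ.≃-trans(ℚᵘₚ.+-congʳ(toℚᵘ 1ℚ)(ℚᵘₚ.≃-sym(toℚᵘ-fromℚᵘ(ℚᵘ.mkℚᵘ(+ n)0))))
   (ℚᵘₚ.≃-sym(toℚᵘ-homo-+ 1ℚ(ι n))))))
  dj : ∀ n -> ι n ≡ + n / 1
  dj n = refl
  nx : ι 0 ≡ 0ℚ
  nx = refl
 xB : ∀ m n -> ι(m +n n)≡ ι m + ι n
 xB z0 n = trans(sym(+-identityˡ(ι n)))(cO(\ t -> t + ι n)(sym nx))
 xB(sC m)n = trans(Sc(m +n n))(trans(cO(\ t -> 1ℚ + t)(xB m n))
  (trans(sym(+-assoc 1ℚ(ι m)(ι n)))(cO(\ t -> t + ι n)(sym(Sc m)))))
 xk : ∀ m n -> ι(m *n n)≡ ι m * ι n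
 xk z0 n = trans nx(trans(sym(*-zeroˡ(ι n)))(cO(\ t -> t * ι n)(sym nx)))
 xk(sC m)n = trans(xB n(m *n n))(trans(cO(\ t -> ι n + t)(xk m n))
  (trans(solve 2(\ m n -> n :+ m :* n :=(con 1ℚ :+ m):* n)refl(ι m)(ι n))(cO(\ t -> t * ι n)(sym(Sc m)))))
 0≤ι : ∀ n -> 0ℚ ≤ ι n
 0≤ι z0 = ≤-reflexive(sym nx)
 0≤ι(sC n)= sB(0ℚ ≤_)(sym(Sc n))(0≤+(nonNegative⁻¹ 1ℚ)(0≤ι n))
 0<ι : ∀ n -> 0ℚ < ι(sC n)
 0<ι n = sB(0ℚ <_)(sym(Sc n))(0<+(positive⁻¹ 1ℚ)(0≤ι n))
 mh : ∀ {m n}-> m ≤n n -> ι m ≤ ι n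
 mh{n = n}zn = ≤-trans(≤-reflexive nx)(0≤ι n)
 mh(ss{m} {n}h)= cP(Sc m)(Sc n)(+-monoʳ-≤ 1ℚ(mh h))
 0≤1 : 0ℚ ≤ 1ℚ
 0≤1 = nonNegative⁻¹ 1ℚ
 0<1 : 0ℚ < 1ℚ
 0<1 = positive⁻¹ 1ℚ
 ar : ∀ q -> ∃ \ n -> q < ι n
 ar q@(mkℚ n d c)= N , lem
  where
  N = sC ℤ.∣ n ∣
  j4 : n ℤ.< + N
  j4 = t8(iC n)(ℤ.+<+(Nn _))
   where
   iC : ∀ i -> i ℤ.≤ + ℤ.∣ i ∣
   iC(+ n)= rK
   iC(ℤ.-[1+ n ])= ℤ.-≤+
  lem : q < ι N
  lem = sB(q <_)(sym(dj N))lem′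
   where
   lem′ : q < + N / 1
   lem′ = toℚᵘ-cancel-<(ℚᵘₚ.<-respʳ-≃(ℚᵘₚ.≃-sym(toℚᵘ-fromℚᵘ(ℚᵘ.mkℚᵘ(+ N)0)))
    (ℚᵘ.*<*(sB(ℤ._< + N *z + sC d)(sym(ih n))
     (t9 j4(sB(ℤ._≤ + N *z + sC d)(ih(+ N))
      (MN(+ N)(ℤ.+≤+(ss zn))))))))
 ah : ∀ q -> ∃ \ n -> q < ι(sC n)
 ah q with ar q
 ... | n , h = n , <-≤-trans h(mh(N1 n))
 0≤^ : ∀ {p}n -> 0ℚ ≤ p -> 0ℚ ≤ p ^ n
 0≤^ z0 h = 0≤1
 0≤^(sC n)h = 0≤* h(0≤^ n h)
 0<^ : ∀ {p}n -> 0ℚ < p -> 0ℚ < p ^ n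
 0<^ z0 h = 0<1
 0<^(sC n)h = 0<* h(0<^ n h)
 mq : ∀ {p q}n -> 0ℚ ≤ p -> p ≤ q -> p ^ n ≤ q ^ n
 mq z0 h pq = ≤-refl
 mq(sC n)h pq = mt h(0≤^ n h)pq(mq n h pq)
 1≤^ : ∀ {p}n -> 1ℚ ≤ p -> 1ℚ ≤ p ^ n
 1≤^ z0 h = ≤-refl
 1≤^(sC n)h = mt 0≤1 0≤1 h(1≤^ n h)
 nI : ∀ {p}n -> 0ℚ ≤ p -> p ≤ 1ℚ -> p ^ n ≤ 1ℚ
 nI z0 h g = ≤-refl
 nI(sC n)h g = mt h(0≤^ n h)g(nI n h g)
 br : ∀ {d}n -> 0ℚ ≤ d -> 1ℚ + ι n * d ≤(1ℚ + d)^ n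
 br{d}z0 h = ≤-reflexive(trans(cO(\ t -> 1ℚ + t * d)nx)(solve 1(\ d -> con 1ℚ :+ con 0ℚ :* d := con 1ℚ)refl d))
 br{d}(sC n)h = ≤-trans
  (bc(ι n *(d * d))(0≤*(0≤ι n)(0≤sq d))
   (trans(solve 2(\ d n ->(con 1ℚ :+ d):*(con 1ℚ :+ n :* d)
    := con 1ℚ :+(con 1ℚ :+ n):* d :+ n :*(d :* d))refl d(ι n))
    (cO(\ t -> 1ℚ + t * d + ι n *(d * d))(sym(Sc n)))))
  (Mn(0≤+ 0≤1 h)(br n h))
 0<½ : 0ℚ < ½
 0<½ = positive⁻¹ ½
 bn : ∀ {s}n -> 0ℚ ≤ s -> s ≤ 1ℚ -> 1ℚ - ι n * s ≤(1ℚ - s)^ n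
 bn{s}z0 h g = ≤-reflexive(trans(cO(\ t -> 1ℚ - t * s)nx)(solve 1(\ s -> con 1ℚ :- con 0ℚ :* s := con 1ℚ)refl s))
 bn{s}(sC n)h g = ≤-trans
  (bc(ι n *(s * s))(0≤*(0≤ι n)(0≤sq s))
   (trans(solve 2(\ s n ->(con 1ℚ :- s):*(con 1ℚ :- n :* s):= con 1ℚ :-(con 1ℚ :+ n):* s :+ n :*(s :* s))refl s(ι n))
    (cO(\ t -> 1ℚ - t * s + ι n *(s * s))(sym(Sc n)))))
  (Mn(p≤q⇒0≤q-p g)(bn n h g))
 sP : ∀ W -> ∃ \ M -> inv(ι(sC M))(0<ι M)* W ≤ 1ℚ
 sP W = let M , h = ah W in M , ≤-trans(Mn{W} {ι(sC M)} {inv(ι(sC M))(0<ι M)}(<⇒≤(I0(0<ι M)))(<⇒≤ h))(≤-reflexive(ip(0<ι M)))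
 i1 : ∀ {p}(h : 0ℚ < p)-> 1ℚ ≤ p -> inv p h ≤ 1ℚ
 i1{p}h le = *-cancelˡ{inv p h} {1ℚ} {p}h(≤-trans(≤-reflexive(ic h))(≤-trans le(≤-reflexive(sym(*-identityʳ p)))))
open Q using (ℚ;½;ι) renaming (0ℚ to 0q;1ℚ to 1q)
module QS = Q.+-*-Solver
infixr 6 _<~_ _<!_
infix 5 !<_
data Pe(x z : ℚ): Set where
 _<!_ : ∀ {y}-> x Q.≤ y -> y Q.≤ z -> Pe x z
 _<~_ : ∀ {y}-> x Q.≤ y -> Pe y z -> Pe x z
!<_ : ∀ {x z}-> Pe x z -> x Q.≤ z
!<(p <! q)= Q.≤-trans p q
!<(p <~ q)= Q.≤-trans p(!< q)
open Q using () renaming (<⇒≤ to lZ)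
open Q using () renaming (≤-reflexive to rl;_*_ to _**_;_≤_ to _<=_;0≤* to n0;0≤1 to n1;*-identityʳ to ii;nonNegative⁻¹ to nN;*-identityˡ to iy;Mn to Mo;_+_ to _++_;_-_ to _-q_;-_ to -q_;0≤+ to N0;0≤p⇒∣p∣≡p to np;bc to By;inv to iv;Hl to Ha;mc to ma;_^_ to _^^_;0≤ι to nc;p≤q⇒0≤q-p to p0;0≤sq to nq;I0 to i0;ic to Iv;positive⁻¹ to pi;0<ι to nd;*-assoc to ac;0≤^ to nf;mh to mg;0≤∣p∣ to Np;Sc to sa;di to dt;+-mono-≤ to mi;neg-antimono-≤ to nt;0<½ to ni;_<_ to _<<_;≤-<-trans to Tr;+-monoʳ-≤ to mj;+-identityʳ to ig;≤-refl to ra;*-cancelˡ to Ca;Pq to Pp;≤-total to Tt;Sq to sn;bg to bf;0<1 to nl;∣-p∣≡∣p∣ to pa;+-comm to cw;+-monoˡ-≤ to ml;xk to xe;nx to nw;<-≤-trans to Tn;mq to mu;_/_ to _//_;0<* to nD;∣p+q∣≤∣p∣+∣q∣ to pb;*-comm to cD;∣p∣≡p∨∣p∣≡-p to pe;ip to iz;i1 to iA;0<+ to nG;+-identityˡ to iB;0≤q-p⇒p≤q to Nq;mt to my;nI to nP;Sn to sK;*-distribʳ-+ to dq;dj to dJ;ah to Ah;xB to xJ;br to bl;*-zeroˡ to zd;+-inverseʳ to b6;ar to An;+-assoc to dZ;toℚᵘ-fromℚᵘ to tV;<-irrefl to jJ;1≤^ to j3;*-distribˡ-+ to l4;cT to m5;+-inverseˡ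 to oT;sP to qx;*-zeroʳ to zq;ι to x2;+-*-commutativeRing to qW;cP to qX;toℚᵘ-injective to qY;toℚᵘ-homo-* to qZ;normalize-pos to q2;bn to q3;≤-trans to q4;∣p-q∣≤∣p∣+∣q∣ to q5;∣p*q∣≡∣p∣*∣q∣ to q6;0<^ to q7;∣p∣≡0⇒p≡0 to q8;≤-antisym to Ay;toℚᵘ to q9)
open QS using () renaming (_:*_ to _*:_;con to Co;solve to sl;_:+_ to _+:_;_:=_ to _=:_;_:-_ to _-:_;:-_ to -:_;Polynomial to PQ)
module FSum {c ℓ} (R : CommutativeRing c ℓ) where
 open CommutativeRing R
 open import Relation.Binary.Reasoning.Setoid setoid
 open import Algebra.Properties.Ring ring using (-‿+-comm)
 private
  S = ℕ -> Carrier
 a8 : ∀ a b c d ->(a + b)+(c + d)≈(a + c)+(b + d)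
 a8 a b c d = trans(+-assoc a b(c + d))(trans(+-congˡ(trans(sym(+-assoc b c d))(trans(+-congʳ(+-comm b c))(+-assoc c b d))))(sym(+-assoc a c(b + d))))
 ∑ : ℕ -> S -> Carrier
 ∑ z0 a = 0#
 ∑(sC n)a = a 0 + ∑ n(\ i -> a(sC i))
 cy : ∀ n{a b : S}->(∀ i -> i <n n -> a i ≈ b i)-> ∑ n a ≈ ∑ n b
 cy z0 h = refl
 cy(sC n)h = +-cong(h 0(ss zn))(cy n \ i lt -> h(sC i)(ss lt))
 ch : ∀ n{a b : S}->(∀ i -> a i ≈ b i)-> ∑ n a ≈ ∑ n b
 ch n h = cy n \ i _ -> h i
 ∑-+ : ∀ n(a b : S)-> ∑ n(\ i -> a i + b i)≈ ∑ n a + ∑ n b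
 ∑-+ z0 a b = sym(+-identityˡ 0#)
 ∑-+(sC n)a b = trans(+-congˡ(∑-+ n _ _))(a8 _ _ _ _)
 ∑-* : ∀ n x(a : S)-> ∑ n(\ i -> x * a i)≈ x * ∑ n a
 ∑-* z0 x a = sym(zeroʳ x)
 ∑-*(sC n)x a = trans(+-congˡ(∑-* n x _))(sym(distribˡ x _ _))
 ∑-*ʳ : ∀ n x(a : S)-> ∑ n(\ i -> a i * x)≈ ∑ n a * x
 ∑-*ʳ n x a = trans(ch n \ i -> *-comm _ _)(trans(∑-* n x a)(*-comm _ _))
 Ng : ∀ n(a : S)-> ∑ n(\ i -> - a i)≈ - ∑ n a
 Ng z0 a = trans(sym(-‿inverseʳ 0#))(+-identityˡ(- 0#))
 Ng(sC n)a = trans(+-congˡ(Ng n _))(-‿+-comm _ _)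
 nB : ∀ n{a : S}->(∀ i -> i <n n -> a i ≈ 0#)-> ∑ n a ≈ 0#
 nB z0 h = refl
 nB(sC n)h = trans(+-cong(h 0(ss zn))(nB n \ i lt -> h(sC i)(ss lt)))(+-identityˡ 0#)
 Ls : ∀ n(a : S)-> ∑(sC n)a ≈ ∑ n a + a n
 Ls z0 a = +-comm _ _
 Ls(sC n)a = trans(+-congˡ(Ls n _))(sym(+-assoc _ _ _))
 sp : ∀ m n(a : S)-> ∑(m +n n)a ≈ ∑ m a + ∑ n(\ i -> a(m +n i))
 sp z0 n a = sym(+-identityˡ _)
 sp(sC m)n a = trans(+-congˡ(sp m n _))(sym(+-assoc _ _ _))
 Sw : ∀ m n(f : ℕ -> ℕ -> Carrier)-> ∑ m(\ i -> ∑ n(f i))≈ ∑ n(\ j -> ∑ m(\ i -> f i j))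
 Sw z0 n f = sym(nB n \ i _ -> refl)
 Sw(sC m)n f = trans(+-congˡ(Sw m n _))(sym(∑-+ n(f 0)_))
 tj : ∀ n(a : S)-> ∑ n(\ i -> a(sC i)+(- a i))≈ a n +(- a 0)
 tj z0 a = sym(-‿inverseʳ(a 0))
 tj(sC n)a = begin
  (a 1 + - a 0)+ ∑ n(\ i -> a(sC(sC i))+ - a(sC i))≈⟨ +-congˡ(tj n(\ i -> a(sC i)))⟩
  (a 1 + - a 0)+(a(sC n)+ - a 1)≈⟨ +-comm _ _ ⟩
  (a(sC n)+ - a 1)+(a 1 + - a 0)≈⟨ +-assoc _ _ _ ⟩
  a(sC n)+(- a 1 +(a 1 + - a 0))≈⟨ +-congˡ(sym(+-assoc _ _ _))⟩
  a(sC n)+((- a 1 + a 1)+ - a 0)≈⟨ +-congˡ(+-congʳ(-‿inverseˡ _))⟩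
  a(sC n)+(0# + - a 0)≈⟨ +-congˡ(+-identityˡ _)⟩
  a(sC n)+ - a 0 ∎
 xK : ∀ n k(a : S)-> k <n n ->(∀ i -> i <n n -> i ≡.≢ k -> a i ≈ 0#)-> ∑ n a ≈ a k
 xK(sC n)z0 a lt h = trans(+-congˡ(nB n \ i l -> h(sC i)(ss l)\ ()))(+-identityʳ _)
 xK(sC n)(sC k)a(ss lt)h = trans(+-congʳ(h 0(ss zn)\ ()))
  (trans(+-identityˡ _)(xK n k _ lt \ i l ne -> h(sC i)(ss l)(\ e -> ne(st e))))
 infix 4 _~s_
 infixl 6 _+s_
 infixl 7 _*s_ _^s_
 record _~s_(a b : S): Set ℓ where
  constructor mk
  field at : ∀ n -> a n ≈ b n
 open _~s_ public
 tl : S -> S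
 tl a n = a(sC n)
 _+s_ _*s_ : S -> S -> S
 (a +s b)n = a n + b n
 (a *s b)z0 = a 0 * b 0
 (a *s b)(sC n)= a 0 * b(sC n)+(tl a *s b)n
 -s_ : S -> S
 (-s a)n = - a n
 _^s_ : Carrier -> S -> S
 (x ^s a)n = x * a n
 Cs : Carrier -> S
 Cs x z0 = x
 Cs x(sC n)= 0#
 0ₛ 1ₛ : S
 0ₛ _ = 0#
 1ₛ = Cs 1#
 af : ∀ {a a′ b b′}n ->(∀ i -> i ≤n n -> a i ≈ a′ i)->(∀ i -> i ≤n n -> b i ≈ b′ i)->(a *s b)n ≈(a′ *s b′)n
 af z0 h g = *-cong(h 0 zn)(g 0 zn)
 af(sC n)h g = +-cong(*-cong(h 0 zn)(g(sC n)Rf))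
  (af n(\ i l -> h(sC i)(ss l))(\ i l -> g i(m1 l)))
 private
  gO : ∀ {a a′ b b′}->(∀ i -> a i ≈ a′ i)->(∀ i -> b i ≈ b′ i)-> ∀ n ->(a *s b)n ≈(a′ *s b′)n
  gO h g n = af n(\ i _ -> h i)(\ i _ -> g i)
  dw : ∀ a b c n ->((a +s b)*s c)n ≈(a *s c)n +(b *s c)n
  dw a b c z0 = distribʳ _ _ _
  dw a b c(sC n)= trans(+-cong(distribʳ _ _ _)(dw(tl a)(tl b)c n))(a8 _ _ _ _)
  zg : ∀ {a}->(∀ i -> a i ≈ 0#)-> ∀ b n ->(a *s b)n ≈ 0#
  zg h b z0 = trans(*-congʳ(h 0))(zeroˡ _)
  zg h b(sC n)= trans(+-cong(trans(*-congʳ(h 0))(zeroˡ _))(zg(\ i -> h(sC i))b n))(+-identityˡ 0#)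
  d2 : ∀ x a b n ->((x ^s a)*s b)n ≈ x *(a *s b)n
  d2 x a b z0 = *-assoc _ _ _
  d2 x a b(sC n)= trans(+-cong(*-assoc _ _ _)(d2 x(tl a)b n))(sym(distribˡ _ _ _))
  bF : ∀ a b n ->(a *s b)(sC n)≈(a *s tl b)n + a(sC n)* b 0
  bF a b z0 = refl
  bF a b(sC n)= trans(+-congˡ(bF(tl a)b n))(sym(+-assoc _ _ _))
  comm : ∀ a b n ->(a *s b)n ≈(b *s a)n
  comm a b z0 = *-comm _ _
  comm a b(sC n)= trans(+-cong(*-comm _ _)(comm(tl a)b n))(trans(+-comm _ _)(sym(bF b a n)))
  ag : ∀ a b c n ->((a *s b)*s c)n ≈(a *s(b *s c))n
  ag a b c z0 = *-assoc _ _ _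
  ag a b c(sC n)= begin
   (a 0 * b 0)* c(sC n)+(((a 0 ^s tl b)+s(tl a *s b))*s c)n ≈⟨ +-cong(*-assoc _ _ _)(dw _ _ c n)⟩
   a 0 *(b 0 * c(sC n))+(((a 0 ^s tl b)*s c)n +((tl a *s b)*s c)n)≈⟨ sym(+-assoc _ _ _)⟩
   (a 0 *(b 0 * c(sC n))+((a 0 ^s tl b)*s c)n)+((tl a *s b)*s c)n
    ≈⟨ +-cong(trans(+-congˡ(d2 _ _ _ n))(sym(distribˡ _ _ _)))(ag(tl a)b c n)⟩
   a 0 *(b *s c)(sC n)+(tl a *s(b *s c))n ∎
  j8 : ∀ x b n ->(Cs x *s b)n ≈ x * b n
  j8 x b z0 = refl
  j8 x b(sC n)= trans(+-congˡ(zg(\ i -> refl)b n))(+-identityʳ _)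
 c4 : ∀ x b -> Cs x *s b ~s x ^s b
 c4 x b = mk(j8 x b)
 ·-*ₛ : ∀ x a b ->(x ^s a)*s b ~s x ^s(a *s b)
 ·-*ₛ x a b = mk(d2 x a b)
 sR : CommutativeRing c ℓ
 sR = record
  { Carrier = S ; _≈_ = _~s_ ; _+_ = _+s_ ; _*_ = _*s_ ; -_ = -s_ ; 0# = 0ₛ ; 1# = 1ₛ
  ; isCommutativeRing = record
   { isRing = record
    { +-isAbelianGroup = record
     { isGroup = record
      { isMonoid = record
       { isSemigroup = record
        { isMagma = record
         { isEquivalence = record { refl = mk \ n -> refl ; sym = \ h -> mk \ n -> sym(at h n); trans = \ h g -> mk \ n -> trans(at h n)(at g n) }
         ; ∙-cong = \ h g -> mk \ n -> +-cong(at h n)(at g n) }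
        ; assoc = \ a b c -> mk \ n -> +-assoc _ _ _ }
       ; identity =(\ a -> mk \ n -> +-identityˡ _),(\ a -> mk \ n -> +-identityʳ _) }
      ; inverse =(\ a -> mk \ n -> -‿inverseˡ _),(\ a -> mk \ n -> -‿inverseʳ _)
      ; ⁻¹-cong = \ h -> mk \ n -> -‿cong(at h n) }
     ; comm = \ a b -> mk \ n -> +-comm _ _ }
    ; *-cong = \ h g -> mk(gO(at h)(at g))
    ; *-assoc = \ a b c -> mk(ag a b c)
    ; *-identity =(\ a -> mk \ n -> trans(j8 1# a n)(*-identityˡ _)),(\ a -> mk \ n -> trans(comm a 1ₛ n)(trans(j8 1# a n)(*-identityˡ _)))
    ; distrib =(\ a b c -> mk \ n -> trans(comm a(b +s c)n)(trans(dw b c a n)(+-cong(comm b a n)(comm c a n)))),(\ a b c -> mk(dw b c a)) }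
   ; *-comm = \ a b -> mk(comm a b) } }
  where open import Data.Product.Base using (_,_)
module Alg2 {c ℓ} (R : CommutativeRing c ℓ) where
 open import Data.Maybe.Base using (Maybe;just;nothing)
 open import Relation.Nullary using (yes;no)
 import Algebra.Solver.Ring
 import Algebra.Solver.Ring.AlmostCommutativeRing as ACR
 import Data.Rational.Properties as ℚₚ
 open CommutativeRing R
 module Ov (k : ℚ -> Carrier) (l5 : ∀ a b -> k (a ++ b) ≈ k a + k b) (l6 : ∀ a b -> k (a ** b) ≈ k a * k b) (kn : ∀ a -> k (-q a) ≈ - k a) (l7 : k 0q ≈ 0#) (K1 : k 1q ≈ 1#) where
  private
   dec : ∀ a b -> Maybe(k a ≈ k b)
   dec a b with a ℚₚ.≟ b
   ... | yes e = just(sB(\ t -> k a ≈ k t)e refl)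
   ... | no _ = nothing
   Mp : ℚₚ.+-*-rawRing ACR.-Raw-AlmostCommutative⟶ ACR.fromCommutativeRing R
   Mp = record { ⟦_⟧ = k ; +-homo = l5 ; *-homo = l6 ; -‿homo = kn ; 0-homo = l7 ; 1-homo = K1 }
   module SM = Algebra.Solver.Ring ℚₚ.+-*-rawRing (ACR.fromCommutativeRing R) Mp dec
  open SM
  private
   q : ℕ -> ℕ -> ℚ
   q a b =(+ a)// sC b
   f0 : ∀ {x y}-> x + - y ≈ 0# -> x ≈ y
   f0{x} {y}h = trans(solve 2(\ x y -> x :=(x :+(:- y)):+ y)refl x y)(trans(+-congʳ h)(+-identityˡ y))
  xx : ∀ x y z -> x *(y * z)≈ y *(x * z)
  xx = solve 3(\ x y z -> x :*(y :* z):= y :*(x :* z))refl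
  n7 : ∀ x y ->(- x)* y ≈ -(x * y)
  n7 = solve 2(\ x y ->(:- x):* y := :-(x :* y))refl
  gP : ∀ x y -> x *(- y)≈ -(x * y)
  gP = solve 2(\ x y -> x :*(:- y):= :-(x :* y))refl
  ay : ∀ x y ->(- x)*(- y)≈ x * y
  ay = solve 2(\ x y ->(:- x):*(:- y):= x :* y)refl
  dU : ∀ x y ->(x + - y)*(x + y)≈ x * x + -(y * y)
  dU = solve 2(\ x y ->(x :+ :- y):*(x :+ y):= x :* x :+ :-(y :* y))refl
  aN : ∀ r g y -> g * g ≈ y ->(r + k(q 6 0)* g)*(r + k(q 6 0)* g)≈ r * r +(k(q 12 0)*(r * g)+ k(q 36 0)* y)
  aN r g y h = trans(solve 2(\ r g ->(r :+ con(q 6 0):* g):*(r :+ con(q 6 0):* g):= r :* r :+(con(q 12 0):*(r :* g):+ con(q 36 0):*(g :* g)))refl r g)(+-congˡ(+-congˡ(*-congˡ h)))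
  module _ {A B A′ B′ P u : Carrier} (uc : u ≈ k (q 1 4) * (k (q 16 0) * A′ + - (k (q 11 0) * A))) (uP : u * P ≈ B) (cancel : ∀ {x} -> u * x ≈ 0# -> x ≈ 0#)
   (r₁ :(k(q 64 0)* B′)*(k(q 16 0)* A′ + k(-q q 11 0)* A)+ B *(k(-q q 22 0)*(k(q 16 0)* A′)+ k(q 32 0)* A)≈ 0#)
   (r₂ :(k(q 4 0)* A + k(q 16 0)* A′)*((k(q 16 0)* A′ + k(-q q 11 0)* A)*(k(q 16 0)* A′ + k(-q q 11 0)* A))+ k(-q q 500 0)*(B * B)≈ 0#)where
   Ae : A′ ≈ k(q 1 3)*(k(q 5 0)*(P * P)+ - A)
   Ae = f0(cancel(cancel(trans(solve 4(\ a b x u -> u :*(u :*(x :+ :-(con(q 1 3):*(con(q 5 0):*(b :* b):+ :- a)))):= con(q 1 15):*((con(q 4 0):* a :+ con(q 16 0):* x):*(u :* u)):+ :-(con(q 5 3):*((u :* b):*(u :* b))))refl A P A′ u)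
    (trans(+-cong(*-congˡ(*-congˡ(*-cong uc uc)))(-‿cong(*-congˡ(*-cong uP uP))))(trans(solve 3(\ a b x -> con(q 1 15):*((con(q 4 0):* a :+ con(q 16 0):* x):*((con(q 1 4):*(con(q 16 0):* x :+ :-(con(q 11 0):* a))):*(con(q 1 4):*(con(q 16 0):* x :+ :-(con(q 11 0):* a))))):+ :-(con(q 5 3):*(b :* b))
     := con(q 1 399):*((con(q 4 0):* a :+ con(q 16 0):* x):*((con(q 16 0):* x :+ con(-q q 11 0):* a):*(con(q 16 0):* x :+ con(-q q 11 0):* a)):+ con(-q q 500 0):*(b :* b)))refl A B A′)
     (trans(*-congˡ r₂)(zeroʳ _)))))))
   Bg : B ≈ P *(k(q 4 0)*(P * P)+ -(k(q 3 0)* A))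
   Bg = trans(sym uP)(trans(*-congʳ(trans uc(*-congˡ(+-congʳ(*-congˡ Ae)))))(solve 2(\ a b -> con(q 1 4):*(con(q 16 0):*(con(q 1 3):*(con(q 5 0):*(b :* b):+ :- a)):+ :-(con(q 11 0):* a)):* b := b :*(con(q 4 0):*(b :* b):+ :-(con(q 3 0):* a)))refl A P))
   private
    PR : P * P ≈ k(q 1 4)*(k(q 4 0)* A′ + A)
    PR = sym(trans(*-congˡ(+-congʳ(*-congˡ Ae)))(solve 2(\ a b -> con(q 1 4):*(con(q 4 0):*(con(q 1 3):*(con(q 5 0):*(b :* b):+ :- a)):+ a):= b :* b)refl A P))
   Bq : B′ ≈ k ½ *(P *(k(q 3 0)* A′ + -(P * P)))
   Bq = f0(cancel(trans(solve 4(\ b x y u -> u :*(y :+ :-(con ½ :*(b :*(con(q 3 0):* x :+ :-(b :* b))))):= u :* y :+ :-(con ½ :*((u :* b):*(con(q 3 0):* x :+ :-(b :* b)))))refl P A′ B′ u)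
    (trans(+-cong(*-congʳ uc)(-‿cong(*-congˡ(*-cong uP(+-congˡ(-‿cong PR))))))
    (trans(solve 4(\ a b x y ->(con(q 1 4):*(con(q 16 0):* x :+ :-(con(q 11 0):* a))):* y :+ :-(con ½ :*(b :*(con(q 3 0):* x :+ :-(con(q 1 4):*(con(q 4 0):* x :+ a)))))
     := con(q 1 319):*((con(q 64 0):* y):*(con(q 16 0):* x :+ con(-q q 11 0):* a):+ b :*(con(-q q 22 0):*(con(q 16 0):* x):+ con(q 32 0):* a)))refl A B A′ B′)
     (trans(*-congˡ r₁)(zeroʳ _))))))
   module _ {P′ : Carrier} (Be : B′ ≈ P′ * (k (q 4 0) * (P′ * P′) + - (k (q 3 0) * A′))) (c8 : ∀ {x} -> (P + k (q 2 0) * P′) * x ≈ 0# -> x ≈ 0#) where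
    Px : k(q 4 0)*(P′ * P′)+ -(k(q 2 0)*(P * P′))+ P * P + -(k(q 3 0)* A′)≈ 0#
    Px = c8(trans(solve 3(\ p r x ->(p :+ con(q 2 0):* r):*(con(q 4 0):*(r :* r):+ :-(con(q 2 0):*(p :* r)):+ p :* p :+ :-(con(q 3 0):* x))
     := con(q 2 0):*((r :*(con(q 4 0):*(r :* r):+ :-(con(q 3 0):* x))):+ :-(con ½ :*(p :*(con(q 3 0):* x :+ :-(p :* p))))))refl P P′ A′)
     (trans(*-congˡ(trans(+-cong(sym Be)(-‿cong(sym Bq)))(-‿inverseʳ B′)))(zeroʳ _)))
    private
     3A′ : k(q 3 0)* A′ ≈ k(q 4 0)*(P′ * P′)+ -(k(q 2 0)*(P * P′))+ P * P
     3A′ = sym(f0 Px)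
    gG :(k(q 1 5)*(P + - P′))*(k(q 1 5)*(P + - P′))≈ k(q 1 11)*(A′ + -(P′ * P′))
    gG = sym(trans(solve 2(\ x r -> con(q 1 11):*(x :+ :-(r :* r)):= con(q 1 35):*(con(q 3 0):* x :+ :-(con(q 3 0):*(r :* r))))refl A′ P′)(trans(*-congˡ(+-congʳ 3A′))
     (solve 2(\ p r -> con(q 1 35):*(con(q 4 0):*(r :* r):+ :-(con(q 2 0):*(p :* r)):+ p :* p :+ :-(con(q 3 0):*(r :* r))):=(con(q 1 5):*(p :+ :- r)):*(con(q 1 5):*(p :+ :- r)))refl P P′)))
    pX : k(q 1 11)*(A + -(P * P))≈(P′ + k(q 2 0)*(k(q 1 5)*(P + - P′)))*(k(q 4 0)*(k(q 1 5)*(P + - P′)))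
    pX = trans(solve 2(\ a p -> con(q 1 11):*(a :+ :-(p :* p)):= con(q 1 8):*(con(q 3 0):*(p :* p):+ :-(con(q 3 0):*(con(q 1 3):*(con(q 5 0):*(p :* p):+ :- a)))))refl A P)
     (trans(*-congˡ(+-congˡ(-‿cong(trans(*-congˡ(sym Ae))3A′))))(solve 2(\ p r -> con(q 1 8):*(con(q 3 0):*(p :* p):+ :-(con(q 4 0):*(r :* r):+ :-(con(q 2 0):*(p :* r)):+ p :* p))
      :=(r :+ con(q 2 0):*(con(q 1 5):*(p :+ :- r))):*(con(q 4 0):*(con(q 1 5):*(p :+ :- r))))refl P P′))
   module _ {p : Carrier} (j9 : p ≈ k (q 1 11) * (A + - (P * P))) where
    Aj : A ≈ P * P + k(q 12 0)* p
    Aj = sym(trans(+-congˡ(*-congˡ j9))(solve 2(\ a p -> p :* p :+ con(q 12 0):*(con(q 1 11):*(a :+ :-(p :* p))):= a)refl A P))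
    AP : A′ ≈ P * P + k(-q q 3 0)* p
    AP = trans Ae(sym(trans(+-congˡ(*-congˡ j9))(solve 2(\ a p -> p :* p :+ con(-q q 3 0):*(con(q 1 11):*(a :+ :-(p :* p))):= con(q 1 3):*(con(q 5 0):*(p :* p):+ :- a))refl A P)))
    bP : B ≈ P *(P * P)+ k(-q q 36 0)*(P * p)
    bP = trans Bg(trans(*-congˡ(+-congˡ(-‿cong(*-congˡ Aj))))(solve 2(\ P p -> P :*(con(q 4 0):*(P :* P):+ :-(con(q 3 0):*(P :* P :+ con(q 12 0):* p))):= P :*(P :* P):+ con(-q q 36 0):*(P :* p))refl P p))
    BP : B′ ≈ P *(P * P)+ k(-q q 9 1)*(P * p)
    BP = trans Bq(trans(*-congˡ(*-congˡ(+-congʳ(*-congˡ AP))))(solve 2(\ P p -> con ½ :*(P :*(con(q 3 0):*(P :* P :+ con(-q q 3 0):* p):+ :-(P :* P))):= P :*(P :* P):+ con(-q q 9 1):*(P :* p))refl P p))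
  module _ {A B A′ B′ P p : Carrier} (hA : A ≈ P * P + k (q 12 0) * p) (HA : A′ ≈ P * P + k (-q q 3 0) * p)
   (hB : B ≈ P *(P * P)+ k(-q q 36 0)*(P * p))(kf : B′ ≈ P *(P * P)+ k(-q q 9 1)*(P * p))where
   private
    Qu : Carrier -> Carrier -> Carrier -> Carrier
    Qu x y z = x +(y * P + z *(P * P))
    qu : Carrier -> Carrier -> Carrier -> Carrier
    qu x y z = x +(k(-q q 2 0)*(y * P)+ k(q 4 0)*(z *(P * P)))
   PD : ∀ x y z -> P * Qu x y z ≈ Qu(k(-q q 2 0)*(B′ * z))(x + k(q 3 0)*(A′ * z))y
   PD x y z = trans(solve 5(\ P p x y z -> P :*(x :+(y :* P :+ z :*(P :* P))):= con(-q q 2 0):*((P :*(P :* P):+ con(-q q 9 1):*(P :* p)):* z):+((x :+ con(q 3 0):*((P :* P :+ con(-q q 3 0):* p):* z)):* P :+ y :*(P :* P)))refl P p x y z)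
    (+-cong(*-congˡ(*-congʳ(sym kf)))(+-congʳ(*-congʳ(+-congˡ(*-congˡ(*-congʳ(sym HA)))))))
   Pu : ∀ x y z -> k(q 2 0)*((- P)* qu x y z)≈ qu(k(-q q 2 0)*(B * z))(x + k(q 3 0)*(A * z))y
   Pu x y z = trans(solve 5(\ P p x y z -> con(q 2 0):*((:- P):*(x :+(con(-q q 2 0):*(y :* P):+ con(q 4 0):*(z :*(P :* P))))):= con(-q q 2 0):*((P :*(P :* P):+ con(-q q 36 0):*(P :* p)):* z):+(con(-q q 2 0):*((x :+ con(q 3 0):*((P :* P :+ con(q 12 0):* p):* z)):* P):+ con(q 4 0):*(y :*(P :* P))))refl P p x y z)
    (+-cong(*-congˡ(*-congʳ(sym hB)))(+-congʳ(*-congˡ(*-congʳ(+-congˡ(*-congˡ(*-congʳ(sym hA))))))))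
   pY : ∀ f -> p * f ≈ k(q 1 2)*(P *(P * f))+ k(-q q 1 2)*(A′ * f)
   pY f = trans(solve 3(\ P p f -> p :* f := con(q 1 2):*(P :*(P :* f)):+ con(-q q 1 2):*((P :* P :+ con(-q q 3 0):* p):* f))refl P p f)(+-congˡ(*-congˡ(*-congʳ(sym HA))))
   pI : ∀ f -> k(q 4 0)*((k(q 1 3)*(P * P)+ - p)* f)≈ k(q 1 2)*(k(q 2 0)*((- P)*(k(q 2 0)*((- P)* f))))+ k(-q q 1 2)*(A * f)
   pI f = trans(solve 3(\ P p f -> con(q 4 0):*((con(q 1 3):*(P :* P):+ :- p):* f):= con(q 1 2):*(con(q 2 0):*((:- P):*(con(q 2 0):*((:- P):* f)))):+ con(-q q 1 2):*((P :* P :+ con(q 12 0):* p):* f))refl P p f)(+-congˡ(*-congˡ(*-congʳ(sym hA))))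
   qm : ∀ x y z ->(x +(y * P + z *(P * P + k(q 36 0)* p)))+ k ½ * qu x y z ≈ k(q 3 1)* x + k(q 3 0)*(A * z)
   qm x y z = trans(solve 5(\ P p x y z ->(x :+(y :* P :+ z :*(P :* P :+ con(q 36 0):* p))):+ con ½ :*(x :+(con(-q q 2 0):*(y :* P):+ con(q 4 0):*(z :*(P :* P)))):= con(q 3 1):* x :+ con(q 3 0):*((P :* P :+ con(q 12 0):* p):* z))refl P p x y z)(+-congˡ(*-congˡ(*-congʳ(sym hA))))
   qs : ∀ a x y z -> a * Qu x y z ≈ Qu(a * x)(a * y)(a * z)
   qs a x y z = solve 5(\ a x y z P -> a :*(x :+(y :* P :+ z :*(P :* P))):= a :* x :+((a :* y):* P :+(a :* z):*(P :* P)))refl a x y z P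
   qd : ∀ a x y z -> a * qu x y z ≈ qu(a * x)(a * y)(a * z)
   qd a x y z = solve 5(\ a x y z P -> a :*(x :+(con(-q q 2 0):*(y :* P):+ con(q 4 0):*(z :*(P :* P)))):= a :* x :+(con(-q q 2 0):*((a :* y):* P):+ con(q 4 0):*((a :* z):*(P :* P))))refl a x y z P
   Qd : ∀ x y z x′ y′ za -> Qu x y z + Qu x′ y′ za ≈ Qu(x + x′)(y + y′)(z + za)
   Qd x y z x′ y′ za = trans(solve 6(\ x a b x′ a′ b′ ->(x :+(a :+ b)):+(x′ :+(a′ :+ b′)):=(x :+ x′):+((a :+ a′):+(b :+ b′)))refl x(y * P)(z *(P * P))x′(y′ * P)(za *(P * P)))(+-congˡ(+-cong(sym(distribʳ P y y′))(sym(distribʳ(P * P)z za))))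
   Qa : ∀ x y z x′ y′ za -> qu x y z + qu x′ y′ za ≈ qu(x + x′)(y + y′)(z + za)
   Qa x y z x′ y′ za = trans(solve 6(\ x a b x′ a′ b′ ->(x :+(con(-q q 2 0):* a :+ con(q 4 0):* b)):+(x′ :+(con(-q q 2 0):* a′ :+ con(q 4 0):* b′)):=(x :+ x′):+(con(-q q 2 0):*(a :+ a′):+ con(q 4 0):*(b :+ b′)))refl x(y * P)(z *(P * P))x′(y′ * P)(za *(P * P)))(+-congˡ(+-cong(*-congˡ(sym(distribʳ P y y′)))(*-congˡ(sym(distribʳ(P * P)z za)))))
module Arith where
 open import Data.Bool.Base using (Bool;true;false;T;_∧_;not)
 open import Data.Integer.Base using (∣_∣;_+_;_*_;_-_;-_;_^_)
 import Data.Integer.DivMod as ℤD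
 open import Data.Integer.Solver using (module +-*-Solver)
 open import Data.List.Base using (List;[];_∷_)
 import Data.Nat.DivMod as ℕD
 open import Data.Nat.Divisibility using (divides;_∣?_)
 open import Relation.Nullary using (¬_;yes;no)
 open import Relation.Nullary.Decidable using (⌊_⌋)
 open import Relation.Binary.Definitions using (tri<;tri≈;tri>)
 private
  module Zs = +-*-Solver
  open Zs using (_:=_;_:+_;_:*_;_:-_;:-_;con)
 St : ℤ × ℤ -> ℤ × ℤ
 St(x , y)= -(+ 2 * y), x + y
 mQ : ℤ × ℤ -> ℤ × ℤ -> ℤ × ℤ
 mQ(x , y)(x′ , y′)= x * x′ - + 2 *(y * y′), x * y′ + y * x′ + y * y′
 pw : ℕ -> ℤ × ℤ
 pw z0 = 1ℤ , 0ℤ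
 pw(sC n)= St(pw n)
 px u : ℕ -> ℤ
 px n = pF(pw n)
 u n = pS(pw n)
 Si : ℕ -> ℤ
 Si 0 = -z 1ℤ
 Si 1 = 0ℤ
 Si 2 = 0ℤ
 Si 3 = 1ℤ
 Si(sC(sC(sC(sC n))))= Si n
 opaque
  a : ℕ -> ℤ
  a k = - u(sC(k +n k))+ Si k *(+ 2)^ k - 1ℤ
  Af : ∀ k -> a k ≡ - u(sC(k +n k))+ Si k *(+ 2)^ k - 1ℤ
  Af k = Re
 pZ : ∀ m n -> pw(m +n n)≡ mQ(pw m)(pw n)
 pZ z0 n = cong₂ _,_(Zs.solve 2(\ x y -> x := con 1ℤ :* x :- con(+ 2):*(con 0ℤ :* y))Re(px n)(u n))(Zs.solve 2(\ x y -> y := con 1ℤ :* y :+ con 0ℤ :* x :+ con 0ℤ :* y)Re(px n)(u n))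
 pZ(sC m)n = != cO St(pZ m n)=!(cong₂ _,_
  (Zs.solve 4(\ x y x′ y′ -> :-(con(+ 2):*(x :* y′ :+ y :* x′ :+ y :* y′)):=(:-(con(+ 2):* y)):* x′ :- con(+ 2):*((x :+ y):* y′))Re(px m)(u m)(px n)(u n))
  (Zs.solve 4(\ x y x′ y′ ->(x :* x′ :- con(+ 2):*(y :* y′)):+(x :* y′ :+ y :* x′ :+ y :* y′):=(:-(con(+ 2):* y)):* y′ :+(x :+ y):* x′ :+(x :+ y):* y′)Re(px m)(u m)(px n)(u n)))
 sM : ∀ q k -> Si(q *n 4 +n k)≡ Si k
 sM z0 k = Re
 sM(sC q)k = sM q k
 record Gb(s : ℤ)(h : ℕ): Set where
  field
   yb ya yc : ℤ
   eq : pw(h +n h)≡(1ℤ + s *(- + 3 + + 7 * yb), s *(+ 6 + + 7 * ya))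
   bG :(+ 2)^ h ≡ 1ℤ + s *(+ 7 * yc)
 module PE {s : ℤ} {h : ℕ} (G : Gb s h) where
  open Gb G
  wc wa wd vg vm : ℤ
  wc = - + 3 + + 7 * yb
  wa = + 6 + + 7 * ya
  wd = + 7 * yc
  vg = - + 9 - + 6 * yb - + 24 * ya + + 7 *(yb * yb) - + 14 *(ya * ya)
  vm = wa *(+ 2 * yb + ya)
  wg : wc * wc - + 2 *(wa * wa)≡ + 7 * vg
  wg = Zs.solve 2(\ x y ->(:- con(+ 3):+ con(+ 7):* x):*(:- con(+ 3):+ con(+ 7):* x):- con(+ 2):*((con(+ 6):+ con(+ 7):* y):*(con(+ 6):+ con(+ 7):* y)):= con(+ 7):*(:- con(+ 9):- con(+ 6):* x :- con(+ 24):* y :+ con(+ 7):*(x :* x):- con(+ 14):*(y :* y)))Re yb ya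
  wj : + 2 *(wc * wa)+ wa * wa ≡ + 7 * vm
  wj = Zs.solve 2(\ x y -> con(+ 2):*((:- con(+ 3):+ con(+ 7):* x):*(con(+ 6):+ con(+ 7):* y)):+(con(+ 6):+ con(+ 7):* y):*(con(+ 6):+ con(+ 7):* y):= con(+ 7):*((con(+ 6):+ con(+ 7):* y):*(con(+ 2):* x :+ y)))Re yb ya
  PL : ℕ -> Set
  PL n = ∃ \ q₁ -> ∃ \ q₂ -> pw(n *n(h +n h))≡(1ℤ + s *(+ n * wc + + 7 *(s * q₁)), s *(+ n * wa + + 7 *(s * q₂)))
  kg : ∀ n -> PL n
  kg z0 = 0ℤ , 0ℤ , cong₂ _,_(Zs.solve 2(\ s w -> con 1ℤ := con 1ℤ :+ s :*(con 0ℤ :* w :+ con(+ 7):*(s :* con 0ℤ)))Re s wc)(Zs.solve 2(\ s w -> con 0ℤ := s :*(con 0ℤ :* w :+ con(+ 7):*(s :* con 0ℤ)))Re s wa)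
  kg(sC n)= go(kg n)
   where
   go : PL n -> PL(sC n)
   go(q₁ , q₂ , e)= qb , qc , != pZ(h +n h)(n *n(h +n h))=~ cong₂ mQ eq e =!(cong₂ _,_ Fs oU)
    where
    qb = + n * vg + q₁ + s *(wc * q₁ - + 2 *(wa * q₂))
    qc = + n * vm + q₂ + s *(wa * q₁ + wc * q₂ + wa * q₂)
    jK : ∀ w ->(1ℤ + + n)* w ≡ + sC n * w
    jK w = Re
    Fs :(1ℤ + s * wc)*(1ℤ + s *(+ n * wc + + 7 *(s * q₁))) - + 2 *(s * wa *(s *(+ n * wa + + 7 *(s * q₂))))≡ 1ℤ + s *(+ sC n * wc + + 7 *(s * qb))
    Fs = != Zs.solve 6(\ s n w x q r ->(con 1ℤ :+ s :* w):*(con 1ℤ :+ s :*(n :* w :+ con(+ 7):*(s :* q))):- con(+ 2):*(s :* x :*(s :*(n :* x :+ con(+ 7):*(s :* r))))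
     := con 1ℤ :+ s :*((con 1ℤ :+ n):* w :+ s :*(n :*(w :* w :- con(+ 2):*(x :* x)):+ con(+ 7):*(q :+ s :*(w :* q :- con(+ 2):*(x :* r))))))Re s(+ n)wc wa q₁ q₂ =~
     cO(\ t -> 1ℤ + s *((1ℤ + + n)* wc + s *(+ n * t + + 7 *(q₁ + s *(wc * q₁ - + 2 *(wa * q₂))))))wg =!
      Zs.solve 6(\ s m w n v q -> con 1ℤ :+ s :*(m :* w :+ s :*(n :*(con(+ 7):* v):+ con(+ 7):* q)):= con 1ℤ :+ s :*(m :* w :+ con(+ 7):*(s :*(n :* v :+ q))))Re s(1ℤ + + n)wc(+ n)vg(q₁ + s *(wc * q₁ - + 2 *(wa * q₂)))
       tI cO(\ t -> 1ℤ + s *(+ sC n * wc + + 7 *(s * t)))(sy(au(+ n * vg)q₁ _))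
     where
     _tI_ : ∀ {A : Set} {x y z : A}-> x ≡ y -> y ≡ z -> x ≡ z
     _tI_ = qT
    oU :(1ℤ + s * wc)*(s *(+ n * wa + + 7 *(s * q₂)))+ s * wa *(1ℤ + s *(+ n * wc + + 7 *(s * q₁)))+ s * wa *(s *(+ n * wa + + 7 *(s * q₂)))≡ s *(+ sC n * wa + + 7 *(s * qc))
    oU = != Zs.solve 6(\ s n w x q r ->(con 1ℤ :+ s :* w):*(s :*(n :* x :+ con(+ 7):*(s :* r))):+ s :* x :*(con 1ℤ :+ s :*(n :* w :+ con(+ 7):*(s :* q))):+ s :* x :*(s :*(n :* x :+ con(+ 7):*(s :* r)))
     := s :*((con 1ℤ :+ n):* x :+ s :*(n :*(con(+ 2):*(w :* x):+ x :* x):+ con(+ 7):*(r :+ s :*(x :* q :+ w :* r :+ x :* r)))))Re s(+ n)wc wa q₁ q₂ =~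
     cO(\ t -> s *((1ℤ + + n)* wa + s *(+ n * t + + 7 *(q₂ + s *(wa * q₁ + wc * q₂ + wa * q₂)))))wj =~
      Zs.solve 6(\ s m w n v q -> s :*(m :* w :+ s :*(n :*(con(+ 7):* v):+ con(+ 7):* q)):= s :*(m :* w :+ con(+ 7):*(s :*(n :* v :+ q))))Re s(1ℤ + + n)wa(+ n)vm(q₂ + s *(wa * q₁ + wc * q₂ + wa * q₂))=!
       cO(\ t -> s *(+ sC n * wa + + 7 *(s * t)))(sy(au(+ n * vm)q₂ _))
  Pc : ℕ -> Set
  Pc n = ∃ \ q ->(+ 2)^(n *n h)≡ 1ℤ + s *(+ n * wd + + 7 *(s * q))
  pk : ∀ n -> Pc n
  pk z0 = 0ℤ , Zs.solve 2(\ s w -> con 1ℤ := con 1ℤ :+ s :*(con 0ℤ :* w :+ con(+ 7):*(s :* con 0ℤ)))Re s wd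
  pk(sC n)= go(pk n)
   where
   go : Pc n -> Pc(sC n)
   go(q , e)= + n *(yc * wd)+ q + s *(wd * q), != Ds(+ 2)h(n *n h)=~(cong₂ _*_ bG e)=!
    Zs.solve 4(\ s n y q ->(con 1ℤ :+ s :*(con(+ 7):* y)):*(con 1ℤ :+ s :*(n :*(con(+ 7):* y):+ con(+ 7):*(s :* q))):= con 1ℤ :+ s :*((con 1ℤ :+ n):*(con(+ 7):* y):+ con(+ 7):*(s :*(n :*(y :*(con(+ 7):* y)):+ q :+ s :*((con(+ 7):* y):* q)))))Re s(+ n)yc q
 Gx : ∀ {s h}-> Gb(+ 7 * s)h -> Gb(+ 7 *(+ 7 * s))(7 *n h)
 Gx{s} {h}G = go(kg 7)(pk 7)
  where
  open PE G
  open Gb G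
  d3 : 7 *n h +n 7 *n h ≡ 7 *n(h +n h)
  d3 = sy(Di 7 h h)
  go : PL 7 -> Pc 7 -> Gb(+ 7 *(+ 7 * s))(7 *n h)
  go(q₁ , q₂ , e)(q , ec)= record { yb = yb + s * q₁ ; ya = ya + s * q₂ ; yc = yc + s * q
   ; eq = != cO pw d3 =~ e =!(cong₂ _,_
    (Zs.solve 3(\ s y q -> con 1ℤ :+(con(+ 7):* s):*(con(+ 7):*(:- con(+ 3):+ con(+ 7):* y):+ con(+ 7):*(con(+ 7):* s :* q)):= con 1ℤ :+ con(+ 7):*(con(+ 7):* s):*(:- con(+ 3):+ con(+ 7):*(y :+ s :* q)))Re s yb q₁)
    (Zs.solve 3(\ s y q ->(con(+ 7):* s):*(con(+ 7):*(con(+ 6):+ con(+ 7):* y):+ con(+ 7):*(con(+ 7):* s :* q)):= con(+ 7):*(con(+ 7):* s):*(con(+ 6):+ con(+ 7):*(y :+ s :* q)))Re s ya q₂))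
   ; bG = != ec =! Zs.solve 3(\ s y q -> con 1ℤ :+(con(+ 7):* s):*(con(+ 7):*(con(+ 7):* y):+ con(+ 7):*(con(+ 7):* s :* q)):= con 1ℤ :+ con(+ 7):*(con(+ 7):* s):*(con(+ 7):*(y :+ s :* q)))Re s yc q }
 inverse : ∀ j -> ∃ \ i -> ∃ \ t -> i *(+ 3 *(+ 2 * px j + u j))≡ 1ℤ + + 7 * t
 inverse z0 = + 6 , + 5 , Re
 inverse(sC j)= go(inverse j)
  where
  go :(∃ \ i -> ∃ \ t -> i *(+ 3 *(+ 2 * px j + u j))≡ 1ℤ + + 7 * t)-> ∃ \ i -> ∃ \ t -> i *(+ 3 *(+ 2 * px(sC j)+ u(sC j)))≡ 1ℤ + + 7 * t
  go(i , t , e)= + 2 * i , 1ℤ + + 8 * t - + 6 *(i *(px j + u j)), != Zs.solve 3(\ i x y -> con(+ 2):* i :*(con(+ 3):*(con(+ 2):*(:-(con(+ 2):* y)):+(x :+ y))):= con(+ 8):*(i :*(con(+ 3):*(con(+ 2):* x :+ y))):- con(+ 42):*(i :*(x :+ y)))Re i(px j)(u j)=~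
   cO(\ z -> + 8 * z - + 42 *(i *(px j + u j)))e =! Zs.solve 3(\ t i z -> con(+ 8):*(con 1ℤ :+ con(+ 7):* t):- con(+ 42):*(i :* z):= con 1ℤ :+ con(+ 7):*(con 1ℤ :+ con(+ 8):* t :- con(+ 6):*(i :* z)))Re t i(px j + u j)
 module _ {s : ℤ} {g : ℕ} (kh : s ≢ 0ℤ) (G : Gb s (g *n 4)) where
  open PE G
  open Gb G
  private h = g *n 4
  dV : ∀ k n -> a(n *n h +n k)≡ a k -> ∃ \ m -> n ≡ m *n 7
  dV k n hyp = go(kg n)(pk n)(inverse j)
   where
   j = sC(k +n k)
   x = px j
   y = u j
   E = Si k *(+ 2)^ k
   Ix : sC((n *n h +n k)+n(n *n h +n k))≡ n *n(h +n h)+n j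
   Ix = != cO sC(bH(n *n h)k)=~ sy(su(n *n h +n n *n h)(k +n k))=! cO(_+n j)(sy(Di n h h))
    where
    bH : ∀ a b ->(a +n b)+n(a +n b)≡(a +n a)+n(b +n b)
    bH a b = != As a b(a +n b)=~ cO(a +n_)(!= sy(As b a b)=~ cO(_+n b)(Cm b a)=! As a b b)=! sy(As a a(b +n b))
   sg : Si(n *n h +n k)≡ Si k
   sg = != cO(\ t -> Si(t +n k))(sy(Ao n g 4))=! sM(n *n g)k
   go : PL n -> Pc n ->(∃ \ i -> ∃ \ t -> i *(+ 3 *(+ 2 * x + y))≡ 1ℤ + + 7 * t)-> ∃ \ m -> n ≡ m *n 7
   go(q₁ , q₂ , e)(q , ec)(i , t , hi)= ∣ M ∣ , !=(cO ∣_∣ nM)=! a4 M(+ 7)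
    where
    R : ℤ
    R = E *(+ n * yc + s * q) - s *(q₁ * y + q₂ *(x + y)) - + n *(yb * y + ya *(x + y))
    M : ℤ
    M = i * R - + n * t
    Uq : u(sC((n *n h +n k)+n(n *n h +n k)))≡(1ℤ + s *(+ n * wc + + 7 *(s * q₁)))* y + s *(+ n * wa + + 7 *(s * q₂))* x + s *(+ n * wa + + 7 *(s * q₂))* y
    Uq = != cO u Ix =! cO pS(!= pZ(n *n(h +n h))j =! cO(\ z -> mQ z(x , y))e)
    p1 : Si(n *n h +n k)*(+ 2)^(n *n h +n k)≡ E *(1ℤ + s *(+ n * wd + + 7 *(s * q)))
    p1 = !=(cong₂ _*_ sg(!= Ds(+ 2)(n *n h)k =~ cO(_*(+ 2)^ k)ec =!(jI _((+ 2)^ k))))=! sy(qz(Si k)((+ 2)^ k)_)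
    dP : -((1ℤ + s *(+ n * wc + + 7 *(s * q₁)))* y + s *(+ n * wa + + 7 *(s * q₂))* x + s *(+ n * wa + + 7 *(s * q₂))* y)+ E *(1ℤ + s *(+ n * wd + + 7 *(s * q))) - 1ℤ ≡ - y + E - 1ℤ
    dP = != cong₂(\ p r -> - p + r - 1ℤ)(sy Uq)(sy p1)=~ sy(Af(n *n h +n k))=~ hyp =! Af k
    sZ : s *(+ 7 * R - + n *(+ 3 *(+ 2 * x + y)))≡ s * 0ℤ
    sZ = != sy(iu _)=~ fU s(+ n)x y E =~ cO(_-(- y + E - 1ℤ))dP =~ b9(- y + E - 1ℤ)=! sy(Ze s)
     where
     fU : ∀ s n x y E -> s *(+ 7 *(E *(n * yc + s * q) - s *(q₁ * y + q₂ *(x + y)) - n *(yb * y + ya *(x + y))) - n *(+ 3 *(+ 2 * x + y)))+ 0ℤ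
      ≡ -((1ℤ + s *(n * wc + + 7 *(s * q₁)))* y + s *(n * wa + + 7 *(s * q₂))* x + s *(n * wa + + 7 *(s * q₂))* y)+ E *(1ℤ + s *(n * wd + + 7 *(s * q))) - 1ℤ -(- y + E - 1ℤ)
     fU s n x y E = Zs.solve 11(\ s n x y E q q₁ q₂ yb ya yc -> s :*(con(+ 7):*(E :*(n :* yc :+ s :* q):- s :*(q₁ :* y :+ q₂ :*(x :+ y)):- n :*(yb :* y :+ ya :*(x :+ y))):- n :*(con(+ 3):*(con(+ 2):* x :+ y))):+ con 0ℤ
      := :-((con 1ℤ :+ s :*(n :*(:- con(+ 3):+ con(+ 7):* yb):+ con(+ 7):*(s :* q₁))):* y :+ s :*(n :*(con(+ 6):+ con(+ 7):* ya):+ con(+ 7):*(s :* q₂)):* x :+ s :*(n :*(con(+ 6):+ con(+ 7):* ya):+ con(+ 7):*(s :* q₂)):* y):+ E :*(con 1ℤ :+ s :*(n :*(con(+ 7):* yc):+ con(+ 7):*(s :* q))):- con 1ℤ :-(:- y :+ E :- con 1ℤ))Re s n x y E q q₁ q₂ yb ya yc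
    instance
     nz : ℤ.NonZero s
     nz = NZ kh
    gQ : + n *(+ 3 *(+ 2 * x + y))≡ + 7 * R
    gQ = sy(Ij(+ 7 * R)_(qA s _ _ sZ))
    nM : + n ≡ M * + 7
    nM = != Zs.solve 2(\ n t -> n := n :*(con 1ℤ :+ con(+ 7):* t):- con(+ 7):*(n :* t))Re(+ n)t =~ cO(\ z -> + n * z - + 7 *(+ n * t))(sy hi)=~
     Zs.solve 4(\ n i l t -> n :*(i :* l):- con(+ 7):*(n :* t):= i :*(n :* l):- con(+ 7):*(n :* t))Re(+ n)i(+ 3 *(+ 2 * x + y))t =~ cO(\ z -> i * z - + 7 *(+ n * t))gQ =!
      Zs.solve 4(\ i r n t -> i :*(con(+ 7):* r):- con(+ 7):*(n :* t):=(i :* r :- n :* t):* con(+ 7))Re i R(+ n)t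
module Arith2 where
 open Arith public
 open import Data.Bool.Base using (Bool;true;false;T;_∧_;not)
 open import Data.Integer.Base using (∣_∣;_+_;_*_;_-_;-_;_^_)
 import Data.Integer.DivMod as ℤD
 open import Data.Integer.Solver using (module +-*-Solver)
 open import Data.List.Base using (List;[];_∷_)
 import Data.Nat.DivMod as ℕD
 open import Data.Nat.Divisibility using (divides;n∣m⇒m%n≡0)
 open import Relation.Nullary using (¬_)
 open import Relation.Binary.Definitions using (tri<;tri≈;tri>)
 private
  module Zs = +-*-Solver
  open Zs using (_:=_;_:+_;_:*_;_:-_;:-_;con)
 opaque
  unfolding a
  Am : a 1 ≡ 0ℤ × a 2 ≡ 0ℤ × a 3 ≡ 0ℤ × a 4 ≡ 0ℤ
  Am = Re , Re , Re , Re
  A6 : a 6 ≡ 0ℤ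
  A6 = Re
 qo : ℤ ->(d : ℕ).{{_ : ℕ.NonZero d}}-> ℤ
 qo x d = x ℤD./ℕ d
 gk : Gb(+ 1)(24 *n 4)
 gk = record { yb = qo(px 192 + + 2)7 ; ya = qo(u 192 - + 6)7 ; yc = qo((+ 2)^ 96 - 1ℤ)7 ; eq = Re ; bG = Re }
 gl : Gb(+ 7 * + 1)(7 *n(24 *n 4))
 gl = record { yb = qo(px 1344 + + 20)49 ; ya = qo(u 1344 - + 42)49 ; yc = qo((+ 2)^ 672 - 1ℤ)49 ; eq = Re ; bG = Re }
 7^ : ℕ -> ℕ
 7^ z0 = 1
 7^(sC r)= 7 *n 7^ r
 kj : ∀ r -> Gb(+ 7^ r)(7^ r *n 24 *n 4)
 kj r = sB(Gb(+ 7^ r))(sy(Ao(7^ r)24 4))(go r)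
  where
  go : ∀ r -> Gb(+ 7^ r)(7^ r *n(24 *n 4))
  go z0 = gk
  go(sC z0)= gl
  go(sC(sC r))= sB(\ h -> Gb(+ 7^(sC(sC r)))h)(sy(Ao 7(7^(sC r))(24 *n 4)))(sB(\ s -> Gb s(7 *n(7^(sC r)*n(24 *n 4))))(sy(!= pP 7(7 *n 7^ r)=! cO(+ 7 *_)(pP 7(7^ r))))
   (Gx{+ 7^ r}(sB(\ s -> Gb s(7^(sC r)*n(24 *n 4)))(pP 7(7^ r))(go(sC r)))))
 N7 : ∀ n -> n <n 7^ n
 N7 z0 = ss zn
 N7(sC n)= Ta(ss(N7 n))(mA(7^ n) {1} {7^ n}(ss zn ≤~ N7 n)≤~ mB(7^ n)(me(7^ n)_))
 bI : ∀ k N -> a(N *n 96 +n k)≡ a k -> N ≡ 0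
 bI k N h = fn(l8 N)
  where
  7^≢0 : ∀ r -> + 7^ r ≢ 0ℤ
  7^≢0 r e = ℕₚ.<⇒≢(tA zn(N7 r))(sy(cO ∣_∣ e))
  l8 : ∀ r -> ∃ \ n -> N ≡ n *n 7^ r
  l8 z0 = N , sy(ik N)
  l8(sC r)= go(l8 r)
   where
   go :(∃ \ n -> N ≡ n *n 7^ r)-> ∃ \ n -> N ≡ n *n 7^(sC r)
   go(n , e)= pF d , != e =~ cO(_*n 7^ r)(pS d)=! Ao(pF d)7(7^ r)
    where
    Ix : n *n(7^ r *n 24 *n 4)≡ N *n 96
    Ix = != cO(n *n_)(Ao(7^ r)24 4)=~ sy(Ao n(7^ r)96)=! cO(_*n 96)(sy e)
    d = dV{+ 7^ r} {7^ r *n 24}(7^≢0 r)(kj r)k n(!= cO(\ t -> a(t +n k))Ix =! h)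
  fn :(∃ \ n -> N ≡ n *n 7^ N)-> N ≡ 0
  fn(z0 , e)= e
  fn(sC n , e)= ⊥-elim(ℕₚ.<⇒≱(N7 N)(me(7^ N)(n *n 7^ N)≤~ ri(sy e)))
 M : ℕ
 M = 49408
 infix 4 _≋_
 record _≋_(x y : ℤ): Set where
  constructor mw
  field
   by : ℤ
   eq : x ≡ y + by * + M
 rd : ∀ {x}-> x ≋ x
 rd{x}= mw 0ℤ(sy(iu x))
 tB : ∀ {x y z}-> x ≋ y -> y ≋ z -> x ≋ z
 tB{x} {y} {z}(mw q e)(mw r f)= mw(q + r)(!= e =~ cO(_+ q * + M)f =! Zs.solve 4(\ z q r m -> z :+ r :* m :+ q :* m := z :+(q :+ r):* m)Re z q r(+ M))
 private
  pA : px 200 ≋ px 8 × u 200 ≋ u 8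
  pA = mw(qo(px 200 - px 8)M)Re , mw(qo(u 200 - u 8)M)Re
  pH : ∀ i -> px(i +n 200)≋ px(i +n 8)× u(i +n 200)≋ u(i +n 8)
  pH z0 = pA
  pH(sC i)= go(pH i)
   where
   go : px(i +n 200)≋ px(i +n 8)× u(i +n 200)≋ u(i +n 8)-> px(sC i +n 200)≋ px(sC i +n 8)× u(sC i +n 200)≋ u(sC i +n 8)
   go(mw q e , mw r f)= mw(-(+ 2 * r))(!= cO(\ t -> -(+ 2 * t))f =! Zs.solve 3(\ y r m -> :-(con(+ 2):*(y :+ r :* m)):= :-(con(+ 2):* y):+(:-(con(+ 2):* r)):* m)Re(u(i +n 8))r(+ M)),
    mw(q + r)(!=(cong₂ _+_ e f)=! Zs.solve 5(\ x y q r m ->(x :+ q :* m):+(y :+ r :* m):=(x :+ y):+(q :+ r):* m)Re(px(i +n 8))(u(i +n 8))q r(+ M))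
  cU : ℤ
  cU = qo((+ 2)^ 104 -(+ 2)^ 8)M
  Cq :(+ 2)^ 104 ≡(+ 2)^ 8 + cU * + M
  Cq = Re
  2-per : ∀ i ->(+ 2)^(i +n 104)≡(+ 2)^(i +n 8)+((+ 2)^ i * cU)* + M
  2-per i = != Ds(+ 2)i 104 =~ cO((+ 2)^ i *_)Cq =~ gR((+ 2)^ i)((+ 2)^ 8)cU(+ M)=! cO(_+((+ 2)^ i * cU)* + M)(sy(Ds(+ 2)i 8))
   where
   gR : ∀ p e c m -> p *(e + c * m)≡ p * e +(p * c)* m
   gR = Zs.solve 4(\ p e c m -> p :*(e :+ c :* m):= p :* e :+(p :* c):* m)Re
 gT : ∀ i -> a(i +n 104)≋ a(i +n 8)
 gT i = go(pS(pH(i +n i +n 9)))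
  where
  Ix : ∀ c -> sC((i +n c)+n(i +n c))≡(i +n i)+n sC(c +n c)
  Ix c = != cO sC(!= As i c(i +n c)=~ cO(i +n_)(!= sy(As c i c)=~ cO(_+n c)(Cm c i)=! As i c c)=! sy(As i i(c +n c)))=! sy(su(i +n i)(c +n c))
  iX : ∀ c ->(i +n i)+n(9 +n c)≡(i +n i +n 9)+n c
  iX c = sy(As(i +n i)9 c)
  sg : Si(i +n 104)≡ Si(i +n 8)
  sg = != cO Si(Cm i 104)=! cO Si(Cm 8 i)
  go : u(i +n i +n 9 +n 200)≋ u(i +n i +n 9 +n 8)-> a(i +n 104)≋ a(i +n 8)
  go(mw q e)= mw(s *((+ 2)^ i * cU) - q)(!= Af(i +n 104)=~(!= cong₂(\ x y -> - x + y - 1ℤ)(!= cO u(!= Ix 104 =! iX 200)=~ e =! cO(\ t -> u t + q * + M)(sy(!= Ix 8 =! iX 8)))(cong₂ _*_ sg(2-per i))=!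
   fn(u(sC((i +n 8)+n(i +n 8))))q(+ M)s((+ 2)^(i +n 8))((+ 2)^ i * cU))=! cO(_+(s *((+ 2)^ i * cU) - q)* + M)(sy(Af(i +n 8))))
   where
   s = Si(i +n 8)
   fn : ∀ x q m s p c -> -(x + q * m)+ s *(p + c * m) - 1ℤ ≡ - x + s * p - 1ℤ +(s * c - q)* m
   fn = Zs.solve 6(\ x q m s p c -> :-(x :+ q :* m):+ s :*(p :+ c :* m):- con 1ℤ := :- x :+ s :* p :- con 1ℤ :+(s :* c :- q):* m)Re
 aA : ∀ q i -> a(q *n 96 +n(i +n 8))≋ a(i +n 8)
 aA z0 i = rd
 aA(sC q)i = tB(sB(\ t -> a t ≋ a(q *n 96 +n i +n 8))ee(gT(q *n 96 +n i)))(sB(\ t -> a t ≋ a(i +n 8))(sy(As(q *n 96)i 8))(aA q i))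
  where
  ee : q *n 96 +n i +n 104 ≡ sC q *n 96 +n(i +n 8)
  ee = != As(q *n 96)i 104 =~ cO(q *n 96 +n_)(!= sy(As i 8 96)=! Cm(i +n 8)96)=~ sy(As(q *n 96)96(i +n 8))=! cO(_+n(i +n 8))(Cm(q *n 96)96)
 f : ℕ -> ℤ
 f z0 = a 7
 f(sC i)= a(i +n 8)
 private
  t1 :(ℕ -> ℤ)-> ℕ -> List ℤ
  t1 g z0 = []
  t1 g(sC n)= g 0 ∷ t1(\ i -> g(sC i))n
  dD : ℤ -> ℤ -> Bool
  dD x y = not(∣ x - y ∣ ℕ.% M ℕ.≡ᵇ 0)
  fe : ℤ -> List ℤ -> Bool
  fe x [] = true
  fe x(y ∷ ys)= dD x y ∧ fe x ys
  Dt : List ℤ -> Bool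
  Dt [] = true
  Dt(x ∷ xs)= fe x xs ∧ Dt xs
  Th : ∀ {x y}-> T(x ∧ y)-> T x × T y
  Th{true} {true}_ = tt , tt
  dx : ∀ {x y}-> T(dD x y)-> ¬(x ≋ y)
  dx{x} {y}t(mw q e)= no(n∣m⇒m%n≡0 ∣ x - y ∣ M(divides ∣ q ∣(!=(cO ∣_∣(!= cO(_- y)e =! Zs.solve 2(\ y z -> y :+ z :- y := z)Re y(q * + M)))=! a4 q(+ M))))t
   where
   no : ∀ {n}-> n ≡ 0 -> T(not(n ℕ.≡ᵇ 0))-> ⊥
   no Re()
  fr : ∀ {x}g n -> T(fe x(t1 g n))-> ∀ j -> j <n n -> ¬(x ≋ g j)
  fr{x}g(sC n)t z0 _ = dx(pF(Th{dD x(g 0)}t))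
  fr{x}g(sC n)t(sC j)(ss lt)= fr(\ i -> g(sC i))n(pS(Th{dD x(g 0)}t))j lt
  du : ∀ g n -> T(Dt(t1 g n))-> ∀ i j -> i <n j -> j <n n -> ¬(g i ≋ g j)
  du g(sC n)t z0(sC j)_(ss lt)= fr(\ i -> g(sC i))n(pF(Th{fe(g 0)(t1(\ i -> g(sC i))n)}t))j lt
  du g(sC n)t(sC i)(sC j)(ss lt)(ss lQ)= du(\ i -> g(sC i))n(pS(Th{fe(g 0)(t1(\ i -> g(sC i))n)}t))i j lt lQ
  opaque
   unfolding a
   fd : T(Dt(t1 f 97))
   fd = tt
   kk : a 5 ≋ a 101
   kk = mw(qo(a 5 - a 101)M)Re
   km : a 6 ≋ a 102
   km = mw(qo(a 6 - a 102)M)Re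
 aB : ∀ {x y}-> x ≋ y -> y ≋ x
 aB{x} {y}(mw q e)= mw(- q)(!= Zs.solve 3(\ y q m -> y :=(y :+ q :* m):+(:- q):* m)Re y q(+ M)=! cO(_+(- q)* + M)(sy e))
 Fi : ∀ i j -> i <n 97 -> j <n 97 -> f i ≋ f j -> i ≡ j
 Fi i j hi hj h with qB i j
 ... | tri< lt _ _ = ⊥-elim(du f 97 fd i j lt hj h)
 ... | tri≈ _ e _ = e
 ... | tri> _ _ gt = ⊥-elim(du f 97 fd j i gt hi(aB h))
 Cd : ℕ -> Set
 Cd k = ∃ \ i -> i <n 97 × a k ≋ f i ×((i ≡ 0 × k ≡ 7)⊎ ∃ \ j -> i ≡ sC j × ∃ \ q -> k +n 96 ≡ q *n 96 +n(j +n 8))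
 cG : ∀ k -> 5 ≤n k -> Cd k
 cG 0()
 cG 1(ss())
 cG 2(ss(ss()))
 cG 3(ss(ss(ss())))
 cG 4(ss(ss(ss(ss()))))
 cG 5 _ = 94 , xb 95 97 tt , kk , iR(93 , Re , 0 , Re)
 cG 6 _ = 95 , xb 96 97 tt , km , iR(94 , Re , 0 , Re)
 cG 7 _ = 0 , ss zn , rd , iL(Re , Re)
 cG(sC(sC(sC(sC(sC(sC(sC(sC k))))))))_ = sC r , ss(ℕD.m%n<n k 96), sB(\ t -> a t ≋ a(r +n 8))eq(aA q r), iR(r , Re , sC q , != Cm(8 +n k)96 =~ cO(96 +n_)(sy eq)=! sy(As 96(q *n 96)(r +n 8)))
  where
  r = k ℕ.% 96
  q = k ℕ./ 96
  eq : q *n 96 +n(r +n 8)≡ 8 +n k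
  eq = != sy(As(q *n 96)r 8)=~(Cm _ 8)=! cO(8 +n_)(!= Cm(q *n 96)r =! sy(ℕD.m≡m%n+[m/n]*n k 96))
 ai : ∀ k l -> 5 ≤n k -> 5 ≤n l -> a k ≡ a l -> k ≡ l
 ai k l hk hl h = go(cG k hk)(cG l hl)
  where
  aD : ∀ k l j q qa -> a k ≡ a l -> k +n 96 ≡ q *n 96 +n(j +n 8)-> l +n 96 ≡ qa *n 96 +n(j +n 8)-> q ≤n qa -> k ≡ l
  aD k l j q qa h e ej le = sy(!= lM =! cO(\ N -> N *n 96 +n k)(bI k N(!= cO a(sy lM)=! sy h)))
   where
   N = qa -n q
   lM : l ≡ N *n 96 +n k
   lM = cZ 96 l(N *n 96 +n k)(!= ej =~ cO(\ t -> t *n 96 +n(j +n 8))(sy(qC le))=~ cO(_+n(j +n 8))(qD 96 N q)=~ As(N *n 96)(q *n 96)(j +n 8)=~ cO(N *n 96 +n_)(sy e)=! sy(As(N *n 96)k 96))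
  go : Cd k -> Cd l -> k ≡ l
  go(i , hi , c , t)(ij , ko , cF , tf)= fn t tf
   where
   fY : i ≡ ij
   fY = Fi i ij hi ko(tB(aB c)(sB(_≋ f ij)(sy h)cF))
   fn :((i ≡ 0 × k ≡ 7)⊎ ∃ \ j -> i ≡ sC j × ∃ \ q -> k +n 96 ≡ q *n 96 +n(j +n 8))->((ij ≡ 0 × l ≡ 7)⊎ ∃ \ j -> ij ≡ sC j × ∃ \ q -> l +n 96 ≡ q *n 96 +n(j +n 8))-> k ≡ l
   fn(iL(_ , e))(iL(_ , ej))= != e =! sy ej
   fn(iL(z , _))(iR(j , s , _))= ⊥-elim(gM(!= sy z =~ fY =! s))
   fn(iR(j , s , _))(iL(z , _))= ⊥-elim(gM(!= sy z =~ sy fY =! s))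
   fn(iR(j , s , q , e))(iR(m6 , m7 , qa , ej))= Or(tu q qa)
    where
    kp : m6 ≡ j
    kp = st(!= sy m7 =~ sy fY =! s)
    jL : l +n 96 ≡ qa *n 96 +n(j +n 8)
    jL = != ej =! cO(\ t -> qa *n 96 +n(t +n 8))kp
    Or : q ≤n qa ⊎ qa ≤n q -> k ≡ l
    Or(iL le)= aD k l j q qa h e jL le
    Or(iR le)= sy(aD l k j qa q(sy h)jL e le)
 d4 : ∀ k -> 5 ≤n k -> a k ≡ 0ℤ -> k ≡ 6
 d4 k hk h = ai k 6 hk(xb 5 6 tt)(!= h =! sy A6)
module PiQ where
 open Q
 module FQ = FSum qW
 open FQ using (∑;ch;∑-+;∑-*;∑-*ʳ;tj;Sw;Ng)
 open ≡ using (refl;sym;trans;module ≡-Reasoning)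
 open Q.+-*-Solver using (solve;_:=_;_:+_;_:*_;_:-_;:-_;con)
 import Data.Rational.Unnormalised.Base as ℚᵘ
 import Data.Rational.Unnormalised.Properties as ℚᵘₚ
 gU : ∀ i k -> i / sC k ≡(i / 1)* inv(ι(sC k))(0<ι k)
 gU i k = trans(sym(*-identityʳ _))(trans(cO(\ t ->(i / sC k)* t)(sym(ic(0<ι k))))
  (trans(sym(*-assoc(i / sC k)(ι(sC k))_))(cO(\ t -> t * inv(ι(sC k))(0<ι k))e)))
  where
  e :(i / sC k)* ι(sC k)≡ i / 1
  e = trans(cO(\ t ->(i / sC k)* t)(dj(sC k)))(toℚᵘ-injective(ℚᵘₚ.≃-trans(toℚᵘ-homo-*(i / sC k)((+ sC k)/ 1))
   (ℚᵘₚ.≃-trans(ℚᵘₚ.*-cong(toℚᵘ-fromℚᵘ(ℚᵘ.mkℚᵘ i k))(toℚᵘ-fromℚᵘ(ℚᵘ.mkℚᵘ(+ sC k)0)))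
    (ℚᵘₚ.≃-trans(ℚᵘ.*≡*(trans(ih(i *z + sC k))(cO(\ t -> i *z + t)(sym(ik(sC k))))))(ℚᵘₚ.≃-sym(toℚᵘ-fromℚᵘ(ℚᵘ.mkℚᵘ i 0)))))))
 fZ : ∀ i j ->(i *z j)/ 1 ≡(i / 1)*(j / 1)
 fZ i j = toℚᵘ-injective(ℚᵘₚ.≃-trans(toℚᵘ-fromℚᵘ(ℚᵘ.mkℚᵘ(i *z j)0))(ℚᵘₚ.≃-sym(ℚᵘₚ.≃-trans(toℚᵘ-homo-*(i / 1)(j / 1))
  (ℚᵘₚ.≃-trans(ℚᵘₚ.*-cong(toℚᵘ-fromℚᵘ(ℚᵘ.mkℚᵘ i 0))(toℚᵘ-fromℚᵘ(ℚᵘ.mkℚᵘ j 0)))(ℚᵘ.*≡* refl)))))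
 kq : ∀ i j ->(i +z j)/ 1 ≡(i / 1)+(j / 1)
 kq i j = toℚᵘ-injective(ℚᵘₚ.≃-trans(toℚᵘ-fromℚᵘ(ℚᵘ.mkℚᵘ(i +z j)0))(ℚᵘₚ.≃-sym(ℚᵘₚ.≃-trans(toℚᵘ-homo-+(i / 1)(j / 1))
  (ℚᵘₚ.≃-trans(ℚᵘₚ.+-cong(toℚᵘ-fromℚᵘ(ℚᵘ.mkℚᵘ i 0))(toℚᵘ-fromℚᵘ(ℚᵘ.mkℚᵘ j 0)))(ℚᵘ.*≡*(cO(\ t -> t *z + 1)(cong₂ _+z_(ih i)(ih j))))))))
 ng : ℚ
 ng = - 1q
 N4 : ℚ
 N4 =(1q + 1q)+(1q + 1q)
 c : ℕ -> ℚ
 c m = inv(ι(sC(m +n m)))(0<ι(m +n m))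
 C0 : ∀ m -> 0q < c m
 C0 m = I0(0<ι(m +n m))
 lr : ∀ n ->(-z 1ℤ)^z n *z + 4 / sC(2 *n n)≡ N4 *(ng ^ n * c n)
 lr n = trans(gU((-z 1ℤ)^z n *z + 4)(2 *n n))(trans(cong₂ _*_(trans(fZ((-z 1ℤ)^z n)(+ 4))(cO(\ t -> t * N4)(pw n)))(cO(\ k -> inv(ι(sC k))(0<ι k))(cO(\ t -> n +n t)(Iy n))))
  (solve 3(\ s f c -> s :* f :* c := f :*(s :* c))refl(ng ^ n)N4(c n)))
  where
  pw : ∀ n ->(-z 1ℤ)^z n / 1 ≡ ng ^ n
  pw z0 = refl
  pw(sC n)= trans(fZ(-z 1ℤ)((-z 1ℤ)^z n))(cO(\ t -> ng * t)(pw n))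
 mx : ∀ n{a b : ℕ -> ℚ}->(∀ i -> i <n n -> a i ≤ b i)-> ∑ n a ≤ ∑ n b
 mx z0 h = ≤-refl
 mx(sC n)h = +-mono-≤(h 0(ss zn))(mx n \ i lt -> h(sC i)(ss lt))
 Ct : ∀ n q -> ∑ n(\ _ -> q)≡ ι n * q
 Ct z0 q = sym(trans(cO(\ t -> t * q)nx)(*-zeroˡ q))
 Ct(sC n)q = trans(cO(\ t -> q + t)(Ct n q))(trans(solve 2(\ q i -> q :+ i :* q :=(con 1q :+ i):* q)refl q(ι n))(cO(\ t -> t * q)(sym(Sc n))))
 Ab : ∀ n(a : ℕ -> ℚ)-> ∣ ∑ n a ∣ ≤ ∑ n(\ i -> ∣ a i ∣)
 Ab z0 a = ≤-refl
 Ab(sC n)a = ≤-trans(∣p+q∣≤∣p∣+∣q∣(a 0)_)(+-monoʳ-≤ ∣ a 0 ∣(Ab n _))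
 Ai : ∀ {x y}-> x ≤ y -> - y ≤ x -> ∣ x ∣ ≤ y
 Ai{x} {y}h g = go(∣p∣≡p∨∣p∣≡-p x)
  where
  go : ∣ x ∣ ≡ x ⊎ ∣ x ∣ ≡ - x -> ∣ x ∣ ≤ y
  go(iL e)= ≤-trans(≤-reflexive e)h
  go(iR e)= ≤-trans(≤-reflexive e)(≤-trans(neg-antimono-≤ g)(≤-reflexive(solve 1(\ y -> :-(:- y):= y)refl y)))
 nF : ∀ n x -> ∣ ng ^ n * x ∣ ≡ ∣ x ∣
 nF z0 x = cO ∣_∣(*-identityˡ x)
 nF(sC n)x = trans(cO ∣_∣(solve 2(\ s x -> :- con 1q :* s :* x := :-(s :* x))refl(ng ^ n)x))(trans(∣-p∣≡∣p∣(ng ^ n * x))(nF n x))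
 pd : ∀ N{a b}-> 0q ≤ a -> a ≤ b -> ι(sC N)*(a ^ N *(b - a))≤ b ^ sC N - a ^ sC N
 pd z0{a} {b}ha ab = ≤-reflexive(trans(cO(\ t -> t *(1q *(b - a)))(trans(Sc 0)(cO(\ t -> 1q + t)nx)))(solve 2(\ a b ->(con 1q :+ con 0q):*(con 1q :*(b :- a)):= b :* con 1q :- a :* con 1q)refl a b))
 pd(sC N) {a} {b}ha ab = ≤-trans(≤-reflexive(trans(cO(\ t -> t *(a * a ^ N *(b - a)))(Sc(sC N)))
  (solve 4(\ i a p b ->(con 1q :+ i):*(a :* p :*(b :- a)):= a :*(i :*(p :*(b :- a))):+ a :* p :*(b :- a))refl(ι(sC N))a(a ^ N)b)))
  (≤-trans(+-monoˡ-≤ _(mt ha(0≤*(0≤ι(sC N))(0≤*(0≤^ N ha)(p≤q⇒0≤q-p ab)))ab(pd N ha ab)))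
   (≤-reflexive(solve 4(\ a b x y -> b :*(y :- a :* x):+ a :* x :*(b :- a):= b :* y :- a :*(a :* x))refl a b(a ^ N)(b ^ sC N))))
 pf : ∀ N{a b}-> 0q ≤ a -> a ≤ b -> b ^ sC N - a ^ sC N ≤ ι(sC N)*(b ^ N *(b - a))
 pf z0{a} {b}ha ab = ≤-reflexive(trans(solve 2(\ a b -> b :* con 1q :- a :* con 1q :=(con 1q :+ con 0q):*(con 1q :*(b :- a)))refl a b)(cO(\ t -> t *(1q *(b - a)))(sym(trans(Sc 0)(cO(\ t -> 1q + t)nx)))))
 pf(sC N) {a} {b}ha ab = ≤-trans(≤-reflexive(solve 4(\ a b x y -> b :* y :- a :* x := b :*(y :- x):+ x :*(b :- a))refl a b(a ^ sC N)(b ^ sC N)))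
  (≤-trans(+-mono-≤(Mn{b ^ sC N - a ^ sC N} {_} {b}(≤-trans ha ab)(pf N ha ab))(mc{a ^ sC N} {b ^ sC N} {b - a}(p≤q⇒0≤q-p ab)(mq(sC N)ha ab)))
   (≤-reflexive(trans(solve 4(\ i b p a -> b :*(i :*(p :*(b :- a))):+ b :* p :*(b :- a):=(con 1q :+ i):*(b :* p :*(b :- a)))refl(ι(sC N))b(b ^ N)a)
    (cO(\ t -> t *(b * b ^ N *(b - a)))(sym(Sc(sC N)))))))
 L : ℕ -> ℚ
 L n = ∑ n(\ m -> ng ^ m * c m)
 module Sub (k : ℕ) where
  K : ℕ
  K = sC k
  h : ℚ
  h = inv(ι K)(0<ι k)
  hR : 0q < h
  hR = I0(0<ι k)
  x : ℕ -> ℚ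
  x j = ι j * h
  x0 : ∀ j -> 0q ≤ x j
  x0 j = 0≤*(0≤ι j)(<⇒≤ hR)
  Xs : ∀ j -> x(sC j)≡ h + x j
  Xs j = trans(cO(\ t -> t * h)(Sc j))(solve 2(\ i h ->(con 1q :+ i):* h := h :+ i :* h)refl(ι j)h)
  Xd : ∀ j -> x(sC j) - x j ≡ h
  Xd j = trans(cO(\ t -> t - x j)(Xs j))(solve 2(\ h x -> h :+ x :- x := h)refl h(x j))
  Xm : ∀ j -> x j ≤ x(sC j)
  Xm j = bc h(<⇒≤ hR)(trans(Xs j)(+-comm h(x j)))
  XK : x K ≡ 1q
  XK = ic(0<ι k)
  xV : x 0 ≡ 0q
  xV = trans(cO(\ t -> t * h)nx)(*-zeroˡ h)
  p : ℕ -> ℚ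
  p j = x j * x(sC j)
  pD : ∀ j -> 0q ≤ p j
  pD j = 0≤*(x0 j)(x0(sC j))
  1+p>0 : ∀ j -> 0q < 1q + p j
  1+p>0 j = 0<+ 0<1(pD j)
  δ : ℕ -> ℚ
  δ j = h * inv(1q + p j)(1+p>0 j)
  T : ℚ
  T = ∑ K δ
  S : ℕ -> ℚ
  S m = ∑ K(\ j -> h * p j ^ m)
  SD : ∀ m -> ∣ S m - c m ∣ ≤ h
  SD m = Ai hi lo
   where
   open ≤-Reasoning
   i2 : ℚ
   i2 = ι(sC(m +n m))
   u : ℕ -> ℚ
   u j = x j ^ m
   F G : ℕ -> ℚ
   F j = c m * x j ^ sC(m +n m)
   G j = h *(u j * u j)
   uu : ∀ j -> x j ^(m +n m)≡ u j * u j
   uu j = ^-+(x j)m m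
   U0 : ∀ j -> 0q ≤ u j
   U0 j = 0≤^ m(x0 j)
   um : ∀ j -> u j ≤ u(sC j)
   um j = mq m(x0 j)(Xm j)
   ci : c m * i2 ≡ 1q
   ci = ip(0<ι(m +n m))
   pm : ∀ j -> h * p j ^ m ≡ h *(u j * u(sC j))
   pm j = cO(\ t -> h * t)(di(x j)(x(sC j))m)
   GE : ∀ j -> G j ≤ F(sC j) - F j
   GE j = begin
    h *(u j * u j)≡⟨ trans(*-comm h _)(cong₂ _*_(sym(uu j))(sym(Xd j)))⟩
    x j ^(m +n m)*(x(sC j) - x j)≡⟨ trans(sym(*-identityˡ _))(trans(cO(\ t -> t *(x j ^(m +n m)*(x(sC j) - x j)))(sym ci))(*-assoc(c m)i2 _))⟩
    c m *(i2 *(x j ^(m +n m)*(x(sC j) - x j)))≤⟨ Mn(<⇒≤(C0 m))(pd(m +n m)(x0 j)(Xm j))⟩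
    c m *(x(sC j)^ sC(m +n m) - x j ^ sC(m +n m))≡⟨ solve 3(\ c a b -> c :*(a :- b):= c :* a :- c :* b)refl(c m)(x(sC j)^ sC(m +n m))(x j ^ sC(m +n m))⟩
    F(sC j) - F j ∎
   FG : ∀ j -> F(sC j) - F j ≤ G(sC j)
   FG j = begin
    F(sC j) - F j ≡⟨ sym(solve 3(\ c a b -> c :*(a :- b):= c :* a :- c :* b)refl(c m)(x(sC j)^ sC(m +n m))(x j ^ sC(m +n m)))⟩
    c m *(x(sC j)^ sC(m +n m) - x j ^ sC(m +n m))≤⟨ Mn(<⇒≤(C0 m))(pf(m +n m)(x0 j)(Xm j))⟩
    c m *(i2 *(x(sC j)^(m +n m)*(x(sC j) - x j)))≡⟨ sym(trans(sym(*-identityˡ _))(trans(cO(\ t -> t *(x(sC j)^(m +n m)*(x(sC j) - x j)))(sym ci))(*-assoc(c m)i2 _)))⟩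
    x(sC j)^(m +n m)*(x(sC j) - x j)≡⟨ sym(trans(*-comm h _)(cong₂ _*_(sym(uu(sC j)))(sym(Xd j))))⟩
    h *(u(sC j)* u(sC j))∎
   Mh : ∀ j -> h * p j ^ m ≤(F(sC j) - F j)+(G(sC j) - G j)
   Mh j = begin
    h * p j ^ m ≡⟨ pm j ⟩
    h *(u j * u(sC j))≤⟨ Mn(<⇒≤ hR)(mc(U0(sC j))(um j))⟩
    G(sC j)≡⟨ solve 2(\ a b -> a := b :+(a :- b))refl(G(sC j))(G j)⟩
    G j +(G(sC j) - G j)≤⟨ +-monoˡ-≤(G(sC j) - G j)(GE j)⟩
    (F(sC j) - F j)+(G(sC j) - G j)∎
   Ml : ∀ j ->(F(sC j) - F j)+(-(G(sC j) - G j))≤ h * p j ^ m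
   Ml j = begin
    (F(sC j) - F j) -(G(sC j) - G j)≤⟨ +-monoˡ-≤(-(G(sC j) - G j))(FG j)⟩
    G(sC j) -(G(sC j) - G j)≡⟨ solve 2(\ a b -> a :-(a :- b):= b)refl(G(sC j))(G j)⟩
    G j ≤⟨ Mn(<⇒≤ hR)(Mn(U0 j)(um j))⟩
    h *(u j * u(sC j))≡⟨ sym(pm j)⟩
    h * p j ^ m ∎
   1^ : ∀ n -> 1q ^ n ≡ 1q
   1^ z0 = refl
   1^(sC n)= trans(*-identityˡ _)(1^ n)
   jM : ∑ K(\ j -> F(sC j) - F j)≡ c m
   jM = trans(tj K F)(trans(cong₂(\ s t -> c m * s ^ sC(m +n m) - c m * t ^ sC(m +n m))XK xV)
    (trans(cO(\ t -> c m * t - c m *(0q * 0q ^(m +n m)))(1^(sC(m +n m))))(solve 2(\ c z -> c :* con 1q :- c :*(con 0q :* z):= c)refl(c m)(0q ^(m +n m)))))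
   jN : ∑ K(\ j -> G(sC j) - G j)≤ h
   jN = begin
    ∑ K(\ j -> G(sC j) - G j)≡⟨ tj K G ⟩
    G K - G 0 ≤⟨ bc(G 0)(0≤*(<⇒≤ hR)(0≤sq(u 0)))(solve 2(\ a b -> a :=(a :- b):+ b)refl(G K)(G 0))⟩
    G K ≡⟨ cO(\ t -> h *(t * t))(trans(cO(\ t -> t ^ m)XK)(1^ m))⟩
    h *(1q * 1q)≡⟨ *-identityʳ h ⟩
    h ∎
   hi : S m - c m ≤ h
   hi = begin
    S m - c m ≤⟨ +-monoˡ-≤(- c m)(mx K \ j _ -> Mh j)⟩
    ∑ K(\ j ->(F(sC j) - F j)+(G(sC j) - G j)) - c m ≡⟨ cO(\ t -> t - c m)(trans(∑-+ K(\ j -> F(sC j) - F j)(\ j -> G(sC j) - G j))(cO(\ t -> t + ∑ K(\ j -> G(sC j) - G j))jM))⟩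
    c m + ∑ K(\ j -> G(sC j) - G j) - c m ≡⟨ solve 2(\ a b -> a :+ b :- a := b)refl(c m)(∑ K(\ j -> G(sC j) - G j))⟩
    ∑ K(\ j -> G(sC j) - G j)≤⟨ jN ⟩
    h ∎
   lo : - h ≤ S m - c m
   lo = begin
    - h ≤⟨ neg-antimono-≤ jN ⟩
    - ∑ K(\ j -> G(sC j) - G j)≡⟨ solve 2(\ a b -> :- b :=(a :+(:- b)):- a)refl(c m)(∑ K(\ j -> G(sC j) - G j))⟩
    (c m + - ∑ K(\ j -> G(sC j) - G j)) - c m ≡⟨ cO(\ t -> t - c m)(sym(trans(∑-+ K(\ j -> F(sC j) - F j)(\ j -> -(G(sC j) - G j)))(cong₂ _+_ jM(Ng K(\ j -> G(sC j) - G j)))))⟩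
    ∑ K(\ j ->(F(sC j) - F j)+ -(G(sC j) - G j)) - c m ≤⟨ +-monoˡ-≤(- c m)(mx K \ j _ -> Ml j)⟩
    S m - c m ∎
  gc : ∀ n q ->(1q + q)* ∑ n(\ m -> ng ^ m * q ^ m)≡ 1q - ng ^ n * q ^ n
  gc z0 q = solve 1(\ q ->(con 1q :+ q):* con 0q := con 1q :- con 1q :* con 1q)refl q
  gc(sC n)q = trans(cO(\ t ->(1q + q)* t)(FQ.Ls n(\ m -> ng ^ m * q ^ m)))(trans(*-distribˡ-+(1q + q)_ _)(trans(cO(\ t -> t +(1q + q)*(ng ^ n * q ^ n))(gc n q))
   (solve 3(\ q s r ->(con 1q :- s :* r):+(con 1q :+ q):*(s :* r):= con 1q :-(:- con 1q :* s):*(q :* r))refl q(ng ^ n)(q ^ n))))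
  Tf : ∀ n -> ∣ T - L n ∣ ≤ ι(sC n)* h + c n
  Tf n = begin
   ∣ T - L n ∣ ≡⟨ cO ∣_∣ split ⟩
   ∣ ∑ n(\ m -> ng ^ m *(S m - c m))+ ng ^ n * R ∣ ≤⟨ ∣p+q∣≤∣p∣+∣q∣(∑ n(\ m -> ng ^ m *(S m - c m)))(ng ^ n * R)⟩
   ∣ ∑ n(\ m -> ng ^ m *(S m - c m))∣ + ∣ ng ^ n * R ∣ ≤⟨ +-mono-≤ first(≤-trans(≤-reflexive(trans(nF n R)(0≤p⇒∣p∣≡p R0)))Rv)⟩
   ι n * h +(h + c n)≡⟨ trans(solve 3(\ i h c -> i :* h :+(h :+ c):=(con 1q :+ i):* h :+ c)refl(ι n)h(c n))(cO(\ t -> t * h + c n)(sym(Sc n)))⟩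
   ι(sC n)* h + c n ∎
   where
   open ≤-Reasoning
   v : ℕ -> ℚ
   v j = inv(1q + p j)(1+p>0 j)
   v0 : ∀ j -> 0q ≤ v j
   v0 j = <⇒≤(I0(1+p>0 j))
   R : ℚ
   R = ∑ K(\ j -> h *(p j ^ n * v j))
   R0 : 0q ≤ R
   R0 = ≤-trans(≤-reflexive(sym(trans(Ct K 0q)(*-zeroʳ(ι K)))))(mx K \ j _ -> 0≤*(<⇒≤ hR)(0≤*(0≤^ n(pD j))(v0 j)))
   Rv : R ≤ h + c n
   Rv = begin
    R ≤⟨ mx K(\ j _ -> Mn(<⇒≤ hR)(≤-trans(Mn{v j} {1q} {p j ^ n}(0≤^ n(pD j))(i1(1+p>0 j)(bc(p j)(pD j)refl)))(≤-reflexive(*-identityʳ(p j ^ n)))))⟩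
    S n ≡⟨ solve 2(\ s c -> s :=(s :- c):+ c)refl(S n)(c n)⟩
    (S n - c n)+ c n ≤⟨ +-monoˡ-≤(c n)(≤-trans(pp(S n - c n))(SD n))⟩
    h + c n ∎
    where
    pp : ∀ q -> q ≤ ∣ q ∣
    pp q = go(≤-total 0q q)
     where
     go : 0q ≤ q ⊎ q ≤ 0q -> q ≤ ∣ q ∣
     go(iL g)= ≤-reflexive(sym(0≤p⇒∣p∣≡p g))
     go(iR g)= ≤-trans g(0≤∣p∣ q)
   first : ∣ ∑ n(\ m -> ng ^ m *(S m - c m))∣ ≤ ι n * h
   first = begin
    ∣ ∑ n(\ m -> ng ^ m *(S m - c m))∣ ≤⟨ Ab n _ ⟩
    ∑ n(\ m -> ∣ ng ^ m *(S m - c m)∣)≤⟨ mx n(\ m _ -> ≤-trans(≤-reflexive(nF m(S m - c m)))(SD m))⟩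
    ∑ n(\ _ -> h)≡⟨ Ct n h ⟩
    ι n * h ∎
   d5 : ∀ j -> δ j ≡ ∑ n(\ m -> ng ^ m *(h * p j ^ m))+ ng ^ n *(h *(p j ^ n * v j))
   d5 j = trans(cO(\ t -> h * t)(trans(sym(*-identityˡ(v j)))(trans(cO(\ t -> t * v j)(trans(solve 1(\ s -> con 1q :=(con 1q :- s):+ s)refl(ng ^ n * p j ^ n))(cO(\ t -> t + ng ^ n * p j ^ n)(sym(gc n(p j))))))
    (trans(solve 4(\ o g r v ->(o :* g :+ r):* v :=(o :* v):* g :+ r :* v)refl(1q + p j)(∑ n(\ m -> ng ^ m * p j ^ m))(ng ^ n * p j ^ n)(v j))
     (cO(\ t -> t * ∑ n(\ m -> ng ^ m * p j ^ m)+ ng ^ n * p j ^ n * v j)(ic(1+p>0 j)))))))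
    (trans(solve 5(\ h g s r v -> h :*(con 1q :* g :+ s :* r :* v):= h :* g :+ s :*(h :*(r :* v)))refl h(∑ n(\ m -> ng ^ m * p j ^ m))(ng ^ n)(p j ^ n)(v j))
     (cO(\ t -> t + ng ^ n *(h *(p j ^ n * v j)))(trans(sym(∑-* n h(\ m -> ng ^ m * p j ^ m)))(ch n \ m -> solve 3(\ h s r -> h :*(s :* r):= s :*(h :* r))refl h(ng ^ m)(p j ^ m)))))
   split : T - L n ≡ ∑ n(\ m -> ng ^ m *(S m - c m))+ ng ^ n * R
   split = trans(cO(\ t -> t - L n)(trans(ch K d5)(trans(∑-+ K(\ j -> ∑ n(\ m -> ng ^ m *(h * p j ^ m)))(\ j -> ng ^ n *(h *(p j ^ n * v j))))
    (cong₂ _+_(trans(Sw K n(\ j m -> ng ^ m *(h * p j ^ m)))(ch n \ m -> ∑-* K(ng ^ m)(\ j -> h * p j ^ m)))(∑-* K(ng ^ n)(\ j -> h *(p j ^ n * v j)))))))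
    (trans(solve 3(\ a r l -> a :+ r :- l :=(a :- l):+ r)refl(∑ n(\ m -> ng ^ m * S m))(ng ^ n * R)(L n))
     (cO(\ t -> t + ng ^ n * R)(trans(cO(\ t -> ∑ n(\ m -> ng ^ m * S m)+ t)(sym(Ng n(\ m -> ng ^ m * c m))))
      (trans(sym(∑-+ n(\ m -> ng ^ m * S m)(\ m -> -(ng ^ m * c m))))(ch n \ m -> solve 3(\ s a b -> s :* a :+(:-(s :* b)):= s :*(a :- b))refl(ng ^ m)(S m)(c m))))))
module Ar = Arith2
open import Defs renaming (ofℚ to oq;ofℤ to oz;Eventually to Evt;fromℚ to fq)
module Cplx where
 open import Data.Rational.Base using (_⊓_)
 open ≡ using (refl;sym;trans;module ≡-Reasoning)
 open import Relation.Nullary using (¬_;yes;no;contradiction)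
 open import Level using (0ℓ)
 open Q.+-*-Solver using (solve;_:=_;_:+_;_:*_;_:-_;:-_;con)
 Em : ∀ {P P′ : ℕ -> Set}->(∀ n -> P n -> P′ n)-> Evt P -> Evt P′
 Em f(N , h)= N , \ n le -> f n(h n le)
 eI : ∀ {P P′ : ℕ -> Set}-> Evt P -> Evt P′ -> Evt(\ n -> P n × P′ n)
 eI(N , h)(M , g)= N ℕ.⊔ M , \ n le -> h n(Mm N M le), g n(md N M le)
 em : ∀ {P P′ PM : ℕ -> Set}->(∀ n -> P n -> P′ n -> PM n)-> Evt P -> Evt P′ -> Evt PM
 em f h g = Em(\ n -> \ { (p , pv)-> f n p pv })(eI h g)
 eJ : ∀ {P : Set}-> Evt(\ _ -> P)-> P
 eJ(N , h)= h N Rf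
 nr : ℚ -> ℚ -> ℚ
 nr a b = a ** a ++ b ** b
 No : ∀ a b c d{p q}-> 0q <= p -> 0q <= q -> nr a b <= p ** p -> nr c d <= q ** q ->
  nr(a ++ c)(b ++ d)<=(p ++ q)**(p ++ q)
 No a b c d{p} {q}hp hq oV oW = qX
  (solve 4(\ a b c d ->(a :+ c):*(a :+ c):+(b :+ d):*(b :+ d)
   :=((a :* a :+ b :* b):+(c :* c :+ d :* d)):+((a :* c :+ b :* d):+(a :* c :+ b :* d)))refl a b c d)
  (solve 2(\ p q ->(p :+ q):*(p :+ q):=(p :* p :+ q :* q):+(p :* q :+ p :* q))refl p q)
  (mi(mi oV oW)(mi S S))
  where
  S : a ** c ++ b ** d <= p ** q
  S = sK(n0 hp hq)(!< By((a ** d -q b ** c)**(a ** d -q b ** c))(nq(a ** d -q b ** c))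
   (solve 4(\ a b c d ->(a :* a :+ b :* b):*(c :* c :+ d :* d)
    :=(a :* c :+ b :* d):*(a :* c :+ b :* d):+(a :* d :- b :* c):*(a :* d :- b :* c))refl a b c d)<~
   my(N0(nq a)(nq b))(N0(nq c)(nq d))oV oW <!
    rl(solve 2(\ p q ->(p :* p):*(q :* q):=(p :* q):*(p :* q))refl p q))
 Nu : ∀ a b c d -> nr(a ** c ++ -q(b ** d))(a ** d ++ b ** c)≡ nr a b ** nr c d
 Nu = solve 4(\ a b c d ->(a :* c :+ :-(b :* d)):*(a :* c :+ :-(b :* d)):+(a :* d :+ b :* c):*(a :* d :+ b :* c)
  :=(a :* a :+ b :* b):*(c :* c :+ d :* d))refl
 aq : ∀ {a e}-> Q.∣ a ∣ <= e -> a ** a <= e ** e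
 aq{a} {e}h = sB(_<= e ** e)eq(sn(Np a)h)
  where
  eq : Q.∣ a ∣ ** Q.∣ a ∣ ≡ a ** a
  eq with pe a
  ... | iL e = cong₂ _**_ e e
  ... | iR e = trans(cong₂ _**_ e e)(solve 1(\ a ->(:- a):*(:- a):= a :* a)refl a)
 sE : ∀ {a e}-> 0q <= e -> a ** a <= e ** e -> Q.∣ a ∣ <= e
 sE{a} {e}he h with pe a
 ... | iL eq = sB(_<= e)(sym eq)(sK he h)
 ... | iR eq = sB(_<= e)(sym eq)(sK he
  (sB(_<= e ** e)(solve 1(\ a -> a :* a :=(:- a):*(:- a))refl a)h))
 kw : ∀ {a b p q}-> Q.∣ a ∣ <= p -> Q.∣ b ∣ <= q -> nr a b <=(p ++ q)**(p ++ q)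
 kw{a} {b} {p} {q}ha hb = !< mi(aq ha)(aq hb)<!
  By(p ** q ++ p ** q)(N0 pq pq)
   (solve 2(\ p q ->(p :+ q):*(p :+ q):=(p :* p :+ q :* q):+(p :* q :+ p :* q))refl p q)
  where pq = n0(!< Np a <! ha)(!< Np b <! hb)
 Nb : ℂ -> ℕ -> ℚ
 Nb z n = seq(re z)n ** seq(re z)n ++ seq(im z)n ** seq(im z)n
 0≤N² : ∀ z n -> 0q <= Nb z n
 0≤N² z n = N0(nq(seq(re z)n))(nq(seq(im z)n))
 infix 4 _<|_ _|>_ _≐_
 record _<|_(z : ℂ)(q : ℚ): Set where
  constructor mv
  field
   nn : 0q <= q
   bd : ∀ p -> q << p -> Evt \ n -> Nb z n <= p ** p
 open _<|_ public
 _|>_ : ℂ -> ℚ -> Set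
 z |> c = Evt \ n -> c ** c <= Nb z n
 _≐_ : ℂ -> ℂ -> Set
 z ≐ w = ∀ n -> seq(re z)n ≡ seq(re w)n × seq(im z)n ≡ seq(im w)n
 Rx : ℂ -> ℚ -> Set
 Rx z q = ∀ p -> q << p -> Evt \ n -> seq(re z)n <= p
 Ny : ∀ {z w}-> z ≐ w -> ∀ n -> Nb z n ≡ Nb w n
 Ny h n = cong₂ nr(pF(h n))(pS(h n))
 ≼-≐ : ∀ {z w q}-> z ≐ w -> z <| q -> w <| q
 ≼-≐{z} {w}e h = mv(nn h)\ p lt -> Em(\ n -> sB(_<= p ** p)(Ny{z} {w}e n))(bd h p lt)
 mo : ∀ {z q r}-> q <= r -> z <| q -> z <| r
 mo le h = mv(!< nn h <! le)\ p lt -> bd h p(Tr le lt)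
 Cl : ∀ {z q}-> 0q <= q ->(∀ ε -> 0q << ε -> z <| q ++ ε)-> z <| q
 Cl{z} {q}hq h = mv hq \ p lt -> bd(h(½ **(p -q q))(Ha(Pp lt)))p
  (bf(½ **(p -q q))(Ha(Pp lt))
   (solve 2(\ p q -> p :=(q :+ con ½ :*(p :- q)):+ con ½ :*(p :- q))refl p q))
 opaque
  unfolding fq _+ℝ_ _*ℝ_ -ℝ_
  ≼-+ : ∀ {z w q r}-> z <| q -> w <| r -> z + w <| q ++ r
  ≼-+{z} {w} {q} {r}hz hw = mv(N0(nn hz)(nn hw))\ p lt ->
   let dY = Ha(Pp lt);d = ½ **(p -q(q ++ r));q< = bf{q}d dY refl;r< = bf{r}d dY refl
   in em(\ n a b -> !< No(seq(re z)n)(seq(im z)n)(seq(re w)n)(seq(im w)n)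
    (!< nn hz <!(lZ q<))(!< nn hw <!(lZ r<))a b <!
    rl(cO(\ t -> t ** t)
     (solve 3(\ p q r ->(q :+ con ½ :*(p :-(q :+ r))):+(r :+ con ½ :*(p :-(q :+ r))):= p)refl p q r)))
    (bd hz(q ++ d)q<)(bd hw(r ++ d)r<)
  ≼-* : ∀ {z w q r}-> z <| q -> w <| r -> z * w <| q ** r
  ≼-*{z} {w} {q} {r}hz hw = mv(n0(nn hz)(nn hw))\ p lt ->
   let d = p -q q ** r;ky : 0q << q ++ r ++ 1q;ky = sB(0q <<_)(cw 1q(q ++ r))(nG nl(N0(nn hz)(nn hw)));e = d ** iv(q ++ r ++ 1q)ky;η = 1q ⊓ e;nL : 0q << η;nL = m0 nl(nD(Pp lt)(i0 ky));q< = bf{q}η nL refl;r< = bf{r}η nL refl;0≤η = lZ nL;Q0 = !< nn hz <!(lZ q<);ry = !< nn hw <!(lZ r<);le :(q ++ η)**(r ++ η)<= p;le = !<(!< rl(solve 3(\ q r η ->(q :+ η):*(r :+ η):= q :* r :+(q :+ r :+ η):* η)refl q r η)<! mj(q ** r)(my(N0(N0(nn hz)(nn hw))0≤η)0≤η(mj(q ++ r)(p⊓q≤p 1q e))(p⊓q≤q 1q e)))<! rl(trans(cO(q ** r ++_)(trans(solve 3(\ s d i -> s :*(d :* i):= d :*(s :* i))refl(q ++ r ++ 1q)d(iv(q ++ r ++ 1q)ky))(trans(cO(d **_)(Iv ky))(ii d))))(solve 2(\ p t -> t :+(p :- t):= p)refl p(q ** r)))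
   in em(\ n a b -> !< rl(Nu(seq(re z)n)(seq(im z)n)(seq(re w)n)(seq(im w)n))<~
    my(0≤N² z n)(0≤N² w n)a b <~
    rl(solve 2(\ a b ->(a :* a):*(b :* b):=(a :* b):*(a :* b))refl(q ++ η)(r ++ η))<!
     sn(n0 Q0 ry)le)
    (bd hz(q ++ η)q<)(bd hw(r ++ η)r<)
   where
   open import Data.Rational.Properties using (p⊓q≤p;p⊓q≤q;⊓-sel)
   m0 : ∀ {a b}-> 0q << a -> 0q << b -> 0q << a ⊓ b
   m0{a} {b}ha hb with ⊓-sel a b
   ... | iL e = sB(0q <<_)(sym e)ha
   ... | iR e = sB(0q <<_)(sym e)hb
  Ne : ∀ {z q}-> z <| q -> - z <| q
  Ne{z}h = mv(nn h)\ p lt -> Em(\ n -> sB(_<= p ** p)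
   (solve 2(\ a b -> a :* a :+ b :* b :=(:- a):*(:- a):+(:- b):*(:- b))refl(seq(re z)n)(seq(im z)n)))(bd h p lt)
  Of : ∀ q -> oq q <| Q.∣ q ∣
  Of q = mv(Np q)\ p lt -> 0 , \ n _ -> sB(_<= p ** p)
   (solve 1(\ q -> q :* q := q :* q :+ con 0q :* con 0q)refl q)(aq(lZ lt))
  xq : 𝕚 <| 1q
  xq = mv n1 \ p lt -> 0 , \ n _ -> sn n1(lZ lt)
  Nf : ∀ q z n -> Nb(oq q * z)n ≡(q ** q)** Nb z n
  Nf q z n = solve 3(\ q a b ->(q :* a :+ :-(con 0q :* b)):*(q :* a :+ :-(con 0q :* b))
   :+(q :* b :+ con 0q :* a):*(q :* b :+ con 0q :* a):=(q :* q):*(a :* a :+ b :* b))refl q(seq(re z)n)(seq(im z)n)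
  ≐-+ : ∀ {z za w wb}-> z ≐ za -> w ≐ wb -> z + w ≐ za + wb
  ≐-+ h g n = cong₂ _++_(pF(h n))(pF(g n)), cong₂ _++_(pS(h n))(pS(g n))
  sv : ∀ z w n -> Nb(z - w)n ≡ nr(seq(re z)n -q seq(re w)n)(seq(im z)n -q seq(im w)n)
  sv z w n = refl
 ei : ∀ z -> ∃ \ q -> z <| q
 ei z with cauchy(re z)1q nl | cauchy(im z)1q nl
 ... | N , h | M , g = B , mv B0 \ p lt -> N ℕ.⊔ M , \ n le -> !< kw{seq(re z)n} {seq(im z)n}(fU(seq(re z)n)(h n N(Mm N M le)Rf))(fU(seq(im z)n)(g n M(md N M le)Rf))<!
  sn B0(lZ lt)
  where
  a = seq(re z)N
  b = seq(im z)M
  B =(Q.∣ a ∣ ++ 1q)++(Q.∣ b ∣ ++ 1q)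
  B0 : 0q <= B
  B0 = N0(N0(Np a)n1)(N0(Np b)n1)
  fU : ∀ x{y}-> Q.∣ x -q y ∣ << 1q -> Q.∣ x ∣ <= Q.∣ y ∣ ++ 1q
  fU x{y}lt = !< rl(cO Q.∣_∣(solve 2(\ x y -> x := y :+(x :- y))refl x y))<~
   pb y(x -q y)<!(mj Q.∣ y ∣(lZ lt))
 Cu : ∀ z ε -> 0q << ε -> ∃ \ N -> ∀ m n -> N ≤n m -> N ≤n n ->
  nr(seq(re z)m -q seq(re z)n)(seq(im z)m -q seq(im z)n)<= ε ** ε
 Cu z ε na with cauchy(re z)(½ ** ε)(Ha na)| cauchy(im z)(½ ** ε)(Ha na)
 ... | N , h | M , g = N ℕ.⊔ M , \ m n p q -> !< kw{seq(re z)m -q seq(re z)n} {seq(im z)m -q seq(im z)n}(lZ(h m n(Mm N M p)(Mm N M q)))(lZ(g m n(md N M p)(md N M q)))<!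
  rl(solve 1(\ e ->(con ½ :* e :+ con ½ :* e):*(con ½ :* e :+ con ½ :* e):= e :* e)refl ε)
 Ir : ∀ z w ->(∀ ε -> 0q << ε -> Evt \ n -> Nb(z - w)n <= ε ** ε)-> z ≈ w
 Ir z w h = record { close = \ ε na -> Em(\ n le -> Tr(sE(lZ(Ha na))
  (!< By(b n ** b n)(nq(b n))refl <! sB(_<= _)(sv z w n)le))(hI na))(h(½ ** ε)(Ha na)) }
  , record { close = \ ε na -> Em(\ n le -> Tr(sE(lZ(Ha na))
   (!< By(a n ** a n)(nq(a n))(cw(a n ** a n)(b n ** b n))<! sB(_<= _)(sv z w n)le))(hI na))(h(½ ** ε)(Ha na)) }
  where
  a b : ℕ -> ℚ
  a n = seq(re z)n -q seq(re w)n
  b n = seq(im z)n -q seq(im w)n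
  hI : ∀ {ε}-> 0q << ε -> ½ ** ε << ε
  hI{ε}h = bf(½ ** ε)(Ha h)(solve 1(\ e -> e := con ½ :* e :+ con ½ :* e)refl ε)
 eK : ∀ {z w}-> z ≈ w -> ∀ ε -> 0q << ε -> Evt \ n -> Nb(z - w)n <= ε ** ε
 eK{z} {w}(h , g)ε na = em(\ n p q -> !< rl(sv z w n)<~ kw{seq(re z)n -q seq(re w)n} {seq(im z)n -q seq(im w)n}(lZ p)(lZ q)<!
  rl(solve 1(\ e ->(con ½ :* e :+ con ½ :* e):*(con ½ :* e :+ con ½ :* e):= e :* e)refl ε))
  (_≈ℝ_.close h(½ ** ε)(Ha na))(_≈ℝ_.close g(½ ** ε)(Ha na))
 nj : ∀ {z w}-> z ≈ w -> z - w <| 0q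
 nj h = mv ra \ p lt -> eK h p lt
 ny : ∀ {z w}-> z - w <| 0q -> z ≈ w
 ny{z} {w}h = Ir z w \ ε na -> bd h ε na
 xl : ∀ {z w}->(∀ ε -> 0q << ε -> z - w <| ε)-> z ≈ w
 xl{z} {w}h = ny(Cl ra \ ε na -> sB(z - w <|_)(sym(iB ε))(h ε na))
module Cx where
 open Cplx public
 open import Data.Maybe.Base using (Maybe;just;nothing)
 open import Relation.Binary.Structures using (IsEquivalence)
 open import Relation.Nullary using (¬_;yes;no;contradiction)
 open import Algebra.Structures {A = ℂ} _≈_
 open import Level using (0ℓ)
 import Algebra.Solver.Ring
 import Algebra.Solver.Ring.AlmostCommutativeRing as ACR
 import Data.Rational.Properties as ℚₚ
 open Q.+-*-Solver using (solve;_:=_;_:+_;_:*_;_:-_;:-_;con)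
 private
  xW : ∀ ε -> ½ ** ε ++ ½ ** ε ≡ ε
  xW = solve 1(\ e -> con ½ :* e :+ con ½ :* e := e)Re
 opaque
  unfolding fq _+ℝ_ _*ℝ_ -ℝ_
  ≐⇒≈ : ∀ {z w}-> z ≐ w -> z ≈ w
  ≐⇒≈{z} {w}h = Ir z w \ ε na -> 0 , \ n _ -> sB(_<= ε ** ε)(sy(eq n))(nq ε)
   where
   eq : ∀ n -> Nb(z - w)n ≡ 0q
   eq n = != cong₂(\ a b ->(a -q seq(re w)n)**(a -q seq(re w)n)++(b -q seq(im w)n)**(b -q seq(im w)n))(pF(h n))(pS(h n))=!
    solve 2(\ a b ->(a :- a):*(a :- a):+(b :- b):*(b :- b):= con 0q)Re(seq(re w)n)(seq(im w)n)
  private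
   d6 : ∀ z w n -> Nb(z - w)n ≡ Nb(w - z)n
   d6 z w n = solve 4(\ a b c d ->(a :- c):*(a :- c):+(b :- d):*(b :- d):=(c :- a):*(c :- a):+(d :- b):*(d :- b))Re
    (seq(re z)n)(seq(im z)n)(seq(re w)n)(seq(im w)n)
   t7 : ∀ z w v ->(z - w)+(w - v)≐ z - v
   t7 z w v n = lem(seq(re z)n)(seq(re w)n)(seq(re v)n), lem(seq(im z)n)(seq(im w)n)(seq(im v)n)
    where
    lem : ∀ a b c ->(a -q b)++(b -q c)≡ a -q c
    lem = solve 3(\ a b c ->(a :- b):+(b :- c):= a :- c)Re
   bk : ∀ z w -> z +(w - z)≐ w
   bk z w n = lem(seq(re z)n)(seq(re w)n), lem(seq(im z)n)(seq(im w)n)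
    where
    lem : ∀ a b -> a ++(b -q a)≡ b
    lem = solve 2(\ a b -> a :+(b :- a):= b)Re
   Au : ∀ z w za wb ->(z - za)+(w - wb)≐(z + w) -(za + wb)
   Au z w za wb n = lem(seq(re z)n)(seq(re w)n)(seq(re za)n)(seq(re wb)n), lem(seq(im z)n)(seq(im w)n)(seq(im za)n)(seq(im wb)n)
    where
    lem : ∀ a b c d ->(a -q c)++(b -q d)≡(a ++ b) -q(c ++ d)
    lem = solve 4(\ a b c d ->(a :- c):+(b :- d):=(a :+ b):-(c :+ d))Re
   Mu : ∀ z w za wb -> z *(w - wb)+(z - za)* wb ≐ z * w - za * wb
   Mu z w za wb n =
    != sS(x **(u -q ua))(y **(v -q vb))((x -q x′)** ua)((y -q y′)** vb)=~(cong₂ _-q_(ab x u x′ ua)(ab y v y′ vb))=! gV(x ** u)(x′ ** ua)(y ** v)(y′ ** vb)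
    , != gW(x **(v -q vb))(y **(u -q ua))((x -q x′)** vb)((y -q y′)** ua)=~
     (cong₂ _++_(ab x v x′ vb)(ab y u y′ ua))=! gX(x ** v)(x′ ** vb)(y ** u)(y′ ** ua)
    where
    x y u v x′ y′ ua vb : ℚ
    x = seq(re z)n
    y = seq(im z)n
    u = seq(re w)n
    v = seq(im w)n
    x′ = seq(re za)n
    y′ = seq(im za)n
    ua = seq(re wb)n
    vb = seq(im wb)n
    ab : ∀ a c a′ cF -> a **(c -q cF)++(a -q a′)** cF ≡ a ** c -q a′ ** cF
    ab = solve 4(\ a c a′ cF -> a :*(c :- cF):+(a :- a′):* cF := a :* c :- a′ :* cF)Re
    sS : ∀ p q r s ->(p -q q)++(r -q s)≡(p ++ r) -q(q ++ s)
    sS = solve 4(\ p q r s ->(p :- q):+(r :- s):=(p :+ r):-(q :+ s))Re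
    gW : ∀ p q r s ->(p ++ q)++(r ++ s)≡(p ++ r)++(q ++ s)
    gW = solve 4(\ p q r s ->(p :+ q):+(r :+ s):=(p :+ r):+(q :+ s))Re
    gX : ∀ p q r s ->(p -q q)++(r -q s)≡(p ++ r) -q(q ++ s)
    gX = sS
    gV : ∀ p q r s ->(p -q q) -q(r -q s)≡(p -q r) -q(q -q s)
    gV = solve 4(\ p q r s ->(p :- q):-(r :- s):=(p :- r):-(q :- s))Re
   bJ : ∀ z w -> -(z - w)≐(- z) -(- w)
   bJ z w n = lem(seq(re z)n)(seq(re w)n), lem(seq(im z)n)(seq(im w)n)
    where
    lem : ∀ a b -> -q(a -q b)≡(-q a) -q(-q b)
    lem = solve 2(\ a b -> :-(a :- b):=(:- a):-(:- b))Re
  private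
   gY : ∀ a b c d e f ->(a ** c -q b ** d)** e -q(a ** d ++ b ** c)** f ≡ a **(c ** e -q d ** f) -q b **(c ** f ++ d ** e)
   gY = solve 6(\ a b c d e f ->(a :* c :- b :* d):* e :-(a :* d :+ b :* c):* f := a :*(c :* e :- d :* f):- b :*(c :* f :+ d :* e))Re
   g1 : ∀ a b c d e f ->(a ** c -q b ** d)** f ++(a ** d ++ b ** c)** e ≡ a **(c ** f ++ d ** e)++ b **(c ** e -q d ** f)
   g1 = solve 6(\ a b c d e f ->(a :* c :- b :* d):* f :+(a :* d :+ b :* c):* e := a :*(c :* f :+ d :* e):+ b :*(c :* e :- d :* f))Re
   g2 : ∀ a b -> 1q ** a -q 0q ** b ≡ a
   g2 = solve 2(\ a b -> con 1q :* a :- con 0q :* b := a)Re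
   g3 : ∀ a b -> 1q ** b ++ 0q ** a ≡ b
   g3 = solve 2(\ a b -> con 1q :* b :+ con 0q :* a := b)Re
   g5 : ∀ a b c d e f -> a **(c ++ e) -q b **(d ++ f)≡(a ** c -q b ** d)++(a ** e -q b ** f)
   g5 = solve 6(\ a b c d e f -> a :*(c :+ e):- b :*(d :+ f):=(a :* c :- b :* d):+(a :* e :- b :* f))Re
   g7 : ∀ a b c d e f -> a **(d ++ f)++ b **(c ++ e)≡(a ** d ++ b ** c)++(a ** f ++ b ** e)
   g7 = solve 6(\ a b c d e f -> a :*(d :+ f):+ b :*(c :+ e):=(a :* d :+ b :* c):+(a :* f :+ b :* e))Re
   g8 : ∀ a b c d -> a ** c -q b ** d ≡ c ** a -q d ** b
   g8 = solve 4(\ a b c d -> a :* c :- b :* d := c :* a :- d :* b)Re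
   g9 : ∀ a b c d -> a ** d ++ b ** c ≡ c ** b ++ d ** a
   g9 = solve 4(\ a b c d -> a :* d :+ b :* c := c :* b :+ d :* a)Re
   pJ : ∀ x y z ->(x * y)* z ≐ x *(y * z)
   pJ x y z n = gY(seq(re x)n)(seq(im x)n)(seq(re y)n)(seq(im y)n)(seq(re z)n)(seq(im z)n)
    , g1(seq(re x)n)(seq(im x)n)(seq(re y)n)(seq(im y)n)(seq(re z)n)(seq(im z)n)
   Ps : ∀ x y z ->(x + y)+ z ≐ x +(y + z)
   Ps x y z n = dZ(seq(re x)n)(seq(re y)n)(seq(re z)n), dZ(seq(im x)n)(seq(im y)n)(seq(im z)n)
   pR : ∀ x -> 0# + x ≐ x
   pR x n = iB _ , iB _
   pT : ∀ x -> x + 0# ≐ x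
   pT x n = ig _ , ig _
   pK : ∀ x ->(- x)+ x ≐ 0#
   pK x n = oT(seq(re x)n), oT(seq(im x)n)
   pL : ∀ x -> x +(- x)≐ 0#
   pL x n = b6(seq(re x)n), b6(seq(im x)n)
   pU : ∀ x y -> x + y ≐ y + x
   pU x y n = cw(seq(re x)n)(seq(re y)n), cw(seq(im x)n)(seq(im y)n)
   pM : ∀ x -> 1# * x ≐ x
   pM x n = g2(seq(re x)n)(seq(im x)n), g3(seq(re x)n)(seq(im x)n)
   pV : ∀ x y z -> x *(y + z)≐ x * y + x * z
   pV x y z n = g5(seq(re x)n)(seq(im x)n)(seq(re y)n)(seq(im y)n)(seq(re z)n)(seq(im z)n)
    , g7(seq(re x)n)(seq(im x)n)(seq(re y)n)(seq(im y)n)(seq(re z)n)(seq(im z)n)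
   Pm : ∀ x y -> x * y ≐ y * x
   Pm x y n = g8(seq(re x)n)(seq(im x)n)(seq(re y)n)(seq(im y)n), g9(seq(re x)n)(seq(im x)n)(seq(re y)n)(seq(im y)n)
   pE : ∀ p q -> oq(p ++ q)≐ oq p + oq q
   pE p q n = Re , Re
   pG : ∀ p q -> oq(p ** q)≐ oq p * oq q
   pG p q n =
    solve 2(\ p q -> p :* q := p :* q :- con 0q :* con 0q)Re p q , solve 2(\ p q -> con 0q := p :* con 0q :+ con 0q :* q)Re p q
   Pn : ∀ p -> oq(-q p)≐ - oq p
   Pn p n = Re , Re
   pW : 𝕚 * 𝕚 ≐ - 1#
   pW n = Re , Re
 ≈-refl : ∀ {z}-> z ≈ z
 ≈-refl{z}= ≐⇒≈{z} {z}\ n -> Re , Re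
 ≈-sym : ∀ {z w}-> z ≈ w -> w ≈ z
 ≈-sym{z} {w}h = Ir w z \ ε na -> Em(\ n -> sB(_<= ε ** ε)(d6 z w n))(eK h ε na)
 tn : ∀ {z w v}-> z ≈ w -> w ≈ v -> z ≈ v
 tn{z} {w} {v}h g = ny(≼-≐(t7 z w v)(≼-+(nj h)(nj g)))
 rp : ∀ {z w q}-> z ≈ w -> z <| q -> w <| q
 rp{z} {w} {q}h b = sB(w <|_)(ig q)(≼-≐(bk z w)(≼-+ b(nj(≈-sym h))))
 private
  cM : ∀ {z za w wb}-> z ≈ za -> w ≈ wb -> z + w ≈ za + wb
  cM{z} {za} {w} {wb}h g = ny(≼-≐(Au z w za wb)(≼-+(nj h)(nj g)))
  cS : ∀ {z za w wb}-> z ≈ za -> w ≈ wb -> z * w ≈ za * wb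
  cS{z} {za} {w} {wb}h g = ny(≼-≐(Mu z w za wb)
   (sB(z *(w - wb)+(z - za)* wb <|_)(eq(pF(ei z))(pF(ei wb)))
    (≼-+(≼-*(pS(ei z))(nj g))(≼-*(nj h)(pS(ei wb))))))
   where
   eq : ∀ a b -> a ** 0q ++ 0q ** b ≡ 0q
   eq = solve 2(\ a b -> a :* con 0q :+ con 0q :* b := con 0q)Re
  nU : ∀ {z w}-> z ≈ w -> - z ≈ - w
  nU{z} {w}h = ny(≼-≐(bJ z w)(Ne(nj h)))
  cB : ∀ x y -> x * y ≈ y * x
  cB x y = ≐⇒≈(Pm x y)
  iY : ∀ x -> 1# * x ≈ x
  iY x = ≐⇒≈(pM x)
  dT : ∀ x y z -> x *(y + z)≈ x * y + x * z
  dT x y z = ≐⇒≈(pV x y z)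
  IC : IsCommutativeRing _+_ _*_ -_ 0# 1#
  IC = record
   { isRing = record
    { +-isAbelianGroup = record
     { isGroup = record
      { isMonoid = record
       { isSemigroup = record
        { isMagma = record
         { isEquivalence = record { refl = \ {z}-> ≈-refl{z}; sym = ≈-sym ; trans = tn }
         ; ∙-cong = cM }
        ; assoc = \ x y z -> ≐⇒≈(Ps x y z) }
       ; identity =(\ x -> ≐⇒≈(pR x)),(\ x -> ≐⇒≈(pT x)) }
      ; inverse =(\ x -> ≐⇒≈(pK x)),(\ x -> ≐⇒≈(pL x))
      ; ⁻¹-cong = nU }
     ; comm = \ x y -> ≐⇒≈(pU x y) }
    ; *-cong = cS
    ; *-assoc = \ x y z -> ≐⇒≈(pJ x y z)
    ; *-identity = iY ,(\ x -> tn(cB x 1#)(iY x))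
    ; distrib = dT ,(\ x y z -> tn(cB(y + z)x)(tn(dT x y z)(cM(cB x y)(cB x z)))) }
   ; *-comm = cB }
 oc : ∀ p q -> oq(p ++ q)≈ oq p + oq q
 oc p q = ≐⇒≈(pE p q)
 ob : ∀ p q -> oq(p ** q)≈ oq p * oq q
 ob p q = ≐⇒≈(pG p q)
 oe : ∀ p -> oq(-q p)≈ - oq p
 oe p = ≐⇒≈(Pn p)
 xn : 𝕚 * 𝕚 ≈ - 1#
 xn = ≐⇒≈ pW
 rn : CommutativeRing 0ℓ 0ℓ
 rn = record { isCommutativeRing = IC }
 private
  Mp : ℚₚ.+-*-rawRing ACR.-Raw-AlmostCommutative⟶ ACR.fromCommutativeRing rn
  Mp = record { ⟦_⟧ = oq ; +-homo = oc ; *-homo = ob ; -‿homo = oe ; 0-homo = ≈-refl ; 1-homo = ≈-refl }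
  dec : ∀ p q -> Maybe(oq p ≈ oq q)
  dec p q with p ℚₚ.≟ q
  ... | yes e = just(sB(\ t -> oq p ≈ oq t)e ≈-refl)
  ... | no _ = nothing
 module ℂ-Solver = Algebra.Solver.Ring ℚₚ.+-*-rawRing (ACR.fromCommutativeRing rn) Mp dec
infixr 6 _~~_ _~!_
infix 5 !~_
data Pf(x z : ℂ): Set where
 _~!_ : ∀ {y}-> x ≈ y -> y ≈ z -> Pf x z
 _~~_ : ∀ {y}-> x ≈ y -> Pf y z -> Pf x z
!~_ : ∀ {x z}-> Pf x z -> x ≈ z
!~(p ~! q)= Cx.tn p q
!~(p ~~ q)= Cx.tn p(!~ q)
module CSolve where
 open Cx.ℂ-Solver public using (_:=_;_:+_;_:*_;_:-_;:-_;_:^_) renaming (solve to sV;con to #)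
open Cx using () renaming (≈-refl to rR;≈-sym to yY)
module Lim where
 open Cx public
 open Q.+-*-Solver using (solve;_:=_;_:+_;_:*_;_:-_;:-_;con)
 infix 4 _=>_
 _=>_ :(ℕ -> ℂ)-> ℂ -> Set
 s => L = ∀ ε -> 0q << ε -> Evt \ n -> s n - L <| ε
 Ch :(ℕ -> ℂ)-> Set
 Ch s = ∀ ε -> 0q << ε -> ∃ \ N -> ∀ m n -> N ≤n m -> N ≤n n -> s m - s n <| ε
 private
  record D(z : ℂ)(m : ℕ)(w : ℂ)(n : ℕ)(e : ℚ): Set where
   constructor MD
   field uD : nr(seq(re z)m -q seq(re w)n)(seq(im z)m -q seq(im w)n)<= e ** e
  DQ : ∀ z m w n{e}-> D z m w n e -> D w n z m e
  DQ z m w n{e}(MD h)= MD(sB(_<= e ** e)(solve 4(\ a b c d ->(a :- c):*(a :- c):+(b :- d):*(b :- d):=(c :- a):*(c :- a):+(d :- b):*(d :- b))Re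
   (seq(re z)m)(seq(im z)m)(seq(re w)n)(seq(im w)n))h)
  DH : ∀ z m w n v k{e f}-> 0q <= e -> 0q <= f -> D z m w n e -> D w n v k f -> D z m v k(e ++ f)
  DH z m w n v k he hf(MD p)(MD q)= MD(!< rl(cong₂ nr(lem(seq(re z)m)(seq(re w)n)(seq(re v)k))(lem(seq(im z)m)(seq(im w)n)(seq(im v)k)))<!
   No(seq(re z)m -q seq(re w)n)(seq(im z)m -q seq(im w)n)(seq(re w)n -q seq(re v)k)(seq(im w)n -q seq(im v)k)he hf p q)
   where
   lem : ∀ a b c -> a -q c ≡(a -q b)++(b -q c)
   lem = solve 3(\ a b c -> a :- c :=(a :- b):+(b :- c))Re
  D7 : ∀ z m w n{e}-> 0q <= e -> D z m w n e -> Q.∣ seq(re z)m -q seq(re w)n ∣ <= e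
  D7 z m w n he(MD h)= sE he(!< By(y ** y)(nq y)Re <! h)
   where y = seq(im z)m -q seq(im w)n
  D8 : ∀ z m w n{e}-> 0q <= e -> D z m w n e -> Q.∣ seq(im z)m -q seq(im w)n ∣ <= e
  D8 z m w n he(MD h)= sE he(!< By(x ** x)(nq x)(cw(x ** x)(y ** y))<! h)
   where
   x = seq(re z)m -q seq(re w)n
   y = seq(im z)m -q seq(im w)n
  Dj : ∀ z m w n{e f}-> 0q <= e -> e <= f -> D z m w n e -> D z m w n f
  Dj z m w n he ef(MD h)= MD(!< h <! sn he ef)
  ¼ : ℚ
  ¼ = ½ ** ½
  f1 : ∀ {ε}-> 0q << ε -> 0q << ¼ ** ε
  f1 h = nD(Ha ni)h
  ut : ∀ n -> 0q << iv(ι(sC n))(nd n)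
  ut n = i0(nd n)
  ui : ℕ -> ℚ
  ui n = iv(ι(sC n))(nd n)
 sT : ∀ ε -> 0q << ε -> ∃ \ N -> ∀ n -> N ≤n n -> iv(ι(sC n))(nd n)<= ε
 sT ε na = pF a , \ n NF -> Ca{iv(ι(sC n))(nd n)} {ε} {ι(sC n)}(nd n)(sB(_<= ι(sC n)** ε)(sy(Iv(nd n)))
  (sB(_<= ι(sC n)** ε)(iz na)(ma{iv ε na} {ι(sC n)} {ε}(lZ na)(!<(lZ(pS a))<! mg(NF ≤~ N1 n)))))
  where a = An(iv ε na)
 module _ (s : ℕ -> ℂ) (cs : Ch s) where
  private
   Ix : ℕ -> ℕ
   Ix n = pF(Cu(s n)(ui n)(ut n))
   Ip : ∀ n j -> Ix n ≤n j -> D(s n)(Ix n)(s n)j(ui n)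
   Ip n j le = MD(pS(Cu(s n)(ui n)(ut n))(Ix n)j Rf le)
   x y : ℕ -> ℚ
   x n = seq(re(s n))(Ix n)
   y n = seq(im(s n))(Ix n)
   kz : ∀ ε -> 0q << ε -> ∃ \ N -> ∀ m n -> N ≤n m -> N ≤n n -> D(s m)(Ix m)(s n)(Ix n)((½ ** ε ++ ½ ** ε)++(½ ** ε ++ ½ ** ε))
   kz ε na =
    let N , h = cs(¼ ** ε)(f1 na);M , g = sT(½ ** ε)(Ha na)
    in N ℕ.⊔ M , \ m n pm pn ->
    let J , close = bd(h m n(Mm N M pm)(Mm N M pn))(½ ** ε)lt;j = J ℕ.⊔(Ix m ℕ.⊔ Ix n);oX : D(s m)j(s n)j(½ ** ε);oX = MD(!< rl(sy(sv(s m)(s n)j))<! close j(mN J _));l = Dj(s m)(Ix m)(s m)j(lZ(ut m))(g m(md N M pm))(Ip m j(mN(Ix m)(Ix n)≤~(mE J _)));r = Dj(s n)(Ix n)(s n)j(lZ(ut n))(g n(md N M pn))(Ip n j(mE(Ix m)(Ix n)≤~(mE J _)));H0 = lZ(Ha na);hZ = N0 H0 H0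
    in Dj(s m)(Ix m)(s n)(Ix n)(N0 hZ H0)(By(½ ** ε)H0
     (solve 1(\ e ->(e :+ e):+(e :+ e):=((e :+ e):+ e):+ e)Re(½ ** ε)))
     (DH(s m)(Ix m)(s n)j(s n)(Ix n)hZ H0(DH(s m)(Ix m)(s m)j(s n)j H0 H0 l oX)(DQ(s n)(Ix n)(s n)j r))
    where
    lt : ¼ ** ε << ½ ** ε
    lt = bf(¼ ** ε)(f1 na)(solve 1(\ e -> con ½ :* e := con ¼ :* e :+ con ¼ :* e)Re ε)
   sI : ∀ ε -> let e = ¼ ** ε in (½ ** e ++ ½ ** e)++(½ ** e ++ ½ ** e)≡ ½ ** ε
   sI = solve 1(\ e ->(con ½ :*(con ¼ :* e):+ con ½ :*(con ¼ :* e)):+(con ½ :*(con ¼ :* e):+ con ½ :*(con ¼ :* e)):= con ½ :* e)Re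
   cN : ∀ ε -> 0q << ε -> ∃ \ N -> ∀ m n -> N ≤n m -> N ≤n n -> D(s m)(Ix m)(s n)(Ix n)(½ ** ε)
   cN ε na = sB(\ t -> ∃ \ N -> ∀ m n -> N ≤n m -> N ≤n n -> D(s m)(Ix m)(s n)(Ix n)t)(sI ε)(kz(¼ ** ε)(f1 na))
   hI : ∀ {ε}-> 0q << ε -> ½ ** ε << ε
   hI{ε}h = bf(½ ** ε)(Ha h)(solve 1(\ e -> e := con ½ :* e :+ con ½ :* e)Re ε)
  l9 : ℂ
  l9 = mkℂ(mkℝ x(\ ε na -> pF(cN ε na), \ m n p q -> Tr(D7(s m)(Ix m)(s n)(Ix n)(lZ(Ha na))(pS(cN ε na)m n p q))(hI na)))
   (mkℝ y(\ ε na -> pF(cN ε na), \ m n p q -> Tr(D8(s m)(Ix m)(s n)(Ix n)(lZ(Ha na))(pS(cN ε na)m n p q))(hI na)))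
  lp : s => l9
  lp ε na =
   let N , c = cN ε na;M , g = sT(½ ** ε)(Ha na);H0 = lZ(Ha na)
   in N ℕ.⊔ M , \ n le -> mv(lZ na)\ p lt ->
   N ℕ.⊔ Ix n , \ j lf -> !< rl(sv(s n)l9 j)<!
    D.uD(Dj(s n)j(s j)(Ix j)(lZ na)(lZ lt)
     (sB(D(s n)j(s j)(Ix j))(solve 1(\ e -> con ½ :* e :+ con ½ :* e := e)Re ε)
      (DH(s n)j(s n)(Ix n)(s j)(Ix j)H0 H0
       (DQ(s n)(Ix n)(s n)j(Dj(s n)(Ix n)(s n)j(lZ(ut n))(g n(md N M le))(Ip n j(md N(Ix n)lf))))
       (c n j(Mm N M le)(Mm N(Ix n)lf)))))
 module _ (z : ℂ) (c : ℚ) (C0 : 0q << c) (lb : z |> c) where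
  private
   k : ℕ -> ℕ
   k n = n +n pF lb
   a b Da : ℕ -> ℚ
   a n = seq(re z)(k n)
   b n = seq(im z)(k n)
   Da n = nr(a n)(b n)
   c5 : 0q << c ** c
   c5 = nD C0 C0
   D5 : ∀ n -> c ** c <= Da n
   D5 n = pS lb(k n)(mG(pF lb)n)
   DD : ∀ n -> 0q << Da n
   DD n = Tn c5(D5 n)
   i : ℕ -> ℚ
   i n = iv(Da n)(DD n)
   C = iv c C0
   CF : 0q << C
   CF = i0 C0
   iK : ∀ n -> i n <= C ** C
   iK n = Ca c5(!< ma(lZ(i0(DD n)))(D5 n)<! rl
    (!= Iv(DD n)=! sy(!= solve 2(\ c i -> c :* c :*(i :* i):=(c :* i):*(c :* i))Re c C =!
     (cong₂ _**_(Iv C0)(Iv C0)))))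
   xN : ∀ n -> a n ** i n **(a n ** i n)++ b n ** i n **(b n ** i n)≡ i n
   xN n = != solve 3(\ a b i ->(a :* i):*(a :* i):+(b :* i):*(b :* i):=(a :* a :+ b :* b):* i :* i)Re(a n)(b n)(i n)=~
    cO(\ t -> t ** i n)(Iv(DD n))=! iy(i n)
   dP : ∀ m n -> nr(a m ** i m -q a n ** i n)(-q b m ** i m -q -q b n ** i n)
    ≡ i m ** i n ** nr(a m -q a n)(b m -q b n)
   dP m n = != ee(a m ** i m)(b m ** i m)(a n ** i n)(b n ** i n)(b m)(i m)(b n)(i n)Re Re =~
    cong₂(\ t u -> t -q(1q ++ 1q)** u)(cong₂ _++_(xN m)(xN n))(ec(a m)(b m)(i m)(a n)(b n)(i n))=~
     d7(i m)(i n)(a m ** a n ++ b m ** b n)(Da m)(Da n)(Iv(DD m))(Iv(DD n))=!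
      cO(i m ** i n **_)(kA(a m)(b m)(a n)(b n))
    where
    ee : ∀ α β xp xu b i b′ ij -> b ** i ≡ β -> b′ ** ij ≡ xu -> nr(α -q xp)(-q b ** i -q -q b′ ** ij)≡
     ((α ** α ++ β ** β)++(xp ** xp ++ xu ** xu)) -q(1q ++ 1q)**(α ** xp ++ β ** xu)
    ee α _ xp _ b i b′ ij Re Re = != cO(nr(α -q xp))(solve 4(\ b i b′ ij -> :- b :* i :- :- b′ :* ij := :-(b :* i):- :-(b′ :* ij))Re b i b′ ij)=!
     solve 4(\ α β xp xu ->(α :- xp):*(α :- xp):+(:- β :- :- xu):*(:- β :- :- xu)
      :=((α :* α :+ β :* β):+(xp :* xp :+ xu :* xu)):- con(1q ++ 1q):*(α :* xp :+ β :* xu))Re α(b ** i)xp(b′ ** ij)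
    ec : ∀ a b i a′ b′ ij -> a ** i **(a′ ** ij)++ b ** i **(b′ ** ij)≡(i ** ij)**(a ** a′ ++ b ** b′)
    ec a b i a′ b′ ij = !=(cong₂ _++_(sw a i a′ ij)(sw b i b′ ij))=! sy(l4(i ** ij)(a ** a′)(b ** b′))
     where
     sw : ∀ a i a′ ij -> a ** i **(a′ ** ij)≡ i ** ij **(a ** a′)
     sw = solve 4(\ a i a′ ij -> a :* i :*(a′ :* ij):= i :* ij :*(a :* a′))Re
    d7 : ∀ i ij X D Da -> D ** i ≡ 1q -> Da ** ij ≡ 1q ->(i ++ ij) -q(1q ++ 1q)**(i ** ij ** X)≡ i ** ij **(D ++ Da -q(1q ++ 1q)** X)
    d7 i ij X D Da p q = != cong₂(\ t u ->(t ++ u) -q(1q ++ 1q)**(i ** ij ** X))(sy(!= cO(i **_)q =! ii i))(sy(!= cO(ij **_)p =! ii ij))=!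
     solve 5(\ i ij X D Da ->(i :*(Da :* ij):+ ij :*(D :* i)):- con(1q ++ 1q):*(i :* ij :* X):= i :* ij :*(D :+ Da :- con(1q ++ 1q):* X))Re i ij X D Da
    kA : ∀ a b a′ b′ -> nr a b ++ nr a′ b′ -q(1q ++ 1q)**(a ** a′ ++ b ** b′)≡ nr(a -q a′)(b -q b′)
    kA = solve 4(\ a b a′ b′ ->(a :* a :+ b :* b):+(a′ :* a′ :+ b′ :* b′):- con(1q ++ 1q):*(a :* a′ :+ b :* b′):=(a :- a′):*(a :- a′):+(b :- b′):*(b :- b′))Re
   bo : ∀ ε -> 0q << ε -> ∃ \ N -> ∀ m n -> N ≤n m -> N ≤n n ->
    nr(a m ** i m -q a n ** i n)(-q b m ** i m -q -q b n ** i n)<= ε ** ε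
   bo ε na =
    let N , h = Cu z(ε **(c ** c))(nD na c5)
    in N , \ m n p q -> !< rl(dP m n)<~ my(n0(lZ(i0(DD m)))(lZ(i0(DD n))))(N0(nq(a m -q a n))(nq(b m -q b n)))
     (my(lZ(i0(DD m)))(lZ(i0(DD n)))(iK m)(iK n))
     (h(k m)(k n)(p ≤~(me m _))(q ≤~(me n _)))<!
     rl(!= solve 3(\ c C e -> C :* C :*(C :* C):*(e :*(c :* c):*(e :*(c :* c)))
      :=(c :* C):*(c :* C):*((c :* C):*(c :* C)):*(e :* e))Re c C ε =~
      cO(\ t -> t ** t **(t ** t)**(ε ** ε))(Iv C0)=! iy(ε ** ε))
   hI : ∀ {ε}-> 0q << ε -> ½ ** ε << ε
   hI{ε}h = bf(½ ** ε)(Ha h)(solve 1(\ e -> e := con ½ :* e :+ con ½ :* e)Re ε)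
  rc : ℂ
  rc = mkℂ
   (mkℝ(\ n -> a n ** i n)\ ε na -> pF(bo(½ ** ε)(Ha na)), \ m n p q -> Tr(sE(lZ(Ha na))
    (!< By((-q b m ** i m -q -q b n ** i n)**(-q b m ** i m -q -q b n ** i n))(nq(-q b m ** i m -q -q b n ** i n))Re <!
     pS(bo(½ ** ε)(Ha na))m n p q))(hI na))
   (mkℝ(\ n -> -q b n ** i n)\ ε na -> pF(bo(½ ** ε)(Ha na)), \ m n p q -> Tr(sE(lZ(Ha na))
    (!< By((a m ** i m -q a n ** i n)**(a m ** i m -q a n ** i n))(nq(a m ** i m -q a n ** i n))(cw((a m ** i m -q a n ** i n)**(a m ** i m -q a n ** i n))_)<!
     pS(bo(½ ** ε)(Ha na))m n p q))(hI na))
  rg : rc <| C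
  rg = mv(lZ CF)\ p lt -> 0 , \ n _ -> !< rl(lem n)<~ iK n <! sn(lZ CF)(lZ lt)
   where
   lem : ∀ n -> nr(a n ** i n)(-q b n ** i n)≡ i n
   lem n = != cO(a n ** i n **(a n ** i n)++_)(solve 2(\ b i ->(:- b :* i):*(:- b :* i):=(b :* i):*(b :* i))Re(b n)(i n))=! xN n
  private
   opaque
    unfolding fq _+ℝ_ _*ℝ_ -ℝ_
    pw : ∀ n -> Nb(rc * z - 1#)n ≡ i n ** nr(seq(re z)n -q a n)(seq(im z)n -q b n)
    pw n = != ee(a n)(b n)(i n)(seq(re z)n)(seq(im z)n)=~
     cO(\ t -> t **(xT n) -q(1q ++ 1q)**(a n ** i n ** seq(re z)n ++ b n ** i n ** seq(im z)n)++ 1q)(xN n)=~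
      cO(\ t -> i n **(xT n) -q(1q ++ 1q)**(a n ** i n ** seq(re z)n ++ b n ** i n ** seq(im z)n)++ t)(sy(Iv(DD n)))=!
       solve 5(\ a b i x y -> i :*(x :* x :+ y :* y):- con(1q ++ 1q):*(a :* i :* x :+ b :* i :* y):+(a :* a :+ b :* b):* i
        := i :*((x :- a):*(x :- a):+(y :- b):*(y :- b)))Re(a n)(b n)(i n)(seq(re z)n)(seq(im z)n)
     where
     xT : ℕ -> ℚ
     xT n = nr(seq(re z)n)(seq(im z)n)
     d8 : ∀ α β x y ->(α ** x ++ β ** y -q 1q)**(α ** x ++ β ** y -q 1q)++(α ** y -q β ** x)**(α ** y -q β ** x)
      ≡(α ** α ++ β ** β)** nr x y -q(1q ++ 1q)**(α ** x ++ β ** y)++ 1q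
     d8 = solve 4(\ α β x y ->(α :* x :+ β :* y :- con 1q):*(α :* x :+ β :* y :- con 1q):+(α :* y :- β :* x):*(α :* y :- β :* x)
      :=(α :* α :+ β :* β):*(x :* x :+ y :* y):- con(1q ++ 1q):*(α :* x :+ β :* y):+ con 1q)Re
     ee : ∀ a b i x y -> nr((a ** i)** x -q(-q b ** i)** y -q 1q)((a ** i)** y ++(-q b ** i)** x -q 0q)
      ≡(a ** i **(a ** i)++ b ** i **(b ** i))** nr x y -q(1q ++ 1q)**(a ** i ** x ++ b ** i ** y)++ 1q
     ee a b i x y = != cong₂ nr(solve 4(\ α b i y -> α :-(:- b :* i):* y :- con 1q := α :+(b :* i):* y :- con 1q)Re(a ** i ** x)b i y)
      (solve 4(\ α b i x -> α :+(:- b :* i):* x :- con 0q := α :-(b :* i):* x)Re(a ** i ** y)b i x)=!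
      d8(a ** i)(b ** i)x y
  Rc : rc * z ≈ 1#
  Rc = Ir(rc * z)1# \ ε na -> let N , h = Cu z(ε ** c)(nD na C0)in
   N , \ n le -> !< rl(pw n)<~ my(lZ(i0(DD n)))(N0(nq(seq(re z)n -q a n))(nq(seq(im z)n -q b n)))(iK n)
    (h n(k n)le(le ≤~(me n _)))<!
    rl(!= solve 3(\ c C e -> C :* C :*(e :* c :*(e :* c)):=(c :* C):*(c :* C):*(e :* e))Re c C ε =~
     cO(\ t -> t ** t **(ε ** ε))(Iv C0)=! iy(ε ** ε))
  rm : ∀ δ -> 0q <= δ -> Evt(\ n -> δ ** Nb z n <= seq(im z)n)-> Evt(\ n -> δ <= seq(im(- rc))n)
  rm δ hH(N , f)= N , \ n le -> !< rl(sy(!= ac δ(Da n)(i n)=~ cO(δ **_)(Iv(DD n))=! ii δ))<~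
   ma{δ ** Da n} {b n} {i n}(lZ(i0(DD n)))(!< rl(cO(δ **_)(D9 n))<! f(k n)(le ≤~(me n _)))<! rl(ja n)
   where
   opaque
    unfolding -ℝ_ _*ℝ_ _+ℝ_
    ja : ∀ n -> b n ** i n ≡ seq(im(- rc))n
    ja n = solve 2(\ b i -> b :* i := :-(:- b :* i))Re(b n)(i n)
    D9 : ∀ n -> Da n ≡ Nb z(k n)
    D9 n = Re
module Srs where
 open Lim public
 open FSum rn public
 module ℂR = CommutativeRing rn
 private
  module CS = ℂ-Solver
 Zo : ∀ {z}-> z ≈ 0# -> z <| 0q
 Zo h = rp(yY h)(Of 0q)
 sj : ∀ {z w q r}-> z <| q -> w <| r -> z - w <| q ++ r
 sj h g = ≼-+ h(Ne g)
 sG : ∀ {z w q}-> z - w <| q -> w - z <| q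
 sG{z} {w}h = rp(CS.solve 2(\ z w -> CS.:-(z CS.:- w)CS.:= w CS.:- z)rR z w)(Ne h)
 tC : ∀ {z w v q r}-> z - w <| q -> w - v <| r -> z - v <| q ++ r
 tC{z} {w} {v}h g = rp(CS.solve 3(\ z w v ->(z CS.:- w)CS.:+(w CS.:- v)CS.:= z CS.:- v)rR z w v)(≼-+ h g)
 ≼-^ : ∀ {z q}n -> z <| q -> z ^ n <| q ^^ n
 ≼-^ z0 h = Of 1q
 ≼-^(sC n)h = ≼-* h(≼-^ n h)
 ck : ∀ {z w}n -> z ≈ w -> z ^ n ≈ w ^ n
 ck z0 h = rR
 ck(sC n)h = ℂR.*-cong h(ck n h)
 sb : ∀ {z w za wb}-> z ≈ za -> w ≈ wb -> z - w ≈ za - wb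
 sb h g = ℂR.+-cong h(ℂR.-‿cong g)
 private
  h2 : ∀ ε -> ½ ** ε ++ ½ ** ε ≡ ε
  h2 = sl 1(\ e -> Co ½ *: e +: Co ½ *: e =: e)Re
 ≼-½ : ∀ {z w v}ε -> z - w <| ½ ** ε -> w - v <| ½ ** ε -> z - v <| ε
 ≼-½{z} {v = v}ε h g = sB(z - v <|_)(h2 ε)(tC h g)
 uq : ∀ {s L La}-> s => L -> s => La -> L ≈ La
 uq h g = xl \ ε na -> eJ(em(\ n p q -> ≼-½ ε(sG p)q)(h(½ ** ε)(Ha na))(g(½ ** ε)(Ha na)))
 Rs : ∀ {s t L La}->(∀ n -> s n ≈ t n)-> L ≈ La -> s => L -> t => La
 Rs h g p ε na = Em(\ n -> rp(sb(h n)g))(p ε na)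
 cA : ∀ z ->(\ _ -> z)=> z
 cA z ε na = 0 , \ _ _ -> mo(lZ na)(nj rR)
 ⟶-+ : ∀ {s t L La}-> s => L -> t => La ->(\ n -> s n + t n)=> L + La
 ⟶-+{s} {t} {L} {La}h g ε na = em(\ n p q -> sB(s n + t n -(L + La)<|_)(h2 ε)
  (rp(CS.solve 4(\ s t L La ->(s CS.:- L)CS.:+(t CS.:- La)CS.:=(s CS.:+ t)CS.:-(L CS.:+ La))rR(s n)(t n)L La)(≼-+ p q)))
  (h(½ ** ε)(Ha na))(g(½ ** ε)(Ha na))
 bK : ∀ {s L}-> s => L ->(\ n -> - s n)=> - L
 bK{s} {L}h ε na = Em(\ n p -> rp(CS.solve 2(\ s L -> CS.:-(s CS.:- L)CS.:=(CS.:- s)CS.:-(CS.:- L))rR(s n)L)(Ne p))(h ε na)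
 sN : ∀ {s t L La}-> s => L -> t => La ->(\ n -> s n - t n)=> L - La
 sN h g = ⟶-+ h(bK g)
 Sr : ∀ {q ε}-> 0q <= q -> 0q << ε -> ∃ \ η -> 0q << η × q ** η <= ε
 Sr{q} {ε}hq hL = ε ** i , nD hL(i0 q1),
  !< ma{q} {q ++ 1q} {ε ** i}(lZ(nD hL(i0 q1)))(By 1q n1 Re)<!
   rl(!= sl 3(\ q e i -> q *:(e *: i)=: e *:(q *: i))Re(q ++ 1q)ε i =~
    cO(ε **_)(Iv q1)=! ii ε)
  where
  q1 : 0q << q ++ 1q
  q1 = sB(0q <<_)(cw 1q q)(nG nl hq)
  i = iv(q ++ 1q)q1
 ⟶-*ˡ : ∀ {s L}z -> s => L ->(\ n -> z * s n)=> z * L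
 ⟶-*ˡ{s} {L}z h ε na =
  let q , hq = ei z;η , nL , le = Sr(nn hq)na
  in Em(\ n p -> mo le(rp(CS.solve 3(\ z s L -> z CS.:*(s CS.:- L)CS.:=(z CS.:* s)CS.:-(z CS.:* L))rR z(s n)L)(≼-* hq p)))(h η nL)
 ⟶-≼ : ∀ {s L b}-> 0q <= b -> s => L -> Evt(\ n -> s n <| b)-> L <| b
 ⟶-≼{s} {L} {b}hb h g = Cl hb \ ε na -> eJ(em(\ n p q ->
  rp(CS.solve 2(\ s L -> s CS.:+(L CS.:- s)CS.:= L)rR(s n)L)(≼-+ p(sG q)))g(h ε na))
 ⟶-* : ∀ {s t L La}-> s => L -> t => La ->(\ n -> s n * t n)=> L * La
 ⟶-*{s} {t} {L} {La}h g ε na =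
  let q , hq = ei L;r , hr = ei La;η , nL , le = Sr(N0(nn hq)n1)(Ha na);θ , m8 , lf = Sr(nn hr)(Ha na)
  in em(\ n a b -> ≼-½ ε
   (mo le(rp(CS.solve 3(\ s t La -> s CS.:*(t CS.:- La)CS.:=(s CS.:* t)CS.:-(s CS.:* La))rR(s n)(t n)La)
    (≼-*(rp(CS.solve 2(\ s L -> L CS.:+(s CS.:- L)CS.:= s)rR(s n)L)(≼-+ hq(pS a)))b)))
   (mo lf(rp(CS.solve 3(\ s L La -> La CS.:*(s CS.:- L)CS.:=(s CS.:* La)CS.:-(L CS.:* La))rR(s n)L La)(≼-* hr(pF a)))))
   (eI(h θ m8)(h 1q nl))(g η nL)
 Nx :(ℕ -> ℚ)-> Set
 Nx b = ∀ ε -> 0q << ε -> Evt \ n -> b n <= ε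
 Sz : ∀ {s L b}-> Nx b ->(∀ n -> s n - L <| b n)-> s => L
 Sz nb h ε na = Em(\ n le -> mo le(h n))(nb ε na)
 Hr : ∀ {b : ℕ -> ℚ} {C}->(∀ n -> ι n ** b n <= C)-> Nx b
 Hr{b} {C}h ε na =
  let N , lt = Ah(C ** iv ε na)in sC N , \ n le ->
   Ca{b n} {ε} {ι n}(Tn(nd N)(mg le))(!< h n <~
    rl(!= sy(ii C)=~ cO(C **_)(sy(iz na))=! sy(ac C _ ε))<!
     ma{C ** iv ε na} {ι n} {ε}(lZ na)(!<(lZ lt)<! mg le))
 ph : ∀ {κ}n -> 0q <= κ -> κ <= 1q -> ι n **(κ ^^ n)**(1q -q κ)<= 1q
 ph{κ}n hN nu = !<(!< rl(sl 3(\ i k d -> i *: k *: d =: k *:(i *: d))Re(ι n)(κ ^^ n)d)<!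
  Mo{ι n ** d} {(1q ++ d)^^ n} {κ ^^ n}(nf n hN)(!< By 1q n1(cw 1q(ι n ** d))<! bl n jb))<~
  rl(sy(dt κ(1q ++ d)n))<!
   nP n(n0 hN(N0 n1 jb))(By(d ** d)(nq d)
    (sl 1(\ k -> Co 1q =: k *:(Co 1q +:(Co 1q -: k))+:(Co 1q -: k)*:(Co 1q -: k))Re κ))
  where
  d = 1q -q κ
  jb = p0 nu
 pu : ∀ {κ}C -> 0q <= C -> 0q <= κ -> κ << 1q -> Nx(\ n -> C ** κ ^^ n)
 pu{κ}C hC hN nu = Hr{C = C ** iv d dY}\ n -> Ca{r = d}dY
  (!< rl(sl 4(\ d i C k -> d *:(i *:(C *: k))=: C *:(i *: k *: d))Re d(ι n)C(κ ^^ n))<~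
  Mo{ι n **(κ ^^ n)** d} {1q} {C}hC(ph n hN(lZ nu))<!
   rl(!= cO(C **_)(sy(Iv dY))=! sl 3(\ C d i -> C *:(d *: i)=: d *:(C *: i))Re C d(iv d dY)))
  where
  d = 1q -q κ
  dY = Pp nu
 Sa :(ℕ -> ℂ)-> ℂ -> Set
 Sa a s =(\ n -> ∑ n a)=> s
 record Go(a : ℕ -> ℂ): Set where
  constructor gy
  field
   C κ : ℚ
   0≤C : 0q <= C
   0≤κ : 0q <= κ
   nu : κ << 1q
   dS : ∀ n -> a n <| C ** κ ^^ n
  1-κ>0 : 0q << 1q -q κ
  1-κ>0 = Pp nu
  Tl : ℚ
  Tl = C ** iv(1q -q κ)1-κ>0
  0≤total : 0q <= Tl
  0≤total = n0 0≤C(lZ(i0 1-κ>0))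
 ge : ∀ {a C κ}n(nu : 0q << 1q -q κ)-> 0q <= C -> 0q <= κ ->(∀ i -> a i <| C ** κ ^^ i)-> ∑ n a <| C ** iv(1q -q κ)nu
 ge z0 lt hC hN h = mo(n0 hC(lZ(i0 lt)))(Of 0q)
 ge{a} {C} {κ}(sC n)lt hC hN h = sB(a 0 + ∑ n(tl a)<|_)eq(≼-+(h 0)(ge{tl a} {C ** κ}n lt(n0 hC hN)hN
  \ i -> sB(a(sC i)<|_)(sy(ac C κ(κ ^^ i)))(h(sC i))))
  where
  eq : C ** 1q ++ C ** κ ** iv(1q -q κ)lt ≡ C ** iv(1q -q κ)lt
  eq = != cO(\ t -> C ** t ++ C ** κ ** iv(1q -q κ)lt)(sy(Iv lt))=!
   sl 3(\ C k i -> C *:((Co 1q -: k)*: i)+: C *: k *: i =: C *: i)Re C κ(iv(1q -q κ)lt)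
 module _ {a : ℕ -> ℂ} (g : Go a) where
  open Go g
  Rt : ℕ -> ℚ
  Rt n = Tl ** κ ^^ n
  Gm : ∀ m n -> ∑(n +n m)a - ∑ n a <| Rt n
  Gm m n = rp(!~ CS.solve 2(\ x y -> y CS.:=(x CS.:+ y)CS.:- x)rR(∑ n a)(∑ m(\ i -> a(n +n i)))~!
   ℂR.+-congʳ(yY(sp n m a)))
   (sB(∑ m(\ i -> a(n +n i))<|_)(sl 3(\ C k i -> C *: k *: i =: C *: i *: k)Re C(κ ^^ n)(iv(1q -q κ)1-κ>0))
    (ge m 1-κ>0(n0 0≤C(nf n 0≤κ))0≤κ \ i ->
     sB(a(n +n i)<|_)(!= cO(C **_)(Q.^-+ κ n i)=! sy(ac C(κ ^^ n)(κ ^^ i)))(dS(n +n i))))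
  ru : Nx Rt
  ru = pu Tl 0≤total 0≤κ nu
  private
   m9 : Ch(\ n -> ∑ n a)
   m9 ε na =
    let N , h = ru ε na in N , \ m n pm pn -> go m n pm pn(tu n m)h
    where
    lf : ∀ m n{N}-> N ≤n n ->(∀ k -> N ≤n k -> Rt k <= ε)-> n ≤n m -> ∑ m a - ∑ n a <| ε
    lf m n pn h le = mo(h n pn)(sB(\ t -> ∑ t a - ∑ n a <| Rt n)(mm le)(Gm(m -n n)n))
    go : ∀ m n{N}-> N ≤n m -> N ≤n n -> n ≤n m ⊎ m ≤n n ->(∀ k -> N ≤n k -> Rt k <= ε)-> ∑ m a - ∑ n a <| ε
    go m n pm pn(iL le)h = lf m n pn h le
    go m n pm pn(iR le)h = sG(lf n m pm h le)
  opaque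
   gm : ℂ
   gm = l9(\ n -> ∑ n a)m9
   gu : Sa a gm
   gu = lp(\ n -> ∑ n a)m9
  0≤rest : ∀ n -> 0q <= Rt n
  0≤rest n = n0 0≤total(nf n 0≤κ)
  gi : ∀ n -> gm - ∑ n a <| Rt n
  gi n = ⟶-≼(0≤rest n)(sN gu(cA(∑ n a)))(n , \ m le -> sB(\ t -> ∑ t a - ∑ n a <| Rt n)(mm le)(Gm(m -n n)n))
  gq : gm <| Tl
  gq = sB(gm <|_)(ii Tl)(rp(CS.solve 1(\ x -> x CS.:- CS.con 0q CS.:= x)rR gm)(gi 0))
open Srs.ℂR using () renaming (*-congˡ to co;*-congʳ to cn;+-congˡ to Cn;+-congʳ to Cg;reflexive to rx;+-cong to ca;*-identityˡ to ie;-‿cong to cc;*-cong to cd;+-identityʳ to Ie;*-identityʳ to In;zeroˡ to ze;*-assoc to ao;+-identityˡ to Ii;zeroʳ to zr;distribˡ to dr;*-comm to cp;-‿inverseʳ to ir;distribʳ to dv;+-assoc to bE;+-comm to qR;-‿inverseˡ to qS)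
module Prd where
 open Srs public
 private
  module CS = ℂ-Solver
 Ss : ∀ {a s t}-> Sa a s -> Sa a t -> s ≈ t
 Ss = uq
 Su : ∀ {a b s t}->(∀ n -> a n ≈ b n)-> s ≈ t -> Sa a s -> Sa b t
 Su h g p = Rs(\ n -> ch n h)g p
 Sk : ∀ {a b s t}-> Sa a s -> Sa b t -> Sa(\ n -> a n + b n)(s + t)
 Sk{a} {b}h g = Rs(\ n -> yY(∑-+ n a b))rR(⟶-+ h g)
 Sd : ∀ {a s}z -> Sa a s -> Sa(\ n -> z * a n)(z * s)
 Sd{a}z h = Rs(\ n -> yY(∑-* n z a))rR(⟶-*ˡ z h)
 s5 : ∀ {s L}-> s => L ->(\ n -> s(sC n))=> L
 s5 h ε na = let N , g = h ε na in N , \ n le -> g(sC n)(m1 le)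
 uh : ∀ {s L}->(\ n -> s(sC n))=> L -> s => L
 uh{s} {L}h ε na = let N , g = h ε na in sC N , \ { (sC n)(ss le)-> g n le }
 SB : ∀ {a s}-> Sa a s -> Sa(tl a)(s - a 0)
 SB{a}h = Rs(\ n -> CS.solve 2(\ x y ->(x CS.:+ y)CS.:- x CS.:= y)rR(a 0)(∑ n(tl a)))rR(sN(s5 h)(cA(a 0)))
 Sg : ∀ {a s}-> Sa(tl a)s -> Sa a(a 0 + s)
 Sg{a} {s}h = uh{\ n -> ∑ n a}(⟶-+(cA(a 0))h)
 record Rk(κ : ℚ): Set where
  field
   B xh : ℚ
   0≤B : 0q <= B
   0≤κ′ : 0q <= xh
   nS : xh << 1q
   dS : ∀ n -> ι(sC n)** κ ^^ n <= B ** xh ^^ n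
 rE : ∀ {κ}-> 0q <= κ -> κ << 1q -> Rk κ
 rE{κ}hN nu = record
  { B = B ; xh = κ **(1q ++ e); 0≤B = N0 n1(lZ(i0 E0)); 0≤κ′ = n0 hN(N0 n1(lZ E0))
  ; nS = bf(½ **(1q -q κ)**(1q ++(1q -q κ)))(nD E0(nG nl(lZ dY)))
   (sl 1(\ k -> Co 1q =: k *:(Co 1q +: Co ½ *:(Co 1q -: k))+: Co ½ *:(Co 1q -: k)*:(Co 1q +:(Co 1q -: k)))Re κ)
  ; dS = \ n -> !< ma{ι(sC n)} {B **(1q ++ e)^^ n} {κ ^^ n}(nf n hN)(lem n)<!
   rl(!= sl 3(\ B p k -> B *: p *: k =: B *:(k *: p))Re B((1q ++ e)^^ n)(κ ^^ n)=!
    cO(B **_)(sy(dt κ(1q ++ e)n))) }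
  where
  dY = Pp nu
  e = ½ **(1q -q κ)
  E0 = Ha dY
  B = 1q ++ iv e E0
  lem : ∀ n -> ι(sC n)<= B **(1q ++ e)^^ n
  lem n = !< By(ι n ** e ++ iv e E0)(N0(n0(nc n)(lZ E0))(lZ(i0 E0)))
   (!= sl 3(\ i e v ->(Co 1q +: v)*:(Co 1q +: i *: e)=: Co 1q +: i *:(e *: v)+:(i *: e +: v))Re(ι n)e(iv e E0)=!
    cO(\ t -> t ++(ι n ** e ++ iv e E0))(!= cO(\ t -> 1q ++ ι n ** t)(Iv E0)=~ cO(1q ++_)(ii(ι n))=! sy(sa n)))<!
   Mo{1q ++ ι n ** e} {(1q ++ e)^^ n} {B}(N0 n1(lZ(i0 E0)))(bl n(lZ E0))
 gw : ∀ {a}(g : Go a) {κ}-> Go.κ g <= κ -> κ << 1q -> Go a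
 gw g{κ}le lt = gy C κ 0≤C(!< 0≤κ <! le)lt \ n -> mo(Mo 0≤C(mu n 0≤κ le))(dS n)
  where open Go g hiding (κ)
 record Gg(a b : ℕ -> ℂ): Set where
  field
   C D κ : ℚ
   0≤C : 0q <= C
   0≤D : 0q <= D
   0≤κ : 0q <= κ
   nu : κ << 1q
   dF : ∀ n -> a n <| C ** κ ^^ n
   dG : ∀ n -> b n <| D ** κ ^^ n
 gh : ∀ {a b}-> Go a -> Go b -> Gg a b
 gh{a} {b}g h = go(Tt(Go.κ g)(Go.κ h))
  where
  go : Go.κ g <= Go.κ h ⊎ Go.κ h <= Go.κ g -> Gg a b
  go(iL le)= let g′ = gw g le(Go.nu h)in record { C = Go.C g′ ; D = Go.C h ; κ = Go.κ h ; 0≤C = Go.0≤C g′ ; 0≤D = Go.0≤C h ; 0≤κ = Go.0≤κ h ; nu = Go.nu h ; dF = Go.dS g′ ; dG = Go.dS h }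
  go(iR le)= let hg = gw h le(Go.nu g)in record { C = Go.C g ; D = Go.C hg ; κ = Go.κ g ; 0≤C = Go.0≤C g ; 0≤D = Go.0≤C hg ; 0≤κ = Go.0≤κ g ; nu = Go.nu g ; dF = Go.dS g ; dG = Go.dS hg }
 kB : ∀ {a b}-> Go a -> Go b -> Go(\ n -> a n + b n)
 kB{a} {b}g h = gy(C ++ D)κ(N0 0≤C 0≤D)0≤κ nu \ n -> sB(a n + b n <|_)(sy(dq(κ ^^ n)C D))(≼-+(dF n)(dG n))
  where open Gg(gh g h)
 kC : ∀ {a}z -> Go a -> Go(\ n -> z * a n)
 kC{a}z g = gy(q ** C)κ(n0(nn hq)0≤C)0≤κ nu \ n -> sB(z * a n <|_)(sy(ac q C(κ ^^ n)))(≼-* hq(dS n))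
  where
  open Go g
  q = pF(ei z)
  hq = pS(ei z)
 gz : ∀ {a b}->(∀ n -> a n ≈ b n)-> Go a -> Go b
 gz h g = gy C κ 0≤C 0≤κ nu \ n -> rp(h n)(dS n)
  where open Go g
 Gn : ∀ {a C κ}-> 0q <= C -> 0q <= κ -> κ << 1q ->(∀ n -> a n <| C **(ι(sC n)** κ ^^ n))-> Go a
 Gn{a} {C}hC hN nu h = gy(C ** B)xh(n0 hC 0≤B)0≤κ′ nS \ n -> mo(!< Mo hC(dS n)<! rl(sy(ac C B(xh ^^ n))))(h n)
  where open Rk(rE hN nu)
 cE : ∀ {a b C D κ}->(∀ n -> a n <| C ** κ ^^ n)->(∀ n -> b n <| D ** κ ^^ n)->
  ∀ n ->(a *s b)n <| ι(sC n)**(C ** D)** κ ^^ n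
 cE{a} {b} {C} {D} {κ}ha hb z0 = sB(a 0 * b 0 <|_)(!= sl 2(\ C D -> C *: Co 1q *:(D *: Co 1q)=:(Co 1q +: Co 0q)*:(C *: D)*: Co 1q)Re C D =!
  cO(\ t -> t **(C ** D)** 1q)(sy(!= sa 0 =! cO(1q ++_)nw)))(≼-*(ha 0)(hb 0))
 cE{a} {b} {C} {D} {κ}ha hb(sC n)= sB(a 0 * b(sC n)+(tl a *s b)n <|_)
  (!= sl 5(\ C D k p i -> C *: Co 1q *:(D *:(k *: p))+: i *:(C *: k *: D)*: p =:(Co 1q +: i)*:(C *: D)*:(k *: p))Re C D κ(κ ^^ n)(ι(sC n))=!
   cO(\ t -> t **(C ** D)**(κ ** κ ^^ n))(sy(sa(sC n))))
  (≼-+(≼-*(ha 0)(hb(sC n)))(cE{tl a} {b} {C ** κ} {D} {κ}(\ i -> sB(a(sC i)<|_)(sy(ac C κ(κ ^^ i)))(ha(sC i)))hb n))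
 gA : ∀ {a b}-> Go a -> Go b -> Go(a *s b)
 gA{a} {b}g h = Gn(n0 0≤C 0≤D)0≤κ nu \ n -> sB((a *s b)n <|_)
  (sl 3(\ i c k -> i *: c *: k =: c *:(i *: k))Re(ι(sC n))(C ** D)(κ ^^ n))(cE{a} {b} {C} {D} {κ}dF dG n)
  where open Gg(gh g h)
 cK : ∀ n a b -> ∑ n(a *s b)≈ ∑ n(\ i -> a i * ∑(n -n i)b)
 cK z0 a b = rR
 cK(sC n)a b = !~ Cn{a 0 * b 0}(∑-+ n(\ i -> a 0 * b(sC i))(tl a *s b))~~
  yY(bE(a 0 * b 0)_ _)~!
   ca(∑-*(sC n)(a 0)b)(cK n(tl a)b)
 ∑-≼ : ∀ n{a q}-> 0q <= q ->(∀ i -> i <n n -> a i <| q)-> ∑ n a <| ι n ** q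
 ∑-≼ z0{q = q}hq h = mo(rl(sy(!= cO(_** q)nw =! zd q)))(Of 0q)
 ∑-≼(sC n) {a} {q}hq h = sB(∑(sC n)a <|_)(!= sl 2(\ q i -> q +: i *: q =:(Co 1q +: i)*: q)Re q(ι n)=! cO(_** q)(sy(sa n)))
  (≼-+(h 0(ss zn))(∑-≼ n hq \ i lt -> h(sC i)(ss lt)))
 Sx : ∀ {a b s t}-> Go a -> Go b -> Sa a s -> Sa b t -> Sa(a *s b)(s * t)
 Sx{a} {b} {s} {t}ga gb ha hb = Rs(\ n -> CS.solve 2(\ x y -> x CS.:-(x CS.:- y)CS.:= y)rR(∑ n a * t)(∑ n(a *s b)))
  (CS.solve 1(\ x -> x CS.:- CS.con 0q CS.:= x)rR(s * t))
  (sN(Rs(\ n -> rR)rR(⟶-* ha(cA t)))(Sz oY bo))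
  where
  open Gg (gh ga gb)
  gg : Go b
  gg = gy D κ 0≤D 0≤κ nu dG
  E = C ** Go.Tl gg
  0≤E : 0q <= E
  0≤E = n0 0≤C(Go.0≤total gg)
  rz : ∀ m -> t - ∑ m b <| Rt gg m
  rz m = rp(Cg(Ss(gu gg)hb))(gi gg m)
  td : ∀ n i -> i <n n -> a i *(t - ∑(n -n i)b)<| E ** κ ^^ n
  td n i lt = sB(a i *(t - ∑(n -n i)b)<|_)
   (!= sl 4(\ C p T q -> C *: p *:(T *: q)=: C *: T *:(p *: q))Re C(κ ^^ i)(Go.Tl gg)(κ ^^(n -n i))=!
    cO(E **_)(!= sy(Q.^-+ κ i(n -n i))=! cO(κ ^^_)(mm(ℕₚ.<⇒≤ lt))))
   (≼-*(dF i)(rz(n -n i)))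
  jO : ℕ -> ℚ
  jO n = ι n **(E ** κ ^^ n)
  bo : ∀ n ->(∑ n a * t - ∑ n(a *s b)) - 0# <| jO n
  bo n = rp(!~(ch n \ i -> CS.solve 3(\ a t y -> a CS.:*(t CS.:- y)CS.:= a CS.:* t CS.:- a CS.:* y)rR(a i)t(∑(n -n i)b))~~
   (∑-+ n(\ i -> a i * t)(\ i -> -(a i * ∑(n -n i)b)))~~ ca(∑-*ʳ n t a)(!~(Ng n _)~! cc(yY(cK n a b)))~!
    CS.solve 1(\ x -> x CS.:= x CS.:- CS.con 0q)rR(∑ n a * t - ∑ n(a *s b)))
   (∑-≼ n(n0 0≤E(nf n 0≤κ))(td n))
  open Rk (rE 0≤κ nu) renaming (dS to rH)
  oY : Nx jO
  oY ε na = let N , h = pu(E ** B)(n0 0≤E 0≤B)0≤κ′ nS ε na in N , \ n le -> !<(!< rl(sl 3(\ i e k -> i *:(e *: k)=: e *:(i *: k))Re(ι n)E(κ ^^ n))<~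
   Mo{ι n ** κ ^^ n} {B ** xh ^^ n} {E}0≤E(!< ma{ι n} {ι(sC n)} {κ ^^ n}(nf n 0≤κ)(mg(N1 n))<! rH n)<!
    rl(sy(ac E B(xh ^^ n))))<! h n le
module Expo where
 open Prd public
 open import Data.Nat.Base using (_!)
 open CSolve
 ia : ℕ -> ℚ
 ia n =((+ 1)//(n !)) {{n ℕₚ.!≢0}}
 private
  d9 : ∀ m .{{_ : ℕ.NonZero m}}-> ι m **((+ 1)// m)≡ 1q
  d9 m@(sC k)= != cO(_**((+ 1)// m))(dJ m)=! qY(ℚᵘₚ.≃-trans(qZ((+ m)// 1)((+ 1)// m))
   (ℚᵘₚ.≃-trans(ℚᵘₚ.*-cong(tV(ℚᵘ.mkℚᵘ(+ m)0))(tV(ℚᵘ.mkℚᵘ(+ 1)k)))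
    (ℚᵘ.*≡*(cO +_(!= ik(m *n 1)=~ ik m =~ sy(b7 m)=~ cO(1 *n_)(sy(Iy m))=! Re)))))
   where
   import Data.Rational.Unnormalised.Base as ℚᵘ
   import Data.Rational.Unnormalised.Properties as ℚᵘₚ
 iZ : ∀ n -> ι(n !)** ia n ≡ 1q
 iZ n = d9(n !) {{n ℕₚ.!≢0}}
 iw : ∀ n -> 0q << ia n
 iw n = pi(ia n) {{q2 1(n !) {{n ℕₚ.!≢0}}}}
 Is : ∀ n -> ι(sC n)** ia(sC n)≡ ia n
 Is n = != sy(iy _)=~ cO(_**(ι(sC n)** ia(sC n)))(sy(iZ n))=~
  sl 4(\ a b c d -> a *: b *:(c *: d)=: b *:(c *: a *: d))Re(ι(n !))(ia n)(ι(sC n))(ia(sC n))=~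
   cO(ia n **_)(!= cO(_** ia(sC n))(sy(xe(sC n)(n !)))=! iZ(sC n))=! ii(ia n)
 iT : ia 0 ≡ 1q
 iT = Re
 iJ : ∀ n -> ia(sC n)<= ia n
 iJ n = !< By(ι n ** ia(sC n))(n0(nc n)(lZ(iw(sC n))))Re <!
  rl(!= sl 2(\ v i -> v +: i *: v =:(Co 1q +: i)*: v)Re(ia(sC n))(ι n)=~
   cO(_** ia(sC n))(sy(sa n))=! Is n)
 iH : ∀ n -> ia n <= 1q
 iH z0 = ra
 iH(sC n)= !< iJ n <! iH n
 private
  jc : ∀ N n -> sC N ≤n sC n -> ι(sC N)^^ sC n ** ia(sC n)<= ι(sC N)^^ n ** ia n
  jc N n le = !< rl(sl 3(\ b p v -> b *: p *: v =: p *:(b *: v))Re(ι(sC N))(ι(sC N)^^ n)(ia(sC n)))<!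
   Mo{ι(sC N)** ia(sC n)} {ia n} {ι(sC N)^^ n}(nf n(nc(sC N)))
    (!< ma{ι(sC N)} {ι(sC n)} {ia(sC n)}(lZ(iw(sC n)))(mg le)<! rl(Is n))
  bB : ∀ N n -> ι(sC N)^^ n ** ia n <= ι(sC N)^^ N
  bB N z0 = j3 N 1≤
   where
   1≤ : 1q <= ι(sC N)
   1≤ = By(ι N)(nc N)(sa N)
  bB N(sC n)= go(tu(sC n)N)
   where
   1≤ : 1q <= ι(sC N)
   1≤ = By(ι N)(nc N)(sa N)
   go : sC n ≤n N ⊎ N ≤n sC n -> ι(sC N)^^ sC n ** ia(sC n)<= ι(sC N)^^ N
   go(iL le)= !< Mo{ia(sC n)} {1q} {ι(sC N)^^ sC n}(nf(sC n)(nc(sC N)))(iH(sC n))<~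
    rl(ii _)<! sB(\ t -> ι(sC N)^^ sC n <= ι(sC N)^^ t)(mm le)
     (!< rl(sy(ii(ι(sC N)^^ sC n)))<~ Mo{1q} {ι(sC N)^^(N -n sC n)} {ι(sC N)^^ sC n}(nf(sC n)(nc(sC N)))(j3(N -n sC n)1≤)<!
      rl(sy(Q.^-+(ι(sC N))(sC n)(N -n sC n))))
   go(iR le)= gB(mH le)
    where
    gB : N <n sC n ⊎ N ≡ sC n -> ι(sC N)^^ sC n ** ia(sC n)<= ι(sC N)^^ N
    gB(iL lt)= !< jc N n lt <! bB N n
    gB(iR eq)= go(iL(ri(sy eq)))
 eT : ℂ -> ℕ -> ℂ
 eT t n = oq(ia n)* t ^ n
 n2 : ℚ
 n2 = 1q ++ 1q
 iD : ∀ n -> oq(ia n)<| ia n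
 iD n = sB(oq(ia n)<|_)(np(lZ(iw n)))(Of(ia n))
 opaque
  iM : ∀ b -> 0q <= b -> ∃ \ C -> 0q <= C ×(∀ n -> ia n ** b ^^ n <= C ** ½ ^^ n)
  iM b b0 = ι(sC N)^^ N , nf N(nc(sC N)), le
   where
   N : ℕ
   N = pF(Ah(n2 ** b))
   kD : b <= ι(sC N)** ½
   kD = !< rl(sl 1(\ b -> b =:(Co n2 *: b)*: Co ½)Re b)<! ma{n2 ** b} {ι(sC N)} {½}(lZ ni)(lZ(pS(Ah(n2 ** b))))
   le : ∀ n -> ia n ** b ^^ n <= ι(sC N)^^ N ** ½ ^^ n
   le n = !< Mo{b ^^ n} {(ι(sC N)** ½)^^ n} {ia n}(lZ(iw n))(mu n b0 kD)<~
    rl(!= cO(ia n **_)(dt(ι(sC N))½ n)=! sl 3(\ v p h -> v *:(p *: h)=: p *: v *: h)Re(ia n)(ι(sC N)^^ n)(½ ^^ n))<!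
     ma{ι(sC N)^^ n ** ia n} {ι(sC N)^^ N} {½ ^^ n}(nf n(lZ ni))(bB N n)
 aE : ½ << 1q
 aE = bf ½ ni Re
 tT : ℕ -> ℂ -> ℕ -> ℂ
 tT k t n = oq(ia(k +n n))* t ^ n
 Io : ∀ k n -> ia(k +n n)<= ia n
 Io z0 n = ra
 Io(sC k)n = !< iJ(k +n n)<! Io k n
 Tg : ∀ k t -> Go(tT k t)
 Tg k t = gy(pF d)½(pF(pS d))(lZ ni)aE \ n -> mo
  (!< ma{ia(k +n n)} {ia n} {b ^^ n}(nf n(nn hb))(Io k n)<! pS(pS d)n)(≼-*(iD(k +n n))(≼-^ n hb))
  where
  b : ℚ
  b = pF(ei t)
  hb : t <| b
  hb = pS(ei t)
  d = iM b(nn hb)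
 Ep : ∀ t -> Go(eT t)
 Ep = Tg 0
 opaque
  exp : ℂ -> ℂ
  exp t = gm{eT t}(Ep t)
  es : ∀ t -> Sa(eT t)(exp t)
  es t = gu{eT t}(Ep t)
 ET : ∀ {s t}-> s ≈ t -> ∀ n -> eT s n ≈ eT t n
 ET h n = co(ck n h)
 ep : ∀ {s t}-> s ≈ t -> exp s ≈ exp t
 ep{s} {t}h = Ss(es s)(Su(\ n -> yY(ET h n))rR(es t))
 oa : ℕ -> ℂ
 oa n = oq(ι n)
 os : ∀ n -> oa(sC n)≈ 1# + oa n
 os n = !~ rx(cO oq(sa n))~! oc 1q(ι n)
 θ :(ℕ -> ℂ)-> ℕ -> ℂ
 θ a n = oa n * a n
 o0 : oa 0 ≈ 0#
 o0 = rx(cO oq nw)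
 xC : ∀ a b n -> oa n *(a *s b)n ≈(θ a *s b)n +(a *s θ b)n
 xC a b z0 = !~ z(a 0 * b 0)~! yY(!~ ca(!~ cn(z(a 0))~! ze(b 0))(!~ co(z(b 0))~! zr(a 0))~! Ii 0#)
  where
  z : ∀ w -> oa 0 * w ≈ 0#
  z w = !~ cn o0 ~! ze w
 xC a b(sC n)= !~ cn(os n)~~ sV 4(\ i x y c ->(# 1q :+ i):*(x :* y :+ c):= x :*((# 1q :+ i):* y):+(c :+ i :* c))rR(oa n)(a 0)(b(sC n))((tl a *s b)n)~~
  ca(co(cn(yY(os n))))(Cn(xC(tl a)b n))~~
  sV 4(\ p q r s -> p :+(q :+(r :+ s)):=(# 0q :+(r :+ q)):+(p :+ s))rR(a 0 *(oa(sC n)* b(sC n)))((tl a *s b)n)((θ(tl a)*s b)n)((tl a *s θ b)n)~!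
   Cg(ca(yY(!~ cn(!~ cn o0 ~! ze(a 0))~! ze(b(sC n))))
    (yY(!~ at(SR.*-congʳ{b} {tl(θ a)} {θ(tl a)+s tl a}(mk \ i -> !~ cn(os i)~! sV 2(\ i x ->(# 1q :+ i):* x := i :* x :+ x)rR(oa i)(a(sC i))))n ~!
     at(SR.distribʳ b(θ(tl a))(tl a))n)))
  where module SR = CommutativeRing sR
 a9 : ∀ t n -> θ(eT t)(sC n)≈ t * eT t n
 a9 t n = !~ sV 4(\ i v t p -> i :*(v :*(t :* p)):=(i :* v):*(t :* p))rR(oa(sC n))(oq(ia(sC n)))t(t ^ n)~~
  cn(!~ yY(ob(ι(sC n))(ia(sC n)))~! rx(cO oq(Is n)))~!
   sV 3(\ v t p -> v :*(t :* p):= t :*(v :* p))rR(oq(ia n))t(t ^ n)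
 Oc : ∀ n{z w}-> oa(sC n)* z ≈ oa(sC n)* w -> z ≈ w
 Oc n{z} {w}h = !~ yY(e z)~~ co h ~! e w
  where
  v = iv(ι(sC n))(nd n)
  e : ∀ z -> oq v *(oa(sC n)* z)≈ z
  e z = !~ yY(ao _ _ z)~~ cn(!~ yY(ob v(ι(sC n)))~! rx(cO oq(iz(nd n))))~! ie z
 eV : ∀ s t n ->(eT s *s eT t)n ≈ eT(s + t)n
 eV s t z0 = sV 0((# 1q :* # 1q):*(# 1q :* # 1q):= # 1q :* # 1q)rR
 eV s t(sC n)= Oc n(!~ xC(eT s)(eT t)(sC n)~~ ca(lO s t)(!~ at(SR.*-comm(eT s)(θ(eT t)))(sC n)~~ lO t s ~! co(at(SR.*-comm(eT t)(eT s))n))~~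
  yY(dv((eT s *s eT t)n)s t)~~ co(eV s t n)~! yY(a9(s + t)n))
  where
  module SR = CommutativeRing sR
  lO : ∀ s t ->(θ(eT s)*s eT t)(sC n)≈ s *(eT s *s eT t)n
  lO s t = !~ ca(!~ cn(!~ cn o0 ~! ze(eT s 0))~! ze(eT t(sC n)))
   (!~ at(SR.*-congʳ{eT t} {tl(θ(eT s))} {s ^s eT s}(mk(a9 s)))n ~! at(·-*ₛ s(eT s)(eT t))n)~!
   (Ii _)
 eF : ∀ s t -> exp(s + t)≈ exp s * exp t
 eF s t = Ss(es(s + t))(Su(eV s t)rR(Sx(Ep s)(Ep t)(es s)(es t)))
 e0 : exp 0# ≈ 1#
 e0 = Ss(es 0#)\ ε na -> 1 , \ { (sC n)(ss le)-> mo(lZ na)(nj(!~ ca(sV 0(# 1q :* # 1q := # 1q)rR)(nB n \ i _ -> sV 2(\ v p -> v :*(# 0q :* p):= # 0q)rR(oq(ia(sC i)))(0# ^ i))~! Ie 1#)) }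
 Eg : ∀ t -> exp t * exp(- t)≈ 1#
 Eg t = !~ yY(eF t(- t))~~ ep(ir t)~! e0
 eQ : ∀ n t -> exp t ^ n ≈ exp(oa n * t)
 eQ z0 t = yY(!~ ep(!~ cn o0 ~! ze t)~! e0)
 eQ(sC n)t = !~ co(eQ n t)~~ yY(eF t _)~! ep(yY(!~ cn(os n)~! sV 2(\ i t ->(# 1q :+ i):* t := t :+ i :* t)rR(oa n)t))
 opaque
  tR : ℕ -> ℂ -> ℂ
  tR k t = gm{tT k t}(Tg k t)
  tS : ∀ k t -> Sa(tT k t)(tR k t)
  tS k t = gu{tT k t}(Tg k t)
 TR : ∀ t -> tR 0 t ≈ exp t
 TR t = Ss(tS 0 t)(es t)
 te : ∀ k t -> tR k t ≈ oq(ia k)+ t * tR(sC k)t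
 te k t = !~ Ss(tS k t)(Sg{tT k t}(Su
  (\ n -> !~ sV 3(\ t v p -> t :*(v :* p):= v :*(t :* p))rR t(oq(ia(sC k +n n)))(t ^ n)~! rx(cO(\ j -> oq(ia j)*(t * t ^ n))(sy(su k n))))
  rR(Sd t(tS(sC k)t))))~!
  Cg(!~(In _)~! rx(cO(\ j -> oq(ia j))(Iy k)))
 tE : ∀ k t{b}-> t <| b -> b << 1q ->(mU : 0q << 1q -q b)-> tR k t <| ia k ** iv(1q -q b)mU
 tE k t{b}hb lt mU = ⟶-≼(n0(lZ(iw k))(lZ(i0 mU)))(tS k t)(0 , \ n _ ->
  ge n mU(lZ(iw k))(nn hb)\ i -> mo(ma{ia(k +n i)} {ia k} {b ^^ i}(nf i(nn hb))(sB(\ j -> ia j <= ia k)(Cm i k)(iI i k)))(≼-*(iD(k +n i))(≼-^ i hb)))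
  where
  iI : ∀ i k -> ia(i +n k)<= ia k
  iI = Io
 opaque
  ty : ∀ b -> 0q <= b -> ∃ \ B -> ∀ k t -> t <| b -> tR k t <| B
  ty b b0 = C ** iv(1q -q ½)lt , \ k t ht -> ⟶-≼(n0 0≤C(lZ(i0 lt)))(tS k t)(0 , \ n _ ->
   ge n lt 0≤C(lZ ni)\ i -> mo(!< ma{ia(k +n i)} {ia i} {b ^^ i}(nf i b0)(Io k i)<! pS(pS d)i)(≼-*(iD(k +n i))(≼-^ i ht)))
   where
   d : ∃ \ C -> 0q <= C ×(∀ n -> ia n ** b ^^ n <= C ** ½ ^^ n)
   d = iM b b0
   C : ℚ
   C = pF d
   0≤C : 0q <= C
   0≤C = pF(pS d)
   lt : 0q << 1q -q ½
   lt = Pp aE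
module Expb where
 open Expo public
 open CSolve
 private
  opaque
   unfolding fq _+ℝ_ _*ℝ_ -ℝ_
   NA : ∀ u n -> Nb(1# + u)n ≡ 1q ++(seq(re u)n ++ seq(re u)n)++ Nb u n
   NA u n = sl 2(\ a b ->(Co 1q +: a)*:(Co 1q +: a)+:(Co 0q +: b)*:(Co 0q +: b)
    =: Co 1q +:(a +: a)+:(a *: a +: b *: b))Re(seq(re u)n)(seq(im u)n)
   Ro : ∀ q z n -> seq(re(oq q * z))n ≡ q ** seq(re z)n
   Ro q z n = sl 3(\ q a b -> q *: a -: Co 0q *: b =: q *: a)Re q(seq(re z)n)(seq(im z)n)
 1+-≼ : ∀ {u y b}-> 0q <= y -> y <= ½ -> Evt(\ n -> seq(re u)n <= -q y)-> Evt(\ n -> Nb u n <= b ** b)->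
  1# + u <| 1q -q y ++ b ** b
 1+-≼{u} {y} {b}hy yg hr hb = mv fa \ p lt -> em(\ n r s -> !< rl(NA u n)<~
  mi(mj 1q(mi r r))s <~ le <! sn fa(lZ lt))hr hb
  where
  c = 1q -q y ++ b ** b
  1-y≥ : ½ <= 1q -q y
  1-y≥ = By(½ -q y)(p0 yg)(sl 1(\ y -> Co 1q -: y =: Co ½ +:(Co ½ -: y))Re y)
  fa : 0q <= c
  fa = N0(!<(lZ ni)<! 1-y≥)(nq b)
  le :(1q ++(-q y ++ -q y))++ b ** b <= c ** c
  le = By(y ** y ++ n2 **(½ -q y)**(b ** b)++(b ** b)**(b ** b))
   (N0(N0(nq y)(n0(n0(N0 n1 n1)(p0 yg))(nq b)))(nq(b ** b)))
   (sl 2(\ y b ->(Co 1q -: y +: b)*:(Co 1q -: y +: b)=: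
    ((Co 1q +:(-: y +: -: y))+: b)+:(y *: y +: Co n2 *:(Co ½ -: y)*: b +: b *: b))Re y(b ** b))
 ey : ∀ u -> exp u ≈(1# + u)+(u * u)* tR 2 u
 ey u = !~ yY(TR u)~~ te 0 u ~~ Cn(co(te 1 u))~!
  sV 2(\ u r -> # 1q :+ u :*(# 1q :+ u :* r):=(# 1q :+ u):+(u :* u):* r)rR u(tR 2 u)
 eW : ∀ {t x}(x0 : 0q <= x)(1+x>0 : 0q << 1q ++ x)-> Evt(\ n -> seq(re t)n <= -q x)-> exp t <| iv(1q ++ x)1+x>0
 eW{t} {x}x0 1+x>0 hr = Cl(lZ IA)bo
  where
  I = iv(1q ++ x)1+x>0
  IA : 0q << I
  IA = i0 1+x>0
  q = pF(ei t)
  hq = pS(ei t)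
  b = q ++ 1q
  qf : q << b
  qf = bf 1q nl Re
  b0 : 0q <= b
  b0 = N0(nn hq)n1
  ht : t <| b
  ht = mo(lZ qf)hq
  B = pF(ty b b0)
  hB = pS(ty b b0)
  B0 : 0q <= B
  B0 = nn(hB 0 0#(mo b0(Of 0q)))
  D = b ** b ++ b ** b ** B
  D0 : 0q <= D
  D0 = N0(nq b)(n0(nq b)B0)
  N4 = n2 ++ n2
  4D≥0 : 0q <= N4 ** D
  4D≥0 = n0(N0(N0 n1 n1)(N0 n1 n1))D0
  module _ (M : ℕ) where
   N = sC M
   i = iv(ι N)(nd M)
   jd : 0q << i
   jd = i0(nd M)
   je : i <= 1q
   je = iA(nd M)(By(ι M)(nc M)(sa M))
   Ni : ι N ** i ≡ 1q
   Ni = Iv(nd M)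
   u = oq i * t
   κ = 1q -q x ** i ++ D **(i ** i)
   ib : 0q <= i ** b
   ib = n0(lZ jd)b0
   ub : u <| i ** b
   ub = ≼-*(sB(oq i <|_)(np(lZ jd))(Of i))ht
   Ub : u <| b
   Ub = mo(!< ma{i} {1q} {b}b0 je <! rl(iy b))ub
   kE : x ** i <= ½ -> exp u <| κ
   kE le = rp(yY(ey u))(sB((1# + u)+(u * u)* tR 2 u <|_)
    (sl 4(\ x i b B ->(Co 1q -: x *: i +:(i *: b)*:(i *: b))+:(i *: b *:(i *: b))*: B
     =: Co 1q -: x *: i +:(b *: b +: b *: b *: B)*:(i *: i))Re x i b B)
    (≼-+(1+-≼{u} {x ** i} {i ** b}(n0 x0(lZ jd))le
     (Em(\ n h -> !< rl(Ro i t n)<~ Mo{seq(re t)n} { -q x} {i}(lZ jd)h <!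
      rl(sl 2(\ i x -> i *:(-: x)=: -:(x *: i))Re i x))hr)
     (Em(\ n h -> !< rl(Nf i t n)<~ Mo{Nb t n} {b ** b} {i ** i}(nq i)h <!
      rl(sl 2(\ i b -> i *: i *:(b *: b)=: i *: b *:(i *: b))Re i b))(bd hq b qf)))
     (≼-*(≼-* ub ub)(hB 2 u Ub))))
   kF : x ** i <= ½ -> exp t <| κ ^^ N
   kF le = rp(!~ eQ N u ~! ep(!~ yY(ao(oa N)(oq i)t)~~
    cn(!~ yY(ob(ι N)i)~! rx(cO oq Ni))~! ie t))(≼-^ N(kE le))
   s = n2 ** D **(i ** i)
   module _ (lg : x ** i <= ½) (lh : N4 ** D ** i <= 1q) where
    y = x ** i
    y0 : 0q <= y
    y0 = n0 x0(lZ jd)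
    nH : 0q <= κ
    nH = N0(p0(!< lg <!(lZ aE)))(n0 D0(nq i))
    S0 : 0q <= s
    S0 = n0(n0(N0 n1 n1)D0)(nq i)
    Ns : ι N ** s ≡ ½ **(N4 ** D ** i)
    Ns = != sl 3(\ n D i -> n *:(Co n2 *: D *:(i *: i))=:(n *: i)*:(Co n2 *: D *: i))Re(ι N)D i =~
     cO(_**(n2 ** D ** i))Ni =! sl 2(\ D i -> Co 1q *:(Co n2 *: D *: i)=: Co ½ *:(Co N4 *: D *: i))Re D i
    Nz : ι N ** s <= ½
    Nz = !< rl Ns <~ Mo{N4 ** D ** i} {1q} {½}(lZ ni)lh <! rl(ii ½)
    S1 : s <= 1q
    S1 = !< By(ι M ** s)(n0(nc M)S0)(!= cO(_** s)(sa M)=! sl 2(\ m s ->(Co 1q +: m)*: s =: s +: m *: s)Re(ι M)s)<~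
     Nz <!(lZ aE)
    kG : κ **(1q ++ y)**(1q -q s)<= 1q
    kG = !< ma{κ **(1q ++ y)} {1q ++ s} {1q -q s}(p0 S1)
     (By(y ** y ++ D **(i ** i)**(1q -q y))(N0(nq y)(n0(n0 D0(nq i))(p0(!< lg <!(lZ aE)))))
      (sl 3(\ x i D -> Co 1q +: Co n2 *: D *:(i *: i)=:
       (Co 1q -: x *: i +: D *:(i *: i))*:(Co 1q +: x *: i)+:(x *: i *:(x *: i)+: D *:(i *: i)*:(Co 1q -: x *: i)))Re x i D))<!
     By(s ** s)(nq s)(sl 1(\ s -> Co 1q =:(Co 1q +: s)*:(Co 1q -: s)+: s *: s)Re s)
    P = κ ^^ N
    Pz : 0q <= P
    Pz = nf N nH
    mR : P **(1q ++ x)**(1q -q ι N ** s)<= 1q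
    mR = !< my(n0 Pz(lZ 1+x>0))(p0(!< Nz <!(lZ aE)))
     (Mo{1q ++ x} {(1q ++ y)^^ N} {P}Pz(!< rl(cO(1q ++_)(sy(!= sl 3(\ n x i -> n *:(x *: i)=: x *:(n *: i))Re(ι N)x i =~ cO(x **_)Ni =! ii x)))<! bl N y0))
     (q3 N S0 S1)<~
     rl(!= cO(_**(1q -q s)^^ N)(sy(dt κ(1q ++ y)N))=! sy(dt(κ **(1q ++ y))(1q -q s)N))<!
      nP N(n0(n0 nH(N0 n1 y0))(p0 S1))kG
    Z = P **(1q ++ x)
    Z0 : 0q <= Z
    Z0 = n0 Pz(lZ 1+x>0)
    Z2 : Z <= n2
    Z2 = Ca{Z} {n2} {½}ni(!<(!< rl(cD ½ Z)<! Mo{½} {1q -q ι N ** s} {Z}Z0(By(½ -q ι N ** s)(p0 Nz)(sl 1(\ r -> Co 1q -: r =: Co ½ +:(Co ½ -: r))Re(ι N ** s))))<! mR)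
    Za : Z <= 1q ++ N4 ** D ** i
    Za = !< rl(sl 2(\ z r -> z =: z *:(Co 1q -: r)+: z *: r)Re Z(ι N ** s))<!
     mi mR(!< ma{Z} {n2} {ι N ** s}(n0(nc N)S0)Z2 <! rl(!= cO(n2 **_)Ns =! sl 1(\ r -> Co n2 *:(Co ½ *: r)=: r)Re(N4 ** D ** i)))
    PN : P <= I ++ N4 ** D ** i
    PN = !< rl(!= sy(ii P)=~ cO(P **_)(sy(Iv 1+x>0))=! sy(ac P(1q ++ x)I))<~
     ma{Z} {1q ++ N4 ** D ** i} {I}(lZ IA)Za <~ rl(sl 2(\ I r ->(Co 1q +: r)*: I =: I +: I *: r)Re I(N4 ** D ** i))<!
      mj I(!< ma{I} {1q} {N4 ** D ** i}(n0 4D≥0(lZ jd))(iA 1+x>0(By x x0 Re))<! rl(iy _))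
  bo : ∀ ε -> 0q << ε -> exp t <| I ++ ε
  bo ε na = mo(!< PN M lg lh <! mj I lF)(kF M lg)
   where
   V = iv ε na
   W =(x ++ x)++ N4 ** D ++ N4 ** D ** V
   M : ℕ
   M = pF(qx W)
   iq = i M
   iW : iq ** W <= 1q
   iW = pS(qx W)
   pQ : ∀ a -> a <= W -> iq ** a <= 1q
   pQ a le = !< Mo{a} {W} {iq}(lZ(jd M))le <! iW
   VE = lZ(i0 na)
   lg : x ** iq <= ½
   lg = Ca{x ** iq} {½} {n2}(nG nl n1)(!< rl(sl 2(\ x i -> Co n2 *:(x *: i)=: i *:(x +: x))Re x iq)<!
    pQ(x ++ x)(By(N4 ** D ++ N4 ** D ** V)(N0 4D≥0(n0 4D≥0 VE))(dZ(x ++ x)_ _)))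
   lh : N4 ** D ** iq <= 1q
   lh = !< rl(cD(N4 ** D)iq)<! pQ(N4 ** D)(By(x ++ x ++ N4 ** D ** V)(N0(N0 x0 x0)(n0 4D≥0 VE))
    (sl 3(\ x d e -> x +: d +: e =: d +:(x +: e))Re(x ++ x)(N4 ** D)(N4 ** D ** V)))
   lF : N4 ** D ** iq <= ε
   lF = Ca{N4 ** D ** iq} {ε} {V}(i0 na)(!< rl(sl 3(\ d i v -> v *:(d *: i)=: i *:(d *: v))Re(N4 ** D)iq V)<~
    pQ(N4 ** D ** V)(By(x ++ x ++ N4 ** D)(N0(N0 x0 x0)4D≥0)(cw _(N4 ** D ** V)))<! rl(sy(iz na)))
module Conv where
 open Expb public
 open import Data.Fin.Base using (toℕ)
 open import Function.Base using (_∘_)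
 opaque
  unfolding fq _+ℝ_ _*ℝ_ -ℝ_
  se : ∀ q n -> seq(fq q)n ≡ q
  se q n = Re
  aF : ∀ x n -> seq(R.- x)n ≡ -q seq x n
  aF x n = Re
  s1 : ∀ x y n -> seq(x R.+ y)n ≡ seq x n ++ seq y n
  s1 x y n = Re
 sA : ∀ x y n -> seq(x R.- y)n ≡ seq x n -q seq y n
 sA x y n = != s1 x(R.- y)n =! cO(seq x n ++_)(aF y n)
 sr : ∀ q n -> seq(R.- fq q)n ≡ -q q
 sr q n = != aF(fq q)n =!(cO -q_(se q n))
 private
  bi : ∀ {x y ε}-> 0q << ε -> Evt(\ n -> Q.∣ seq x n -q seq y n ∣ <= ½ ** ε)->
   (R.- fq ε R.<(x R.- y))×((x R.- y)R.< fq ε)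
  bi{x} {y} {ε}na(N , h)=
   record { gap = ½ **(½ ** ε); gap>0 = mV ; separated = N , \ n le -> m5(cO(_++ ½ **(½ ** ε))(sr ε n))(sA x y n)(Tn(bf(½ **(½ ** ε))mV(sl 1(\ e -> -:(Co ½ *: e)=:(-: e +: Co ½ *:(Co ½ *: e))+: Co ½ *:(Co ½ *: e))Re ε))(lo(h n le))) }
   , record { gap = ½ **(½ ** ε); gap>0 = mV ; separated = N , \ n le -> m5(cO(_++ ½ **(½ ** ε))(sA x y n))(se ε n)(Tr(ml(½ **(½ ** ε))(hi(h n le)))(bf(½ **(½ ** ε))mV(sl 1(\ e -> e =:(Co ½ *: e +: Co ½ *:(Co ½ *: e))+: Co ½ *:(Co ½ *: e))Re ε))) }
   where
   mV = Ha(Ha na)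
   hi : ∀ {q e}-> Q.∣ q ∣ <= e -> q <= e
   hi{q}le = !< pp q <! le
    where
    pp : ∀ q -> q <= Q.∣ q ∣
    pp q = go(Tt 0q q)
     where
     go : 0q <= q ⊎ q <= 0q -> q <= Q.∣ q ∣
     go(iL g)= rl(sy(np g))
     go(iR g)= !< g <! Np q
   lo : ∀ {q e}-> Q.∣ q ∣ <= e -> -q e <= q
   lo{q} {e}le = !< nt(hi{ -q q} {e}(!< rl(pa q)<! le))<! rl(sl 1(\ q -> -:(-: q)=: q)Re q)
  lq : ∀ {x y ε}->(R.- fq ε R.<(x R.- y))×((x R.- y)R.< fq ε)-> Evt(\ n -> Q.∣ seq x n -q seq y n ∣ <= ε)
  lq{x} {y} {ε}(p , q)= em(\ n a b -> Bt(!< By(R._<_.gap q)(lZ(R._<_.gap>0 q))(cO(_++ R._<_.gap q)(sA x y n))<~(lZ b)<! rl(se ε n))(!< By(R._<_.gap p)(lZ(R._<_.gap>0 p))(cO(_++ R._<_.gap p)(sr ε n))<~(lZ a)<! rl(sA x y n)))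
   (R._<_.separated p)(R._<_.separated q)
   where
   Bt : ∀ {x y}-> x <= y -> -q y <= x -> Q.∣ x ∣ <= y
   Bt{x} {y}h g = go(pe x)
    where
    go : Q.∣ x ∣ ≡ x ⊎ Q.∣ x ∣ ≡ -q x -> Q.∣ x ∣ <= y
    go(iL e)= !< rl e <! h
    go(iR e)= !< rl e <~ nt g <! rl(sl 1(\ y -> -:(-: y)=: y)Re y)
  SN : ∀ {z w ε}-> 0q << ε -> z - w <| ½ **(½ ** ε)->
   Evt(\ n -> Q.∣ seq(re z)n -q seq(re w)n ∣ <= ½ ** ε)× Evt(\ n -> Q.∣ seq(im z)n -q seq(im w)n ∣ <= ½ ** ε)
  SN{z} {w} {ε}na h =
   Em(\ n le -> sE(lZ(Ha na))(!< By((seq(im z)n -q seq(im w)n)**(seq(im z)n -q seq(im w)n))(nq(seq(im z)n -q seq(im w)n))Re <! le))B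
   , Em(\ n le -> sE(lZ(Ha na))(!< By((seq(re z)n -q seq(re w)n)**(seq(re z)n -q seq(re w)n))(nq(seq(re z)n -q seq(re w)n))(cw((seq(re z)n -q seq(re w)n)**(seq(re z)n -q seq(re w)n))_)<! le))B
   where
   B : Evt(\ n -> nr(seq(re z)n -q seq(re w)n)(seq(im z)n -q seq(im w)n)<=(½ ** ε)**(½ ** ε))
   B = Em(\ n -> q4(rl(sy(sv z w n))))(bd h(½ ** ε)(bf(½ **(½ ** ε))(Ha(Ha na))(sl 1(\ e -> e =: Co ½ *: e +: Co ½ *: e)Re(½ ** ε))))
  jo : ∀ {z w ε}-> 0q << ε -> Evt(\ n -> Q.∣ seq(re z)n -q seq(re w)n ∣ <= ½ ** ε)-> Evt(\ n -> Q.∣ seq(im z)n -q seq(im w)n ∣ <= ½ ** ε)-> z - w <| ε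
  jo{z} {w} {ε}na h g = mv(lZ na)\ p lt -> em(\ n a b -> !< rl(sv z w n)<~ kw{seq(re z)n -q seq(re w)n} {seq(im z)n -q seq(im w)n}a b <~
   rl(sl 1(\ e ->(Co ½ *: e +: Co ½ *: e)*:(Co ½ *: e +: Co ½ *: e)=: e *: e)Re ε)<! sn(lZ na)(lZ lt))h g
 Cv : ∀ {s L}-> s => L -> R.ConvergesTo(re ∘ s)(re L)× R.ConvergesTo(im ∘ s)(im L)
 Cv{s} {L}h =(\ ε na -> Em(\ n p -> bi{re(s n)} {re L}na(pF(SN{s n} {L}na p)))(h _(Ha(Ha na))))
  ,(\ ε na -> Em(\ n p -> bi{im(s n)} {im L}na(pS(SN{s n} {L}na p)))(h _(Ha(Ha na))))
 Ce : ∀ {s L}-> R.ConvergesTo(re ∘ s)(re L)× R.ConvergesTo(im ∘ s)(im L)-> s => L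
 Ce{s} {L}(h , g)ε na = em(\ n p q -> jo{s n} {L}na(lq{re(s n)} {re L}p)(lq{im(s n)} {im L}q))(h _(Ha na))(g _(Ha na))
 Ap : ∀ x ->(\ n -> oq(seq x n))=> ofℝ x
 Ap x ε na = let N , h = cauchy x(½ ** ε)(Ha na)in N , \ n le -> jo{oq(seq x n)} {ofℝ x}na
  (N , \ j lf -> !< rl(cO(\ t -> Q.∣ t -q seq x j ∣)(se(seq x n)j))<!(lZ(h n j le lf)))
  (0 , \ j _ -> !< rl(cO Q.∣_∣(b6(seq R.0# j)))<!(lZ(Ha na)))
 Os : ∀ (q p : ℕ -> ℚ)n -> p 0 ≡ 0q ->(∀ m -> p(sC m)≡ p m ++ q m)-> ofℝ(R.sum{n}(\ i -> fq(q(toℕ i))))≈ oq(p n)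
 Os q p n e h = ≐⇒≈ \ j -> != sy(ig _)=~ cO(seq(R.sum{n}(\ i -> fq(q(toℕ i))))j ++_)(sy e)=~ go n q p h j =! sy(se(p n)j), Re
  where
  go : ∀ n(q p : ℕ -> ℚ)->(∀ m -> p(sC m)≡ p m ++ q m)-> ∀ j -> seq(R.sum{n}(\ i -> fq(q(toℕ i))))j ++ p 0 ≡ p n
  go z0 q p h j = != cO(_++ p 0)(se 0q j)=! iB(p 0)
  go(sC n)q p h j = != cO(_++ p 0)(!= s1(fq(q 0))X j =! cO(_++ seq X j)(se(q 0)j))=~
   sl 3(\ a b c -> a +: b +: c =: b +:(c +: a))Re(q 0)(seq X j)(p 0)=~ cO(seq X j ++_)(sy(h 0))=! go n(q ∘ sC)(p ∘ sC)(h ∘ sC)j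
   where
   X : ℝ
   X = R.sum{n}(\ i -> fq(q(sC(toℕ i))))
 s2 : ∀ n(a : ℕ -> ℂ)-> R.sum{n}(re ∘ a ∘ toℕ)≡ re(∑ n a)
 s2 z0 a = Re
 s2(sC n)a = cO(re(a 0)R.+_)(s2 n(a ∘ sC))
 s3 : ∀ n(a : ℕ -> ℂ)-> R.sum{n}(im ∘ a ∘ toℕ)≡ im(∑ n a)
 s3 z0 a = Re
 s3(sC n)a = cO(im(a 0)R.+_)(s3 n(a ∘ sC))
 private
  cH : ∀ {s t : ℕ -> ℝ} {L}->(∀ n -> s n ≡ t n)-> R.ConvergesTo s L -> R.ConvergesTo t L
  cH{L = L}h c ε na = Em(\ n -> sB(\ x ->(R.- fq ε R.<(x R.- L))×((x R.- L)R.< fq ε))(h n))(c ε na)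
 SH : ∀ {a s}-> Sa a s -> HasSum a s
 SH{a}h = cH(\ n -> sy(s2 n a))(pF(Cv h)), cH(\ n -> sy(s3 n a))(pS(Cv h))
 HS : ∀ {a s}-> HasSum a s -> Sa a s
 HS{a}(h , g)= Ce(cH(\ n -> s2 n a)h , cH(\ n -> s3 n a)g)
module Pi1 where
 open Conv public
 private module P = PiQ
 open P using (N4;L;c;module Sub)
 open import Data.Fin.Base using (toℕ)
 open CSolve
 aO : ∀ {a b}C -> 0q <= C ->(∀ k -> a <= b ++ C ** iv(ι(sC k))(nd k))-> a <= b
 aO{a} {b}C hC h = Q.≮⇒≥ \ lt ->
  let dY = Pp lt;η , nL , le = Sr hC(Ha dY);N , g = sT η nL
  in jJ Re(Tr(h N)(Tr(mj b(!< Mo hC(g N Rf)<! le))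
   (bf(½ **(a -q b))(Ha dY)(sl 2(\ a b -> a =: b +: Co ½ *:(a -: b)+: Co ½ *:(a -: b))Re a b))))
 Lt : ∀ m n -> Q.∣ L m -q L n ∣ <= c m ++ c n
 Lt m n = aO(ι(sC m)++ ι(sC n))(N0(nc(sC m))(nc(sC n)))\ k -> let open Sub k in
  !< rl(cO Q.∣_∣(sl 3(\ a b t -> a -: b =:(t -: b) -:(t -: a))Re(L m)(L n)T))<~
   q5(T -q L n)(T -q L m)<~ mi(Tf n)(Tf m)<!
    rl(sl 5(\ i j h a b ->(i *: h +: a)+:(j *: h +: b)=:(b +: a)+:(j +: i)*: h)Re(ι(sC n))(ι(sC m))h(c n)(c m))
 jP : ∀ {m n}-> m ≤n n -> c n <= c m
 jP{m} {n}le = Ca{c n} {c m} {ι(sC(n +n n))}(nd(n +n n))(!< rl(!= Iv(nd(n +n n))=! sy(Iv(nd(m +n m))))<!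
  ma{ι(sC(m +n m))} {ι(sC(n +n n))} {c m}(lZ(P.C0 m))(mg(ss(mC le le))))
 Ci : ∀ n -> c n <= iv(ι(sC n))(nd n)
 Ci n = Ca{c n} {_} {ι(sC(n +n n))}(nd(n +n n))(!< rl(!= Iv(nd(n +n n))=! sy(Iv(nd n)))<!
  ma{ι(sC n)} {ι(sC(n +n n))} {iv(ι(sC n))(nd n)}(lZ(i0(nd n)))(mg(ss(me n n))))
 8ℚ : ℚ
 8ℚ = N4 ++ N4
 0≤8 : 0q <= 8ℚ
 0≤8 = N0{N4} {N4}0≤4 0≤4
  where
  0≤4 : 0q <= N4
  0≤4 = N0(N0 n1 n1)(N0 n1 n1)
 0≤4ℚ : 0q <= N4
 0≤4ℚ = N0(N0 n1 n1)(N0 n1 n1)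
 4L-close : ∀ m n -> Q.∣ N4 ** L m -q N4 ** L n ∣ <= N4 **(c m ++ c n)
 4L-close m n = !< rl(!=(cO Q.∣_∣(sl 3(\ f a b -> f *: a -: f *: b =: f *:(a -: b))Re N4(L m)(L n)))=~
  q6 N4(L m -q L n)=! cO(_** Q.∣ L m -q L n ∣)(np 0≤4ℚ))<! Mo 0≤4ℚ(Lt m n)
 xf : ℝ
 xf = mkℝ(\ n -> N4 ** L n)\ ε na ->
  let η , nL , le = Sr 0≤8(Ha na);N , g = sT η nL
  in N , \ m n pm pn -> Tr(4L-close m n)(Tr
   (!< Mo{c m ++ c n} {η ++ η}0≤4ℚ(mi(!< Ci m <! g m pm)(!< Ci n <! g n pn))<~
    rl(sl 1(\ e -> Co N4 *:(e +: e)=: Co 8ℚ *: e)Re η)<! le)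
   (bf(½ ** ε)(Ha na)(sl 1(\ e -> e =: Co ½ *: e +: Co ½ *: e)Re ε)))
 π : ℂ
 π = ofℝ xf
 Lu :(\ n -> oq(N4 ** L n))=> π
 Lu = Ap xf
 private
  td : ℕ -> ℚ
  td n =(-z 1ℤ)^z n *z + 4 // sC(2 *n n)
  LB : ∀ m -> N4 ** L(sC m)≡ N4 ** L m ++ td m
  LB m = != cO(N4 **_)(P.FQ.Ls m(\ m -> P.ng ^^ m ** c m))=~(l4 N4(L m)_)=! cO(N4 ** L m ++_)(sy(P.lr m))
  pt : ∀ n -> ofℝ(R.sum{n}(\ i -> fq(td(toℕ i))))≈ oq(N4 ** L n)
  pt n = Os td(\ n -> N4 ** L n)n(zq N4)LB
 iP : ∀ {x}-> R.IsPi x ->(\ n -> oq(N4 ** L n))=> ofℝ x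
 iP{x}h = Rs pt rR(Ce(h , pS(Cv(cA 0#))))
 IP : ∀ {x}-> R.IsPi x -> ofℝ x ≈ π
 IP h = uq(iP h)Lu
 kH : R.IsPi xf
 kH = pF(Cv(Rs{t = \ n -> ofℝ(R.sum{n}(\ i -> fq(td(toℕ i))))}(\ n -> yY(pt n))rR Lu))
 gs : ℚ -> ℚ -> ℂ
 gs a b = oq a + 𝕚 * oq b
 private
  opaque
   unfolding fq _+ℝ_ _*ℝ_ -ℝ_
   Nh : ∀ a b n -> Nb(gs a b)n ≡ a ** a ++ b ** b
   Nh a b n = sl 2(\ a b ->(a +:(Co 0q *: b -: Co 1q *: Co 0q))*:(a +:(Co 0q *: b -: Co 1q *: Co 0q))
    +:(Co 0q +:(Co 0q *: Co 0q +: Co 1q *: b))*:(Co 0q +:(Co 0q *: Co 0q +: Co 1q *: b))=: a *: a +: b *: b)Re a b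
   Rg : ∀ b n -> seq(re(gs 0q b))n ≡ -q 0q
   Rg b n = sl 1(\ b -> Co 0q +:(Co 0q *: b -: Co 1q *: Co 0q)=: Co 0q)Re b
 Gu : ∀ {a b q}-> 0q <= q -> a ** a ++ b ** b <= q ** q -> gs a b <| q
 Gu{a} {b}hq h = mv hq \ p lt -> 0 , \ n _ -> !< rl(Nh a b n)<~ h <! sn hq(lZ lt)
 kI : iv(1q ++ 0q)(nG nl ra)≡ 1q
 kI = != sy(iy _)=! Iv(nG nl ra)
 eL : ∀ b -> exp(gs 0q b)<| 1q
 eL b = sB(exp(gs 0q b)<|_)kI(eW{gs 0q b}ra(nG nl ra)(0 , \ n _ -> rl(Rg b n)))
 I* : ℚ -> ℂ
 I* b = 𝕚 * oq b
 Ik : ∀ b -> I* b ≈ gs 0q b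
 Ik b = sV 1(\ t -> t := # 0q :+ t)rR(I* b)
 Iq : ∀ a b -> I* a + I* b ≈ I*(a ++ b)
 Iq a b = !~ yY(dr 𝕚(oq a)(oq b))~! co(yY(oc a b))
 et : ∀ u -> exp u ≈ 1# + u * tR 1 u
 et u = !~ yY(TR u)~! te 0 u
 eM : ∀ s t -> exp s - exp t ≈ exp t *((s - t)* tR 1(s - t))
 eM s t = !~ sb(!~ ep(sV 2(\ s t -> s := t :+(s :- t))rR s t)~~ eF t(s - t)~! co(et(s - t)))rR ~!
  sV 2(\ e u -> e :*(# 1q :+ u):- e := e :* u)rR(exp t)((s - t)* tR 1(s - t))
 eY : ∀ {s L}-> s => L ->(\ n -> exp(s n))=> exp L
 eY{s} {L}h ε na =
  let B , hB = ty 1q n1;q , hq = ei(exp L);B0 = nn(hB 0 0#(mo n1(Of 0q)));η , nL , le = Sr(n0(nn hq)B0)na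
  in em(\ n a b -> mo(!< rl(sl 3(\ q B e -> q *:(e *: B)=: q *: B *: e)Re q B η)<! le)
   (rp(yY(eM(s n)L))(≼-* hq(≼-* b(hB 1(s n - L)a)))))(h 1q nl)(h η nL)
 If : ∀ b q -> 0q <= q -> Q.∣ b ∣ <= q -> I* b <| q
 If b q hq h = sB(I* b <|_)(iy q)(≼-* xq(mo h(Of b)))
 module _ (k : ℕ) where
  open Sub k hiding (S)
  private
   v1 : ∀ j -> iv(1q ++ p j)(1+p>0 j)<= 1q
   v1 j = iA(1+p>0 j)(By(p j)(pD j)Re)
   nK : ∀ j -> 0q <= δ j
   nK j = n0(lZ hR)(lZ(i0(1+p>0 j)))
   h3 : ∀ j -> δ j <= h
   h3 j = !< Mo(lZ hR)(v1 j)<! rl(ii h)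
   h4 : h <= 1q
   h4 = iA(nd k)(By(ι k)(nc k)(sa k))
   1+sq>0 : ∀ y -> 0q << 1q ++ y ** y
   1+sq>0 y = nG nl(nq y)
   V : ℚ -> ℂ
   V y = oq(iv(1q ++ y ** y)(1+sq>0 y))*(1# + I* y)
   Vi : ∀ y -> V y *(1# - I* y)≈ 1#
   Vi y = !~ sV 3(\ s i y -> s :*(# 1q :+ i :* y):*(# 1q :- i :* y):= s :*(# 1q :-(i :* i):*(y :* y)))rR S 𝕚(oq y)~~
    co(sb rR(cn xn))~~ sV 2(\ s y -> s :*(# 1q :-(:- # 1q):*(y :* y)):= s :*(# 1q :+ y :* y))rR S(oq y)~~
     co(yY(!~ oc 1q(y ** y)~! Cn(ob y y)))~~ yY(ob _(1q ++ y ** y))~! rx(cO oq(iz(1+sq>0 y)))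
    where S = oq(iv(1q ++ y ** y)(1+sq>0 y))
   Vm : ∀ y -> let s = iv(1q ++ y ** y)(1+sq>0 y)in V y ≈ gs s(s ** y)
   Vm y = !~ sV 3(\ s i y -> s :*(# 1q :+ i :* y):= s :+ i :*(s :* y))rR(oq s)𝕚(oq y)~! Cn(co(yY(ob s y)))
    where s = iv(1q ++ y ** y)(1+sq>0 y)
   V1 : ∀ y -> V y <| 1q
   V1 y = rp(yY(Vm y))(Gu n1(!< rl(!= sl 2(\ s y -> s *: s +: s *: y *:(s *: y)=:((Co 1q +: y *: y)*: s)*: s)Re s y =!
    cO(_** s)(Iv(1+sq>0 y)))<~ rl(iy s)<~ iA(1+sq>0 y)(By(y ** y)(nq y)Re)<! rl(sy(iy 1q))))
    where s = iv(1q ++ y ** y)(1+sq>0 y)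
   ρ : ℕ -> ℂ
   ρ j =(1# + I*(δ j))* V(δ j)
   fb : ∀ j -> ρ j <| 1q
   fb j = rp(yY eq)(Gu{s **(1q -q y ** y)} {s **(y ++ y)}n1(rl(!= sl 2(\ s y -> s *:(Co 1q -: y *: y)*:(s *:(Co 1q -: y *: y))+: s *:(y +: y)*:(s *:(y +: y))=:((Co 1q +: y *: y)*: s)*:((Co 1q +: y *: y)*: s))Re s y =!
    (cong₂ _**_(Iv(1+sq>0 y))(Iv(1+sq>0 y))))))
    where
    y = δ j
    s = iv(1q ++ y ** y)(1+sq>0 y)
    eq : ρ j ≈ gs(s **(1q -q y ** y))(s **(y ++ y))
    eq = !~ sV 3(\ s i y ->(# 1q :+ i :* y):*(s :*(# 1q :+ i :* y)):= s :*(# 1q :+(i :* i):*(y :* y)):+ i :*(s :*(y :+ y)))rR(oq s)𝕚(oq y)~!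
     ca(!~ co(!~ Cn(cn xn)~~ sV 1(\ y -> # 1q :+(:- # 1q):* y := # 1q :- y)rR(oq y * oq y)~! yY(!~ oc 1q(-q(y ** y))~! Cn(!~(oe _)~! cc(ob y y))))~!
      yY(ob s _))(co(yY(!~(ob s _)~! co(oc y y))))
   w : ℕ -> ℂ
   w z0 = 1#
   w(sC j)= w j * ρ j
   jf : ∀ j ->(1# + I*(x(sC j)))*(1# - I*(x j))≈ oq(1q ++ p j)*(1# + I*(δ j))
   jf j = !~ sV 3(\ i a b ->(# 1q :+ i :* b):*(# 1q :- i :* a):=(# 1q :-(i :* i):*(a :* b)):+ i :*(b :- a))rR 𝕚(oq(x j))(oq(x(sC j)))~~
    ca(Cn(cc(cd xn(yY(ob(x j)(x(sC j)))))))(co(!~ yY(!~(oc _ _)~! Cn(oe _))~! rx(cO oq hH)))~~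
     ca(sV 1(\ a -> # 1q :-(:- # 1q):* a := # 1q :+ a)rR(oq(p j)))(co(ob(1q ++ p j)(δ j)))~~
      Cg(yY(oc 1q(p j)))~! sV 3(\ a i d -> a :+ i :*(a :* d):= a :*(# 1q :+ i :* d))rR(oq(1q ++ p j))𝕚(oq(δ j))
    where
    hH : x(sC j) -q x j ≡(1q ++ p j)** δ j
    hH = != Xd j =! sy(!= sl 3(\ a h v -> a *:(h *: v)=: h *:(a *: v))Re(1q ++ p j)h(iv(1q ++ p j)(1+p>0 j))=~ cO(h **_)(Iv(1+p>0 j))=! ii h)
   cW : ∀ j ->(1# - I*(x(sC j)))*(1# + I*(x j))≈ oq(1q ++ p j)*(1# - I*(δ j))
   cW j = !~ sV 3(\ i a b ->(# 1q :- i :* b):*(# 1q :+ i :* a):=(# 1q :-(i :* i):*(a :* b)):- i :*(b :- a))rR 𝕚(oq(x j))(oq(x(sC j)))~~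
    sb(Cn(cc(cd xn(yY(ob(x j)(x(sC j)))))))(co(!~ yY(!~(oc _ _)~! Cn(oe _))~! rx(cO oq hH)))~~
     sb(sV 1(\ a -> # 1q :-(:- # 1q):* a := # 1q :+ a)rR(oq(p j)))(co(ob(1q ++ p j)(δ j)))~~
      Cg(yY(oc 1q(p j)))~! sV 3(\ a i d -> a :- i :*(a :* d):= a :*(# 1q :- i :* d))rR(oq(1q ++ p j))𝕚(oq(δ j))
    where
    hH : x(sC j) -q x j ≡(1q ++ p j)** δ j
    hH = != Xd j =! sy(!= sl 3(\ a h v -> a *:(h *: v)=: h *:(a *: v))Re(1q ++ p j)h(iv(1q ++ p j)(1+p>0 j))=~ cO(h **_)(Iv(1+p>0 j))=! ii h)
   VF : ∀ y -> V(-q y)*(1# + I* y)≈ 1#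
   VF y = !~ co(!~ sV 2(\ i y -> # 1q :+ i :* y := # 1q :- i :*(:- y))rR 𝕚(oq y)~! Cn(cc(co(yY(oe y)))))~! Vi(-q y)
   wp : ∀ j -> w j *(1# - I*(x j))≈ 1# + I*(x j)
   wp z0 = !~ co(Cn(cc(co(rx(cO oq xV)))))~~
    sV 1(\ i -> # 1q :*(# 1q :- i :* # 0q):= # 1q :+ i :* # 0q)rR 𝕚 ~! Cn(co(rx(cO oq(sy xV))))
   wp(sC j)= begin
    W *(A * D)* b8 ≈⟨ yY(ie _)⟩
    1# *(W *(A * D)* b8)≈⟨ cn(yY(VF(x j)))⟩
    V(-q x j)* fc *(W *(A * D)* b8)≈⟨ sV 6(\ v a W A D b -> v :* a :*(W :*(A :* D):* b):= v :*(W :* A :* D :*(b :* a)))rR(V(-q x j))fc W A D b8 ⟩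
    V(-q x j)*(W * A * D *(b8 * fc))≈⟨ co(co(cW j))⟩
    V(-q x j)*(W * A * D *(Pj *(1# - I*(δ j))))≈⟨ sV 6(\ v W A D P B -> v :*(W :* A :* D :*(P :* B)):= v :*(W :*(P :* A)):*(D :* B))rR(V(-q x j))W A D Pj(1# - I*(δ j))⟩
    V(-q x j)*(W *(Pj * A))*(D *(1# - I*(δ j)))≈⟨ cd(co(co(yY(jf j))))(Vi(δ j))⟩
    V(-q x j)*(W *(bj * f2))* 1# ≈⟨ sV 4(\ v W b a -> v :*(W :*(b :* a)):* # 1q := v :*(W :* a):* b)rR(V(-q x j))W bj f2 ⟩
    V(-q x j)*(W * f2)* bj ≈⟨ cn(co(wp j))⟩
    V(-q x j)* fc * bj ≈⟨ !~ cn(VF(x j))~! ie bj ⟩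
    bj ∎
    where
    open import Relation.Binary.Reasoning.Setoid ℂR.setoid
    W A D b8 bj fc f2 Pj : ℂ
    W = w j
    A = 1# + I*(δ j)
    D = V(δ j)
    b8 = 1# - I*(x(sC j))
    bj = 1# + I*(x(sC j))
    fc = 1# + I*(x j)
    f2 = 1# - I*(x j)
    Pj = oq(1q ++ p j)
   wK : w K ≈ 𝕚
   wK = !~ yY(!~ co(Vi(x K))~! In(w K))~~
    sV 3(\ w v a -> w :*(v :* a):= v :*(w :* a))rR(w K)(V(x K))(1# - I*(x K))~~
     co(!~ wp K ~! yY kJ)~~ sV 3(\ v i a -> v :*(i :* a):= i :*(v :* a))rR(V(x K))𝕚(1# - I*(x K))~~ co(Vi(x K))~! In 𝕚
    where
    I1 : I*(x K)≈ 𝕚 * 1#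
    I1 = co(rx(cO oq XK))
    kJ : 𝕚 *(1# - I*(x K))≈ 1# + I*(x K)
    kJ = !~ co(sb rR I1)~~ sV 1(\ i -> i :*(# 1q :- i :* # 1q):= i :- i :* i)rR 𝕚 ~~ Cn(cc xn)~~
     sV 1(\ i -> i :-(:- # 1q):= # 1q :+ i :* # 1q)rR 𝕚 ~! Cn(yY I1)
   τ : ℕ -> ℚ
   τ j = P.FQ.∑ j δ
   e : ℕ -> ℂ
   e j = exp(I*(τ j ++ τ j))
   E : ℕ -> ℂ
   E j = exp(I*(δ j ++ δ j))
   jg : ∀ j -> e(sC j)≈ e j * E j
   jg j = !~ ep(!~ co(rx(cO oq(!= cO(\ t -> t ++ t)(P.FQ.Ls j δ)=! sl 2(\ a b ->(a +: b)+:(a +: b)=:(a +: a)+:(b +: b))Re(τ j)(δ j))))~!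
    yY(Iq(τ j ++ τ j)(δ j ++ δ j)))~! eF(I*(τ j ++ τ j))(I*(δ j ++ δ j))
  private
   B : ℚ
   B = pF(ty n2(N0 n1 n1))
   xO : ∀ j -> E j *(1# - I*(δ j)) -(1# + I*(δ j))<|(n2 ** h)**(n2 ** h)**(B ** n2 ++ ½)
   xO j = rp(yY eq)(≼-*(≼-* ub ub)(sj(≼-*(pS(ty n2(N0 n1 n1))2 u u2)kK)(mo ra(Of ½))))
    where
    u = I*(δ j ++ δ j)
    U = I*(δ j)
    uc : u ≈ U + U
    uc = yY(Iq(δ j)(δ j))
    bL : Q.∣ δ j ∣ <= h
    bL = !< rl(np(nK j))<! h3 j
    ub : u <| n2 ** h
    ub = rp(yY uc)(sB(U + U <|_)(sl 1(\ h -> h +: h =: Co n2 *: h)Re h)(≼-+(If(δ j)h(lZ hR)bL)(If(δ j)h(lZ hR)bL)))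
    u2 : u <| n2
    u2 = mo(!< Mo{h} {1q} {n2}(N0 n1 n1)h4 <! rl(ii n2))ub
    kK : 1# - U <| n2
    kK = sj(Of 1q)(If(δ j)1q n1(!< bL <! h4))
    eq : E j *(1# - U) -(1# + U)≈(u * u)*(tR 2 u *(1# - U) - oq ½)
    eq = !~ Cg(cn(ey u))~~ Cg(cn(ca(Cn uc)(cn(cd uc uc))))~~
     sV 2(\ U R ->(# 1q :+(U :+ U):+(U :+ U):*(U :+ U):* R):*(# 1q :- U):-(# 1q :+ U):=((U :+ U):*(U :+ U)):*(R :*(# 1q :- U):- # ½))rR U(tR 2 u)~!
      cn(cd(yY uc)(yY uc))
   dW : ∀ j -> e j - w j <| ι j **((n2 ** h)**(n2 ** h)**(B ** n2 ++ ½))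
   dW z0 = mo(rl(sy(!= cO(_** M)nw =! zd M)))(nj(!~ ep(sV 1(\ i -> i :* # 0q := # 0q)rR 𝕚)~! e0))
    where M =(n2 ** h)**(n2 ** h)**(B ** n2 ++ ½)
   dW(sC j)= sB(e(sC j) - w(sC j)<|_)(!= sl 2(\ i m -> i *: m *: Co 1q +: Co 1q *:(Co 1q *: m)=:(Co 1q +: i)*: m)Re(ι j)M =! cO(_** M)(sy(sa j)))
    (rp eq(≼-+(≼-*(dW j)(fb j))(≼-* jh(≼-*(V1(δ j))(xO j)))))
    where
    M =(n2 ** h)**(n2 ** h)**(B ** n2 ++ ½)
    jh : e j <| 1q
    jh = rp(ep(yY(Ik _)))(eL(τ j ++ τ j))
    eq :(e j - w j)* ρ j + e j *(V(δ j)*(E j *(1# - I*(δ j)) -(1# + I*(δ j))))≈ e(sC j) - w(sC j)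
    eq = !~ sV 6(\ e w A V E b ->(e :- w):*(A :* V):+ e :*(V :*(E :* b :- A)):= e :* E :*(V :* b):- w :*(A :* V))rR(e j)(w j)(1# + I*(δ j))(V(δ j))(E j)(1# - I*(δ j))~!
     Cg(!~ co(Vi(δ j))~~(In _)~! yY(jg j))
  ff : exp(I*(T ++ T)) - 𝕚 <| h **(N4 **(B ** n2 ++ ½))
  ff = rp(sb rR wK)(sB(e K - w K <|_)(!= sl 3(\ i h b -> i *:((Co n2 *: h)*:(Co n2 *: h)*: b)=:(i *: h)*:(h *:(Co N4 *: b)))Re(ι K)h(B ** n2 ++ ½)=~
   cO(_**(h **(N4 **(B ** n2 ++ ½))))(Iv(nd k))=!(iy _))(dW K))
module Pi where
 open Pi1 public
 private module P = PiQ
 open P using (N4;L;c;module Sub)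
 open import Data.Fin.Base using (toℕ)
 open CSolve
 private
  Bj Bc Mc : ℚ
  Bj = pF(ty n2(N0 n1 n1))
  Bc = pF(ty N4 0≤4ℚ)
  Mc = N4 **(Bj ** n2 ++ ½)
  0≤2 : 0q <= n2
  0≤2 = N0 n1 n1
  0≤B₂ : 0q <= Bj
  0≤B₂ = nn(pS(ty n2 0≤2)0 0#(mo 0≤2(Of 0q)))
  0≤B₄ : 0q <= Bc
  0≤B₄ = nn(pS(ty N4 0≤4ℚ)0 0#(mo 0≤4ℚ(Of 0q)))
  0≤M₀ : 0q <= Mc
  0≤M₀ = n0 0≤4ℚ(N0(n0 0≤B₂ 0≤2)(lZ ni))
  ui : ℕ -> ℚ
  ui n = iv(ι(sC n))(nd n)
  Un : ∀ n -> 0q <= ui n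
  Un n = lZ(i0(nd n))
  Ui : ∀ n -> ui n <= 1q
  Ui n = iA(nd n)(By(ι n)(nc n)(sa n))
  module _ (n k : ℕ) (hk : ι (sC n) ** ι (sC n) <= ι k) where
   open Sub k using (h;hR;T;Tf)
   nh : ι(sC n)** h <= ui n
   nh = Ca{ι(sC n)** h} {ui n} {ι(sC n)}(nd n)(!< rl(sy(ac(ι(sC n))(ι(sC n))h))<~
    ma{ι(sC n)** ι(sC n)} {ι(sC k)} {h}(lZ hR)(!< hk <! mg(N1 k))<! rl(!= Iv(nd k)=! sy(Iv(nd n))))
   kM : h <= ui n
   kM = !<(!< rl(sy(iy h))<! ma{1q} {ι(sC n)} {h}(lZ hR)(By(ι n)(nc n)(sa n)))<! nh
   dw : Q.∣(L n -q T)++(L n -q T)∣ <= N4 ** ui n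
   dw = !< pb(L n -q T)(L n -q T)<~ mi On On <! rl(sl 1(\ u ->(u +: u)+:(u +: u)=: Co N4 *: u)Re(ui n))
    where
    On : Q.∣ L n -q T ∣ <= ui n ++ ui n
    On = !< rl(!= sy(pa(L n -q T))=!(cO Q.∣_∣(sl 2(\ l t -> -:(l -: t)=: t -: l)Re(L n)T)))<~
     Tf n <! mi nh(Ci n)
   y : ℂ
   y = I*((L n -q T)++(L n -q T))
   yh : y <| N4 ** ui n
   yh = If((L n -q T)++(L n -q T))(N4 ** ui n)(n0 0≤4ℚ(Un n))dw
   dP : exp(I*(L n ++ L n)) - exp(I*(T ++ T))<| 1q **(N4 ** ui n ** Bc)
   dP = rp(yY(eM(I*(L n ++ L n))(I*(T ++ T))))(≼-*(rp(ep(yY(Ik(T ++ T))))(eL(T ++ T)))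
    (≼-*(rp(yY eq)yh)(pS(ty N4 0≤4ℚ)1(I*(L n ++ L n) - I*(T ++ T))(rp(yY eq)(mo(!< Mo 0≤4ℚ(Ui n)<! rl(ii N4))yh)))))
    where
    eq : I*(L n ++ L n) - I*(T ++ T)≈ y
    eq = !~(!~ sV 3(\ i a b -> i :* a :- i :* b := i :*(a :+(:- b)))rR 𝕚(oq(L n ++ L n))(oq(T ++ T))~! co(!~ Cn(yY(oe(T ++ T)))~! yY(oc(L n ++ L n)(-q(T ++ T)))))~!
     co(rx(cO oq(sl 2(\ l t ->(l +: l)+:(-:(t +: t))=:(l -: t)+:(l -: t))Re(L n)T)))
   close : exp(I*(L n ++ L n)) - 𝕚 <|(N4 ** Bc ++ Mc)** ui n
   close = mo(!< mj(1q **(N4 ** ui n ** Bc))(ma{h} {ui n} {Mc}0≤M₀ kM)<!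
    rl(sl 3(\ u b m -> Co 1q *:(Co N4 *: u *: b)+: u *: m =:(Co N4 *: b +: m)*: u)Re(ui n)Bc Mc))
    (tC dP(ff k))
 e2 : exp(oq ½ *(𝕚 * π))≈ 𝕚
 e2 = uq(eY(Rs(\ n -> c2 n)rR(⟶-*ˡ(oq ½)(⟶-*ˡ 𝕚 Lu))))
  (Sz{b = \ n -> C ** ui n}(Hr{C = C}\ n -> !< rl(sl 3(\ i c u -> i *:(c *: u)=: c *:(i *: u))Re(ι n)C(ui n))<~
   Mo CC(!< ma{ι n} {ι(sC n)} {ui n}(Un n)(mg(N1 n))<! rl(Iv(nd n)))<! rl(ii C))(\ n -> close n(sC n *n sC n)(rl(sy(xe(sC n)(sC n))))))
  where
  C : ℚ
  C = N4 ** Bc ++ Mc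
  CC : 0q <= C
  CC = N0(n0 0≤4ℚ 0≤B₄)0≤M₀
  c2 : ∀ n -> oq ½ *(𝕚 * oq(N4 ** L n))≈ I*(L n ++ L n)
  c2 n = !~ co(co(ob N4(L n)))~~ sV 2(\ i l -> # ½ :*(i :*(# N4 :* l)):= i :*(l :+ l))rR 𝕚(oq(L n))~! co(yY(oc(L n)(L n)))
 2πi : ℂ
 2πi = oq n2 *(π * 𝕚)
 E2 : exp 2πi ≈ 1#
 E2 = !~ ep(!~ sV 2(\ i p -> # n2 :*(p :* i):= # N4 :*(# ½ :*(i :* p)))rR 𝕚 π ~! cn(rx(cO oq oZ)))~~
  yY(eQ 4(oq ½ *(𝕚 * π)))~~ ck 4 e2 ~~ sV 1(\ i -> i :*(i :*(i :*(i :* # 1q))):=(i :* i):*(i :* i))rR 𝕚 ~~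
   cd xn xn ~! sV 0((:- # 1q):*(:- # 1q):= # 1q)rR
  where
  oZ : N4 ≡ ι 4
  oZ = sy(dJ 4)
module Nome where
 open Pi public
 private module P = PiQ
 open P using (N4;L;c)
 open import Relation.Nullary.Decidable using (toWitness)
 open CSolve
 3ℚ : ℚ
 3ℚ = 1q ++ n2
 xc : ℚ
 xc =(+ 81)// 25
 private
  1/100 : ℚ
  1/100 =(+ 1)// 100
  1/100>0 : 0q << 1/100
  1/100>0 = pi 1/100
  opaque
   unfolding x2 iv
   Lo : ∃ \ a -> 3ℚ ++ N4 ** 1/100 <= N4 ** L a -q N4 ** c a × N4 ** L a ++ N4 ** c a ++ N4 ** 1/100 <= xc
   Lo = 30 , toWitness{a? =(3ℚ ++ N4 ** 1/100)Q.≤?(N4 ** L 30 -q N4 ** c 30)}tt , toWitness{a? =(N4 ** L 30 ++ N4 ** c 30 ++ N4 ** 1/100)Q.≤? xc}tt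
 private
  bm : ∀ {q e}-> Q.∣ q ∣ <= e -> q <= e
  bm{q}h = go(Tt 0q q)
   where
   go : 0q <= q ⊎ q <= 0q -> q <= _
   go(iL g)= !< rl(sy(np g))<! h
   go(iR g)= !< g <~ Np q <! h
  n3 : ∀ a n -> c n <= 1/100 -> Q.∣ N4 ** L n -q N4 ** L a ∣ <= N4 ** c a ++ N4 ** 1/100
  n3 a n le = !< 4L-close n a <~ Mo 0≤4ℚ(ml(c a)le)<! rl(sl 3(\ f x y -> f *:(x +: y)=: f *: y +: f *: x)Re N4 1/100(c a))
  eG : Evt(\ n -> c n <= 1/100)
  eG = let N , h = sT 1/100 1/100>0 in N , \ n le -> !< Ci n <! h n le
  lG : ∀ t e a c l -> t ++ e <= a -q c -> Q.∣ l -q a ∣ <= c ++ e -> t <= l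
  lG t e a c l h g = Nq(!< N0(p0 h)(p0 lo)<! rl
   (sl 5(\ t e a c l ->(a -: c -:(t +: e))+:(c +: e -:(a -: l))=: l -: t)Re t e a c l))
   where
   lo : a -q l <= c ++ e
   lo = bm{a -q l} {c ++ e}(!< rl(!=(cO Q.∣_∣(sl 2(\ a l -> a -: l =: -:(l -: a))Re a l))=! pa(l -q a))<! g)
  ur : ∀ t e a c l -> a ++ c ++ e <= t -> Q.∣ l -q a ∣ <= c ++ e -> l <= t
  ur t e a c l h g = Nq(!< N0(p0 h)(p0(bm{l -q a} {c ++ e}g))<! rl
   (sl 5(\ t e a c l ->(t -:(a +: c +: e))+:(c +: e -:(l -: a))=: t -: l)Re t e a c l))
 private
  lH : ∀ n -> c n <= 1/100 -> 3ℚ <= N4 ** L n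
  lH n le = lG 3ℚ(N4 ** 1/100)(N4 ** L(pF Lo))(N4 ** c(pF Lo))(N4 ** L n)(pF(pS Lo))(n3(pF Lo)n le)
  ji : ∀ n -> c n <= 1/100 -> N4 ** L n <= xc
  ji n le = ur xc(N4 ** 1/100)(N4 ** L(pF Lo))(N4 ** c(pF Lo))(N4 ** L n)(pS(pS Lo))(n3(pF Lo)n le)
 bu : Evt(\ n -> 3ℚ <= seq xf n × seq xf n <= xc)
 bu = pF eG , \ n le -> lH n(pS eG n le), ji n(pS eG n le)
 private
  opaque
   unfolding fq _+ℝ_ _*ℝ_ -ℝ_
   Nj : ∀ x n -> Nb(ofℝ x)n ≡ seq x n ** seq x n
   Nj x n = sl 1(\ x -> x *: x +: Co 0q *: Co 0q =: x *: x)Re(seq x n)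
   r2 : ∀ z n -> seq(re(2πi * z))n ≡ -q(n2 **(seq xf n ** seq(im z)n))
   r2 z n = sl 3(\ p a b ->(Co n2 *:(p *: Co 0q -: Co 0q *: Co 1q) -: Co 0q *:(p *: Co 1q +: Co 0q *: Co 0q))*: a
    -:(Co n2 *:(p *: Co 1q +: Co 0q *: Co 0q)+: Co 0q *:(p *: Co 0q -: Co 0q *: Co 1q))*: b
    =: -:(Co n2 *:(p *: b)))Re(seq xf n)(seq(re z)n)(seq(im z)n)
 nT : 0q <= xc
 nT = nN xc
 xP : π <| xc
 xP = mv nT \ p lt -> Em(\ n h -> !< rl(Nj xf n)<! sn(!< N0 n1(N0 n1 n1)<! pF h)(!< pS h <!(lZ lt)))bu
 2πi-≼ : 2πi <| n2 ** xc
 2πi-≼ = sB(2πi <|_)(cO(n2 **_)(ii xc))(≼-*(Of n2)(≼-* xP xq))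
 Im : ℂ -> ℚ -> Set
 Im z δ = Evt \ n -> δ <= seq(im z)n
 opaque
  e : ℂ -> ℂ
  e z = exp(2πi * z)
  Ed : ∀ z -> e z ≈ exp(2πi * z)
  Ed z = rR
 en : ∀ {z w}-> z ≈ w -> e z ≈ e w
 en{z} {w}h = !~ Ed z ~~ ep(co h)~! yY(Ed w)
 eP : ∀ z w -> e(z + w)≈ e z * e w
 eP z w = !~(Ed _)~~ ep(dr 2πi z w)~~(eF _ _)~! cd(yY(Ed z))(yY(Ed w))
 o1 : e 0# ≈ 1#
 o1 = !~ Ed 0# ~~ ep(zr 2πi)~! e0
 oG : e 1# ≈ 1#
 oG = !~ Ed 1# ~~ ep(In 2πi)~! E2
 mW : ∀ n z -> e z ^ n ≈ e(oa n * z)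
 mW n z = !~ ck n(Ed z)~~(eQ n _)~~ ep(sV 3(\ n p z -> n :*(p :* z):= p :*(n :* z))rR(oa n)2πi z)~! yY(Ed _)
 1^ : ∀ n -> 1# ^ n ≈ 1#
 1^ z0 = rR
 1^(sC n)= !~(ie _)~! 1^ n
 Eo : ∀ n -> e(oa n)≈ 1#
 Eo n = !~ en(yY(In(oa n)))~~ yY(mW n 1#)~~ ck n oG ~! 1^ n
 eR : ∀ z -> e z * e(- z)≈ 1#
 eR z = !~ yY(eP z(- z))~~ en(ir z)~! o1
 bM : ∀ z -> e(z + 1#)≈ e z
 bM z = !~ eP z 1# ~~ co oG ~! In(e z)
 6ℚ : ℚ
 6ℚ = n2 ** 3ℚ
 0≤6 : 0q <= 6ℚ
 0≤6 = nN 6ℚ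
 1+6δ>0 : ∀ {δ}-> 0q <= δ -> 0q << 1q ++ 6ℚ ** δ
 1+6δ>0 h = nG nl(n0 0≤6 h)
 eU : ∀ {z δ}(nK : 0q <= δ)-> Im z δ -> e z <| iv(1q ++ 6ℚ ** δ)(1+6δ>0 nK)
 eU{z} {δ}nK h = rp(yY(Ed z))(eW{2πi * z} {6ℚ ** δ}(n0 0≤6 nK)(1+6δ>0 nK)
  (em(\ n a b -> !< rl(r2 z n)<! nt(!< rl(ac n2 3ℚ δ)<!
   Mo{3ℚ ** δ} {seq xf n ** seq(im z)n} {n2}(N0 n1 n1)(my(N0 n1(N0 n1 n1))nK(pF a)b)))bu h))
 i3 : ∀ (h : 0q << 1q ++ 6ℚ ** 0q)-> iv(1q ++ 6ℚ ** 0q)h ≡ 1q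
 i3 h = != sy(iy _)=~ cO(_** iv(1q ++ 6ℚ ** 0q)h)(sy(cO(1q ++_)(zq 6ℚ)))=! Iv h
 fg : ∀ {z}-> Im z 0q -> e z <| 1q
 fg{z}h = sB(e z <|_)(i3(1+6δ>0 ra))(eU ra h)
 private
  tw : oz(+ 2)≈ oq n2
  tw = rR
  nW : ∀ x z -> ofℝ x ≈ π -> oz(+ 2)* ofℝ x * 𝕚 * z ≈ 2πi * z
  nW x z h = tn{oz(+ 2)* ofℝ x * 𝕚 * z} {oz(+ 2)* π * 𝕚 * z} {2πi * z}(cn{z} {oz(+ 2)* ofℝ x * 𝕚} {oz(+ 2)* π * 𝕚}(cn{𝕚} {oz(+ 2)* ofℝ x} {oz(+ 2)* π}(co{oz(+ 2)} {ofℝ x} {π}h)))(sV 4(\ a p i z -> a :* p :* i :* z := a :*(p :* i):* z)rR(oq n2)π 𝕚 z)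
 nV : ∀ z{q}-> IsNome z q -> q ≈ e(pF z)
 nV(z , _)(x , hx , hq)= !~ Ss(HS hq)(es(oz(+ 2)* ofℝ x * 𝕚 * z))~!(tn{exp(oz(+ 2)* ofℝ x * 𝕚 * z)} {exp(2πi * z)} {e z}(ep{oz(+ 2)* ofℝ x * 𝕚 * z} {2πi * z}(nW x z(IP hx)))(yY{e z} {exp(2πi * z)}(Ed z)))
 fh : ∀ z -> IsNome z(e(pF z))
 fh(z , _)= xf , kH , SH(Su(\ n -> rR)(tn{exp(oz(+ 2)* ofℝ xf * 𝕚 * z)} {exp(2πi * z)} {e z}(ep{oz(+ 2)* ofℝ xf * 𝕚 * z} {2πi * z}(nW xf z(rR{π})))(yY{e z} {exp(2πi * z)}(Ed z)))(es(oz(+ 2)* ofℝ xf * 𝕚 * z)))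
 aG : ∀ {u q}(lt : 0q << 1q -q q)-> q << 1q -> u <| q -> ∃ \ v -> v *(1# - u)≈ 1# × v <| iv(1q -q q)lt
 aG{u} {q}lt Q1 h = gm{pw}g , eq , sB(gm{pw}g <|_)(iy _)(⟶-≼(n0 n1(lZ(i0 lt)))(gu{pw}g)(0 , \ n _ -> ge n lt n1(nn h)(Go.dS g)))
  where
  pw : ℕ -> ℂ
  pw n = u ^ n
  g : Go pw
  g = gy 1q q n1(nn h)Q1 \ n -> sB(u ^ n <|_)(sy(iy(q ^^ n)))(≼-^ n h)
  s = gm{pw}g
  eq : s *(1# - u)≈ 1#
  eq = !~ sV 2(\ s u -> s :*(# 1q :- u):= s :- u :* s)rR s u ~~ Cg(Ss(gu{pw}g)(Sg{pw}(Sd u(gu{pw}g))))~!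
   sV 2(\ s u ->(# 1q :+ u :* s):- u :* s := # 1q)rR s u
 Ig : ∀ k i -> ia(k +n i)<= ia k ** iv(ι(sC k))(nd k)^^ i
 Ig k z0 = rl(!= cO ia(Iy k)=! sy(ii(ia k)))
 Ig k(sC i)= !< rl(cO ia(su k i))<~ St <~ ma{ia(k +n i)} {ia k ** r ^^ i} {r}(lZ(i0(nd k)))(Ig k i)<!
  rl(sl 3(\ a p r -> a *: p *: r =: a *:(r *: p))Re(ia k)(r ^^ i)r)
  where
  r = iv(ι(sC k))(nd k)
  m = k +n i
  St : ia(sC m)<= ia m ** r
  St = Ca{ia(sC m)} {ia m ** r} {ι(sC k)}(nd k)(!< ma{ι(sC k)} {ι(sC m)} {ia(sC m)}(lZ(iw(sC m)))(mg(ss(me k i)))<!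
   rl(!= Is m =! sy(!= sl 3(\ a v r -> a *:(v *: r)=: v *:(a *: r))Re(ι(sC k))(ia m)r =~ cO(ia m **_)(Iv(nd k))=! ii(ia m))))
 Tu : ∀ k t{b q}-> t <| b -> iv(ι(sC k))(nd k)** b <= q ->(lt : 0q << 1q -q q)-> tR k t <| ia k ** iv(1q -q q)lt
 Tu k t{b} {q}hb le lt = ⟶-≼(n0(lZ(iw k))(lZ(i0 lt)))(tS k t)(0 , \ n _ ->
  ge n lt(lZ(iw k))qe \ i -> mo(!< ma{ia(k +n i)} {ia k ** r ^^ i} {b ^^ i}(nf i(nn hb))(Ig k i)<~
   rl(!=(ac(ia k)_ _)=! cO(ia k **_)(sy(dt r b i)))<! Mo{(r ** b)^^ i} {q ^^ i} {ia k}(lZ(iw k))(mu i(n0(lZ(i0(nd k)))(nn hb))le))(≼-*(iD(k +n i))(≼-^ i hb)))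
  where
  r = iv(ι(sC k))(nd k)
  qe : 0q <= q
  qe = !< n0(lZ(i0(nd k)))(nn hb)<! le
module Shc where
 open Nome public
 open import Relation.Nullary.Decidable using (toWitness)
 open CSolve
 private
  q : ℕ -> ℕ -> ℚ
  q a b =(+ a)// sC b
 H : ℕ -> ℂ -> ℂ
 H k t = tR k t + tR k(- t)
 HC : ∀ k t -> H k t ≈ oq(n2 ** ia k)+(t * t)* H(sC(sC k))t
 HC k t = !~ ca(St t)(St(- t))~~
  sV 5(\ a b t x y ->(a :+ t :*(b :+ t :* x)):+(a :+(:- t):*(b :+(:- t):* y)):= # n2 :* a :+(t :* t):*(x :+ y))rR(oq(ia k))(oq(ia(sC k)))t(tR(sC(sC k))t)(tR(sC(sC k))(- t))~!
   Cg{(t * t)* H(sC(sC k))t}(yY(ob n2(ia k)))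
  where
  St : ∀ t -> tR k t ≈ oq(ia k)+ t *(oq(ia(sC k))+ t * tR(sC(sC k))t)
  St t = !~ te k t ~! Cn{oq(ia k)}(co{t}(te(sC k)t))
 private
  Hs : ∀ k t r -> n2 ** ia k ≡ r -> H k t ≈ oq r +(t * t)* H(sC(sC k))t
  Hs k t r eq = !~ HC k t ~! Cg{(t * t)* H(sC(sC k))t}(rx(cO oq eq))
 aM : ℂ -> ℂ
 aM t = oq ½ * H 1 t
 bN : ∀ t -> exp t - exp(- t)≈(t + t)* aM t
 bN t = !~ sb(et t)(et(- t))~! sV 3(\ t x y ->(# 1q :+ t :* x):-(# 1q :+(:- t):* y):=(t :+ t):*(# ½ :*(x :+ y)))rR t(tR 1 t)(tR 1(- t))
 eO : ∀ t -> exp t + exp(- t)≈ oq n2 +(t * t)* H 2 t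
 eO t = !~ ca(yY(TR t))(yY(TR(- t)))~! Hs 0 t n2 Re
 private
  7/4 : ℚ
  7/4 = q 7 3
  2/3 : ℚ
  2/3 = q 2 2
  opaque
   unfolding x2 iv
   aP : let b = 7/4; lt = pi(1q -q q 7 31)in
    iv(ι 8)(nd 7)** b <= q 7 31 × b ** b **(q 1 5 ++ b ** b **(q 1 119 ++ b ** b **(ia 7 ** iv(1q -q q 7 31)lt)))<= 2/3
   aP = toWitness{a? =(iv(ι 8)(nd 7)** 7/4)Q.≤? q 7 31}tt
    , toWitness{a? =(7/4 ** 7/4 **(q 1 5 ++ 7/4 ** 7/4 **(q 1 119 ++ 7/4 ** 7/4 **(ia 7 ** iv(1q -q q 7 31)(pi(1q -q q 7 31))))))Q.≤? 2/3}tt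
 private
  kN : ∀ {T x y z w a b c}-> x ≈ a + T * y -> y ≈ b + T * z -> z ≈ c + T * w -> x ≈ a + T *(b + T *(c + T * w))
  kN{T} {x} {y} {z} {w} {a} {b} {c}p q r = tn{x} {a + T * y} {a + T *(b + T *(c + T * w))}p(Cn{a} {T * y} {T *(b + T *(c + T * w))}(co{T} {y} {b + T *(c + T * w)}(tn{y} {b + T * z} {b + T *(c + T * w)}q(Cn{b} {T * z} {T *(c + T * w)}(co{T} {z} {c + T * w}r)))))
  Hf : ∀ {x y r}-> x ≈ y -> oq ½ * y - 1# ≈ r -> oq ½ * x - 1# ≈ r
  Hf{x} {y} {r}p q = tn{oq ½ * x - 1#} {oq ½ * y - 1#} {r}(Cg{ - 1#} {oq ½ * x} {oq ½ * y}(co{oq ½} {x} {y}p))q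
 jj : ∀ t -> aM t - 1# ≈(t * t)*(oq(q 1 5)+(t * t)*(oq(q 1 119)+(t * t)*(oq ½ * H 7 t)))
 jj t = Hf{H 1 t} {oq n2 +(t * t)*(oq(q 1 2)+(t * t)*(oq(q 1 59)+(t * t)* H 7 t))} {(t * t)*(oq(q 1 5)+(t * t)*(oq(q 1 119)+(t * t)*(oq ½ * H 7 t)))}
  (kN{t * t} {H 1 t} {H 3 t} {H 5 t} {H 7 t} {oq n2} {oq(q 1 2)} {oq(q 1 59)}(Hs 1 t n2 Re)(Hs 3 t(q 1 2)Re)(Hs 5 t(q 1 59)Re))
  (sV 2(\ T h -> # ½ :*(# n2 :+ T :*(#(q 1 2):+ T :*(#(q 1 59):+ T :* h))):- # 1q := T :*(#(q 1 5):+ T :*(#(q 1 119):+ T :*(# ½ :* h))))rR(t * t)(H 7 t))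
 private
  aQ : ∀ {t}-> t <| 7/4 -> aM t - 1# <| 2/3
  aQ{t}ht = mo(pS aP)(rp{(t * t)*(oq(q 1 5)+(t * t)*(oq(q 1 119)+(t * t)*(oq ½ * H 7 t)))} {aM t - 1#}(yY{aM t - 1#} {(t * t)*(oq(q 1 5)+(t * t)*(oq(q 1 119)+(t * t)*(oq ½ * H 7 t)))}(jj t))(≼-*(≼-* ht ht)(≼-+(Of(q 1 5))(≼-*(≼-* ht ht)(≼-+(Of(q 1 119))(≼-*(≼-* ht ht)h7))))))
   where
   r = ia 7 ** iv(1q -q q 7 31)(pi(1q -q q 7 31))
   h7 : oq ½ * H 7 t <| r
   h7 = sB(oq ½ * H 7 t <|_)(sl 1(\ r -> Co ½ *:(r +: r)=: r)Re r)
    (≼-*(Of ½)(≼-+(Tu 7 t{7/4} {q 7 31}ht(pF aP)(pi(1q -q q 7 31)))(Tu 7(- t) {7/4} {q 7 31}(Ne ht)(pF aP)(pi(1q -q q 7 31)))))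
 Sv : ∀ {t}-> t <| 7/4 -> ∃ \ v -> v * aM t ≈ 1# × v <| 3ℚ
 Sv{t}ht = let v , eq , b = aG{1# - aM t} {2/3}(pi(1q -q 2/3))(bf(1q -q 2/3)(pi(1q -q 2/3))Re)(sG(aQ ht))
  in v , !~ co(sV 1(\ s -> s := # 1q :-(# 1q :- s))rR(aM t))~! eq , mo(rl fj)b
  where
  opaque
   unfolding iv
   fj : iv(1q -q 2/3)(pi(1q -q 2/3))≡ 3ℚ
   fj = Re
 ½-≼ : ∀ {t}-> t <| q 7 1 -> oq ½ * t <| 7/4
 ½-≼ h = ≼-*(Of ½)h
 Hq : ∀ t ->(t * t)*(H 2 t - aM(oq ½ * t)* aM(oq ½ * t))≈ 0#
 Hq t = !~ sV 4(\ t h s c ->(t :* t):*(h :- s :* s):=(# n2 :+(t :* t):* h):- # n2 :-(t :* s):*(t :* s))rR t(H 2 t)S 1# ~~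
  sb(Cg(yY(eO t)))(cd oE oE)~~ sb(Cg(ca sq jk))rR ~~
   sV 2(\ x y ->(x :* x :+ y :* y):- # n2 :-(x :- y):*(x :- y):= # n2 :*(x :* y :- # 1q))rR x y ~~ co(Cg(Eg(oq ½ * t)))~! sV 0(# n2 :*(# 1q :- # 1q):= # 0q)rR
  where
  S = aM(oq ½ * t)
  x = exp(oq ½ * t)
  y = exp(-(oq ½ * t))
  oE : t * S ≈ x - y
  oE = !~ cn(sV 1(\ t -> t := # ½ :* t :+ # ½ :* t)rR t)~! yY(bN(oq ½ * t))
  sq : exp t ≈ x * x
  sq = !~ ep(sV 1(\ t -> t := # ½ :* t :+ # ½ :* t)rR t)~!(eF _ _)
  jk : exp(- t)≈ y * y
  jk = !~ ep(sV 1(\ t -> :- t :=(:-(# ½ :* t)):+(:-(# ½ :* t)))rR t)~!(eF _ _)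
 module RB {t ω : ℂ} (ht : t <| q 7 1) (tY : t * ω ≈ 1#) where
  G V T : ℂ
  G = H 2 t
  V = pF(Sv(½-≼ ht))* pF(Sv(½-≼ ht))
  T = t * t
  private
   v = pF(Sv(½-≼ ht))
   vs : v * aM(oq ½ * t)≈ 1#
   vs = pF(pS(Sv(½-≼ ht)))
  Vq : V <| 3ℚ ** 3ℚ
  Vq = ≼-*(pS(pS(Sv(½-≼ ht))))(pS(pS(Sv(½-≼ ht))))
  Tv : T *(ω * ω)≈ 1#
  Tv = !~ sV 2(\ t w ->(t :* t):*(w :* w):=(t :* w):*(t :* w))rR t ω ~~ cd tY tY ~! ie 1#
  Tj : ∀ {z w}-> T * z ≈ T * w -> z ≈ w
  Tj{z} {w}h = !~ ej z ~~ co h ~! yY(ej w)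
   where
   ej : ∀ z -> z ≈(ω * ω)*(T * z)
   ej z = !~ yY(ie z)~~ cn(yY Tv)~! sV 3(\ T o z -> T :* o :* z := o :*(T :* z))rR T(ω * ω)z
  VG : V * G ≈ 1#
  VG = !~ co GH ~~ sV 2(\ v s -> v :* v :*(s :* s):=(v :* s):*(v :* s))rR v(aM(oq ½ * t))~~ cd vs vs ~! ie 1#
   where
   GH : G ≈ aM(oq ½ * t)* aM(oq ½ * t)
   GH = Tj(!~ sV 3(\ T g s -> T :* g := T :*(g :- s):+ T :* s)rR T G(aM(oq ½ * t)* aM(oq ½ * t))~~ Cg(Hq t)~!(Ii _))
  cl aa : ℂ
  aa = H 4 t
  cl = H 6 t
  b₁ = H 8 t
  k₁ = H 10 t
  GG : G ≈ 1# + T * aa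
  GG = Hs 2 t 1q Re
  d1 : aa ≈ oq(q 1 11)+ T * cl
  d1 = Hs 4 t(q 1 11)Re
  j5 : cl ≈ oq(q 1 359)+ T * b₁
  j5 = Hs 6 t(q 1 359)Re
  mX : b₁ ≈ oq(q 1 20159)+ T * k₁
  mX = Hs 8 t(q 1 20159)Re
module Shc2 where
 open Shc public
 open import Relation.Nullary.Decidable using (toWitness)
 open CSolve
 private
  q : ℕ -> ℕ -> ℚ
  q a b =(+ a)// sC b
 module Aw (T G aa cl b₁ k₁ : ℂ) (GG : G ≈ 1# + T * aa) (d1 : aa ≈ oq (q 1 11) + T * cl)
  (j5 : cl ≈ oq(q 1 359)+ T * b₁)(mX : b₁ ≈ oq(q 1 20159)+ T * k₁)where
  Xa : ℂ
  Xa = cl - oq(q 12 0)* b₁ - oq(q 6 0)*(cl *(oq(q 1 11)+ aa)) - oq(q 1 119)*(aa *(1# + G))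
  private
   SG : T * G + oq(q 6 0) - oq(q 6 0)*(G * G)≈ T *(1# - oq(q 12 0)* aa)+ T * T *(aa - oq(q 6 0)*(aa * aa))
   SG = tn{L G} {L(1# + T * aa)} {T *(1# - oq(q 12 0)* aa)+ T * T *(aa - oq(q 6 0)*(aa * aa))}(cg{G} {1# + T * aa}GG)
    (sV 2(\ T a -> T :*(# 1q :+ T :* a):+ #(q 6 0):- #(q 6 0):*((# 1q :+ T :* a):*(# 1q :+ T :* a)):= T :*(# 1q :- #(q 12 0):* a):+ T :* T :*(a :- #(q 6 0):*(a :* a)))rR T aa)
    where
    L : ℂ -> ℂ
    L y = T * y + oq(q 6 0) - oq(q 6 0)*(y * y)
    cg : ∀ {x y}-> x ≈ y -> L x ≈ L y
    cg{x} {y}h = sb{T * x + oq(q 6 0)} {oq(q 6 0)*(x * x)} {T * y + oq(q 6 0)} {oq(q 6 0)*(y * y)}(Cg{oq(q 6 0)} {T * x} {T * y}(co{T} {x} {y}h))(co{oq(q 6 0)} {x * x} {y * y}(cd{x} {y} {x} {y}h h))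
   o2 : aa * aa ≈ oq(q 1 143)+ T *(cl *(oq(q 1 11)+ aa))
   o2 = !~ sV 1(\ a -> a :* a := #(q 1 143):+(a :- #(q 1 11)):*(#(q 1 11):+ a))rR aa ~! Cn(!~ cn Tc ~!(ao T cl _))
    where
    Tc : aa - oq(q 1 11)≈ T * cl
    Tc = !~ Cg d1 ~! sV 1(\ x -> #(q 1 11):+ x :- #(q 1 11):= x)rR(T * cl)
   o3 : aa * aa * aa ≈ oq(q 1 1727)+ T *(cl *(aa * aa + oq(q 1 11)* aa + oq(q 1 143)))
   o3 = !~ sV 1(\ a -> a :* a :* a := #(q 1 1727):+(a :- #(q 1 11)):*(a :* a :+ #(q 1 11):* a :+ #(q 1 143)))rR aa ~! Cn(!~ cn Tc ~!(ao T cl _))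
    where
    Tc : aa - oq(q 1 11)≈ T * cl
    Tc = !~ Cg d1 ~! sV 1(\ x -> #(q 1 11):+ x :- #(q 1 11):= x)rR(T * cl)
   GI : G * G ≈ 1# + T *(aa *(1# + G))
   GI = !~ sV 1(\ G -> G :* G := # 1q :+(G :- # 1q):*(# 1q :+ G))rR G ~! Cn{1#}(!~ cn(!~ Cg{ - 1#}GG ~! sV 1(\ x -> # 1q :+ x :- # 1q := x)rR(T * aa))~!(ao T aa _))
   GJ : G * G * G ≈ 1# + T *(aa *(G * G + G + 1#))
   GJ = !~ sV 1(\ G -> G :* G :* G := # 1q :+(G :- # 1q):*(G :* G :+ G :+ # 1q))rR G ~! Cn{1#}(!~ cn(!~ Cg{ - 1#}GG ~! sV 1(\ x -> # 1q :+ x :- # 1q := x)rR(T * aa))~!(ao T aa _))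
  jl : T * G + oq(q 6 0)≈ oq(q 6 0)*(G * G)+ T * T *(oq(q 1 119)*(G * G)+ T * Xa)
  jl = tn{X} {Y +(X - Y)} {Y + T * T * Z}(sV 2(\ x y -> x := y :+(x :- y))rR X Y)(Cn{Y} {X - Y} {T * T * Z}(tn{X - Y} {T * u + T * T * w} {T * T * Z}SG
   (tn{T * u + T * T * w} {T *(T * v)+ T * T * w} {T * T * Z}(Cg{T * T * w} {T * u} {T *(T * v)}(co{T} {u} {T * v}p3))
    (tn{T *(T * v)+ T * T * w} {T * T *(v + w)} {T * T * Z}(sV 3(\ T x y -> T :*(T :* x):+ T :* T :* y := T :* T :*(x :+ y))rR T v w)(co{T * T} {v + w} {Z}p5)))))
   where
   X Y Z u v w cF a′ m n Rm : ℂ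
   X = T * G + oq(q 6 0)
   Y = oq(q 6 0)*(G * G)
   Z = oq(q 1 119)*(G * G)+ T * Xa
   u = 1# - oq(q 12 0)* aa
   v = -(oq(q 12 0)* cl)
   w = aa - oq(q 6 0)*(aa * aa)
   cF = oq(q 1 359)+ T * b₁
   a′ = oq(q 1 11)+ T * cl
   m = cl *(oq(q 1 11)+ aa)
   n = aa *(1# + G)
   Rm = T * Xa
   p3 : u ≈ T * v
   p3 = tn{u} {1# - oq(q 12 0)* a′} {T * v}(Cn{1#} { -(oq(q 12 0)* aa)} { -(oq(q 12 0)* a′)}(cc{oq(q 12 0)* aa} {oq(q 12 0)* a′}(co{oq(q 12 0)} {aa} {a′}d1)))(sV 2(\ T c -> # 1q :- #(q 12 0):*(#(q 1 11):+ T :* c):= T :*(:-(#(q 12 0):* c)))rR T cl)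
   p5 : v + w ≈ Z
   p5 = tn{v + w} { -(oq(q 12 0)* cF)+(a′ - oq(q 6 0)*(oq(q 1 143)+ T * m))} {Z}
    (ca{v} { -(oq(q 12 0)* cF)} {w} {a′ - oq(q 6 0)*(oq(q 1 143)+ T * m)}(cc{oq(q 12 0)* cl} {oq(q 12 0)* cF}(co{oq(q 12 0)} {cl} {cF}j5))(sb{aa} {oq(q 6 0)*(aa * aa)} {a′} {oq(q 6 0)*(oq(q 1 143)+ T * m)}d1(co{oq(q 6 0)} {aa * aa} {oq(q 1 143)+ T * m}o2)))
    (tn{ -(oq(q 12 0)* cF)+(a′ - oq(q 6 0)*(oq(q 1 143)+ T * m))} {oq(q 1 119)*(1# + T * n)+ Rm} {Z}(sV 5(\ T b c m n ->(:-(#(q 12 0):*(#(q 1 359):+ T :* b))):+((#(q 1 11):+ T :* c):- #(q 6 0):*(#(q 1 143):+ T :* m))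
     := #(q 1 119):*(# 1q :+ T :* n):+ T :*(c :- #(q 12 0):* b :- #(q 6 0):* m :- #(q 1 119):* n))rR T b₁ cl m n)
     (Cg{Rm} {oq(q 1 119)*(1# + T * n)} {oq(q 1 119)*(G * G)}(co{oq(q 1 119)} {1# + T * n} {G * G}(yY{G * G} {1# + T * n}GI))))
  private
   30Q 360Q 120Q : ℂ
   30Q = oq(q 30 0)
   360Q = oq(q 360 0)
   120Q = oq(q 120 0)
   Ef EF Ej : ℂ
   Ef = 30Q - 360Q * aa
   EF = 1# + 30Q * aa - 360Q *(aa * aa)
   Ej = oq(q 2 0)* aa - 120Q *(aa * aa * aa)+ T *(aa * aa)
   aR : T * T *(G * G)+ 30Q *(T * G)+ 120Q - 120Q *(G * G * G)≈ T * Ef + T * T * EF + T * T * T * Ej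
   aR = tn{L G} {L(1# + T * aa)} {T * Ef + T * T * EF + T * T * T * Ej}(cg{G} {1# + T * aa}GG)
    (sV 2(\ T a -> let G = # 1q :+ T :* a in
     T :* T :*(G :* G):+ #(q 30 0):*(T :* G):+ #(q 120 0):- #(q 120 0):*(G :* G :* G)
     := T :*(#(q 30 0):- #(q 360 0):* a):+ T :* T :*(# 1q :+ #(q 30 0):* a :- #(q 360 0):*(a :* a)):+ T :* T :* T :*(#(q 2 0):* a :- #(q 120 0):*(a :* a :* a):+ T :*(a :* a)))rR T aa)
    where
    L : ℂ -> ℂ
    L y = T * T *(y * y)+ 30Q *(T * y)+ 120Q - 120Q *(y * y * y)
    cg : ∀ {x y}-> x ≈ y -> L x ≈ L y
    cg{x} {y}h = sb{T * T *(x * x)+ 30Q *(T * x)+ 120Q} {120Q *(x * x * x)} {T * T *(y * y)+ 30Q *(T * y)+ 120Q} {120Q *(y * y * y)}(Cg{120Q} {T * T *(x * x)+ 30Q *(T * x)} {T * T *(y * y)+ 30Q *(T * y)}(ca{T * T *(x * x)} {T * T *(y * y)} {30Q *(T * x)} {30Q *(T * y)}(co{T * T} {x * x} {y * y}(cd{x} {y} {x} {y}h h))(co{30Q} {T * x} {T * y}(co{T} {x} {y}h))))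
     (co{120Q} {x * x * x} {y * y * y}(cd{x * x} {y * y} {x} {y}(cd{x} {y} {x} {y}h h)h))
   d8 : Ef ≈ T *(-(360Q * cl))
   d8 = !~ Cn(cc(co d1))~! sV 2(\ T c -> #(q 30 0):- #(q 360 0):*(#(q 1 11):+ T :* c):= T :*(:-(#(q 360 0):* c)))rR T cl
   W : ℂ
   W = 30Q * cl + 360Q *(T *(cl * cl))
   ee : EF ≈ 1# - T * W
   ee = !~ sb(Cn(co d1))(co(cd d1 d1))~!
    sV 2(\ T c -> # 1q :+ #(q 30 0):*(#(q 1 11):+ T :* c):- #(q 360 0):*((#(q 1 11):+ T :* c):*(#(q 1 11):+ T :* c)):= # 1q :- T :*(#(q 30 0):* c :+ #(q 360 0):*(T :*(c :* c))))rR T cl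
   ec : -(360Q * cl)+(1# - T * W)≈ T *(-(360Q * b₁) - W)
   ec = !~ Cg(cc(co j5))~! sV 3(\ T b y ->(:-(#(q 360 0):*(#(q 1 359):+ T :* b))):+(# 1q :- T :* y):= T :*(:-(#(q 360 0):* b):- y))rR T b₁ W
   m n : ℂ
   m = cl *(aa * aa + oq(q 1 11)* aa + oq(q 1 143))
   n = aa *(G * G + G + 1#)
   kO : -(360Q * b₁) - 30Q * cl ≈ oq(-q q 17 167)+ T *(-(360Q * k₁) - 30Q * b₁)
   kO = !~ sb(cc(co mX))(co j5)~! sV 3(\ T k b ->(:-(#(q 360 0):*(#(q 1 20159):+ T :* k))):- #(q 30 0):*(#(q 1 359):+ T :* b)
    := #(-q q 17 167):+ T :*((:-(#(q 360 0):* k)):- #(q 30 0):* b))rR T k₁ b₁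
   kQ : oq(q 2 0)* aa - 120Q *(aa * aa * aa)≈ oq(q 7 71)+ T *(oq(q 2 0)* cl - 120Q * m)
   kQ = !~ sb(co d1)(co o3)~! sV 3(\ T c m -> #(q 2 0):*(#(q 1 11):+ T :* c):- #(q 120 0):*(#(q 1 1727):+ T :* m)
    := #(q 7 71):+ T :*(#(q 2 0):* c :- #(q 120 0):* m))rR T cl m
   xH xS : ℂ
   xH = -(360Q * k₁) - 30Q * b₁
   xS = oq(q 2 0)* cl - 120Q * m
  Ya : ℂ
  Ya = xH + xS - 360Q *(cl * cl)+ aa * aa + oq(q 1 251)* n
  private
   Fn :(-(360Q * b₁) - W)+ Ej ≈ oq(-q q 1 251)*(G * G * G)+ T * Ya
   Fn = !~ sV 6(\ b c d e g h ->(:- b :-(c :+ d)):+(e :- g :+ h):=(:- b :- c):+(e :- g):+(h :- d))rR(360Q * b₁)(30Q * cl)(360Q *(T *(cl * cl)))(oq(q 2 0)* aa)(120Q *(aa * aa * aa))(T *(aa * aa))~~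
    Cg(ca kO kQ)~~ sV 6(\ T x y c a n ->(#(-q q 17 167):+ T :* x):+(#(q 7 71):+ T :* y):+(T :* a :- #(q 360 0):*(T :* c))
     := #(-q q 1 251):*(# 1q :+ T :* n):+ T :*(x :+ y :- #(q 360 0):* c :+ a :+ #(q 1 251):* n))rR T xH xS(cl * cl)(aa * aa)n ~!
     Cg(co(yY GJ))
  jm : T * T *(G * G)+ 30Q *(T * G)+ 120Q ≈ 120Q *(G * G * G)+ T * T * T *(oq(-q q 1 251)*(G * G * G)+ T * Ya)
  jm = !~ sV 2(\ x y -> x := y :+(x :- y))rR(T * T *(G * G)+ 30Q *(T * G)+ 120Q)(120Q *(G * G * G))~! Cn(!~ aR ~~
   Cg(ca(co d8)(co ee))~~
   sV 4(\ T x y z -> T :*(T :* x):+ T :* T :* y :+ T :* T :* T :* z := T :* T :*(x :+ y):+ T :* T :* T :* z)rR T(-(360Q * cl))(1# - T * W)Ej ~~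
   Cg(co ec)~~
   sV 3(\ T x y -> T :* T :*(T :* x):+ T :* T :* T :* y := T :* T :* T :*(x :+ y))rR T(-(360Q * b₁) - W)Ej ~! co Fn)
 s4 : ∀ P Q R S F N T X(k l : ℚ)-> Q * R ≈ 1# -> S * P ≈ 1# -> S * R * F ≈ N -> N ≈ oq k * R + S *(oq l * R + T * X)->
  F - oq k * P - oq l ≈ T *(Q * X)
 s4 P Q R S F N T X k l QR SP h g = !~ Cg(Cg Fa)~!
  sV 3(\ kP l x ->(kP :* # 1q :+ # 1q :*(l :* # 1q :+ x)):- kP :- l := x)rR(oq k * P)(oq l)(T *(Q * X))
  where
  Fa : F ≈ oq k * P * 1# + 1# *(oq l * 1# + T *(Q * X))
  Fa = !~ yY(ie F)~~ cn(yY(!~ cd QR SP ~! ie 1#))~~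
   sV 5(\ P Q R S F -> Q :* R :*(S :* P):* F := P :* Q :*(S :* R :* F))rR P Q R S F ~~
   co(!~ h ~! g)~~
   co(sV 4(\ a b c d -> a :+ b :*(c :+ d):= a :+(b :* c :+ b :* d))rR(oq k * R)S(oq l * R)(T * X))~~
   sV 7(\ P Q R k S l x -> P :* Q :*(k :* R :+(S :*(l :* R):+ S :* x)):= k :* P :*(Q :* R):+(S :* P):*(l :*(Q :* R):+ Q :* x))rR P Q R(oq k)S(oq l)(T * X)~!
    ca(co QR)(cd SP(ca(co QR)(sV 3(\ Q T X -> Q :*(T :* X):= T :*(Q :* X))rR Q T X)))
module Fk where
 open Shc2 public
 open CSolve
 private
  q : ℕ -> ℕ -> ℚ
  q a b =(+ a)// sC b
 ∇ :(ℕ -> ℚ)-> ℕ -> ℚ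
 ∇ r z0 = r z0
 ∇ r(sC n)= r(sC n) -q r n
 ∇^ : ℕ ->(ℕ -> ℚ)-> ℕ -> ℚ
 ∇^ z0 r = r
 ∇^(sC k)r = ∇(∇^ k r)
 Δ :(ℚ -> ℚ)-> ℚ -> ℚ
 Δ g y = g(1q ++ y) -q g y
 td :(ℕ -> ℚ)-> ℂ -> ℕ -> ℂ
 td r x n = oq(r n)* x ^ n
 SF : ∀ {r x S}-> Sa(td r x)S -> Sa(td(∇ r)x)((1# - x)* S)
 SF{r} {x} {S}h = Su eq(sV 2(\ x S -> S :+ #(-q 1q):*(# 0q :+ x :* S):=(# 1q :- x):* S)rR x S)
  (Sk h(Sd(oq(-q 1q))(Sg{sh}(Sd x h))))
  where
  sh : ℕ -> ℂ
  sh z0 = 0#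
  sh(sC n)= x * td r x n
  eq : ∀ n -> td r x n + oq(-q 1q)* sh n ≈ td(∇ r)x n
  eq z0 = sV 1(\ t -> t :+ #(-q 1q):* # 0q := t)rR(td r x 0)
  eq(sC n)= !~ sV 4(\ a b x p -> a :*(x :* p):+ #(-q 1q):*(x :*(b :* p)):=(a :+(:- b)):*(x :* p))rR(oq(r(sC n)))(oq(r n))x(x ^ n)~!
   cn(yY(!~ oc(r(sC n))(-q r n)~! Cn(oe(r n))))
 Sj : ∀ k{r x S}-> Sa(td r x)S -> Sa(td(∇^ k r)x)((1# - x)^ k * S)
 Sj z0{r} {x}h = Su{td r x}(\ _ -> rR)(yY(ie _))h
 Sj(sC k) {r} {x} {S}h = Su{td(∇^(sC k)r)x}(\ _ -> rR)(yY(ao _ _ S))(SF{∇^ k r} {x}(Sj k{r} {x}h))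
 Sf : ∀ k{a : ℕ -> ℂ}->(∀ n -> a(k +n n)≈ 0#)-> Sa a(∑ k a)
 Sf k{a}h ε na = k , \ n le -> mo(lZ na)(nj(sB(\ m -> ∑ m a ≈ ∑ k a)(mm le)
  (!~ sp k(n -n k)a ~~ Cn(nB(n -n k)\ i _ -> h i)~!(Ie _))))
 private
  pw : ℕ -> ℕ -> ℚ
  pw k n = ι n ^^ k
  i4 : ∀ (r : ℕ -> ℚ)(g : ℚ -> ℚ)j ->(∀ n -> r(j +n n)≡ g(ι n))-> ∀ n -> ∇ r(sC j +n n)≡ Δ g(ι n)
  i4 r g j h n = cong₂ _-q_(!= cO r(sy(su j n))=~ h(sC n)=! cO g(sa n))(h n)
  xr : ℕ ->(ℚ -> ℚ)-> ℚ -> ℚ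
  xr z0 g = g
  xr(sC k)g = Δ(xr k g)
  pl : ∀ k j -> ∀ n -> ∇^ k(pw j)(k +n n)≡ xr k(\ y -> y ^^ j)(ι n)
  pl z0 j n = Re
  pl(sC k)j n = i4(∇^ k(pw j))(xr k(\ y -> y ^^ j))k(pl k j)n
  cr : ∀ {g g′ : ℚ -> ℚ}->(∀ y -> g y ≡ g′ y)-> ∀ y -> Δ g y ≡ Δ g′ y
  cr h y = cong₂ _-q_(h(1q ++ y))(h y)
  cQ : ∀ y -> xr 4(\ y -> y ^^ 3)y ≡ 0q
  cQ y = != cr(cr(cr{g′ = \ y -> 3ℚ **(y ** y)++ 3ℚ ** y ++ 1q}
   (sl 1(\ y -> let s = Co 1q +: y in s *:(s *:(s *: Co 1q)) -: y *:(y *:(y *: Co 1q))=: Co 3ℚ *:(y *: y)+: Co 3ℚ *: y +: Co 1q)Re)))y =~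
   cr(cr{g′ = \ y -> q 6 0 ** y ++ q 6 0}
    (sl 1(\ y -> let s = Co 1q +: y; P = \ s -> Co 3ℚ *:(s *: s)+: Co 3ℚ *: s +: Co 1q in P s -: P y =: Co(q 6 0)*: y +: Co(q 6 0))Re))y =!
    sl 1(\ y -> let s = Co 1q +: y; P = \ s -> Co(q 6 0)*: s +: Co(q 6 0)in (P(Co 1q +: s) -: P s) -:(P s -: P y)=: Co 0q)Re y
  fi : ∀ y -> xr 6(\ y -> y ^^ 5)y ≡ 0q
  fi y = != cr(cr(cr(cr(cr{g′ = kR}
   (sl 1(\ y -> let s = Co 1q +: y; F = \ s -> s *:(s *:(s *:(s *:(s *: Co 1q))))in F s -: F y =: PH y)Re)))))y =~
   cr(cr(cr(cr{g′ = kS}(sl 1(\ y -> PH(Co 1q +: y) -: PH y =: PI y)Re))))y =~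
   cr(cr(cr{g′ = p5}(sl 1(\ y -> PI(Co 1q +: y) -: PI y =: PJ y)Re)))y =~
   cr(cr{g′ = p3}(sl 1(\ y -> PJ(Co 1q +: y) -: PJ y =: Pj y)Re))y =!
    sl 1(\ y -> let s = Co 1q +: y in (Pj(Co 1q +: s) -: Pj s) -:(Pj s -: Pj y)=: Co 0q)Re y
   where
   kR kS p5 p3 : ℚ -> ℚ
   kR y = q 5 0 **(y ** y ** y ** y)++ q 10 0 **(y ** y ** y)++ q 10 0 **(y ** y)++ q 5 0 ** y ++ 1q
   kS y = q 20 0 **(y ** y ** y)++ q 60 0 **(y ** y)++ q 70 0 ** y ++ q 30 0
   p5 y = q 60 0 **(y ** y)++ q 180 0 ** y ++ q 150 0
   p3 y = q 120 0 ** y ++ q 240 0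
   PH PI PJ Pj : ∀ {n}-> PQ n -> PQ n
   PH y = Co(q 5 0)*:(y *: y *: y *: y)+: Co(q 10 0)*:(y *: y *: y)+: Co(q 10 0)*:(y *: y)+: Co(q 5 0)*: y +: Co 1q
   PI y = Co(q 20 0)*:(y *: y *: y)+: Co(q 60 0)*:(y *: y)+: Co(q 70 0)*: y +: Co(q 30 0)
   PJ y = Co(q 60 0)*:(y *: y)+: Co(q 180 0)*: y +: Co(q 150 0)
   Pj y = Co(q 120 0)*: y +: Co(q 240 0)
  opaque
   unfolding x2
   vd : ∇^ 4(pw 3)0 ≡ 0q × ∇^ 4(pw 3)1 ≡ 1q × ∇^ 4(pw 3)2 ≡ q 4 0 × ∇^ 4(pw 3)3 ≡ 1q
   vd = Re , Re , Re , Re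
   vh : ∇^ 6(pw 5)0 ≡ 0q × ∇^ 6(pw 5)1 ≡ 1q × ∇^ 6(pw 5)2 ≡ q 26 0 × ∇^ 6(pw 5)3 ≡ q 66 0 × ∇^ 6(pw 5)4 ≡ q 26 0 × ∇^ 6(pw 5)5 ≡ 1q
   vh = Re , Re , Re , Re , Re , Re
  Te : ∀ (r : ℕ -> ℚ) {c}x n -> r n ≡ c -> td r x n ≈ oq c * x ^ n
  Te r x n h = cn(rx(cO oq h))
 Fe : ∀ {x F}-> Sa(td(\ n -> ι n ^^ 3)x)F ->(1# - x)^ 4 * F ≈ x + oq(q 4 0)*(x * x)+ x * x * x
 Fe{x} {F}h = Ss(Sj 4{\ n -> ι n ^^ 3} {x}h)(Su{td(∇^ 4(\ n -> ι n ^^ 3))x}(\ _ -> rR)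
  (!~ ca(Te(∇^ 4(\ n -> ι n ^^ 3))x 0(pF vd))(ca(Te(∇^ 4(\ n -> ι n ^^ 3))x 1(pF(pS vd)))(ca(Te(∇^ 4(\ n -> ι n ^^ 3))x 2(pF(pS(pS vd))))(Cg(Te(∇^ 4(\ n -> ι n ^^ 3))x 3(pS(pS(pS vd)))))))~!
   sV 1(\ x -> # 0q :* # 1q :+(# 1q :*(x :* # 1q):+(#(q 4 0):*(x :*(x :* # 1q)):+(# 1q :*(x :*(x :*(x :* # 1q))):+ # 0q))):= x :+ #(q 4 0):*(x :* x):+ x :* x :* x)rR x)
  (Sf 4{td(∇^ 4(\ n -> ι n ^^ 3))x}\ n -> !~ Te(∇^ 4(\ n -> ι n ^^ 3))x(4 +n n)(!= pl 4 3 n =! cQ(ι n))~!(ze _)))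
 Fq : ∀ {x F}-> Sa(td(\ n -> ι n ^^ 5)x)F ->(1# - x)^ 6 * F ≈ x * x * x *(oq(q 66 0))+(x * x + x * x *(x * x))* oq(q 26 0)+(x + x *(x * x *(x * x)))
 Fq{x} {F}h = Ss(Sj 6{\ n -> ι n ^^ 5} {x}h)(Su{td(∇^ 6(\ n -> ι n ^^ 5))x}(\ _ -> rR)
  (!~ ca(Te(∇^ 6(\ n -> ι n ^^ 5))x 0(pF v))(ca(Te(∇^ 6(\ n -> ι n ^^ 5))x 1(pF(pS v)))(ca(Te(∇^ 6(\ n -> ι n ^^ 5))x 2(pF(pS(pS v))))(ca(Te(∇^ 6(\ n -> ι n ^^ 5))x 3(pF(pS(pS(pS v)))))(ca(Te(∇^ 6(\ n -> ι n ^^ 5))x 4(pF(pS(pS(pS(pS v))))))(Cg(Te(∇^ 6(\ n -> ι n ^^ 5))x 5(pS(pS(pS(pS(pS v)))))))))))~!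
   sV 1(\ x -> # 0q :* # 1q :+(# 1q :*(x :* # 1q):+(#(q 26 0):*(x :*(x :* # 1q)):+(#(q 66 0):*(x :*(x :*(x :* # 1q))):+(#(q 26 0):*(x :*(x :*(x :*(x :* # 1q)))):+(# 1q :*(x :*(x :*(x :*(x :*(x :* # 1q))))):+ # 0q)))))
    := x :* x :* x :* #(q 66 0):+(x :* x :+ x :* x :*(x :* x)):* #(q 26 0):+(x :+ x :*(x :* x :*(x :* x))))rR x)
  (Sf 6{td(∇^ 6(\ n -> ι n ^^ 5))x}\ n -> !~ Te(∇^ 6(\ n -> ι n ^^ 5))x(6 +n n)(!= pl 6 5 n =! fi(ι n))~!(ze _)))
  where v = vh
 module _ {x y : ℂ} (xy : x * y ≈ 1#) where
  D : ℂ
  D = x + y - oq n2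
  sq :(1# - x)*(1# - x)≈ x * D
  sq = !~ sV 1(\ x ->(# 1q :- x):*(# 1q :- x):= x :* x :+ # 1q :- # n2 :* x)rR x ~~ Cg(Cn(yY xy))~!
   sV 2(\ x y -> x :* x :+ x :* y :- # n2 :* x := x :*(x :+ y :- # n2))rR x y
  xZ : ∀ z ->(x * x)* z *(y * y)≈ z
  xZ z = !~ sV 3(\ x y z ->(x :* x):* z :*(y :* y):=(x :* y):*(x :* y):* z)rR x y z ~~ cn(cd xy xy)~! sV 1(\ z -> # 1q :* # 1q :* z := z)rR z
  kT : ∀ {F}->(1# - x)^ 4 * F ≈ x + oq(q 4 0)*(x * x)+ x * x * x -> D * D * F ≈ D + oq(q 6 0)
  kT{F}h = !~ yY(xZ(D * D * F))~~ cn(!~(!~ sV 3(\ x D F -> x :* x :*(D :* D :* F):=(x :* D):*(x :* D):* F)rR x D F ~! cn(cd(yY sq)(yY sq)))~~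
   sV 2(\ u F -> u :* u :*(u :* u):* F := u :*(u :*(u :*(u :* # 1q))):* F)rR(1# - x)F ~! h)~~
   sV 2(\ x y ->(x :+ #(q 4 0):*(x :* x):+ x :* x :* x):*(y :* y):=(x :* y):* y :+ #(q 4 0):*((x :* y):*(x :* y)):+ x :*((x :* y):*(x :* y)))rR x y ~~
   ca(ca(cn xy)(co(cd xy xy)))(co(cd xy xy))~!
    sV 2(\ x y -> # 1q :* y :+ #(q 4 0):*(# 1q :* # 1q):+ x :*(# 1q :* # 1q):= x :+ y :- # n2 :+ #(q 6 0))rR x y
  Xy : ∀ z ->(x * x * x)* z *(y * y * y)≈ z
  Xy z = !~ sV 3(\ x y z ->(x :* x :* x):* z :*(y :* y :* y):=(x :* y):*(x :* y):*(x :* y):* z)rR x y z ~~ cn(cd(cd xy xy)xy)~! sV 1(\ z -> # 1q :* # 1q :* # 1q :* z := z)rR z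
  kU : ∀ {F}->(1# - x)^ 6 * F ≈ x * x * x *(oq(q 66 0))+(x * x + x * x *(x * x))* oq(q 26 0)+(x + x *(x * x *(x * x)))->
   D * D * D * F ≈ D * D + oq(q 30 0)* D + oq(q 120 0)
  kU{F}h = !~ yY(Xy(D * D * D * F))~~ cn(!~(!~ sV 3(\ x D F -> x :* x :* x :*(D :* D :* D :* F):=(x :* D):*(x :* D):*(x :* D):* F)rR x D F ~! cn(cd(cd(yY sq)(yY sq))(yY sq)))~~
   sV 2(\ u F -> u :* u :*(u :* u):*(u :* u):* F := u :*(u :*(u :*(u :*(u :*(u :* # 1q))))):* F)rR(1# - x)F ~! h)~~
   sV 2(\ x y -> let p = x :* y in (x :* x :* x :* #(q 66 0):+(x :* x :+ x :* x :*(x :* x)):* #(q 26 0):+(x :+ x :*(x :* x :*(x :* x)))):*(y :* y :* y)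
    :=(p :* p :* p):* #(q 66 0):+((p :* p):* y :+(p :* p :* p):* x):* #(q 26 0):+(p :*(y :* y):+(p :* p :* p):*(x :* x)))rR x y ~~
   ca(ca(cn mY)(cn(ca(cn(cd xy xy))(cn mY))))(ca(cn xy)(cn mY))~~
   sV 2(\ x y ->(# 1q :* # 1q :* # 1q):* #(q 66 0):+((# 1q :* # 1q):* y :+(# 1q :* # 1q :* # 1q):* x):* #(q 26 0):+(# 1q :*(y :* y):+(# 1q :* # 1q :* # 1q):*(x :* x))
    :=(x :+ y):*(x :+ y):- # n2 :* # 1q :+(x :+ y):* #(q 26 0):+ #(q 66 0):- # n2 :*(x :* y):+ # n2)rR x y ~~
   Cg(sb rR(co xy))~! sV 1(\ c -> c :* c :- # n2 :* # 1q :+ c :* #(q 26 0):+ #(q 66 0):- # n2 :* # 1q :+ # n2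
    :=(c :- # n2):*(c :- # n2):+ #(q 30 0):*(c :- # n2):+ #(q 120 0))rR(x + y)
   where
   mY : x * y *(x * y)*(x * y)≈ 1# * 1# * 1#
   mY = cd(cd xy xy)xy
module Ker where
 open Fk public
 open CSolve
 private
  q : ℕ -> ℕ -> ℚ
  q a b =(+ a)// sC b
 record Ke : Set where
  field
   p h : ℕ
   mZ : sC p ≡ h +n h
   2≤h : 2 ≤n h
   κ ζ C : ℚ
   rI : ∀ {t ω τ F}-> t <| q 7 1 -> t <| τ -> t * ω ≈ 1# -> Sa(td(\ n -> ι n ^^ p)(exp t))F -> F - oq κ *(ω * ω)^ h - oq ζ <| C **(τ ** τ)
 private
  7/2≥0 : 0q <= q 7 1
  7/2≥0 = nN(q 7 1)
  opaque
   Hu : ∃ \ B -> ∀ k t -> t <| q 7 1 -> H k t <| B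
   Hu = _ , \ k t ht -> ≼-+(pS(ty(q 7 1)7/2≥0)k t ht)(pS(ty(q 7 1)7/2≥0)k(- t)(Ne ht))
  B : ℚ
  B = pF Hu
  CA CB VI : ℚ
  VI = 3ℚ ** 3ℚ
  CA =(VI ** VI)**(((B ++ Q.∣ q 12 0 ∣ ** B)++ Q.∣ q 6 0 ∣ **(B **(Q.∣ q 1 11 ∣ ++ B)))++ Q.∣ q 1 119 ∣ **(B **(Q.∣ 1q ∣ ++ B)))
  CB =((VI ** VI)** VI)**((((((Q.∣ q 360 0 ∣ ** B ++ Q.∣ q 30 0 ∣ ** B)++(Q.∣ q 2 0 ∣ ** B ++ Q.∣ q 120 0 ∣ **(B **((B ** B ++ Q.∣ q 1 11 ∣ ** B)++ Q.∣ q 1 143 ∣))))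
   ++ Q.∣ q 360 0 ∣ **(B ** B))++ B ** B))++ Q.∣ q 1 251 ∣ **(B **((B ** B ++ B)++ Q.∣ 1q ∣)))
  xX : ∀ t -> exp t + exp(- t) - oq n2 ≈(t * t)* H 2 t
  xX t = !~ Cg(eO t)~! sV 1(\ x -> # n2 :+ x :- # n2 := x)rR((t * t)* H 2 t)
  DI : ∀ {D y F}-> D ≈ y -> D * D * F ≈ D + oq(q 6 0)-> y * y * F ≈ y + oq(q 6 0)
  DI h e = !~ cn(cd(yY h)(yY h))~~ e ~! Cg h
  DJ : ∀ {D y F}-> D ≈ y -> D * D * D * F ≈ D * D + oq(q 30 0)* D + oq(q 120 0)-> y * y * y * F ≈ y * y + oq(q 30 0)* y + oq(q 120 0)
  DJ h e = !~ cn(cd(cd(yY h)(yY h))(yY h))~~ e ~! Cg(ca(cd h h)(co h))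
 module _ {t ω : ℂ} (ht : t <| q 7 1) (tY : t * ω ≈ 1#) where
  private
   open RB ht tY
   open Aw T G aa cl b₁ k₁ GG d1 j5 mX
   o : ℂ
   o = ω * ω
   b : ∀ k -> H k t <| B
   b k = pS Hu k t ht
   ox : ∀ {x y}-> x * y ≈ 1# ->(x * x)*(y * y)≈ 1#
   ox{x} {y}e = !~ sV 2(\ x y ->(x :* x):*(y :* y):=(x :* y):*(x :* y))rR x y ~~ cd e e ~! ie 1#
   oA : ∀ {x y}-> x * y ≈ 1# ->(x * x * x)*(y * y * y)≈ 1#
   oA{x} {y}e = !~ sV 2(\ x y ->(x :* x :* x):*(y :* y :* y):=((x :* x):*(y :* y)):*(x :* y))rR x y ~~ cd(ox e)e ~! ie 1#
  rA : ∀ {F}-> Sa(td(\ n -> ι n ^^ 3)(exp t))F -> F - oq(q 6 0)*(o * o) - oq(q 1 119)≈ T *((V * V)* Xa)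
  rA{F}hF = s4(o * o)(V * V)(G * G)(T * T)F(T * G + oq(q 6 0))T Xa(q 6 0)(q 1 119)(ox VG)(ox Tv)
   (!~ cn(sV 2(\ T G -> T :* T :*(G :* G):=(T :* G):*(T :* G))rR T G)~! DI(xX t)(kT(Eg t)(Fe{exp t}hF)))jl
  rB : ∀ {F}-> Sa(td(\ n -> ι n ^^ 5)(exp t))F -> F - oq(q 120 0)*(o * o * o) - oq(-q q 1 251)≈ T *((V * V * V)* Ya)
  rB{F}hF = s4(o * o * o)(V * V * V)(G * G * G)(T * T * T)F(T * T *(G * G)+ oq(q 30 0)*(T * G)+ oq(q 120 0))T Ya(q 120 0)(-q q 1 251)(oA VG)(oA Tv)
   (!~ cn(sV 2(\ T G -> T :* T :* T :*(G :* G :* G):=(T :* G):*(T :* G):*(T :* G))rR T G)~~ DJ(xX t)(kU(Eg t)(Fq{exp t}hF))~!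
    sV 2(\ T G ->(T :* G):*(T :* G):+ #(q 30 0):*(T :* G):+ #(q 120 0):= T :* T :*(G :* G):+ #(q 30 0):*(T :* G):+ #(q 120 0))rR T G)jm
  Xb :(V * V)* Xa <| CA
  Xb = ≼-*(≼-* Vq Vq)(sj(sj(sj(b 6)(≼-*(Of(q 12 0))(b 8)))(≼-*(Of(q 6 0))(≼-*(b 6)(≼-+(Of(q 1 11))(b 4)))))(≼-*(Of(q 1 119))(≼-*(b 4)(≼-+(Of 1q)(b 2)))))
  Yb :(V * V * V)* Ya <| CB
  Yb = ≼-*(≼-*(≼-* Vq Vq)Vq)(≼-+(≼-+(sj(≼-+(sj(Ne(≼-*(Of(q 360 0))(b 10)))(≼-*(Of(q 30 0))(b 8)))
   (sj(≼-*(Of(q 2 0))(b 6))(≼-*(Of(q 120 0))(≼-*(b 6)(≼-+(≼-+(≼-*(b 4)(b 4))(≼-*(Of(q 1 11))(b 4)))(Of(q 1 143)))))))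
   (≼-*(Of(q 360 0))(≼-*(b 6)(b 6))))(≼-*(b 4)(b 4)))
   (≼-*(Of(q 1 251))(≼-*(b 4)(≼-+(≼-+(≼-*(b 2)(b 2))(b 2))(Of 1q)))))
 opaque
  Bo : ∃ \ C -> ∀ {t ω τ F}-> t <| q 7 1 -> t <| τ -> t * ω ≈ 1# -> Sa(td(\ n -> ι n ^^ 3)(exp t))F -> F - oq(q 6 0)*((ω * ω)^ 2) - oq(q 1 119)<| C **(τ ** τ)
  Bo = CA , \ {t} {ω} {τ} {F}ht jQ tY hF -> sB(F - oq(q 6 0)*((ω * ω)^ 2) - oq(q 1 119)<|_)(cD(τ ** τ)CA)
   (rp(!~ yY(rA ht tY hF)~! Cg(Cn(cc(co(co(yY(In(ω * ω))))))))(≼-*(≼-* jQ jQ)(Xb ht tY)))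
  Bu : ∃ \ C -> ∀ {t ω τ F}-> t <| q 7 1 -> t <| τ -> t * ω ≈ 1# -> Sa(td(\ n -> ι n ^^ 5)(exp t))F -> F - oq(q 120 0)*((ω * ω)^ 3) - oq(-q q 1 251)<| C **(τ ** τ)
  Bu = CB , \ {t} {ω} {τ} {F}ht jQ tY hF -> sB(F - oq(q 120 0)*((ω * ω)^ 3) - oq(-q q 1 251)<|_)(cD(τ ** τ)CB)
   (rp(!~ yY(rB ht tY hF)~! Cg(Cn(cc(co(sV 1(\ o -> o :* o :* o := o :*(o :*(o :* # 1q)))rR(ω * ω))))))(≼-*(≼-* jQ jQ)(Yb ht tY)))
 ke kr : Ke
 ke = record { p = 3 ; h = 2 ; mZ = Re ; 2≤h = ss(ss zn); κ = q 6 0 ; ζ = q 1 119 ; C = pF Bo ; rI = pS Bo }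
 kr = record { p = 5 ; h = 3 ; mZ = Re ; 2≤h = ss(ss zn); κ = q 120 0 ; ζ = -q q 1 251 ; C = pF Bu ; rI = pS Bu }
module Gro where
 open Nome public
 open import Data.Nat.DivMod as DM using (_/_;_%_)
 open import Relation.Nullary using (Dec;yes;no;¬_)
 open import Relation.Nullary.Negation using (contradiction)
 open CSolve
 Gr : ℚ ->(ℕ -> ℂ)-> Set
 Gr xd c = ∀ δ -> 0q << δ -> ∃ \ C -> 0q <= C ×(∀ n -> c n <| C **(xd **(1q ++ δ))^^ n)
 Hv : ∀ δ -> 0q << δ -> ∃ \ xa -> 0q << xa ×(1q ++ xa)**(1q ++ xa)<= 1q ++ δ
 Hv δ hH = δ ** i , nk , !< rl(sl 1(\ d ->(Co 1q +: d)*:(Co 1q +: d)=: Co 1q +: d *:(Co n2 +: d))Re(δ ** i))<!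
  mj 1q(!< Mo{n2 ++ δ ** i} {n2 ++ δ} {δ ** i}(lZ nk)(mj n2 iU)<! rl(!= ac δ i(n2 ++ δ)=~ cO(δ **_)(iz 2+δ>0)=! ii δ))
  where
  2+δ>0 : 0q << n2 ++ δ
  2+δ>0 = nG(nG nl n1)(lZ hH)
  i = iv(n2 ++ δ)2+δ>0
  nk : 0q << δ ** i
  nk = nD hH(i0 2+δ>0)
  iU : δ ** i <= δ
  iU = !< Mo{i} {1q} {δ}(lZ hH)(iA 2+δ>0(By(1q ++ δ)(N0 n1(lZ hH))(dZ 1q 1q δ)))<! rl(ii δ)
 li : ∀ δ(h : 0q << δ)n -> ι(sC n)<=(1q ++ iv δ h)**(1q ++ δ)^^ n
 li δ h n = !< By(ι n ** δ ++ iv δ h)(N0(n0(nc n)(lZ h))(lZ(i0 h)))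
  (!= sl 3(\ i e v ->(Co 1q +: v)*:(Co 1q +: i *: e)=: Co 1q +: i *:(e *: v)+:(i *: e +: v))Re(ι n)δ(iv δ h)=!
   cO(\ t -> t ++(ι n ** δ ++ iv δ h))(!= cO(\ t -> 1q ++ ι n ** t)(Iv h)=~ cO(1q ++_)(ii(ι n))=! sy(sa n)))<!
  Mo{1q ++ ι n ** δ} {(1q ++ δ)^^ n} {1q ++ iv δ h}(N0 n1(lZ(i0 h)))(bl n(lZ h))
 module _ {xd : ℚ} (oH : 0q <= xd) where
  private
   Ba : ∀ {δ}-> 0q << δ -> 0q <= xd **(1q ++ δ)
   Ba h = n0 oH(N0 n1(lZ h))
   bp : ∀ δ xa(hg : 0q << xa)->(1q ++ xa)**(1q ++ xa)<= 1q ++ δ -> ∀ n ->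
    ι(sC n)**(xd **(1q ++ xa))^^ n <=(1q ++ iv xa hg)**(xd **(1q ++ δ))^^ n
   bp δ xa hg le n = !< ma{ι(sC n)} {(1q ++ iv xa hg)**(1q ++ xa)^^ n} {(xd **(1q ++ xa))^^ n}(nf n(Ba hg))(li xa hg n)<~
    rl(!=(ac(1q ++ iv xa hg)_ _)=! cO((1q ++ iv xa hg)**_)(!= sy(dt(1q ++ xa)(xd **(1q ++ xa))n)=!
     cO(_^^ n)(sl 2(\ a l -> a *:(l *: a)=: l *:(a *: a))Re(1q ++ xa)xd)))<!
     Mo{(xd **((1q ++ xa)**(1q ++ xa)))^^ n} {(xd **(1q ++ δ))^^ n} {1q ++ iv xa hg}(N0 n1(lZ(i0 hg)))
      (mu n(n0 oH(n0(N0 n1(lZ hg))(N0 n1(lZ hg))))(Mo oH le))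
  Ga : ∀ {a b}-> Gr xd a -> Gr xd b -> Gr xd(a *s b)
  Ga{a} {b}ha hb δ hH =
   let xa , hg , le = Hv δ hH;C , hC , da = ha xa hg;D , hD , db = hb xa hg;i = 1q ++ iv xa hg
   in (C ** D)** i , n0(n0 hC hD)(N0 n1(lZ(i0 hg))), \ n ->
    mo(!< rl(sl 3(\ i c p -> i *: c *: p =: c *:(i *: p))Re(ι(sC n))(C ** D)((xd **(1q ++ xa))^^ n))<~
     Mo{_} {_} {C ** D}(n0 hC hD)(bp δ xa hg le n)<! rl(sy(ac(C ** D)i _)))
     (cE{a} {b} {C} {D} {xd **(1q ++ xa)}da db n)
  Gy : ∀ {a}-> Gr xd a -> Gr xd(θ a)
  Gy{a}ha δ hH =
   let xa , hg , le = Hv δ hH;C , hC , da = ha xa hg;i = 1q ++ iv xa hg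
   in C ** i , n0 hC(N0 n1(lZ(i0 hg))), \ n ->
    mo(!< ma{ι n} {ι(sC n)} {C **(xd **(1q ++ xa))^^ n}(n0 hC(nf n(Ba hg)))(mg(N1 n))<~
     rl(sl 3(\ i c p -> i *:(c *: p)=: c *:(i *: p))Re(ι(sC n))C((xd **(1q ++ xa))^^ n))<~
      Mo{_} {_} {C}hC(bp δ xa hg le n)<! rl(sy(ac C i _)))
     (≼-*(mo(rl(np(nc n)))(Of(ι n)))(da n))
  Gw : ∀ {a b}-> Gr xd a -> Gr xd b -> Gr xd(a +s b)
  Gw{a} {b}ha hb δ hH =
   let C , hC , da = ha δ hH;D , hD , db = hb δ hH
   in C ++ D , N0 hC hD , \ n -> sB(a n + b n <|_)(sy(dq((xd **(1q ++ δ))^^ n)C D))(≼-+(da n)(db n))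
  Gf : ∀ {a}z -> Gr xd a -> Gr xd(z ^s a)
  Gf{a}z ha δ hH =
   let C , hC , da = ha δ hH;q , hq = ei z
   in q ** C , n0(nn hq)hC , \ n -> sB(z * a n <|_)(sy(ac q C _))(≼-* hq(da n))
  Gs : ∀ {a b}-> a ~s b -> Gr xd a -> Gr xd b
  Gs h ha δ hH = let C , hC , da = ha δ hH in C , hC , \ n -> rp(at h n)(da n)
  Gc : ∀ z -> Gr xd(Cs z)
  Gc z δ hH = let q , hq = ei z in q , nn hq , \
   { z0 -> sB(z <|_)(sy(ii q))hq
   ; (sC n)-> mo(n0(nn hq)(nf(sC n)(Ba hH)))(Of 0q) }
 0≤1ℚ : 0q <= 1q
 0≤1ℚ = n1
 Gk : ∀ {a b}->(∀ n r -> b n <| r -> a n <| r)-> Gr 1q b -> Gr 1q a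
 Gk h hb δ hH = let C , hC , d = hb δ hH in C , hC , \ n -> h n _(d n)
 Gz : ∀ {c x δ}(h : 0q << δ)(hg : 0q << 1q ++ δ)-> Gr 1q c -> x <| iv(1q ++ δ)hg -> Go(\ n -> c n * x ^ n)
 Gz{c} {x} {δ}h hg g hx =
  let δ₁ = ½ ** δ;C , hC , d = g δ₁(Ha h);ρ = iv(1q ++ δ)hg;b = 1q **(1q ++ δ₁)
  in gy C(b ** ρ)hC(n0(n0 n1(N0 n1(lZ(Ha h))))(lZ(i0 hg)))
   (bf(½ ** δ ** ρ)(nD(Ha h)(i0 hg))(!= sy(Iv hg)=! sl 2(\ d r ->(Co 1q +: d)*: r =: Co 1q *:(Co 1q +: Co ½ *: d)*: r +: Co ½ *: d *: r)Re δ ρ))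
   \ n -> sB(c n * x ^ n <|_)(!=(ac C _ _)=! cO(C **_)(sy(dt b ρ n)))(≼-*(d n)(≼-^ n hx))
 dH : ℕ ->(ℕ -> ℂ)-> ℕ -> ℂ
 dH m a n with n % sC m ℕₚ.≟ 0
 ... | yes _ = a(n / sC m)
 ... | no _ = 0#
 Dy : ∀ m a d -> dH m a(d *n sC m)≈ a d
 Dy m a d with(d *n sC m)% sC m ℕₚ.≟ 0
 ... | yes _ = rx(cO a(DM.m*n/n≡m d(sC m)))
 ... | no ne = contradiction(DM.m*n%n≡0 d(sC m))ne
 dK : ∀ m a n -> n % sC m ≢ 0 -> dH m a n ≈ 0#
 dK m a n ne with n % sC m ℕₚ.≟ 0
 ... | yes e = contradiction e ne
 ... | no _ = rR
 private
  Bl : ∀ m N(b : ℕ -> ℂ)->(∀ n -> n % sC m ≢ 0 -> b n ≈ 0#)-> ∑(N *n sC m)b ≈ ∑ N(\ d -> b(d *n sC m))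
  Bl m z0 b h = rR
  Bl m(sC N)b h = !~ sp(sC m)(N *n sC m)b ~! ca
   (!~ Cn(nB m \ i lt -> h(sC i)\ e -> gN(!= sy(DM.m<n⇒m%n≡m(ss lt))=! e))~! Ie(b 0))
   (!~(Bl m N(\ i -> b(sC m +n i))\ n ne -> h(sC m +n n)\ e -> ne(!= sy(DM.[m+n]%n≡m%n n(sC m))=~ cO(_% sC m)(Cm n(sC m))=! e))~!
    rR)
 sx : ∀ {s L}(φ : ℕ -> ℕ)->(∀ n -> n ≤n φ n)-> s => L ->(\ n -> s(φ n))=> L
 sx φ qr h ε na = let N , g = h ε na in N , \ n le -> g(φ n)(le ≤~ qr n)
 ^-* : ∀ x m n ->(x ^ m)^ n ≈ x ^(n *n m)
 ^-* x m z0 = rR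
 ^-* x m(sC n)= !~ co(^-* x m n)~! yY(^-+ x m(n *n m))
  where
  ^-+ : ∀ x m n -> x ^(m +n n)≈ x ^ m * x ^ n
  ^-+ x z0 n = yY(ie _)
  ^-+ x(sC m)n = !~ co(^-+ x m n)~! yY(ao x _ _)
 SI : ∀ m a x{S}-> Go(\ n -> dH m a n * x ^ n)-> Sa(\ n -> a n *(x ^ sC m)^ n)S -> Sa(\ n -> dH m a n * x ^ n)S
 SI m a x{S}g h = Su(\ _ -> rR)(uq(sx(\ n -> n *n sC m)(\ n -> ri(sy(ik n))≤~ mr n(ss zn))(gu{b}g))
  (Rs(\ N -> yY(!~(Bl m N b \ n ne -> !~ cn(dK m a n ne)~!(ze _))~!(ch N \ d -> cd(Dy m a d)(yY(^-* x(sC m)d)))))rR h))(gu{b}g)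
  where
  b : ℕ -> ℂ
  b n = dH m a n * x ^ n
 Gi : ∀ m{a}-> Gr 1q a -> Gr 1q(dH m a)
 Gi m{a}ha δ hH = let C , hC , d = ha δ hH in C , hC , go C hC d
  where
  b = 1q **(1q ++ δ)
  b1 : 1q <= b
  b1 = By δ(lZ hH)(iy(1q ++ δ))
  pN : ∀ {i j}-> i ≤n j -> b ^^ i <= b ^^ j
  pN{i} {j}le = sB(\ t -> b ^^ i <= b ^^ t)(mm le)(!< rl(sy(ii(b ^^ i)))<~
   Mo{1q} {b ^^(j -n i)} {b ^^ i}(nf i(!< n1 <! b1))(j3(j -n i)b1)<! rl(sy(Q.^-+ b i(j -n i))))
  go : ∀ C -> 0q <= C ->(∀ n -> a n <| C ** b ^^ n)-> ∀ n -> dH m a n <| C ** b ^^ n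
  go C hC d n with n % sC m ℕₚ.≟ 0
  ... | yes _ = mo(Mo hC(pN(DM.m/n≤m n(sC m))))(d(n / sC m))
  ... | no _ = mo(n0 hC(nf n(!< n1 <! b1)))(Of 0q)
 pC : ℕ -> ℕ -> ℂ
 pC p n = oq(ι n ^^ p)
 Gp : ∀ p -> Gr 1q(pC p)
 Gp z0 δ hH = 1q , n1 , \ n -> mo(!< j3 n(By δ(lZ hH)(iy(1q ++ δ)))<! rl(sy(iy _)))(Of 1q)
 Gp(sC p)= Gs n1(mk \ n -> yY(ob(ι n)(ι n ^^ p)))(Gy n1(Gp p))
module Dist where
 open Gro public
 open Fk using (td) public
 open CSolve
 Hp : ℂ -> Set
 Hp u = ∃ \ δ -> 0q << δ × Im u δ
 private
  opaque
   unfolding fq _+ℝ_ _*ℝ_ -ℝ_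
   kV : ∀ z w n -> seq(im(z + w))n ≡ seq(im z)n ++ seq(im w)n
   kV z w n = Re
   oI : ∀ z w n -> seq(im z R.- im w)n ≡ seq(im z)n -q seq(im w)n
   oI z w n = Re
   fk : ∀ q n -> seq(im(oq q))n ≡ 0q
   fk q n = Re
   i5 : ∀ q z n -> seq(im(oq q * z))n ≡ q ** seq(im z)n
   i5 q z n = sl 3(\ q a b -> q *: b +: Co 0q *: a =: q *: b)Re q(seq(re z)n)(seq(im z)n)
 Hb : ∀ {u}q -> Hp u -> Hp(u + oq q)
 Hb{u}q(δ , h , N , f)= δ , h , N , \ n le -> sB(δ <=_)(sy(!= kV u(oq q)n =~ cO(seq(im u)n ++_)(fk q n)=!(ig _)))(f n le)
 Hc : ∀ {u q}-> 0q << q -> Hp u -> Hp(oq q * u)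
 Hc{u} {q}hq(δ , h , N , f)= q ** δ , nD hq h , N , \ n le -> sB(q ** δ <=_)(sy(i5 q u n))(Mo{δ} {seq(im u)n} {q}(lZ hq)(f n le))
 He : ∀ {z w}-> z ≈ w -> Hp z -> Hp w
 He{z} {w}(_ , h)(δ , fl , N , f)= ½ ** δ , Ha fl , N ℕ.⊔ pF c , \ n le ->
  !< By(seq(im z)n -q δ)(p0(f n(Mm N _ le)))(sl 2(\ z d -> z -: Co ½ *: d =: Co ½ *: d +:(z -: d))Re(seq(im z)n)δ)<!
   hi(seq(im z)n)(seq(im w)n)(½ ** δ)(pS c n(md N _ le))
  where
  c = _≈ℝ_.close h(½ ** δ)(Ha fl)
  hi : ∀ a b e -> Q.∣ a -q b ∣ << e -> a -q e <= b
  hi a b e lt = By(e -q(a -q b))(p0(!< fv(a -q b)<!(lZ lt)))(sl 3(\ a b e -> b =: a -: e +:(e -:(a -: b)))Re a b e)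
   where
   fv : ∀ x -> x <= Q.∣ x ∣
   fv x = go(Tt 0q x)
    where
    go : 0q <= x ⊎ x <= 0q -> x <= Q.∣ x ∣
    go(iL p)= rl(sy(np p))
    go(iR p)= !< p <! Np x
 Pw : ℕ -> ℂ -> ℂ -> Set
 Pw p x = Sa(td(\ n -> ι n ^^ p)x)
 0<6 : 0q << 6ℚ
 0<6 = nD(nG nl n1)(nG nl(N0 n1 n1))
 gH : ∀ {c u}-> Gr 1q c -> Hp u -> Go(\ n -> c n * e u ^ n)
 gH g(δ , h , f)= Gz(nD 0<6 h)(1+6δ>0(lZ h))g(eU(lZ h)f)
 Po : ∀ p{u}-> Hp u -> ∃(Pw p(e u))
 Po p h = gm(gH(Gp p)h), gu(gH(Gp p)h)
 PS : ∀ p{x y F G}-> x ≈ y -> Pw p x F -> Pw p y G -> F ≈ G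
 PS p{x} {y}e hF hG = Ss(Su(\ n -> co(ck n e))rR hF)hG
 SA : ∀ {a S}-> Sa a S -> Sa(\ n -> a(2 *n n)+ a(sC(2 *n n)))S
 SA{a}h = Rs(\ N -> go N a)rR(sx(\ n -> 2 *n n)(\ n -> me n _)h)
  where
  go : ∀ N(a : ℕ -> ℂ)-> ∑(2 *n N)a ≈ ∑ N(\ n -> a(2 *n n)+ a(sC(2 *n n)))
  go z0 a = rR
  go(sC N)a = !~ rx(cO(\ k -> ∑ k a)(sQ 2 N))~~ Cn rR ~~ yY(bE _ _ _)~! Cn
   (!~ go N(\ i -> a(sC(sC i)))~!(ch N \ n -> rx(cong₂(\ i j -> a i + a j)(sy(sQ 2 n))(cO sC(sy(sQ 2 n))))))
 o4 : ∀ p{x A B C}-> Pw p x A -> Pw p(- x)B -> Pw p(x * x)C -> A + B ≈ oq(n2 ^^ sC p)* C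
 o4 p{x} {A} {B} {C}hA hB hC = Ss(SA(Sk hA hB))(Su(\ n -> yY(eq n))rR(Sd(oq(n2 ^^ sC p))hC))
  where
  jR : ∀ n ->(- x)^(2 *n n)≈ x ^(2 *n n)× x ^(2 *n n)≈(x * x)^ n
  jR z0 = rR , rR
  jR(sC n)= sB(\ k ->(- x)^ k ≈ x ^ k × x ^ k ≈(x * x)^ sC n)(sy(sQ 2 n))
   (!~ co(co(pF(jR n)))~! sV 2(\ x y ->(:- x):*((:- x):* y):= x :*(x :* y))rR x(x ^(2 *n n)),
    !~ co(co(pS(jR n)))~! yY(ao x x _))
  eq : ∀ n ->(oq(ι(2 *n n)^^ p)* x ^(2 *n n)+ oq(ι(2 *n n)^^ p)*(- x)^(2 *n n))+(oq(ι(sC(2 *n n))^^ p)* x ^ sC(2 *n n)+ oq(ι(sC(2 *n n))^^ p)*(- x)^ sC(2 *n n))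
   ≈ oq(n2 ^^ sC p)*(oq(ι n ^^ p)*(x * x)^ n)
  eq n = !~ ca(Cn(co(pF(jR n))))(Cn(co(co(pF(jR n)))))~~
   sV 4(\ a b x y ->(a :* y :+ a :* y):+(b :*(x :* y):+ b :*((:- x):* y)):= # n2 :*(a :* y))rR(oq(ι(2 *n n)^^ p))(oq(ι(sC(2 *n n))^^ p))x(x ^(2 *n n))~~
   co(cd(!~ rx(cO oq(!= cO(_^^ p)(xe 2 n)=! dt(ι 2)(ι n)p))~!(ob _ _))(pS(jR n)))~~
   sV 4(\ c a b y -> c :*((a :* b):* y):=(c :* a):*(b :* y))rR(oq n2)(oq(ι 2 ^^ p))(oq(ι n ^^ p))((x * x)^ n)~!
    cn(!~ yY(ob _ _)~! rx(cO(\ t -> oq(n2 ** t ^^ p))o5))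
   where
   o5 : ι 2 ≡ n2
   o5 = != sa 1 =~ cO(1q ++_)(!= sa 0 =! cO(1q ++_)nw)=! Re
 fw : e(oq ½)≈ - 1#
 fw = !~(Ed _)~~ ep(sV 2(\ i p -> # n2 :*(p :* i):* # ½ :=(# ½ :*(i :* p)):+(# ½ :*(i :* p)))rR 𝕚 π)~~(eF _ _)~~ cd e2 e2 ~! xn
 tw : ℕ -> ℕ
 tw z0 = 1
 tw(sC r)= tw r +n tw r
 ½^ : ℕ -> ℚ
 ½^ r = ½ ^^ r
 0<½^ : ∀ r -> 0q << ½^ r
 0<½^ r = q7 r ni
 Tw : ∀ r -> ι(tw r)** ½^ r ≡ 1q
 Tw z0 = != ii(ι 1)=~ sa 0 =! cO(1q ++_)nw
 Tw(sC r)= != cO(_** ½^(sC r))(xJ(tw r)(tw r))=~ sl 2(\ a b ->(a +: a)*:(Co ½ *: b)=: a *: b)Re(ι(tw r))(½^ r)=! Tw r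
 dw : ∀ p r{w F}(v : ℕ -> ℂ)-> Hp w -> Pw p(e w)F ->(∀ j -> Pw p(e(oq(½^ r)*(w + oa j)))(v j))-> ∑(tw r)v ≈ oq((n2 ^^ sC p)^^ r)* F
 dw p z0{w} {F}v hw hF hv = !~(Ie _)~~ PS p(en(!~ co(Cn o0)~! sV 1(\ w -> # 1q :*(w :+ # 0q):= w)rR w))(hv 0)hF ~! yY(ie F)
 dw p(sC r) {w} {F}v hw hF hv = !~ sp(tw r)(tw r)v ~~ yY(∑-+(tw r)v(\ i -> v(tw r +n i)))~~ ch(tw r)kW ~~
  (∑-*(tw r)(oq c)vb)~~ co(dw p r vb hw hF h5)~~ yY(ao _ _ F)~! cn(yY(ob c _))
  where
  c = n2 ^^ sC p
  ex : ∀ j -> ∃(Pw p(e(oq(½^ r)*(w + oa j))))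
  ex j = Po p(Hc{w + oa j} {½^ r}(0<½^ r)(Hb{w}(ι j)hw))
  vb : ℕ -> ℂ
  vb j = pF(ex j)
  h5 : ∀ j -> Pw p(e(oq(½^ r)*(w + oa j)))(vb j)
  h5 j = pS(ex j)
  kW : ∀ j -> v j + v(tw r +n j)≈ oq c * vb j
  kW j = o4 p(hv j)
   (Su(\ n -> co(ck n jn))rR(hv(tw r +n j)))
   (Su(\ n -> co(ck n sq))rR(h5 j))
   where
   u = oq(½^(sC r))*(w + oa j)
   hf : oq(½^(sC r))≈ oq ½ * oq(½^ r)
   hf = ob ½(½^ r)
   jn : e(oq(½^(sC r))*(w + oa(tw r +n j)))≈ - e u
   jn = !~ en(!~ co(Cn(!~ rx(cO oq(xJ(tw r)j))~!(oc _ _)))~~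
    sV 4(\ a w t j -> a :*(w :+(t :+ j)):= a :*(w :+ j):+ t :* a)rR(oq(½^(sC r)))w(oa(tw r))(oa j)~!
     Cn(!~ yY(ob _ _)~! rx(cO oq(!= sl 2(\ a b -> a *:(Co ½ *: b)=: Co ½ *:(a *: b))Re(ι(tw r))(½^ r)=~ cO(½ **_)(Tw r)=!(ii ½)))))~~
    eP u(oq ½)~~ co{e u}fw ~! sV 1(\ x -> x :*(:- # 1q):= :- x)rR(e u)
   sq : e(oq(½^ r)*(w + oa j))≈ e u * e u
   sq = !~ en(yY(!~ ca(cn hf)(cn hf)~! sV 2(\ a b -> # ½ :* a :* b :+ # ½ :* a :* b := a :* b)rR(oq(½^ r))(w + oa j)))~! eP u u
module Row where
 open Dist public
 open Ker public
 open CSolve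
 private
  q : ℕ -> ℕ -> ℚ
  q a b =(+ a)// sC b
 private
  opaque
   unfolding fq _+ℝ_ _*ℝ_ -ℝ_
   N2 : ∀ n -> Nb 2πi n ≡(n2 ** seq xf n)**(n2 ** seq xf n)
   N2 n = sl 1(\ p ->(Co n2 *:(p *: Co 0q -: Co 0q *: Co 1q) -: Co 0q *:(p *: Co 1q +: Co 0q *: Co 0q))*:(Co n2 *:(p *: Co 0q -: Co 0q *: Co 1q) -: Co 0q *:(p *: Co 1q +: Co 0q *: Co 0q))
    +:(Co n2 *:(p *: Co 1q +: Co 0q *: Co 0q)+: Co 0q *:(p *: Co 0q -: Co 0q *: Co 1q))*:(Co n2 *:(p *: Co 1q +: Co 0q *: Co 0q)+: Co 0q *:(p *: Co 0q -: Co 0q *: Co 1q))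
    =:(Co n2 *: p)*:(Co n2 *: p))Re(seq xf n)
   2πi≽1 : 2πi |> 1q
   2πi≽1 = pF bu , \ n le -> sB(1q ** 1q <=_)(sy(N2 n))(sn n1(!< By 1q n1 Re <! Mo{1q} {seq xf n} {n2}(N0 n1 n1)(!< By n2(N0 n1 n1)Re <! pF(pS bu n le))))
 opaque
  Λ : ℂ
  Λ = rc 2πi 1q nl 2πi≽1
  xU : 2πi * Λ ≈ 1#
  xU = !~ cp 2πi Λ ~! Rc 2πi 1q nl 2πi≽1
 di : ∀ x y n ->(x * y)^ n ≈ x ^ n * y ^ n
 di x y z0 = yY(ie 1#)
 di x y(sC n)= !~ co(di x y n)~! sV 4(\ x y a b -> x :* y :*(a :* b):= x :* a :*(y :* b))rR x y(x ^ n)(y ^ n)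
 ol : ∀ a n -> oq(a ^^ n)≈ oq a ^ n
 ol a z0 = rR
 ol a(sC n)= !~ ob a(a ^^ n)~! co(ol a n)
 Qb : ∀ a n ->(a ** a)^^ n ≡ a ^^(n +n n)
 Qb a n = != dt a a n =! sy(Q.^-+ a n n)
 ∑-≼′ : ∀ n{a b : ℕ -> ℂ} {c}-> 0q <= c ->(∀ i -> i <n n -> a i - b i <| c)-> ∑ n a - ∑ n b <| ι n ** c
 ∑-≼′ n{a} {b} {c}hc h = rp(!~(∑-+ n a(\ i -> - b i))~! Cn(Ng n b))(∑-≼ n hc h)
 oo : ∀ n -> oa n <| ι n
 oo n = sB(oa n <|_)(np(nc n))(Of(ι n))
 Ei : ∀ w n -> e(w - oa n)≈ e w
 Ei w n = !~ yY(In(e(w - oa n)))~~ co(yY(Eo n))~~ yY(eP(w - oa n)(oa n))~! en(sV 2(\ w n -> w :- n :+ n := w)rR w(oa n))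
 pp : ∀ x -> x <= Q.∣ x ∣
 pp x = go(Tt 0q x)
  where
  go : 0q <= x ⊎ x <= 0q -> x <= Q.∣ x ∣
  go(iL p)= rl(sy(np p))
  go(iR p)= !< p <! Np x
 module Rz (K : Ke) where
  open Ke K
  c : ℂ
  c = oq κ *(Λ * Λ)^ h
  7/2 B : ℚ
  7/2 = q 7 1
  B = Q.∣ C ∣ **(7/2 ** 7/2)++ Q.∣ ζ ∣
  0≤B : 0q <= B
  0≤B = N0(n0(Np C)(nq 7/2))(Np ζ)
  sd : ℂ -> ℂ
  sd o =(o * o)^ h
  sU : ∀ x y -> sd(x * y)≈ sd x * sd y
  sU x y = !~ ck h(sV 2(\ x y -> x :* y :*(x :* y):= x :* x :*(y :* y))rR x y)~! di(x * x)(y * y)h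
  sD : ∀ {x y}-> x ≈ y -> sd x ≈ sd y
  sD e = ck h(cd e e)
  n3 : ∀ {u y F τ}-> Pw p(e u)F -> 2πi * u <| 7/2 -> 2πi * u <| τ -> u * y ≈ 1# -> F - c * sd y - oq ζ <| C **(τ ** τ)
  n3{u} {y} {F} {τ}hF ht jQ uy = rp(Cg(Cn(cc(!~ co(sU Λ y)~! yY(ao _ _ _)))))
   (rI ht jQ(!~ sV 4(\ t u l y -> t :* u :*(l :* y):=(t :* l):*(u :* y))rR 2πi u Λ y ~~ cd xU uy ~! ie 1#)
    (Su(\ n -> co(ck n(Ed u)))rR hF))
  bO : ∀ {u y F}-> Pw p(e u)F -> 2πi * u <| 7/2 -> u * y ≈ 1# -> F - c * sd y <| B
  bO{u} {y} {F}hF ht uy = mo(ml Q.∣ ζ ∣(ma{C} {Q.∣ C ∣} {7/2 ** 7/2}(nq 7/2)(pp C)))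
   (rp(sV 2(\ x z -> x :- z :+ z := x)rR(F - c * sd y)(oq ζ))(≼-+(n3 hF ht ht uy)(Of ζ)))
  module _ (r : ℕ) {w F : ℂ} (o : ℕ -> ℂ) (hw : Hp w) (hF : Pw p (e w) F)
   (ho : ∀ j ->(w - oa(tw r)+ oa j)* o j ≈ 1#)(sT : oq(½^(sC r))* w <| q 1 24)where
   private
    N = tw(sC r)
    ν = ½^(sC r)
    W = w - oa(tw r)
    hW : Hp W
    hW = He{w + oq(-q ι(tw r))} {W}(Cn(oe(ι(tw r))))(Hb{w}(-q ι(tw r))hw)
    ex : ∀ j -> ∃(Pw p(e(oq ν *(W + oa j))))
    ex j = Po p(Hc{W + oa j} {ν}(0<½^(sC r))(Hb{W}(ι j)hW))
    v : ℕ -> ℂ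
    v j = pF(ex j)
    y : ℕ -> ℂ
    y j = oa N * o j
    NG : ι N ** ν ≡ 1q
    NG = Tw(sC r)
    NH : oq ν * oa N ≈ 1#
    NH = !~ yY(ob ν(ι N))~! rx(cO oq(!= cD ν(ι N)=! NG))
    uy : ∀ j -> oq ν *(W + oa j)* y j ≈ 1#
    uy j = !~ sV 4(\ a b n o -> a :* b :*(n :* o):=(a :* n):*(b :* o))rR(oq ν)(W + oa j)(oa N)(o j)~~ cd NH(ho j)~! ie 1#
    o6 : ∀ j -> j <n N -> oq ν *(oa j - oa(tw r))<| ½
    o6 j lt = mo(!< Mo{dL} {ι(tw r)} {Q.∣ ν ∣}(Np ν)kX <! rl(!= cO(_** ι(tw r))(np(lZ(0<½^(sC r))))=! Hf))
     (≼-*(Of ν)(rp(!~ oc(ι j)(-q ι(tw r))~! Cn(oe(ι(tw r))))(Of d)))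
     where
     d = ι j -q ι(tw r)
     dL = Q.∣ d ∣
     Hf : ν ** ι(tw r)≡ ½
     Hf = != sl 2(\ a b -> Co ½ *: b *: a =: Co ½ *:(a *: b))Re(ι(tw r))(½^ r)=~ cO(½ **_)(Tw r)=!(ii ½)
     kX : dL <= ι(tw r)
     kX = go(Tt 0q d)
      where
      go : 0q <= d ⊎ d <= 0q -> dL <= ι(tw r)
      go(iL p)= !< rl(np p)<~ ml(-q ι(tw r))(mg(ℕₚ.<⇒≤ lt))<! rl(!= cO(_-q ι(tw r))(xJ(tw r)(tw r))=! sl 1(\ a -> a +: a -: a =: a)Re(ι(tw r)))
      go(iR p)= !< rl(!= sy(pa d)=! np(nt p))<! By(ι j)(nc j)(sl 2(\ j t -> t =: -:(j -: t)+: j)Re(ι j)(ι(tw r)))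
    ub : ∀ j -> j <n N -> 2πi *(oq ν *(W + oa j))<| 7/2
    ub j lt = mo lem(≼-* 2πi-≼(rp(sV 4(\ a w t j -> a :* w :+ a :*(j :- t):= a :*(w :- t :+ j))rR(oq ν)w(oa(tw r))(oa j))(≼-+ sT(o6 j lt))))
     where
     lem :(n2 ** xc)**(q 1 24 ++ ½)<= 7/2
     lem = By(7/2 -q(n2 **(q 81 24))**(q 1 24 ++ ½))(nN _)Re
    Ec : ∀ j -> j <n N -> v j - c * sd(y j)<| B
    Ec j lt = bO{oq ν *(W + oa j)}(pS(ex j))(ub j lt)(uy j)
    Tl : oq((n2 ^^ sC p)^^ sC r)* F - ∑ N(\ j -> c * sd(y j))<| ι N ** B
    Tl = rp(Cg(dw p(sC r)v hW(Su(\ n -> co(ck n(yY(Ei w(tw r)))))rR hF)(\ j -> pS(ex j))))(∑-≼′ N 0≤B Ec)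
    kc = ν ^^(h +n h)
    kY : oq kc * oq((n2 ^^ sC p)^^ sC r)≈ 1#
    kY = !~ yY(ob kc _)~! rx(cO oq(!= cO(kc **_)(!= cO(\ k ->(n2 ^^ k)^^ sC r)mZ =! pw(h +n h)(sC r))=~ sy(dt ν(n2 ^^ sC r)(h +n h))=~ cO(_^^(h +n h))(!= sy(dt ½ n2(sC r))=! 1^ℚ(sC r))=! 1^ℚ(h +n h)))
     where
     1^ℚ : ∀ n -> 1q ^^ n ≡ 1q
     1^ℚ z0 = Re
     1^ℚ(sC n)= !=(iy _)=! 1^ℚ n
     pw : ∀ m n ->(n2 ^^ m)^^ n ≡(n2 ^^ n)^^ m
     pw m z0 = sy(1^ℚ m)
     pw m(sC n)= != cO(n2 ^^ m **_)(pw m n)=! sy(dt n2(n2 ^^ n)m)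
    aS : oq kc * ∑ N(\ j -> c * sd(y j))≈ c * ∑ N(\ j -> sd(o j))
    aS = !~ yY(∑-* N(oq kc)_)~~(ch N \ j -> !~ co(co(sU(oa N)(o j)))~~
     sV 4(\ n c a b -> n :*(c :*(a :* b)):= c :*((n :* a):* b))rR(oq kc)c(sd(oa N))(sd(o j))~! co(!~ cn On ~!(ie _)))~!(∑-* N c(\ j -> sd(o j)))
     where
     On : oq kc * sd(oa N)≈ 1#
     On = !~ cn(!~ rx(cO oq(sy(Qb ν h)))~~ ol(ν ** ν)h ~! ck h(ob ν ν))~~ yY(sU(oq ν)(oa N))~~ sD NH ~~ ck h(ie 1#)~! 1^ h
   rJ : F - c * ∑ N(\ j -> sd(o j))<| B **(ν ^^ 3)
   rJ = mo le(rp(!~ sV 4(\ n m F s -> n :*(m :* F :- s):=(n :* m):* F :- n :* s)rR(oq kc)(oq((n2 ^^ sC p)^^ sC r))F(∑ N(\ j -> c * sd(y j)))~! sb(!~ cn kY ~! ie F)aS)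
    (≼-*(Of kc)Tl))
    where
    bq = lZ(0<½^(sC r))
    fx : ν <= 1q
    fx = nP(sC r)(lZ ni)(By ½(lZ ni)Re)
    3≤ : ∃ \ m -> h +n h ≡ sC(3 +n m)
    3≤ = _ , sy(mm(mC 2≤h 2≤h))
    m = pF 3≤
    le : Q.∣ kc ∣ **(ι N ** B)<= B **(ν ^^ 3)
    le = !< rl(!= cO(_**(ι N ** B))(!= np(nf(h +n h)bq)=! cO(ν ^^_)(pS 3≤))=~
     sl 4(\ n a N B -> n *: a *:(N *: B)=:(N *: n)*:(B *: a))Re ν(ν ^^(3 +n m))(ι N)B =~ cO(_**(B ** ν ^^(3 +n m)))NG =~(iy _)=! cO(B **_)(Q.^-+ ν 3 m))<!
     Mo{_} {ν ^^ 3} {B}0≤B(!< Mo{ν ^^ m} {1q} {ν ^^ 3}(nf 3 bq)(nP m bq fx)<! rl(ii _))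
module Eis where
 open Row public
 open CSolve
 private
  q : ℕ -> ℕ -> ℚ
  q a b =(+ a)// sC b
 ue : ∀ {x y z}-> x * y ≈ 1# -> x * z ≈ 1# -> y ≈ z
 ue{x} {y} {z}xy xz = !~ yY(In y)~~ co(yY xz)~~ sV 3(\ x y z -> y :*(x :* z):=(x :* y):* z)rR x y z ~~ cn xy ~! ie z
 opaque
  unfolding fq _+ℝ_ _*ℝ_ -ℝ_
  iN : ∀ z n -> seq(im z)n ** seq(im z)n <= Nb z n
  iN z n = By(seq(re z)n ** seq(re z)n)(nq(seq(re z)n))(cw(seq(re z)n ** seq(re z)n)_)
 Ia : ∀ {u δ}(h : 0q << δ)-> Im u δ -> ∃ \ y -> u * y ≈ 1# × y <| iv δ h
 Ia{u} {δ}h(N , f)= rc u δ h lb , !~(cp u _)~! Rc u δ h lb , rg u δ h lb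
  where
  lb : u |> δ
  lb = N , \ n le -> !< sn(lZ h)(f n le)<! iN u n
 Ti : ℕ ->(ℕ -> ℂ)->(ℕ -> ℂ)-> ℕ -> ℂ
 Ti z0 a b j = a j
 Ti(sC T)a b z0 = b T
 Ti(sC T)a b(sC j)= Ti T a b j
 Ts : ∀ T n a b(f : ℂ -> ℂ)-> ∑(T +n n)(\ j -> f(Ti T a b j))≈ ∑ n(\ j -> f(a j))+ ∑ T(\ j -> f(b j))
 Ts z0 n a b f = yY(Ie _)
 Ts(sC T)n a b f = !~ Cn(Ts T n a b f)~~(sV 3(\ x y z -> x :+(y :+ z):= y :+(z :+ x))rR(f(b T))_ _)~! Cn(yY(Ls T _))
 ti : ∀ T{w a b}->(∀ n ->(w + oa n)* a n ≈ 1#)->(∀ n ->(w - oa(sC n))* b n ≈ 1#)-> ∀ j ->(w - oa T + oa j)* Ti T a b j ≈ 1#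
 ti z0{w}ha hb j = !~ cn(Cg(!~ Cn(cc o0)~! sV 1(\ w -> w :- # 0q := w)rR w))~! ha j
 ti(sC T) {w} {a} {b}ha hb z0 = !~ cn(!~ Cn o0 ~!(Ie _))~! hb T
 ti(sC T) {w}ha hb(sC j)= !~ cn(!~ ca(Cn(cc(os T)))(os j)~! sV 3(\ w t j -> w :-(# 1q :+ t):+(# 1q :+ j):= w :- t :+ j)rR w(oa T)(oa j))~! ti T ha hb j
 lw : ∀ {x y b ε}n -> 1q <= b -> x <| b -> y <| b -> x - y <| ε -> x ^ n - y ^ n <| ι n ** b ^^ n ** ε
 lw{b = b} {ε}z0 hb hx hy h = rp(yY(ir 1#))(mo(rl(sy(!= cO(\ t -> t ** 1q ** ε)nw =! sl 1(\ e -> Co 0q *: Co 1q *: e =: Co 0q)Re ε)))(Of 0q))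
 lw{x} {y} {b} {ε}(sC n)hb hx hy h = mo le
  (rp(sV 4(\ x y a c -> x :*(a :- c):+(x :- y):* c := x :* a :- y :* c)rR x y(x ^ n)(y ^ n))(≼-+(≼-* hx(lw n hb hx hy h))(≼-* h(≼-^ n hy))))
  where
  b0 = !< n1 <! hb
  le : b **(ι n ** b ^^ n ** ε)++ ε ** b ^^ n <= ι(sC n)**(b ** b ^^ n)** ε
  le = !< mj(b **(ι n ** b ^^ n ** ε))(!< rl(sy(iy(ε ** b ^^ n)))<! ma{1q} {b} {ε ** b ^^ n}(n0(nn h)(nf n b0))hb)<!
   rl(!= sl 4(\ b i p e -> b *:(i *: p *: e)+: b *:(e *: p)=:(Co 1q +: i)*:(b *: p)*: e)Re b(ι n)(b ^^ n)ε =! cO(\ t -> t **(b ** b ^^ n)** ε)(sy(sa n)))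
 nv : ∀ r -> 0q <= ½^ r
 nv r = lZ(0<½^ r)
 nA : ∀ r -> ½^ r <= 1q
 nA r = nP r(lZ ni)(By ½(lZ ni)Re)
 Sh : ∀ a s -> ½^(a +n s)<= ½^ s
 Sh a s = !< rl(Q.^-+ ½ a s)<~ ma{½^ a} {1q} {½^ s}(nv s)(nA a)<! rl(iy(½^ s))
 nX : ∀ C -> 0q <= C -> Nx(\ s -> C ** ½^ s)
 nX C h = pu C h(lZ ni)aE
 tp : ∀ s -> ∃ \ t -> tw s ≡ sC t
 tp z0 = 0 , Re
 tp(sC s)= _ , cO(_+n tw s)(pS(tp s))
 rb : ℕ -> ℂ
 rb n = oq(iv(ι(sC n))(nd n))
 rv : ∀ n -> oa(sC n)* rb n ≈ 1#
 rv n = !~ yY(ob _ _)~! rx(cO oq(Iv(nd n)))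
 rj : ∀ n -> rb n <| iv(ι(sC n))(nd n)
 rj n = sB(rb n <|_)(np(lZ(i0(nd n))))(Of _)
 1≤ι : ∀ n -> 1q <= ι(sC n)
 1≤ι n = By(ι n)(nc n)(sa n)
 r1 : ∀ n -> rb n <| 1q
 r1 n = mo(iA(nd n)(1≤ι n))(rj n)
 module EI (K : Ke) where
  open Ke K
  open Rz K public
  sW : ∀ x -> sd(- x)≈ sd x
  sW x = ck h(sV 1(\ x ->(:- x):*(:- x):= x :* x)rR x)
  sX : ∀ {x b}-> x <| b -> sd x <|(b ** b)^^ h
  sX hx = ≼-^ h(≼-* hx hx)
  4ℚ′ : ℚ
  4ℚ′ = n2 ** n2
  Lp : ℚ
  Lp = ι h ** 4ℚ′ ^^ h ** 4ℚ′
  0≤2ℚ : 0q <= n2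
  0≤2ℚ = N0 n1 n1
  0≤4ℚ′ : 0q <= 4ℚ′
  0≤4ℚ′ = n0 0≤2ℚ 0≤2ℚ
  0≤Lp : 0q <= Lp
  0≤Lp = n0(n0(nc h)(nf h 0≤4ℚ′))0≤4ℚ′
  aI : ∀ {x y ε}-> x <| n2 -> y <| n2 -> x - y <| ε -> sd x - sd y <| Lp ** ε
  aI{x} {y} {ε}hx hy hL = mo(rl(sl 3(\ i p e -> i *: p *:(e *: Co 4ℚ′)=: i *: p *: Co 4ℚ′ *: e)Re(ι h)(4ℚ′ ^^ h)ε))
   (lw h(By 3ℚ(N0 n1 0≤2ℚ)Re)(≼-* hx hx)(≼-* hy hy)(rp(sV 2(\ x y ->(x :- y):*(x :+ y):= x :* x :- y :* y)rR x y)(≼-* hL(≼-+ hx hy))))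
  cb : ∃ \ b -> c <| b
  cb = ei c
  H1 : ∃ \ m -> h ≡ sC m
  H1 = _ , sy(mm(N1 1 ≤~ 2≤h))
  p8 : ∀ a -> 0q <= a -> a <= 1q -> a ^^ h <= a
  p8 a a0 a1 = sB(\ n -> a ^^ n <= a)(sy(pS H1))(!< Mo{_} {1q} {a}a0(nP(pF H1)a0 a1)<! rl(ii a))
  module SJ {w η} (hw : w <| η) (xt : η <= ½) where
   private
    u : ℕ -> ℂ
    u n = -(w * rb n)
    ub : ∀ n -> u n <| η
    ub n = sB(u n <|_)(ii η)(Ne(≼-* hw(r1 n)))
    1-½ : 0q << 1q -q ½
    1-½ = ni
    nm : ∀ n -> ∃ \ v -> v *(1# - u n)≈ 1# × v <| iv(1q -q ½)1-½
    nm n = aG 1-½ aE(mo xt(ub n))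
    v : ℕ -> ℂ
    v n = pF(nm n)
    vq : ∀ n -> v n <| n2
    vq n = sB(v n <|_)(!= sy(iy _)=~ cO(\ t -> t ** iv(1q -q ½)1-½) {1q} {n2 **(1q -q ½)}Re =~ ac n2(1q -q ½)(iv(1q -q ½)1-½)=! cO(n2 **_)(Iv 1-½))(pS(pS(nm n)))
   Na : ℕ -> ℂ
   Na n = rb n * v n
   nQ : ∀ n ->(w + oa(sC n))* Na n ≈ 1#
   nQ n = !~ sV 4(\ w i r v ->(w :+ i):*(r :* v):= v :*(i :* r :-(:-(w :* r))))rR w(oa(sC n))(rb n)(v n)~~ co(Cg(rv n))~! pF(pS(nm n))
   nJ : ∀ n -> Na n <| iv(ι(sC n))(nd n)** n2
   nJ n = ≼-*(rj n)(vq n)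
   Nc : ∀ n -> Na n <| n2
   Nc n = mo(rl(iy n2))(≼-*(r1 n)(vq n))
   Nr : ∀ n -> Na n - rb n <| n2 ** η
   Nr n = mo(rl(sl 1(\ e -> Co 1q *:(Co n2 *: e)=: Co n2 *: e)Re η))(rp(!~ sV 3(\ r v u -> r :*(v :* u):= r :* v :- r :*(v :*(# 1q :- u)))rR(rb n)(v n)(u n)~!
    Cn(cc(!~ co(pF(pS(nm n)))~! In(rb n))))(≼-*(r1 n)(≼-*(vq n)(ub n))))
  Ef : ℚ
  Ef = Q.∣ C ∣ **((n2 ** xc)**(n2 ** xc))++ B ++ pF cb **(Lp ** n2 ++ Lp ** n2 ++ 4ℚ′ ^^ h)
  module RA (s k : ℕ) (kd : k ≡ 5 +n (s +n s)) where
   private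
    T = tw s
    σ = ½^ s
    η = ½^ k
    xQ : η ≡ ½^ 5 **(σ ** σ)
    xQ = !=(!=(cO ½^ kd)=!(Q.^-+ ½ 5(s +n s)))=! cO(½^ 5 **_)(Q.^-+ ½ s s)
    N5 : ½^ 5 <= q 1 24
    N5 = By(q 1 24 -q ½^ 5)(nN _)Re
    xA : σ ** σ <= σ
    xA = !< Mo{σ} {1q} {σ}(nv s)(nA s)<! rl(ii σ)
    n5 : η <= ½^ 5
    n5 = !< rl(!=(cO ½^ kd)=!(Q.^-+ ½ 5(s +n s)))<~ Mo{½^(s +n s)} {1q} {½^ 5}(nv 5)(nA(s +n s))<! rl(ii(½^ 5))
    xt : η <= ½
    xt = !< n5 <! By(½ -q ½^ 5)(nN _)Re
    nY : 0q <= η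
    nY = nv k
    w : ℂ
    w = 𝕚 * oq η
    wf : w <| η
    wf = mo(rl(!=(iy Q.∣ η ∣)=! np nY))(≼-* xq(Of η))
    hw : Hp w
    hw = η , 0<½^ k , 0 , \ n _ -> rl(sy(kZ n))
     where
     opaque
      unfolding fq _+ℝ_ _*ℝ_ -ℝ_
      kZ : ∀ n -> seq(im w)n ≡ η
      kZ n = sl 1(\ e -> Co 0q *: Co 0q +: Co 1q *: e =: e)Re η
    ex = Po p{w}hw
    F = pF ex
    module P = SJ {w} wf xt
    module M = SJ { - w} (Ne wf) xt
    iq : ℂ
    iq = - 𝕚 * oa(tw k)
    Wi : w * iq ≈ 1#
    Wi = !~ sV 3(\ i a b -> i :* a :*((:- i):* b):=(:-(i :* i)):*(b :* a))rR 𝕚(oq η)(oa(tw k))~~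
     cd(cc xn)(!~ yY(ob _ _)~! rx(cO oq(Tw k)))~! sV 0((:-(:- # 1q)):* # 1q := # 1q)rR
    a b : ℕ -> ℂ
    a z0 = iq
    a(sC n)= P.Na n
    b n = - M.Na n
    ha : ∀ n ->(w + oa n)* a n ≈ 1#
    ha z0 = !~ cn(!~ Cn o0 ~! Ie w)~! Wi
    ha(sC n)= P.nQ n
    hb : ∀ n ->(w - oa(sC n))* b n ≈ 1#
    hb n = !~ sV 3(\ w i y ->(w :- i):*(:- y):=((:- w):+ i):* y)rR w(oa(sC n))(M.Na n)~! M.nQ n
    sm : oq(½^(sC s))* w <| q 1 24
    sm = mo(!< ma{Q.∣ ½^(sC s)∣} {1q} {η}nY(!< rl(np(nv(sC s)))<! nA(sC s))<~ rl(iy η)<~ n5 <! N5)(≼-*(Of(½^(sC s)))wf)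
    fV p9 qv : ℂ
    fV = ∑ T(\ n -> sd(rb n))
    p9 = ∑ T(\ n -> sd(P.Na n))
    qv = ∑ T(\ n -> sd(M.Na n))
    fW fX : ℂ
    fW = ∑ T(\ n -> sd(a n))
    fX = ∑ T(\ n -> sd(b n))
    fy : F - c *(fW + fX)<| B **(½^(sC s)^^ 3)
    fy = rp(Cn(cc(co(Ts T T a b sd))))(rJ s(Ti T a b)hw(pS ex)(ti T ha hb)sm)
    fz : F - c * sd iq - oq ζ <| C **((n2 ** xc ** η)**(n2 ** xc ** η))
    fz = n3{w} {iq}(pS ex)(mo(!< Mo{η} {½} {n2 ** xc}(n0 0≤2ℚ nT)xt <! By(7/2 -q n2 ** xc ** ½)(nN _)Re)(≼-* 2πi-≼ wf))(≼-* 2πi-≼ wf)Wi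
    lR : fW + sd(a T)≈ sd iq + p9
    lR = yY(Ls T(\ n -> sd(a n)))
    aT : ∃ \ t -> T ≡ sC t
    aT = tp s
    Fo : ∀ x ->(x ** n2)**(x ** n2)≡ 4ℚ′ **(x ** x)
    Fo x = sl 2(\ x t ->(x *: t)*:(x *: t)=:(t *: t)*:(x *: x))Re x n2
    lI : ∀ x -> x ≡ σ ->((x ** n2)**(x ** n2))^^ h <= 4ℚ′ ^^ h ** σ
    lI x e = !< rl(!= cO(_^^ h)(!= Fo x =! cO(\ y -> 4ℚ′ **(y ** y))e)=! dt 4ℚ′(σ ** σ)h)<!
     Mo{(σ ** σ)^^ h} {σ} {4ℚ′ ^^ h}(nf h 0≤4ℚ′)(!< p8(σ ** σ)(nq σ)(!< xA <! nA s)<! xA)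
    iO : ∀ t -> T ≡ sC t -> iv(ι(sC t))(nd t)≡ σ
    iO t e = != sy(iy(iv(ι(sC t))(nd t)))=~ cO(_** iv(ι(sC t))(nd t))(sy(Tw s))=~ sl 3(\ t s i -> t *: s *: i =: s *:(t *: i))Re(ι T)σ(iv(ι(sC t))(nd t))=~
     cO(\ n -> σ **(ι n ** iv(ι(sC t))(nd t)))e =~ cO(σ **_)(Iv(nd t))=! ii σ
    n8 : ∀ t -> T ≡ sC t -> sd(P.Na t)<| 4ℚ′ ^^ h ** σ
    n8 t e = mo(lI(iv(ι(sC t))(nd t))(iO t e))(sX{P.Na t} {iv(ι(sC t))(nd t)** n2}(P.nJ t))
    AT : sd(a T)<| 4ℚ′ ^^ h ** σ
    AT = go(tw s)(pF aT)(pS aT)(n8(pF aT)(pS aT))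
     where
     go : ∀ n t -> n ≡ sC t -> sd(P.Na t)<| 4ℚ′ ^^ h ** σ -> sd(a n)<| 4ℚ′ ^^ h ** σ
     go _ t Re x = x
    Tx : ι T **(Lp **(n2 ** η))<= Lp ** n2 ** σ
    Tx = !< rl(!= cO(\ t -> ι T **(Lp **(n2 ** t)))xQ =! sl 4(\ t l s f -> t *:(l *:(Co n2 *:(f *:(s *: s))))=:(t *: s)*:((l *: Co n2 *: s)*: f))Re(ι T)Lp σ(½^ 5))<~
     rl(!= cO(_**(Lp ** n2 ** σ ** ½^ 5))(Tw s)=!(iy _))<~ Mo{½^ 5} {1q} {Lp ** n2 ** σ}(n0(n0 0≤Lp 0≤2ℚ)(nv s))(nA 5)<! rl(ii _)
    0≤e : 0q <= Lp **(n2 ** η)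
    0≤e = n0 0≤Lp(n0 0≤2ℚ nY)
    R2 : ∀ n -> rb n <| n2
    R2 n = mo(By 1q n1 Re)(r1 n)
    dp : p9 - fV <| Lp ** n2 ** σ
    dp = mo Tx(∑-≼′ T{\ n -> sd(P.Na n)} {\ n -> sd(rb n)}0≤e \ i _ -> aI(P.Nc i)(R2 i)(P.Nr i))
    dm : fX - fV <| Lp ** n2 ** σ
    dm = mo Tx(∑-≼′ T{\ n -> sd(b n)} {\ n -> sd(rb n)}0≤e \ i _ -> rp(Cg(yY(sW(M.Na i))))(aI(M.Nc i)(R2 i)(M.Nr i)))
    lg : C **((n2 ** xc ** η)**(n2 ** xc ** η))<= Q.∣ C ∣ **((n2 ** xc)**(n2 ** xc))** σ
    lg = !< ma{C} {Q.∣ C ∣} {(n2 ** xc ** η)**(n2 ** xc ** η)}(nq(n2 ** xc ** η))(pp C)<~ rl(sl 3(\ c t e -> c *:((t *: e)*:(t *: e))=: c *:(t *: t)*:(e *: e))Re Q.∣ C ∣(n2 ** xc)η)<!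
     Mo{η ** η} {σ} {Q.∣ C ∣ **((n2 ** xc)**(n2 ** xc))}(n0(Np C)(nq(n2 ** xc)))
      (!< Mo{η} {1q} {η}nY(nA k)<~ rl(ii η)<~ rl(cO ½^ kd)<~ Sh 5(s +n s)<! Sh s s)
    lh : B **(½^(sC s)^^ 3)<= B ** σ
    lh = Mo{½^(sC s)^^ 3} {σ} {B}0≤B(!< Mo{½^(sC s)^^ 2} {1q} {½^(sC s)}(nv(sC s))(nP 2(nv(sC s))(nA(sC s)))<~ rl(ii _)<! Sh 1 s)
   Rw : oq ζ - oq n2 * c * ∑(tw s)(\ n -> sd(rb n))<| Ef ** ½^ s
   Rw = mo(!< mi(mi lg lh)ra <! rl(sl 6(\ x b c l f s -> x *: s +: b *: s +: c *:(l *: s +: l *: s +: f *: s)=:(x +: b +: c *:(l +: l +: f))*: s)Re(Q.∣ C ∣ **((n2 ** xc)**(n2 ** xc)))B(pF cb)(Lp ** n2)(4ℚ′ ^^ h)σ))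
    (rp eq(≼-+(≼-+(Ne fz)fy)(≼-*(pS cb)(sj(≼-+ dp dm)AT))))
    where
    eq : -(F - c * sd iq - oq ζ)+(F - c *(fW + fX))+ c *(p9 - fV +(fX - fV) - sd(a T))≈ oq ζ - oq n2 * c * fV
    eq = !~ ca(sV 3(\ X Y z ->(:-(X :- z)):+ Y := z :+(Y :- X))rR(F - c * sd iq)(F - c *(fW + fX))(oq ζ))(co(Cn(cc
     (!~ sV 2(\ x y -> y := x :+ y :- x)rR fW(sd(a T))~! Cg lR))))~~
     Cg(Cn(sV 4(\ F c i m -> F :- c :* m :-(F :- c :* i):= c :*(i :- m))rR F c(sd iq)(fW + fX)))~~
     sV 4(\ z c m n -> z :+ c :* m :+ c :* n := z :+ c :*(m :+ n))rR(oq ζ)c(sd iq -(fW + fX))(p9 - fV +(fX - fV) -(sd iq + p9 - fW))~~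
     Cn(co(sV 5(\ i A Bb P D ->(i :-(A :+ Bb)):+(P :- D :+(Bb :- D):-(i :+ P :- A)):= :-(# n2 :* D))rR(sd iq)fW fX p9 fV))~!
      Cn(sV 2(\ c D -> c :*(:-(# n2 :* D)):= :-(# n2 :* c :* D))rR c fV)
module Box where
 open Eis public hiding (D)
 open CSolve
 private
  q : ℕ -> ℕ -> ℚ
  q a b =(+ a)// sC b
 Hw : ∀ {u}-> Hp u -> ∃ \ y -> u * y ≈ 1#
 Hw{u}(δ , h , f)= let y , a , _ = Ia{u}h f in y , a
 tq : ∀ {M T b} {f : ℕ -> ℂ}-> M ≤n T -> 0q <= b ->(∀ i -> M ≤n i -> f i <| b)-> ∑ T f - ∑ M f <| ι T ** b
 tq{M} {T} {b} {f}le hb h = mo(ma{ι(T -n M)} {ι T} {b}hb(mg(mO T M)))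
  (rp(!~ sV 2(\ x y -> y := x :+ y :- x)rR(∑ M f)(∑(T -n M)(\ i -> f(M +n i)))~! Cg(!~ yY(sp M(T -n M)f)~! rx(cO(\ k -> ∑ k f)(mm le))))
   (∑-≼(T -n M)hb \ i _ -> h(M +n i)(me M i)))
 module BK (K : Ke) where
  open Ke K
  open EI K public
  module Pair {z za : ℂ} (hz : Hp z) (Hz : Hp za) (zz : z * za ≈ - 1#) where
   private
    mz : ∀ m -> Hp(oa(sC m)* z)
    mz m = Hc{z} {ι(sC m)}(nd m)hz
    fA : ∀ m n -> ∃ \ y ->(oa(sC m)* z + oa n)* y ≈ 1#
    fA m n = Hw{oa(sC m)* z + oa n}(Hb{oa(sC m)* z}(ι n)(mz m))
    fB : ∀ m n -> ∃ \ y ->(oa(sC m)* z - oa(sC n))* y ≈ 1#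
    fB m n = Hw{oa(sC m)* z - oa(sC n)}(He{oa(sC m)* z + oq(-q ι(sC n))} {oa(sC m)* z - oa(sC n)}(Cn(oe(ι(sC n))))(Hb{oa(sC m)* z}(-q ι(sC n))(mz m)))
   opaque
    op om : ℕ -> ℕ -> ℂ
    op m n = pF(fA m n)
    om m n = pF(fB m n)
    ow : ∀ m n ->(oa(sC m)* z + oa n)* op m n ≈ 1#
    ow m n = pS(fA m n)
    Om : ∀ m n ->(oa(sC m)* z - oa(sC n))* om m n ≈ 1#
    Om m n = pS(fB m n)
   fC : ℕ -> ℕ -> ℂ
   fC m n = sd(op m(sC n))+ sd(om m n)
   ll : ℕ -> ℕ -> ℂ
   ll M m = sd(op m 0)+ ∑ M(fC m)
   Hx : ℕ -> ℂ
   Hx M = ∑ M(\ n -> sd(rb n))+ ∑ M(ll M)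
   private
    xa = pF Hz
    nk = pF(pS Hz)
    k0 = pS(pS Hz)
    qa = pF(ei za)
    R : ℚ
    R = qa ** iv xa nk
    R0 : 0q <= R
    R0 = n0(nn(pS(ei za)))(lZ(i0 nk))
    fU : ∀ s n r -> tw s ≤n n -> ∃ \ y ->(oa n * za + oq r)* y ≈ 1# × za * y <| R ** ½^ s
    fU s n r le = let y , a , b = Ia{oa n * za + oq r}l0 jp in y , a , sB(za * y <|_)(!= cO(qa **_)iO =! sy(ac qa(iv xa nk)(½^ s)))(≼-*(pS(ei za))b)
     where
     lo = ι(tw s)** xa
     f3 : 0q << ι(tw s)
     f3 = sB(\ k -> 0q << ι k)(sy(pS(tp s)))(nd(pF(tp s)))
     l0 : 0q << lo
     l0 = nD f3 nk
     jp : Im(oa n * za + oq r)lo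
     jp = wn(Hb{oa n * za}r(Hc{za} {ι n}(Tn f3(mg le))Hz))
      where
      wn : ∀ h -> Im(oa n * za + oq r)lo
      wn _ = pF k0 , \ k p -> !< ma{ι(tw s)} {ι n} {xa}(lZ nk)(mg le)<! pS(pS(pS(Hb{oa n * za}r(Hc{za} {ι n}(Tn f3(mg le))Hz))))k p
     iO : iv lo l0 ≡ iv xa nk ** ½^ s
     iO = != sy(ii(iv lo l0))=~ cO(iv lo l0 **_)(sy(!=(cong₂ _**_(Tw s)(Iv nk))=! iy 1q))=~
      sl 5(\ l t h d i -> l *:((t *: h)*:(d *: i))=:(l *:(t *: d))*:(i *: h))Re(iv lo l0)(ι(tw s))(½^ s)xa(iv xa nk)=~ cO(_**(iv xa nk ** ½^ s))(iz l0)=!(iy _)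
    oB : ∀ s m n -> tw s ≤n n -> op m n <| R ** ½^ s
    oB s m n le = let y , a , b = fU s n(-q ι(sC m))le in
     rp(ue(!~ cn(!~ Cn(!~ sV 1(\ n -> n :=(:- n):*(:- # 1q))rR(oa n)~! co(yY zz))~! sV 4(\ m z n za -> m :* z :+(:- n):*(z :* za):= z :*(:-(n :* za :- m)))rR(oa(sC m))z(oa n)za)~~
      sV 4(\ z u za y -> z :*(:- u):*(za :* y):=(:-(z :* za)):*(u :* y))rR z(oa n * za - oa(sC m))za y ~~ cd(cc zz)(!~ cn(Cn(yY(oe(ι(sC m)))))~! a)~! sV 0((:-(:- # 1q)):* # 1q := # 1q)rR)(ow m n))b
    oC : ∀ s m n -> tw s ≤n n -> om m n <| R ** ½^ s
    oC s m n le = let y , a , b = fU s(sC n)(ι(sC m))(m1 le)in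
     rp(ue(!~ cn(!~ Cn(!~ sV 1(\ n -> :- n := n :*(:- # 1q))rR(oa(sC n))~! co(yY zz))~! sV 4(\ m z n za -> m :* z :+ n :*(z :* za):= z :*(n :* za :+ m))rR(oa(sC m))z(oa(sC n))za)~~
      sV 4(\ z u za y -> z :* u :*(:-(za :* y)):=(:-(z :* za)):*(u :* y))rR z(oa(sC n)* za + oa(sC m))za y ~~ cd(cc zz)a ~! sV 0((:-(:- # 1q)):* # 1q := # 1q)rR)(Om m n))(Ne b)
   module Ax (F : ℕ -> ℂ) (hF : ∀ m -> Pw p (e (oa (sC m) * z)) (F m)) {ρ : ℚ} (jS : z <| ρ) (a : ℕ) (qw : ½^ (sC (sC a)) ** ρ <= q 1 24) where
    private
     Rr =(R ** R)^^ h
     r0 : 0q <= Rr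
     r0 = nf h(n0 R0 R0)
     D : ℚ
     D = ι(tw(sC a))** Rr
     D0 : 0q <= D
     D0 = n0(nc(tw(sC a)))r0
     b = pF cb
     b0 = nn(pS cb)
    E : ℚ
    E = B ++ b **(D ++ D)
    tF : ∀ a s -> ι(tw(a +n s))≡ ι(tw a)** ι(tw s)
    tF z0 s = sy(!= cO(_** ι(tw s))(!= sa 0 =! cO(1q ++_)nw)=!(iy _))
    tF(sC a)s = != xJ(tw(a +n s))(tw(a +n s))=~(cong₂ _++_(tF a s)(tF a s))=~ sy(dq(ι(tw s))(ι(tw a))(ι(tw a)))=! cO(_** ι(tw s))(sy(xJ(tw a)(tw a)))
    tk : ∀ a s -> tw s ≤n tw(a +n s)
    tk z0 s = Rf
    tk(sC a)s = tk a s ≤~(me _ _)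
    bQ : ∀ a s -> sC(tw s)≤n tw(sC a +n s)
    bQ a s = mA(tw s)(ss zn ≤~ ri(sy(pS(tp s))))≤~ mC(tk a s)(tk a s)
    module _ (s : ℕ) where
     private
      σ = ½^ s
      M = tw s
      r = sC a +n s
      T = tw r
      bt = nv s
      bw = nA s
      k1 : ℚ
      k1 =((R ** σ)**(R ** σ))^^ h
      bh : 0q <= k1
      bh = nf h(nq(R ** σ))
      aV = nq σ
      aW : σ ** σ <= 1q
      aW = !< Mo{σ} {1q} {σ}bt bw <~ rl(ii σ)<! bw
      P2 :(σ ** σ)^^ h <=(σ ** σ)^^ 2
      P2 = sB(\ n ->(σ ** σ)^^ n <=(σ ** σ)^^ 2)(mm 2≤h)(!< rl(Q.^-+(σ ** σ)2(h -n 2))<~ Mo{(σ ** σ)^^(h -n 2)} {1q} {(σ ** σ)^^ 2}(nf 2 aV)(nP(h -n 2)aV aW)<! rl(ii _))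
      xL = σ ^^ 3
      Tb : ι T ** k1 <= D ** xL
      Tb = !< rl(cong₂ _**_(tF(sC a)s)(!= cO(_^^ h)(sl 2(\ r s ->(r *: s)*:(r *: s)=:(r *: r)*:(s *: s))Re R σ)=! dt(R ** R)(σ ** σ)h))<~
       Mo{Rr **(σ ** σ)^^ h} {Rr **(σ ** σ)^^ 2} {ι(tw(sC a))** ι M}(n0(nc(tw(sC a)))(nc M))(Mo{(σ ** σ)^^ h} {(σ ** σ)^^ 2} {Rr}r0 P2)<!
       rl(!= sl 4(\ t m r s ->(t *: m)*:(r *:((s *: s)*:((s *: s)*: Co 1q)))=:(m *: s)*:(t *: r *:(s *:(s *:(s *: Co 1q)))))Re(ι(tw(sC a)))(ι M)Rr σ =~ cO(_**(D ** xL))(Tw s)=!(iy _))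
      Sp Sm : ℕ -> ℕ -> ℂ
      Sp m k = ∑ k(\ n -> sd(op m n))
      Sm m k = ∑ k(\ n -> sd(om m n))
      tJ : ∀ m -> Sp m T - Sp m(sC M)<| D ** xL
      tJ m = mo Tb(tq{sC M} {T}(bQ a s)bh \ i le -> sX{op m i} {R ** σ}(oB s m i(N1 M ≤~ le)))
      tK : ∀ m -> Sm m T - Sm m M <| D ** xL
      tK m = mo Tb(tq{M} {T}(tk(sC a)s)bh \ i le -> sX{om m i} {R ** σ}(oC s m i le))
      sm : ∀ m -> m <n M -> oq(½^(sC r))*(oa(sC m)* z)<| q 1 24
      sm m lt = mo(!<(!< Mo{ι(sC m)** ρ} {ι M ** ρ} {Q.∣ ½^(sC r)∣}(Np _)(ma{ι(sC m)} {ι M} {ρ}(nn jS)(mg lt))<! rl(!= cO(_**(ι M ** ρ))(!= np(nv(sC r))=!(Q.^-+ ½(sC(sC a))s))=~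
       sl 4(\ x s m r -> x *: s *:(m *: r)=:(m *: s)*:(x *: r))Re(½^(sC(sC a)))σ(ι M)ρ =~ cO(_**(½^(sC(sC a))** ρ))(Tw s)=!(iy _)))<! qw)
       (≼-*(Of(½^(sC r)))(≼-*(oo(sC m))jS))
      fy : ∀ m -> m <n M -> F m - c *(Sp m T + Sm m T)<| B ** xL
      fy m lt = mo(Mo{½^(sC r)^^ 3} {xL} {B}0≤B(mu 3(nv(sC r))(Sh(sC(sC a))s)))
       (rp(Cn(cc(co(Ts T T(op m)(om m)sd))))(rJ r(Ti T(op m)(om m))(mz m)(hF m)(ti T(ow m)(Om m))(sm m lt)))
      ln : ∀ m -> ll M m ≈ Sp m(sC M)+ Sm m M
      ln m = !~ Cn(∑-+ M(\ n -> sd(op m(sC n)))(\ n -> sd(om m n)))~! yY(bE _ _ _)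
      fD : ∀ m -> m <n M -> F m - c * ll M m <| E ** xL
      fD m lt = mo(rl(sl 4(\ B b D s -> B *: s +: b *:(D *: s +: D *: s)=:(B +: b *:(D +: D))*: s)Re B b D xL))
       (rp(!~ sV 6(\ F c p m pv m′ -> F :- c :*(p :+ m):+ c :*((p :- pv):+(m :- m′)):= F :- c :*(pv :+ m′))rR(F m)c(Sp m T)(Sm m T)(Sp m(sC M))(Sm m M)~! Cn(cc(co(yY(ln m)))))
        (≼-+(fy m lt)(≼-*(pS cb)(≼-+(tJ m)(tK m)))))
      EB : 0q <= E
      EB = N0 0≤B(n0 b0(N0 D0 D0))
     rF : ∑ M F - c * ∑ M(ll M)<| E ** σ
     rF = mo(!< rl(!= sl 3(\ m e s -> m *:(e *:(s *:(s *:(s *: Co 1q))))=:(m *: s)*:(e *: s *: s))Re(ι M)E σ =~ cO(_**(E ** σ ** σ))(Tw s)=!(iy _))<~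
      Mo{σ} {1q} {E ** σ}(n0 EB bt)bw <! rl(ii _))
      (rp(Cn(cc(∑-* M c(ll M))))(∑-≼′ M{F} {\ m -> c * ll M m}(n0 EB(nf 3 bt))fD))
     jq :(oq ζ + oq n2 * ∑ M F) - oq n2 * c * Hx M <|(Ef ++ n2 ** E)** σ
     jq = mo(rl(sl 3(\ e x s -> e *: s +: Co n2 *:(x *: s)=:(e +: Co n2 *: x)*: s)Re Ef E σ))
      (rp(sV 5(\ z c d S L -> z :- # n2 :* c :* d :+ # n2 :*(S :- c :* L):=(z :+ # n2 :* S):- # n2 :* c :*(d :+ L))rR(oq ζ)c(∑ M(\ n -> sd(rb n)))(∑ M F)(∑ M(ll M)))
       (≼-+(RA.Rw s(5 +n(s +n s))Re)(≼-*(Of n2)rF)))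
module EisS where
 open Box public
 open import Data.Nat.DivMod as DM using (_/_;_%_)
 open CSolve
 private
  q : ℕ -> ℕ -> ℚ
  q a b =(+ a)// sC b
 Nt : ∀ n -> n ≤n tw n
 Nt z0 = zn
 Nt(sC n)= mB 1(Nt n)≤~ mA(tw n)(ss zn ≤~ ri(sy(pS(tp n))))
 lu :(ℕ -> ℂ)-> ℕ -> ℂ
 lu a n = ∑ n(\ m -> dH m a n)
 module LA (a : ℕ -> ℂ) (a0 : a 0 ≈ 0#) (ga : Gr 1q a) where
  dM : ∀ m n -> n ≤n m -> dH m a n ≈ 0#
  dM m z0 _ = !~ Dy m a 0 ~! a0
  dM m(sC n)le = dK m a(sC n)\ eq -> gN(!= sy(DM.m<n⇒m%n≡m(ss le))=! eq)
  LN : ∀ N n -> n ≤n N -> ∑ N(\ m -> dH m a n)≈ lu a n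
  LN N n le = !~ rx(cO(\ k -> ∑ k(\ m -> dH m a n))(sy(mm le)))~~(sp n(N -n n)_)~~ Cn(nB(N -n n)\ i _ -> dM(n +n i)n(me n i))~!(Ie _)
  Gl : Gr 1q(lu a)
  Gl = Gk(\ n r h -> h)(GA(\ δ hH -> pF(ga δ hH), pF(pS(ga δ hH)), \ n ->
   ∑-≼ n(nn(pS(pS(Gi 0 ga δ hH))n))\ m _ -> pS(pS(Gi m ga δ hH))n))
   where
   GA : ∀ {c}->(∀ δ -> 0q << δ -> ∃ \ C -> 0q <= C ×(∀ n -> c n <| ι n **(C **(1q **(1q ++ δ))^^ n)))-> Gr 1q c
   GA{c}h δ hH =
    let xa , hg , le = Hv δ hH;C , hC , d = h xa hg;b = \ δ -> 1q **(1q ++ δ);i = 1q ++ iv xa hg;iE : 0q <= i;iE = N0 n1(lZ(i0 hg));b0 : 0q <= b xa;b0 = n0 n1(N0 n1(lZ hg));bb :(1q ++ xa)** b xa <= b δ;bb = !< rl(sl 1(\ d ->(Co 1q +: d)*:(Co 1q *:(Co 1q +: d))=:(Co 1q +: d)*:(Co 1q +: d))Re xa)<~ le <! rl(sy(iy(1q ++ δ)))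
    in C ** i , n0 hC iE , \ n -> mo
     (!< ma{ι n} {i **(1q ++ xa)^^ n} {C ** b xa ^^ n}(n0 hC(nf n b0))(!< mg(N1 n)<! li xa hg n)<~
     rl(!= sl 4(\ i x c y -> i *: x *:(c *: y)=:(c *: i)*:(x *: y))Re i((1q ++ xa)^^ n)C(b xa ^^ n)=! cO(C ** i **_)(sy(dt(1q ++ xa)(b xa)n)))<!
      Mo{((1q ++ xa)** b xa)^^ n} {b δ ^^ n} {C ** i}(n0 hC iE)(mu n(n0(N0 n1(lZ hg))b0)bb))(d n)
  module _ {u : ℂ} (hu : Hp u) (F : ℕ -> ℂ) (hF : ∀ m -> Sa (\ n -> a n * (e u ^ sC m) ^ n) (F m)) {S : ℂ} (hS : Sa (\ n -> lu a n * e u ^ n) S) where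
   private
    δ = pF hu
    g : ∀ m -> Go(\ n -> dH m a n * e u ^ n)
    g m = gH(Gi m ga)hu
    HF : ∀ m -> Sa(\ n -> dH m a n * e u ^ n)(F m)
    HF m = SI m a(e u)(g m)(hF m)
    gx = g 0
    open Go gx using (κ;0≤κ;nu;Tl;0≤total)
    rt = rE 0≤κ nu
    open Rk rt using (xh;0≤κ′;nS) renaming (B to Br;0≤B to 0≤Br;dS to oJ)
    fy : ∀ N -> ∑ N F - ∑ N(\ n -> lu a n * e u ^ n)<|(Tl ** Br)** xh ^^ N
    fy N = mo(!< ma{ι N} {ι(sC N)} {Tl ** κ ^^ N}(n0 0≤total(nf N 0≤κ))(mg(N1 N))<~
     rl(sl 3(\ i t k -> i *:(t *: k)=: t *:(i *: k))Re(ι(sC N))Tl(κ ^^ N))<~ Mo{ι(sC N)** κ ^^ N} {Br ** xh ^^ N} {Tl}0≤total(oJ N)<! rl(sy(ac Tl Br(xh ^^ N))))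
     (rp(Cn(cc eq))(∑-≼′ N{F} {\ m -> ∑ N(\ n -> dH m a n * e u ^ n)}(n0 0≤total(nf N 0≤κ))\ m _ ->
      rp(Cg(Ss(gu(g m))(HF m)))(gi(g m)N)))
     where
     eq : ∑ N(\ m -> ∑ N(\ n -> dH m a n * e u ^ n))≈ ∑ N(\ n -> lu a n * e u ^ n)
     eq = !~ Sw N N(\ m n -> dH m a n * e u ^ n)~!(cy N \ n lt -> !~(∑-*ʳ N(e u ^ n)(\ m -> dH m a n))~! cn(LN N n(ℕₚ.<⇒≤ lt)))
   Lm : Sa F S
   Lm = Rs(\ N -> sV 2(\ x y -> y :+(x :- y):= x)rR(∑ N F)(∑ N(\ n -> lu a n * e u ^ n)))(Ie S)
    (⟶-+ hS(Sz(pu(Tl ** Br)(n0 0≤total 0≤Br)0≤κ′ nS)\ N -> rp(sV 1(\ x -> x := x :- # 0q)rR _)(fy N)))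
 module EK (K : Ke) where
  open Ke K
  open BK K public
  module Sym {z za : ℂ} (hz : Hp z) (Hz : Hp za) (zz : z * za ≈ - 1#) where
   zj : za * z ≈ - 1#
   zj = !~ cp za z ~! zz
   module P = Pair hz Hz zz
   module P′ = Pair Hz hz zj
   private
    Zz : ∀ {x y}-> x * y ≈ 1# ->(-(z * za))*(x * y)≈ 1#
    Zz xy = !~ cd(cc zz)xy ~! sV 0((:-(:- # 1q)):* # 1q := # 1q)rR
    cl : ∀ m -> sd(P′.op m 0)≈ sd z * sd(rb m)
    cl m = !~ sD(ue(P′.ow m 0)(!~ cn(!~ Cn o0 ~!(Ie _))~~ sV 4(\ m z za r -> m :* za :*(:-(z :* r)):=(:-(z :* za)):*(m :* r))rR(oa(sC m))z za(rb m)~! Zz(rv m)))~~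
     sW(z * rb m)~! sU z(rb m)
    c9 : ∀ n -> sd(rb n)≈ sd z * sd(P.op n 0)
    c9 n = !~ sD(ue(rv n)(!~ sV 3(\ n z o -> n :*(z :* o):=(n :* z):* o)rR(oa(sC n))z(P.op n 0)~~ cn(yY(!~ Cn o0 ~!(Ie _)))~! P.ow n 0))~! sU z(P.op n 0)
    k2 : ∀ m n -> sd(P′.op m(sC n))≈ sd z * sd(P.om n m)
    k2 m n = !~ sD(ue(P′.ow m(sC n))(!~ cn(Cn(!~ sV 1(\ n -> n :=(:- n):*(:- # 1q))rR(oa(sC n))~! co(yY zz)))~~
     sV 5(\ m n z za o ->(m :* za :+(:- n):*(z :* za)):*(z :* o):=(:-(z :* za)):*((n :* z :- m):* o))rR(oa(sC m))(oa(sC n))z za(P.om n m)~! Zz(P.Om n m)))~! sU z(P.om n m)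
    k3 : ∀ m n -> sd(P′.om m n)≈ sd z * sd(P.op n(sC m))
    k3 m n = !~ sD(ue(P′.Om m n)(!~ cn(Cn(!~ sV 1(\ n -> :- n := n :*(:- # 1q))rR(oa(sC n))~! co(yY zz)))~~
     sV 5(\ m n z za o ->(m :* za :+ n :*(z :* za)):*(:-(z :* o)):=(:-(z :* za)):*((n :* z :+ m):* o))rR(oa(sC m))(oa(sC n))z za(P.op n(sC m))~! Zz(P.ow n(sC m))))~~
     (sW _)~! sU z(P.op n(sC m))
   HD : ∀ M -> P′.Hx M ≈ sd z * P.Hx M
   HD M = !~ ca(!~ ch M c9 ~!(∑-* M(sd z)_))
    (!~(ch M \ m -> !~ ca(cl m)(!~(ch M \ n -> !~ ca(k2 m n)(k3 m n)~~ yY(dr(sd z)_ _)~! co(qR _ _))~!(∑-* M(sd z)(\ n -> P.fC n m)))~! yY(dr(sd z)_ _))~~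
     (∑-* M(sd z)(\ m -> sd(rb m)+ ∑ M(\ n -> P.fC n m)))~! co(!~(∑-+ M _ _)~! Cn(Sw M M(\ m n -> P.fC n m))))~~
    yY(dr(sd z)_ _)~! co(!~(sV 3(\ x y z -> x :+(y :+ z):= y :+(x :+ z))rR _ _ _)~! Cn(yY(∑-+ M _ _)))
  sO : ∀ ρ -> 0q <= ρ -> ∃ \ a -> ½^(sC(sC a))** ρ <= q 1 24
  sO ρ jS = let N , f = nX ρ jS(q 1 24)(pi(q 1 24))in
   N , !< rl(cD(½^(sC(sC N)))ρ)<! f(sC(sC N))(N1 N ≤~ N1(sC N))
  Bx : ∀ {z za}(hz : Hp z)(Hz : Hp za)(zz : z * za ≈ - 1#)F ->(∀ m -> Pw p(e(oa(sC m)* z))(F m))-> ∀ {S}-> Sa F S ->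
   (\ s -> oq n2 * c * Pair.Hx hz Hz zz(tw s))=> oq ζ + oq n2 * S
  Bx{z}hz Hz zz F hF{S}hS = Rs(\ s -> sV 2(\ x y -> x :-(x :- y):= y)rR(oq ζ + oq n2 * ∑(tw s)F)_)(sV 1(\ x -> x :- # 0q := x)rR _)
   (sN(⟶-+(cA(oq ζ))(⟶-*ˡ(oq n2)(sx tw Nt hS)))
    (Sz(nX Q.∣ Ef ++ n2 ** E ∣(Np _))\ s -> mo(ma{Ef ++ n2 ** E} {Q.∣ Ef ++ n2 ** E ∣} {½^ s}(nv s)(pp _))(rp(sV 1(\ x -> x := x :- # 0q)rR _)(jq s))))
   where
   ρ = ei z
   sc = sO(pF ρ)(nn(pS ρ))
   open Pair hz Hz zz
   open Ax F hF (pS ρ) (pF sc) (pS sc)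
  e3 : ℕ -> ℂ
  e3 = Cs(oq ζ)+s(oq n2 ^s lu(pC p))
  private
   pO : pC p 0 ≈ 0#
   pO = !~ rx(cO oq(!=(cong₂ _^^_ nw(st(!= mZ =! cO(\ k -> k +n h)(pS H1))))=! z^(pF H1)h(pS H1)))~! rR
    where
    z^ : ∀ m k{j}-> k ≡ sC j -> 0q ^^(m +n k)≡ 0q
    z^ z0 _{j}Re = zd(0q ^^ j)
    z^(sC m)k _ = zd(0q ^^(m +n k))
   module L = LA (pC p) pO (Gp p)
  GC : Gr 1q e3
  GC = Gw n1(Gc n1(oq ζ))(Gf n1(oq n2)L.Gl)
  private
   module V {z : ℂ} (hz : Hp z) where
    mz : ∀ m -> Hp(oa(sC m)* z)
    mz m = Hc{z} {ι(sC m)}(nd m)hz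
    opaque
     F : ℕ -> ℂ
     F m = pF(Po p{oa(sC m)* z}(mz m))
     HF : ∀ m -> Pw p(e(oa(sC m)* z))(F m)
     HF m = pS(Po p{oa(sC m)* z}(mz m))
    hF : ∀ m -> Sa(\ n -> pC p n *(e z ^ sC m)^ n)(F m)
    hF m = Su(\ n -> co{pC p n}(ck n(yY(mW(sC m)z))))rR(HF m)
    lt : ℕ -> ℂ
    lt n = lu(pC p)n * e z ^ n
    gS : Go lt
    gS = gH L.Gl hz
    opaque
     S : ℂ
     S = gm{lt}gS
     hS : Sa lt S
     hS = gu{lt}gS
    FS : Sa F S
    FS = L.Lm hz F hF hS
    o7 : Sa(\ n -> Cs(oq ζ)n * e z ^ n)(oq ζ)
    o7 = Rs(\ _ -> rR)(!~(Ie _)~!(In _))(Sf 1{\ n -> Cs(oq ζ)n * e z ^ n}\ n -> ze _)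
    tM : Sa(\ n -> e3 n * e z ^ n)(oq ζ + oq n2 * S)
    tM = Rs(\ N -> ch N \ n -> sV 4(\ c t s x -> c :* x :+ t :*(s :* x):=(c :+ t :* s):* x)rR(Cs(oq ζ)n)(oq n2)(lu(pC p)n)(e z ^ n))rR
     (Sk{\ n -> Cs(oq ζ)n * e z ^ n} {\ n -> oq n2 * lt n}o7(Sd{lt}(oq n2)hS))
  private
   vl : ∀ {z za}(hz : Hp z)(Hz : Hp za)(zz : z * za ≈ - 1#) {A}-> Sa(\ n -> e3 n * e z ^ n)A ->(\ s -> oq n2 * c * Pair.Hx hz Hz zz(tw s))=> A
   vl{z}hz Hz zz{A}hA = go A(Ss tM hA)
    where
    open V hz
    go : ∀ A -> oq ζ + oq n2 * S ≈ A ->(\ s -> oq n2 * c * Pair.Hx hz Hz zz(tw s))=> A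
    go A eq = Rs{\ s -> oq n2 * c * Pair.Hx hz Hz zz(tw s)}(\ _ -> rR)eq(Bx hz Hz zz F HF{S}FS)
  bx : ∀ {z za}-> Hp z -> Hp za -> z * za ≈ - 1# -> ∀ {A A′}-> Sa(\ n -> e3 n * e z ^ n)A -> Sa(\ n -> e3 n * e za ^ n)A′ -> A′ ≈ sd z * A
  bx{z} {za}hz Hz zz{A} {A′}hA HA = uq(vl Hz hz(Sym.zj hz Hz zz)HA)
   (Rs(\ s -> yY(!~ co(Sym.HD hz Hz zz(tw s))~!(sV 3(\ c s h -> c :*(s :* h):= s :*(c :* h))rR(oq n2 * c)(sd z)_)))rR(⟶-*ˡ(sd z)(vl hz Hz zz hA)))
module MFm where
 open EisS public
 open CSolve
 private
  module Qm where
   open import Data.Rational.Base public using (_⊓_)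
   open import Data.Rational.Properties public using (p⊓q≤p;p⊓q≤q)
 va :(ℕ -> ℂ)-> ℂ -> ℂ -> Set
 va c z = Sa(\ n -> c n * e z ^ n)
 record MF(w : ℕ)(c : ℕ -> ℂ): Set where
  field
   gr : Gr 1q c
   Sl : ∀ {z za A A′}-> Hp z -> Hp za -> z * za ≈ - 1# -> va c z A -> va c za A′ -> A′ ≈ z ^ w * A
 open MF public
 Vl : ∀ {c z}-> Gr 1q c -> Hp z -> ∃(va c z)
 Vl{c} {z}g h = gm{\ n -> c n * e z ^ n}(gH g h), gu{\ n -> c n * e z ^ n}(gH g h)
 Va : ∀ {c z A B}-> va c z A -> va c z B -> A ≈ B
 Va{c} {z}= Ss{\ n -> c n * e z ^ n}
 Vr : ∀ {c d z w A B}-> c ~s d -> z ≈ w -> A ≈ B -> va c z A -> va d w B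
 Vr{c} {d} {z} {w}h hz = Su{\ n -> c n * e z ^ n} {\ n -> d n * e w ^ n}(\ n -> cd(at h n)(ck n(en hz)))
 Vg : ∀ {a b z A B}-> va a z A -> va b z B -> va(a +s b)z(A + B)
 Vg{a} {b} {z}hA hB = Su{\ n -> a n * e z ^ n + b n * e z ^ n} {\ n ->(a +s b)n * e z ^ n}(\ n -> yY(dv(e z ^ n)(a n)(b n)))rR(Sk{\ n -> a n * e z ^ n}hA hB)
 Vb : ∀ {a z A}x -> va a z A -> va(x ^s a)z(x * A)
 Vb{a} {z}x hA = Su{\ n -> x *(a n * e z ^ n)} {\ n ->(x ^s a)n * e z ^ n}(\ n -> yY(ao x(a n)(e z ^ n)))rR(Sd{\ n -> a n * e z ^ n}x hA)
 private
  ^-+′ : ∀ x m n -> x ^(m +n n)≈ x ^ m * x ^ n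
  ^-+′ x z0 n = yY(ie _)
  ^-+′ x(sC m)n = !~ co(^-+′ x m n)~! yY(ao x _ _)
 xo : ∀ x m n -> x ^(m +n n)≈ x ^ m * x ^ n
 xo = ^-+′
 pg : ∀ a b x n ->((\ i -> a i * x ^ i)*s(\ i -> b i * x ^ i))n ≈(a *s b)n * x ^ n
 pg a b x z0 = sV 2(\ a b -> a :* # 1q :*(b :* # 1q):= a :* b :* # 1q)rR(a 0)(b 0)
 pg a b x(sC n)= !~ ca(sV 3(\ a b y -> a :* # 1q :*(b :* y):= a :* b :* y)rR(a 0)(b(sC n))(x ^ sC n))
  (!~ af{\ i -> a(sC i)* x ^ sC i} {\ i -> x *(tl a i * x ^ i)} {\ i -> b i * x ^ i} {\ i -> b i * x ^ i}n(\ i _ -> sV 3(\ a x y -> a :*(x :* y):= x :*(a :* y))rR(a(sC i))x(x ^ i))(\ _ _ -> rR)~~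
   at(·-*ₛ x(\ i -> tl a i * x ^ i)(\ i -> b i * x ^ i))n ~~ co(pg(tl a)b x n)~! sV 3(\ x c y -> x :*(c :* y):= c :*(x :* y))rR x((tl a *s b)n)(x ^ n))~!
  yY(dv(x ^ sC n)(a 0 * b(sC n))((tl a *s b)n))
 Vh : ∀ {a b z A B}-> Gr 1q a -> Gr 1q b -> Hp z -> va a z A -> va b z B -> va(a *s b)z(A * B)
 Vh{a} {b} {z}ga gb h hA hB = Su{(\ i -> a i * e z ^ i)*s(\ i -> b i * e z ^ i)} {\ n ->(a *s b)n * e z ^ n}(pg a b(e z))rR(Sx{\ i -> a i * e z ^ i} {\ i -> b i * e z ^ i}(gH ga h)(gH gb h)hA hB)
 Vc : ∀ x z -> va(Cs x)z x
 Vc x z = Rs(\ _ -> rR)(!~(Ie _)~!(In _))(Sf 1{\ n -> Cs x n * e z ^ n}\ n -> ze _)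
 Mr : ∀ {w a b}-> a ~s b -> MF w a -> MF w b
 Mr{w} {a} {b}h f = record { gr = Gs n1 h(gr f); Sl = \ hz Hz zz hA HA -> Sl f hz Hz zz(Vr(mk \ n -> yY(at h n))rR rR hA)(Vr(mk \ n -> yY(at h n))rR rR HA) }
 Mf : ∀ {w a b}-> MF w a -> MF w b -> MF w(a +s b)
 Mf{w} {a} {b}f g = record { gr = Gw n1(gr f)(gr g); Sl = \ {z} {za}hz Hz zz hA HA ->
  let A , vA = Vl(gr f)hz;B , vB = Vl(gr g)hz;A′ , VA = Vl(gr f)Hz;B′ , VB = Vl(gr g)Hz
  in !~ Va{a +s b} {za}HA(Vg{a} {b} {za}VA VB)~~ ca(Sl f hz Hz zz vA VA)(Sl g hz Hz zz vB VB)~~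
   yY(dr(z ^ w)A B)~! co(Va{a +s b} {z}(Vg{a} {b} {z}vA vB)hA) }
 mF : ∀ {w a}x -> MF w a -> MF w(x ^s a)
 mF{w} {a}x f = record { gr = Gf n1 x(gr f); Sl = \ {z} {za}hz Hz zz hA HA ->
  let A , vA = Vl(gr f)hz;A′ , VA = Vl(gr f)Hz
  in !~ Va{x ^s a} {za}HA(Vb{a} {za}x VA)~~ co(Sl f hz Hz zz vA VA)~~
   sV 3(\ x p A -> x :*(p :* A):= p :*(x :* A))rR x(z ^ w)A ~! co(Va{x ^s a} {z}(Vb{a} {z}x vA)hA) }
 Mb : ∀ {w v a b}-> MF w a -> MF v b -> MF(w +n v)(a *s b)
 Mb{w} {v} {a} {b}f g = record { gr = Ga n1(gr f)(gr g); Sl = \ {z} {za}hz Hz zz hA HA ->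
  let A , vA = Vl(gr f)hz;B , vB = Vl(gr g)hz;A′ , VA = Vl(gr f)Hz;B′ , VB = Vl(gr g)Hz
  in !~ Va{a *s b} {za}HA(Vh{a} {b} {za}(gr f)(gr g)Hz VA VB)~~ cd(Sl f hz Hz zz vA VA)(Sl g hz Hz zz vB VB)~~
   sV 4(\ p A r B -> p :* A :*(r :* B):= p :* r :*(A :* B))rR(z ^ w)A(z ^ v)B ~! cd(yY(^-+′ z w v))(Va{a *s b} {z}(Vh{a} {b} {z}(gr f)(gr g)hz vA vB)hA) }
 Mg : MF 0 1ₛ
 Mg = record { gr = Gc n1 1# ; Sl = \ {z} {za}hz Hz zz hA HA -> !~ Va{1ₛ} {za}HA(Vc 1# za)~~ yY(ie 1#)~! co(Va{1ₛ} {z}(Vc 1# z)hA) }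
 M0 : ∀ w -> MF w 0ₛ
 M0 w = Mr(mk \ n -> ze _)(record { gr = Gf n1 0#(Gc n1 1#); Sl = \ {z} {za}hz Hz zz hA HA ->
  !~ Va{0# ^s 1ₛ} {za}HA(Vb{1ₛ} {za}0#(Vc 1# za))~~ sV 1(\ p -> # 0q :* # 1q := p :*(# 0q :* # 1q))rR(z ^ w)~! co(Va{0# ^s 1ₛ} {z}(Vb{1ₛ} {z}0#(Vc 1# z))hA) })
 module EJ = EK ke
 module EL = EK kr
 bz bA : ℕ -> ℂ
 bz = oq((+ 120)// 1)^s EJ.e3
 bA = oq(-q((+ 252)// 1))^s EL.e3
 Ms : MF 4 bz
 Ms = mF _(record { gr = EJ.GC ; Sl = \ {z}hz Hz zz hA HA -> !~ EJ.bx hz Hz zz hA HA ~! cn(sV 1(\ z ->(z :* z):*((z :* z):* # 1q):= z :*(z :*(z :*(z :* # 1q))))rR z) })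
 Ma : MF 6 bA
 Ma = mF _(record { gr = EL.GC ; Sl = \ {z}hz Hz zz hA HA -> !~ EL.bx hz Hz zz hA HA ~! cn(sV 1(\ z ->(z :* z):*((z :* z):*((z :* z):* # 1q)):= z :*(z :*(z :*(z :*(z :*(z :* # 1q))))))rR z) })
 bR : ∀ ε -> 0q << ε -> ε <= 1q -> ∃ \ z -> Im z 1q × e z <| ε
 bR ε hL jT = z ,(0 , \ n _ -> !< 1≤Y <! rl(sy(Iz n))), mo le(eU{z} {Y}(lZ Yc)(0 , \ n _ -> rl(sy(Iz n))))
  where
  Y = iv ε hL
  Yc = i0 hL
  1≤Y : 1q <= Y
  1≤Y = !< rl(sy(Iv hL))<~ ma{ε} {1q} {Y}(lZ Yc)jT <! rl(iy Y)
  z = 𝕚 * oq Y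
  opaque
   unfolding fq _+ℝ_ _*ℝ_ -ℝ_
   Iz : ∀ n -> seq(im z)n ≡ Y
   Iz n = sl 1(\ e -> Co 0q *: Co 0q +: Co 1q *: e =: e)Re Y
  h = 1+6δ>0(lZ Yc)
  le : iv(1q ++ 6ℚ ** Y)h <= ε
  le = Ca{r = 1q ++ 6ℚ ** Y}h(!< rl(Iv h)<! By(ε ++ 5ℚ)(N0(lZ hL)(nN 5ℚ))
   (!= sl 2(\ Y e ->(Co 1q +: Co 6ℚ *: Y)*: e =: e +: Co 6ℚ *:(e *: Y))Re Y ε =~ cO(\ t -> ε ++ 6ℚ ** t)(Iv hL)=! sl 1(\ e -> e +: Co 6ℚ *: Co 1q =: Co 1q +:(e +: Co 5ℚ))Re ε))
   where
   5ℚ : ℚ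
   5ℚ =(+ 5)// 1
 Vt : ∀ {c z A}-> va c z A -> c 0 ≈ 0# -> ∃ \ B -> e z * B ≈ A × va(tl c)z B
 Vt{c} {z} {A}hA h0 = e(- z)* A , !~ yY(ao _ _ _)~~ cn(eR z)~! ie A ,
  Su{\ n -> e(- z)*(c(sC n)* e z ^ sC n)} {\ n -> tl c n * e z ^ n}(\ n -> !~ sV 4(\ i c x p -> i :*(c :*(x :* p)):=(x :* i):*(c :* p))rR(e(- z))(c(sC n))(e z)(e z ^ n)~~ cn(eR z)~!(ie _))
   (co(!~ Cn(cc(!~ cn h0 ~!(ze _)))~! sV 1(\ A -> A :- # 0q := A)rR A))(Sd{\ n -> c(sC n)* e z ^ sC n}(e(- z))(SB{\ n -> c n * e z ^ n}hA))
 Gq : ∀ {c}-> Gr 1q c -> Gr 1q(tl c)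
 Gq{c}g δ hH = let C , hC , d = g δ hH; b = 1q **(1q ++ δ)in C ** b , n0 hC(n0 n1(N0 n1(lZ hH))), \ n -> sB(c(sC n)<|_)(sy(ac C b(b ^^ n)))(d(sC n))
 private
  m0 : ∀ {a b}-> 0q << a -> 0q << b -> 0q << a Qm.⊓ b
  m0{a} {b}ha hb = go(Tt a b)
   where
   open import Data.Rational.Properties using (p≤q⇒p⊓q≡p;p≥q⇒p⊓q≡q)
   go : a <= b ⊎ b <= a -> 0q << a Qm.⊓ b
   go(iL le)= sB(0q <<_)(sy(p≤q⇒p⊓q≡p le))ha
   go(iR le)= sB(0q <<_)(sy(p≥q⇒p⊓q≡q le))hb
  Cr : ∀ {c}-> Gr 1q c ->(∀ {z A}-> Im z 1q -> va c z A -> A ≈ 0#)-> c 0 ≈ 0#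
  Cr{c}g h = xl \ ε hL ->
   let C , hC , d = g 1q nl;2ℚ′ = 1q **(1q ++ 1q);η , oK , le = Sr{C **(2ℚ′ ** n2)} {ε}(n0 hC(nN(2ℚ′ ** n2)))hL;μ = η Qm.⊓((+ 1)// 4);jU : 0q << μ;jU = m0{η} {(+ 1)// 4}oK(pi((+ 1)// 4));z , hz , ez = bR μ jU(!< Qm.p⊓q≤q η((+ 1)// 4)<! By((+ 3)// 4)(nN((+ 3)// 4))Re);A , vA = Vl g(1q , nl , hz);xR : 2ℚ′ ** μ <= ½;xR = !< Mo{μ} {(+ 1)// 4} {2ℚ′}(nN 2ℚ′)(Qm.p⊓q≤q η _)<! rl Re;nH : 0q <= 2ℚ′ ** μ;nH = n0(nN 2ℚ′)(lZ jU);t : ℕ -> ℂ;t n = c(sC n)* e z ^ sC n;hT : ∀ n -> t n <|(C **(2ℚ′ ** μ))** ½ ^^ n;hT n = mo(!< rl(!= sl 5(\ C b x m y -> C *:(b *: x)*:(m *: y)=: C *:(b *: m)*:(x *: y))Re C 2ℚ′(2ℚ′ ^^ n)μ(μ ^^ n)=! cO((C **(2ℚ′ ** μ))**_)(sy(dt 2ℚ′ μ n)))<! Mo{(2ℚ′ ** μ)^^ n} {½ ^^ n} {C **(2ℚ′ ** μ)}(n0 hC nH)(mu n nH xR))(≼-*(d(sC n))(≼-^(sC n)ez));tM : A - c 0 * 1# <|(C **(2ℚ′ ** μ))** n2;tM = ⟶-≼{\ N -> ∑ N t}(n0(n0 hC nH)(nN n2))(SB{\ n -> c n * e z ^ n}vA)(0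 , \ N _ -> mo(rl(cO((C **(2ℚ′ ** μ))**_)jr))(ge{t} {C **(2ℚ′ ** μ)} {½}N ni(n0 hC nH)(lZ ni)hT))
   in mo(!< rl(sl 3(\ C b m -> C *:(b *: m)*: Co n2 =: C *:(b *: Co n2)*: m)Re C 2ℚ′ μ)<~ Mo{μ} {η} {C **(2ℚ′ ** n2)}(n0 hC(nN(2ℚ′ ** n2)))(Qm.p⊓q≤p η _)<! le)
    (rp(!~ cc(Cg(h hz vA))~! sV 1(\ c -> :-(# 0q :- c :* # 1q):= c :- # 0q)rR(c 0))(Ne tM))
   where
   jr : iv(1q -q ½)ni ≡ n2
   jr = != sy(iy(iv(1q -q ½)ni))=~ cO(\ t -> t ** iv(1q -q ½)ni) {1q} {n2 **(1q -q ½)}Re =~ ac n2(1q -q ½)(iv(1q -q ½)ni)=! cO(n2 **_)(Iv{1q -q ½}ni)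
 IH : ∀ {z}-> Im z 1q -> Hp z
 IH h = 1q , nl , h
 identity : ∀ {c}-> Gr 1q c ->(∀ {z A}-> Im z 1q -> va c z A -> A ≈ 0#)-> ∀ n -> c n ≈ 0#
 identity g h z0 = Cr g h
 identity{c}g h(sC n)= identity{tl c}(Gq{c}g)(\ {z} {B}hz vB ->
  let A , vA = Vl g(IH{z}hz);B′ , eB , VB = Vt{c} {z}vA(Cr g h)
  in !~ Va{tl c} {z}vB VB ~~ yY(ie B′)~~ cn(yY(!~(cp _ _)~! eR z))~~ ao(e(- z))(e z)B′ ~~ co(!~ eB ~! h hz vA)~!(zr _))n
module Zser where
 open MFm public
 private module P = PiQ
 open import Data.Nat.DivMod using (_/_;_%_)
 open import Relation.Nullary using (Dec;yes;no;¬_)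
 open CSolve
 module Z = FSum CR
 oi : ∀ a b -> oz(a +z b)≈ oz a + oz b
 oi a b = !~ rx(cO oq(P.kq a b))~!(oc _ _)
 oh : ∀ a b -> oz(a *z b)≈ oz a * oz b
 oh a b = !~ rx(cO oq(P.fZ a b))~!(ob _ _)
 og : ∀ a -> oz(-z a)≈ - oz a
 og a = yY(!~ yY(!~ Cn(!~ yY(oi a(-z a))~! rx(cO oz(b9 a)))~! Ie(- oz a))~!
  sV 2(\ a b -> :- a :+(a :+ b):= b)rR(oz a)(oz(-z a)))
 ok : ∀ n -> oz(+ n)≈ oa n
 ok n = rx(cO oq(sy(dJ n)))
 private
  opaque
   unfolding fq _+ℝ_ _*ℝ_ -ℝ_
   Oz : ∀ q -> oq q ≈ 0# -> ¬(q ≢ 0q)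
   Oz q(h , _)ne = let N , f = _≈ℝ_.close h Q.∣ q ∣ q0 in jJ(cO Q.∣_∣(ig q))(f N Rf)
    where
    q0 : 0q << Q.∣ q ∣
    q0 = Q.≰⇒> \ le -> ne(q8 q(Ay le(Np q)))
 oy : ∀ {q}-> oq q ≈ 0# -> q ≡ 0q
 oy{q}h = decidable-stable(q Q.≟ 0q)(Oz q h)
  where open import Relation.Nullary.Decidable using (decidable-stable)
 O0 : ∀ a -> oz a ≈ 0# -> a ≡ 0ℤ
 O0 a h = != sy(ih a)=! ℚᵘₚ.drop-*≡*(ℚᵘₚ.≃-trans(ℚᵘₚ.≃-sym(toℚᵘ-fromℚᵘ(ℚᵘ.mkℚᵘ a 0)))(ℚᵘₚ.≃-reflexive(cO q9(oy h))))
  where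
  import Data.Rational.Unnormalised.Base as ℚᵘ
  import Data.Rational.Unnormalised.Properties as ℚᵘₚ
  open import Data.Rational.Properties using (toℚᵘ-fromℚᵘ)
 Oi : ∀ {a b}-> oz a ≈ oz b -> a ≡ b
 Oi{a} {b}h = Ij a b(O0(a -z b)(!~ oi a(-z b)~~ ca h(og b)~! ir(oz b)))
 ta :(ℕ -> ℤ)-> ℕ -> ℂ
 ta a n = oz(a n)
 th : ∀ a b -> ta(a Z.*s b)~s ta a *s ta b
 th a b = mk(go a b)
  where
  go : ∀ a b n -> ta(a Z.*s b)n ≈(ta a *s ta b)n
  go a b z0 = oh(a 0)(b 0)
  go a b(sC n)= !~ oi(a 0 *z b(sC n))((Z.tl a Z.*s b)n)~! ca(oh(a 0)(b(sC n)))(go(Z.tl a)b n)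
 tx : ∀ a b -> ta(a Z.+s b)~s ta a +s ta b
 tx a b = mk \ n -> oi(a n)(b n)
 tD : ∀ a -> ta(Z.-s a)~s -s ta a
 tD a = mk \ n -> og(a n)
 tg : ∀ x a -> ta(x Z.^s a)~s oz x ^s ta a
 tg x a = mk \ n -> oh x(a n)
 dA : ℕ -> ℕ -> ℕ -> ℤ
 dA p n m with n % sC m ℕₚ.≟ 0
 ... | yes _ = +((n / sC m)^n p)
 ... | no _ = 0ℤ
 σ : ℕ -> ℕ -> ℤ
 σ p n = Z.∑ n(dA p n)
 PC : ∀ p n -> oz(+(n ^n p))≈ pC p n
 PC p n = !~ ok(n ^n p)~! rx(cO oq(go p))
  where
  go : ∀ p -> ι(n ^n p)≡ ι n ^^ p
  go z0 = != sa 0 =! cO(1q ++_)nw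
  go(sC p)= != xe n(n ^n p)=! cO(ι n **_)(go p)
 lm : ∀ p n -> oz(σ p n)≈ lu(pC p)n
 lm p n = !~ sY n(dA p n)~! ch n Ec
  where
  sY : ∀ k f -> oz(Z.∑ k f)≈ ∑ k(\ i -> oz(f i))
  sY z0 f = rR
  sY(sC k)f = !~(oi(f 0)_)~! Cn(sY k(\ i -> f(sC i)))
  Ec : ∀ m -> oz(dA p n m)≈ dH m(pC p)n
  Ec m with n % sC m ℕₚ.≟ 0
  ... | yes _ = PC p(n / sC m)
  ... | no _ = rR
 e4 e6 : ℕ -> ℤ
 e4 z0 = 1ℤ
 e4(sC n)= + 240 *z σ 3(sC n)
 e6 z0 = 1ℤ
 e6(sC n)= -z(+ 504)*z σ 5(sC n)
 t4 : ta e4 ~s bz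
 t4 = mk \
  { z0 -> yY(sV 0(#((+ 120)// 1):*(#((+ 1)// 120):+ # n2 :* # 0q):= # 1q)rR)
  ; (sC n)-> !~ oh(+ 240)(σ 3(sC n))~~ co(lm 3(sC n))~! sV 1(\ s -> #((+ 240)// 1):* s := #((+ 120)// 1):*(# 0q :+ # n2 :* s))rR(lu(pC 3)(sC n)) }
 t6 : ta e6 ~s bA
 t6 = mk \
  { z0 -> yY(sV 0(#(-q((+ 252)// 1)):*(#(-q((+ 1)// 252)):+ # n2 :* # 0q):= # 1q)rR)
  ; (sC n)-> !~ oh(-z(+ 504))(σ 5(sC n))~~ co(lm 5(sC n))~! sV 1(\ s -> #(-q((+ 504)// 1)):* s := #(-q((+ 252)// 1)):*(# 0q :+ # n2 :* s))rR(lu(pC 5)(sC n)) }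
 Me : MF 4(ta e4)
 Me = Mr(mk \ n -> yY(at t4 n))Ms
 M6 : MF 6(ta e6)
 M6 = Mr(mk \ n -> yY(at t6 n))Ma
 Dc : ℕ -> ℤ
 Dc =(e4 Z.*s(e4 Z.*s e4))Z.+s(Z.-s(e6 Z.*s e6))
module Disc where
 open Zser public
 open import Data.Nat.DivMod using (_/_;_%_;m/n≤m)
 open import Data.Nat.Tactic.RingSolver using (solve-∀)
 open import Relation.Nullary using (Dec;yes;no;¬_)
 open import Relation.Nullary.Decidable using (toWitness)
 open CSolve
 private
  n# : ℕ -> ℚ
  n# a =(+ a)// 1
 module Inverse (u : ℕ -> ℂ) where
  private
   V : ℕ -> ℕ -> ℂ
   V k z0 = 1#
   V z0(sC n)= 0#
   V(sC k)(sC n)= -(tl u *s V k)n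
   aJ : ∀ k j n -> n ≤n k -> n ≤n j -> V k n ≈ V j n
   aJ k j z0 _ _ = rR
   aJ(sC k)(sC j)(sC n)(ss p)(ss r)= cc(af{tl u}n(\ _ _ -> rR)\ i iK -> aJ k j i(iK ≤~ p)(iK ≤~ r))
  il : ℕ -> ℂ
  il n = V n n
  Ic : ∀ n -> il(sC n)≈ -(tl u *s il)n
  Ic n = cc(af{tl u}n(\ _ _ -> rR)\ i iK -> aJ n i i iK Rf)
  iF : u 0 ≈ 1# -> u *s il ~s 1ₛ
  iF u0 = mk \
   { z0 -> !~ In(u 0)~! u0
   ; (sC n)-> !~ Cg(!~ cn u0 ~~(ie _)~! Ic n)~!(qS _) }
  private
   c2 : ∀ {a s b}A -> 0q <= a -> 0q <= s ->(c : ℕ -> ℂ)->(∀ i -> c i <| A **(s ** a ^^ i))-> ∀ n ->(∀ j -> j ≤n n -> b j <|(a ++ s)^^ j)->(c *s b)n <| A **((a ++ s)^^ sC n -q a ^^ sC n)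
   c2{a} {s}A ha hs c hc z0 hb = mo(rl(sl 3(\ A s a -> A *:(s *: Co 1q)*: Co 1q =: A *:((a +: s)*: Co 1q -: a *: Co 1q))Re A s a))(≼-*(hc 0)(hb 0 zn))
   c2{a} {s} {b}A ha hs c hc(sC n)hb = mo(rl(sl 5(\ A s a p r -> A *:(s *: Co 1q)*: p +: A *: a *:(p -: r)=: A *:((a +: s)*: p -: a *: r))Re A s a((a ++ s)^^ sC n)(a ^^ sC n)))
    (≼-+(≼-*(hc 0)(hb(sC n)Rf))(c2{a} {s} {b}(A ** a)ha hs(tl c)(\ i -> sB(c(sC i)<|_)(sl 4(\ A s a p -> A *:(s *:(a *: p))=: A *: a *:(s *: p))Re A s a(a ^^ i))(hc(sC i)))n \ j le -> hb j(m1 le)))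
  iQ : ∀ {a s}-> 0q <= a -> 0q <= s ->(∀ i -> u(sC i)<| s ** a ^^ i)-> ∀ n -> il n <|(a ++ s)^^ n
  iQ{a} {s}ha hs hu n = go n n Rf
   where
   go : ∀ N n -> n ≤n N -> il n <|(a ++ s)^^ n
   go N z0 _ = Of 1q
   go(sC N)(sC n)(ss le)= rp(yY(Ic n))(Ne(mo(!< rl(iy((a ++ s)^^ sC n -q a ^^ sC n))<! By(a ^^ sC n)(nf(sC n)ha)(sl 2(\ x y -> x =: x -: y +: y)Re((a ++ s)^^ sC n)(a ^^ sC n)))
    (c2{a} {s} {il}1q ha hs(tl u)(\ i -> sB(u(sC i)<|_)(sy(iy _))(hu i))n \ j oL -> go N j(oL ≤~ le))))
 private
  dX : ∀ m{a n b}-> 0q <= b ->(∀ j -> j ≤n n -> a j <| b)-> dH m a n <| b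
  dX m{a} {n} {b}hb h with n % sC m ℕₚ.≟ 0
  ... | yes _ = h(n / sC m)(m/n≤m n(sC m))
  ... | no _ = mo hb(Of 0q)
  lj : ∀ p n -> lu(pC p)n <| ι(n *n n ^n p)
  lj p n = sB(lu(pC p)n <|_)(sy(!= xe n(n ^n p)=! cO(ι n **_)(go p)))(∑-≼ n(nf p(nc n))\ m _ -> dX m(nf p(nc n))\ j le ->
   mo(!< rl(np(nf p(nc j)))<! mu p(nc j)(mg le))(Of(ι j ^^ p)))
   where
   go : ∀ p -> ι(n ^n p)≡ ι n ^^ p
   go z0 = != sa 0 =! cO(1q ++_)nw
   go(sC p)= != xe n(n ^n p)=! cO(ι n **_)(go p)
  ft : ∀ n -> 64 *n(n *n n ^n 3)≤n 81 *n 4 ^n n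
  ft 0 = toWitness{a? = 0 ℕₚ.≤? 81}tt
  ft 1 = toWitness{a? = 64 ℕₚ.≤? 324}tt
  ft 2 = toWitness{a? = 1024 ℕₚ.≤? 1296}tt
  ft(sC(sC(sC m)))= go m
   where
   p7 : ∀ m -> 4 *n(64 *n((3 +n m)*n((3 +n m)*n((3 +n m)*n((3 +n m)*n 1)))))≡ 64 *n((4 +n m)*n((4 +n m)*n((4 +n m)*n((4 +n m)*n 1))))+n 64 *n(68 +n 176 *n m +n 120 *n(m *n m)+n 32 *n(m *n m *n m)+n 3 *n(m *n m *n m *n m))
   p7 = solve-∀
   go : ∀ m -> 64 *n((3 +n m)*n(3 +n m)^n 3)≤n 81 *n 4 ^n(3 +n m)
   go z0 = toWitness{a? = 5184 ℕₚ.≤? 5184}tt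
   go(sC m)=((me _ _)≤~ ri(sy(p7 m)))≤~ mr 4(go m)≤~ ri(k4(4 ^n(3 +n m)))
    where
    k4 : ∀ x -> 4 *n(81 *n x)≡ 81 *n(4 *n x)
    k4 = solve-∀
  s6 : ∀ n -> n *n n ^n 5 ≤n 16 *n 4 ^n n
  s6 0 = toWitness{a? = 0 ℕₚ.≤? 16}tt
  s6 1 = toWitness{a? = 1 ℕₚ.≤? 64}tt
  s6 2 = toWitness{a? = 64 ℕₚ.≤? 256}tt
  s6 3 = toWitness{a? = 729 ℕₚ.≤? 1024}tt
  s6(sC(sC(sC(sC m))))= go m
   where
   p7 : ∀ m -> 4 *n((4 +n m)*n((4 +n m)*n((4 +n m)*n((4 +n m)*n((4 +n m)*n((4 +n m)*n 1))))))≡(5 +n m)*n((5 +n m)*n((5 +n m)*n((5 +n m)*n((5 +n m)*n((5 +n m)*n 1)))))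
    +n(759 +n 5826 *n m +n 5985 *n(m *n m)+n 2620 *n(m *n m *n m)+n 585 *n(m *n m *n m *n m)+n 66 *n(m *n m *n m *n m *n m)+n 3 *n(m *n m *n m *n m *n m *n m))
   p7 = solve-∀
   go : ∀ m ->(4 +n m)*n(4 +n m)^n 5 ≤n 16 *n 4 ^n(4 +n m)
   go z0 = toWitness{a? = 4096 ℕₚ.≤? 4096}tt
   go(sC m)=((me _ _)≤~ ri(sy(p7 m)))≤~ mr 4(go m)≤~ ri(k4(4 ^n(4 +n m)))
    where
    k4 : ∀ x -> 4 *n(16 *n x)≡ 16 *n(4 *n x)
    k4 = solve-∀
 oj : ∀ a -> oz a <| ι ℤ.∣ a ∣
 oj(+ n)= rp(yY(ok n))(oo n)
 oj(ℤ.-[1+ n ])= rp(!~ cc(yY(ok(sC n)))~! yY(og(+ sC n)))(Ne(oo(sC n)))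
 private
  xM : ∀ a n -> ι(a ^n n)≡ ι a ^^ n
  xM a z0 = != sa 0 =! cO(1q ++_)nw
  xM a(sC n)= != xe a(a ^n n)=! cO(ι a **_)(xM a n)
  4≥1 : ∀ n -> 1 ≤n 4 ^n n
  4≥1 z0 = Rf
  4≥1(sC n)= 4≥1 n ≤~(me _ _)
  E4 : ∀ n -> ta e4 n <| ι 304 ** ι 4 ^^ n
  E4 z0 = mo(!< mg{1} {304}(ss zn)<! rl(sy(ii(ι 304))))(oj(+ 1))
  E4(sC n)= mo le(rp(!~ co(yY(lm 3(sC n)))~! yY(oh(+ 240)(σ 3(sC n))))(≼-*(oj(+ 240))(lj 3(sC n))))
   where
   x = sC n *n sC n ^n 3
   jV : 240 *n x ≤n 304 *n 4 ^n sC n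
   jV = qE 4(ri(ee x)≤~ mr 15(ft(sC n))≤~ ri(ec(4 ^n sC n))≤~ qF(4 ^n sC n) {1215} {1216}(N1 1215)≤~ ri(d7(4 ^n sC n)))
    where
    ee : ∀ x -> 4 *n(240 *n x)≡ 15 *n(64 *n x)
    ee = solve-∀
    ec : ∀ x -> 15 *n(81 *n x)≡ 1215 *n x
    ec = solve-∀
    d7 : ∀ x -> 1216 *n x ≡ 4 *n(304 *n x)
    d7 = solve-∀
   le : ι 240 ** ι x <= ι 304 ** ι 4 ^^ sC n
   le = !< rl(sy(xe 240 x))<~ mg jV <! rl(!= xe 304(4 ^n sC n)=! cO(ι 304 **_)(xM 4(sC n)))
  E6 : ∀ n -> ta e6 n <| ι 8064 ** ι 4 ^^ n
  E6 z0 = mo(!< mg{1} {8064}(ss zn)<! rl(sy(ii(ι 8064))))(oj(+ 1))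
  E6(sC n)= mo le(rp(!~ co(yY(lm 5(sC n)))~! yY(oh(-z(+ 504))(σ 5(sC n))))(≼-*(oj(-z(+ 504)))(lj 5(sC n))))
   where
   x = sC n *n sC n ^n 5
   jV : 504 *n x ≤n 8064 *n 4 ^n sC n
   jV = mr 504(s6(sC n))≤~ ri(ee(4 ^n sC n))
    where
    ee : ∀ x -> 504 *n(16 *n x)≡ 8064 *n x
    ee = solve-∀
   le : ι 504 ** ι x <= ι 8064 ** ι 4 ^^ sC n
   le = !< rl(sy(xe 504 x))<~ mg jV <! rl(!= xe 8064(4 ^n sC n)=! cO(ι 8064 **_)(xM 4(sC n)))
  o8 : ∀ n κ -> 0q <= κ -> ι(sC n)** κ ^^ n <= ι 3 **((1q ++ ½)** κ)^^ n
  o8 n κ hN = !< ma{ι(sC n)} {ι 3 **(1q ++ ½)^^ n} {κ ^^ n}(nf n hN)(!<(li ½ ni n)<! rl(cO(_**(1q ++ ½)^^ n)t2))<!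
   rl(!=(ac(ι 3)_ _)=! cO(ι 3 **_)(sy(dt(1q ++ ½)κ n)))
   where
   t2 : 1q ++ iv ½ ni ≡ ι 3
   t2 = != cO(1q ++_)(!= sy(iy(iv ½ ni))=~ cO(\ t -> t ** iv ½ ni) {1q} {n2 ** ½}Re =~(ac n2 ½(iv ½ ni))=! cO(n2 **_)(Iv ni))=! sy(dJ 3)
  nR : ∀ a -> ι a ≡ n# a
  nR a = dJ a
  Pr : ∀ {a b C D κ}-> 0q <= C -> 0q <= D -> 0q <= κ ->(∀ n -> a n <| C ** κ ^^ n)->(∀ n -> b n <| D ** κ ^^ n)-> ∀ n ->(a *s b)n <|(C ** D ** ι 3)**((1q ++ ½)** κ)^^ n
  Pr{a} {b} {C} {D} {κ}hC hD hN ha hb n = mo(!< rl(sl 4(\ C D i p -> i *:(C *: D)*: p =:(C *: D)*:(i *: p))Re C D(ι(sC n))(κ ^^ n))<~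
   Mo{_} {_} {C ** D}(n0 hC hD)(o8 n κ hN)<! rl(sy(ac(C ** D)(ι 3)_)))(cE{a} {b} {C} {D} {κ}ha hb n)
  Ra : ∀ {a : ℕ -> ℂ} {C κ μ}-> 0q <= C -> 0q <= κ -> κ <= μ ->(∀ n -> a n <| C ** κ ^^ n)-> ∀ n -> a n <| C ** μ ^^ n
  Ra{a} {C} {κ} {μ}hC hN le h n = mo(Mo{κ ^^ n} {μ ^^ n} {C}hC(mu n hN le))(h n)
 uj : ℕ -> ℂ
 uj n = oq((+ 1)// 1728)* ta Dc(sC n)
 private
  4·6 :(1q ++ ½)** ι 4 ≡ ι 6
  4·6 = != cO((1q ++ ½)**_)(nR 4)=~ Re =! sy(nR 6)
  6·9 :(1q ++ ½)** ι 6 ≡ ι 9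
  6·9 = != cO((1q ++ ½)**_)(nR 6)=~ Re =! sy(nR 9)
  Ka Kc Kb : ℚ
  Ka = ι 304 ** ι 304 ** ι 3
  Kc = ι 304 ** Ka ** ι 3
  Kb = ι 8064 ** ι 8064 ** ι 3
  e7 : ∀ n ->(ta e4 *s ta e4)n <| Ka ** ι 6 ^^ n
  e7 n = sB(\ t ->(ta e4 *s ta e4)n <| Ka ** t ^^ n)4·6(Pr{ta e4} {ta e4}(nc 304)(nc 304)(nc 4)E4 E4 n)
  0≤K₁ : 0q <= Ka
  0≤K₁ = n0(n0(nc 304)(nc 304))(nc 3)
  0≤K₃ : 0q <= Kb
  0≤K₃ = n0(n0(nc 8064)(nc 8064))(nc 3)
  lA : ∀ {m n}-> m ≤n n -> ι m <= ι n
  lA = mg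
  e8 : ∀ n ->(ta e4 *s(ta e4 *s ta e4))n <| Kc ** ι 9 ^^ n
  e8 n = sB(\ t ->(ta e4 *s(ta e4 *s ta e4))n <| Kc ** t ^^ n)6·9(Pr{ta e4} {ta e4 *s ta e4}(nc 304)0≤K₁(nc 6)(Ra{ta e4}(nc 304)(nc 4)(lA(me 4 2))E4)e7 n)
  e9 : ∀ n ->(ta e6 *s ta e6)n <| Kb ** ι 9 ^^ n
  e9 = Ra{ta e6 *s ta e6}0≤K₃(nc 6)(lA(me 6 3))\ n -> sB(\ t ->(ta e6 *s ta e6)n <| Kb ** t ^^ n)4·6(Pr{ta e6} {ta e6} {ι 8064} {ι 8064} {ι 4}(nc 8064)(nc 8064)(nc 4)E6 E6 n)
 Td : ta Dc ~s(ta e4 *s(ta e4 *s ta e4))+s(-s(ta e6 *s ta e6))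
 Td = mk \ n -> !~ at(tx(e4 Z.*s(e4 Z.*s e4))(Z.-s(e6 Z.*s e6)))n ~! ca
  (!~ at(th e4(e4 Z.*s e4))n ~!(af{ta e4} {ta e4} {ta(e4 Z.*s e4)} {ta e4 *s ta e4}n(\ _ _ -> rR)\ i _ -> at(th e4 e4)i))
  (!~ at(tD(e6 Z.*s e6))n ~! cc(at(th e6 e6)n))
 private
  js : ∀ {i}-> i <n 10 -> ℤ.∣ Dc(2 +n i)∣ ≤n 41472 *n 36 ^n i
  js = toWitness{a? = aU(\ i -> ℤ.∣ Dc(2 +n i)∣ ℕₚ.≤? 41472 *n 36 ^n i)10}tt
  s7 : ∀ K a b c k l m -> K *n a ^n k ≤n c *n b ^n l -> a ≤n b -> K *n a ^n(k +n m)≤n c *n b ^n(l +n m)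
  s7 K a b c k l m h le = ri(!= cO(K *n_)(dR a k m)=! sy(Ao K(a ^n k)(a ^n m)))≤~
   qG h(qH m le)≤~
    ri(!= Ao c(b ^n l)(b ^n m)=! cO(c *n_)(sy(dR b l m)))
  Kd : ∀ a b c x -> ι a **(ι a ** ι a ** ι c)** ι c ** ι x ++ ι b ** ι b ** ι c ** ι x ≡ ι((a *n(a *n a *n c)*n c +n b *n b *n c)*n x)
  Kd a b c x = != sy(dq(ι x)(ι a **(ι a ** ι a ** ι c)** ι c)(ι b ** ι b ** ι c))=! sy(!= xe(a *n(a *n a *n c)*n c +n b *n b *n c)x =! cO(_** ι x)(!= xJ(a *n(a *n a *n c)*n c)(b *n b *n c)=!(cong₂ _++_
   (!= xe(a *n(a *n a *n c))c =! cO(_** ι c)(!= xe a(a *n a *n c)=! cO(ι a **_)(!= xe(a *n a)c =! cO(_** ι c)(xe a a))))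
   (!= xe(b *n b)c =! cO(_** ι c)(xe b b)))))
  Kn :(304 *n(304 *n 304 *n 3)*n 3 +n 8064 *n 8064 *n 3)*n 9 ^n 12 ≤n 41472 *n 36 ^n 10
  Kn = xb _ _ tt
  jt : ∀ m -> ta Dc(12 +n m)<| ι(41472 *n 36 ^n(10 +n m))
  jt m = go(12 +n m)(s7(304 *n(304 *n 304 *n 3)*n 3 +n 8064 *n 8064 *n 3)9 36 41472 12 10 m Kn(me 9 27))
   where
   go : ∀ k{y}->(304 *n(304 *n 304 *n 3)*n 3 +n 8064 *n 8064 *n 3)*n 9 ^n k ≤n y -> ta Dc k <| ι y
   go k jV = mo(!< rl(!= cO(\ t -> Kc ** t ++ Kb ** t)(sy(xM 9 k))=! Kd 304 8064 3(9 ^n k))<! mg jV)(rp(yY(at Td k))(≼-+(e8 k)(Ne(e9 k))))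
  dQ : ∀ n -> ta Dc(2 +n n)<| ι(41472 *n 36 ^n n)
  dQ n = go n(qI n 10)
   where
   go : ∀ n -> n <n 10 ⊎ 10 ≤n n -> ta Dc(2 +n n)<| ι(41472 *n 36 ^n n)
   go n(iL lt)= mo(mg(js lt))(oj(Dc(2 +n n)))
   go n(iR le)= sB(\ k -> ta Dc(2 +n k)<| ι(41472 *n 36 ^n k))(mm le)(jt(n -n 10))
 uf : ∀ n -> uj(sC n)<| ι 24 ** ι 36 ^^ n
 uf n = mo(rl(!=(cong₂ _**_{Q.∣(+ 1)// 1728 ∣} {(+ 1)// 1728}Re(!= xe 41472(36 ^n n)=!(cong₂ _**_{ι 41472}(nR 41472)(xM 36 n))))=~ sy(ac((+ 1)// 1728)(n# 41472)(ι 36 ^^ n))=! cO(_** ι 36 ^^ n)(!= Re =! sy(nR 24))))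
  (≼-*(Of((+ 1)// 1728))(dQ n))
 ug : uj 0 ≈ 1#
 ug = !~ co{oq((+ 1)// 1728)}(rx(cO oz{Dc 1} {+ 1728}Re))~! sV 0(#((+ 1)// 1728):* #(n# 1728):= # 1q)rR
 module uk = Inverse uj
 vj : ℕ -> ℂ
 vj = uk.il
 uv : uj *s vj ~s 1ₛ
 uv = uk.iF ug
 vi : ∀ n -> vj n <| ι 60 ^^ n
 vi n = sB(\ t -> vj n <| t ^^ n)(sy(xJ 36 24))(uk.iQ(nc 36)(nc 24)uf n)
 Mi : MF 12(ta Dc)
 Mi = Mr(mk \ n -> yY(!~ at Td n ~! Cn(sV 1(\ x -> :- x := #(-q 1q):* x)rR((ta e6 *s ta e6)n))))
  (Mf(Mb Me(Mb Me Me))(mF(oq(-q 1q))(Mb M6 M6)))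
module Cau where
 open Disc public
 open import Data.Nat.Divisibility using (_∣_;_∤_;divides)
 open import Relation.Nullary using (¬_)
 open import Relation.Nullary.Negation using (contradiction)
 open CSolve
 ro : ℕ -> ℕ -> ℂ
 ro r j = e(oq(½^ r)* oa j)
 private
  opaque
   unfolding fq _+ℝ_ _*ℝ_ -ℝ_
   Il : ∀ q n -> seq(im(oq q))n ≡ 0q
   Il q n = Re
 e1 : ∀ q -> e(oq q)<| 1q
 e1 q = fg(0 , \ n _ -> rl(sy(Il q n)))
 rq : ∀ r j -> ro r j <| 1q
 rq r j = rp(en(ob(½^ r)(ι j)))(e1(½^ r ** ι j))
 rh : ∀ r j -> ro(sC r)(tw r +n j)≈ - ro(sC r)j
 rh r j = !~ en(!~ co(!~ rx(cO oq(xJ(tw r)j))~!(oc _ _))~~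
  sV 3(\ a t j -> a :*(t :+ j):= a :* j :+ t :* a)rR(oq(½^(sC r)))(oa(tw r))(oa j)~!
   Cn(!~ yY(ob _ _)~! rx(cO oq(!= sl 2(\ a b -> a *:(Co ½ *: b)=: Co ½ *:(a *: b))Re(ι(tw r))(½^ r)=~ cO(½ **_)(Tw r)=!(ii ½)))))~~
  (eP _(oq ½))~~ co{ro(sC r)j}fw ~! sV 1(\ x -> x :*(:- # 1q):= :- x)rR(ro(sC r)j)
 Rq : ∀ r j -> ro(sC r)j * ro(sC r)j ≈ ro r j
 Rq r j = !~ yY(eP _ _)~! en(!~ ca(cn(ob ½(½^ r)))(cn(ob ½(½^ r)))~! sV 2(\ a b -> # ½ :* a :* b :+ # ½ :* a :* b := a :* b)rR(oq(½^ r))(oa j))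
 Ru : ∀ r j t -> ro r j ^(t *n tw r)≈ 1#
 Ru r j t = !~(mW(t *n tw r)_)~~ en(!~ cn(!~ rx(cO oq(xe t(tw r)))~!(ob _ _))~~ sV 4(\ t n h j -> t :* n :*(h :* j):=(n :* h):*(t :* j))rR(oa t)(oa(tw r))(oq(½^ r))(oa j)~~
  cd(!~ yY(ob _ _)~! rx(cO oq(Tw r)))(!~ yY(ob _ _)~! rx(cO oq(sy(xe t j))))~!(ie _))~! Eo(t *n j)
 data Pa : ℕ -> Set where
  fE : ∀ n -> Pa(n +n n)
  oE : ∀ n -> Pa(sC(n +n n))
 py : ∀ n -> Pa n
 py z0 = fE 0
 py(sC n)= St(py n)
  where
  St : ∀ {n}-> Pa n -> Pa(sC n)
  St(fE n)= oE n
  St(oE n)= sB Pa(cO sC(su n n))(fE(sC n))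
 Du : ∀ x n -> x ^(n +n n)≈(x * x)^ n
 Du x n = !~ xo x n n ~! yY(di x x n)
 Ee : ∀ x n ->(- x)^(n +n n)≈ x ^(n +n n)
 Ee x n = !~ Du(- x)n ~~ ck n(sV 1(\ x ->(:- x):*(:- x):= x :* x)rR x)~! yY(Du x n)
 Ot : ∀ r n -> tw r ∤ n -> ∑(tw r)(\ j -> ro r j ^ n)≈ 0#
 Ot z0 n h = contradiction(divides n(sy(ik n)))h
 Ot(sC r)n h = !~(sp(tw r)(tw r)_)~~ yY(∑-+(tw r)_ _)~! go n(py n)h
  where
  go : ∀ n -> Pa n -> tw(sC r)∤ n -> ∑(tw r)(\ j -> ro(sC r)j ^ n + ro(sC r)(tw r +n j)^ n)≈ 0#
  go _(oE n)h = nB(tw r)\ j _ -> !~ Cn(!~ ck(sC(n +n n))(rh r j)~! co(Ee(ro(sC r)j)n))~!(sV 2(\ x y -> x :* y :+(:- x):* y := # 0q)rR(ro(sC r)j)_)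
  go _(fE n)h = !~(ch(tw r)\ j -> !~ Cn(!~ ck(n +n n)(rh r j)~! Ee(ro(sC r)j)n)~~(sV 1(\ x -> x :+ x := # n2 :* x)rR _)~! co{oq n2}(!~ Du(ro(sC r)j)n ~! ck n(Rq r j)))~~
   (∑-*(tw r)(oq n2)(\ j -> ro r j ^ n))~~ co{oq n2}(Ot r n \ { (divides t eq)-> h(divides t(!=(cong₂ _+n_ eq eq)=! sy(Di t(tw r)(tw r)))) })~! zr(oq n2)
 Ct : ∀ n -> ∑ n(\ _ -> 1#)≈ oa n
 Ct z0 = yY o0
 Ct(sC n)= !~ Cn(Ct n)~! yY(os n)
 private
  Ol : ∀ N l n -> l <n N -> n <n N -> n ≢ l -> N ∤(n +n(N -n l))
  Ol N l n lJ j4 ne(divides z0 eq)= ℕₚ.<⇒≢(Ta(qJ lJ)(mG _ n))(sy eq)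
  Ol N l n lJ j4 ne(divides(sC z0)eq)= ne(cZ(N -n l)n l(!= eq =~ Iy N =! sy(mm(ℕₚ.<⇒≤ lJ))))
  Ol N l n lJ j4 ne(divides(sC(sC t))eq)= ℕₚ.<⇒≱(mJ j4(mO N l))(mB N(me N(t *n N))≤~ ri(sy eq))
 module CH {c : ℕ -> ℂ} {zc : ℂ} {C κ b : ℚ} (0≤C : 0q <= C) (0≤κ : 0q <= κ) (nu : κ << 1q) (0≤b : 0q <= b)
  (dS : ∀ n -> c n * e zc ^ n <| C ** κ ^^ n)
  (vw : ∀ r j -> ∃ \ F -> Sa(\ n -> c n * e(zc + oq(½^ r)* oa j)^ n)F × F <| b)where
  private
   yd = e zc
   module _ (r l : ℕ) (lJ : l <n tw r) where
    N = tw r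
    w : ℕ -> ℂ
    w j = ro r j
    t : ℕ -> ℕ -> ℂ
    t j n = c n * e(zc + oq(½^ r)* oa j)^ n
    t3 : ∀ j n -> t j n ≈(c n * yd ^ n)* w j ^ n
    t3 j n = !~ co(!~ ck n(eP zc _)~! di yd(w j)n)~! yY(ao _ _ _)
    w1 : ∀ j n -> w j ^ n <| 1q
    w1 j n = mo(nP n n1 ra)(≼-^ n(rq r j))
    g : ∀ j -> Go(t j)
    g j = gy C κ 0≤C 0≤κ nu \ n -> rp(yY(t3 j n))(mo(rl(ii _))(≼-*(dS n)(w1 j n)))
    R : ℚ
    R = Rt(g 0)N
    S : ℕ -> ℂ
    S j = ∑ N(t j)
    SK : ∀ j -> S j * w j ^(N -n l)<| b ++ R
    SK j = mo(rl(ii _))(≼-*(rp(sV 2(\ F S -> F :+(:-(F :- S)):= S)rR(pF(vw r j))(S j))(≼-+(pS(pS(vw r j)))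
     (Ne(rp(Cg(Ss(gu(g j))(pF(pS(vw r j)))))(gi(g j)N)))))(w1 j(N -n l)))
    mT : ∑ N(\ j -> S j * w j ^(N -n l))≈(c l * yd ^ l)* oa N
    mT = !~(ch N \ j -> !~ yY(∑-*ʳ N(w j ^(N -n l))(t j))~!(ch N \ n -> !~ cn(t3 j n)~~(ao _ _ _)~! co(yY(xo(w j)n(N -n l)))))~~
     Sw N N(\ j n ->(c n * yd ^ n)* w j ^(n +n(N -n l)))~~(ch N \ n -> ∑-* N(c n * yd ^ n)(\ j -> w j ^(n +n(N -n l))))~~
      (xK N l _ lJ \ n lt ne -> !~ co(Ot r _(Ol N l n lJ lt ne))~!(zr _))~!
       co(!~(ch N \ j -> !~ rx(cO(w j ^_)(!= mm(ℕₚ.<⇒≤ lJ)=! sy(b7 N)))~! Ru r j 1)~! Ct N)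
    0≤bR : 0q <= b ++ R
    0≤bR = N0 0≤b(0≤rest(g 0)N)
    fy : c l * yd ^ l <| b ++ R
    fy = mo(rl(!= cO(_**(ι N **(b ++ R)))(np(nv r))=~ sl 3(\ h n b -> h *:(n *: b)=:(n *: h)*: b)Re(½^ r)(ι N)(b ++ R)=~ cO(_**(b ++ R))(Tw r)=!(iy _)))
     (rp(!~ co mT ~~ sV 3(\ h c n -> h :*(c :* n):=(n :* h):* c)rR(oq(½^ r))(c l * yd ^ l)(oa N)~~ cn(!~ yY(ob _ _)~! rx(cO oq(Tw r)))~!(ie _))
      (≼-*(Of(½^ r))(∑-≼ N 0≤bR \ j _ -> SK j)))
  Cy : ∀ l -> c l * e zc ^ l <| b
  Cy l = Cl 0≤b \ ε hL ->
   let M , f = ru(g 0 0(ss zn)0)ε hL;r = sC l +n M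
   in mo(mj b(f(tw r)(mG M(sC l)≤~ Nt r)))(fy r l(me(sC l)M ≤~ Nt r))
module Region where
 open Cau public
 open CSolve
 private
  q : ℕ -> ℕ -> ℚ
  q a b =(+ a)// sC b
 private
  opaque
   unfolding fq _+ℝ_ _*ℝ_ -ℝ_
   i6 : ∀ z r n -> seq(im(z + oq r))n ≡ seq(im z)n
   i6 z r n = ig(seq(im z)n)
   ju : ∀ r z n -> seq(im(oq r * z))n ≡ r ** seq(im z)n
   ju r z n = sl 3(\ q a b -> q *: b +: Co 0q *: a =: q *: b)Re r(seq(re z)n)(seq(im z)n)
   jv : ∀ z r n -> seq(im(z - 𝕚 * oq r))n ≡ seq(im z)n -q r
   jv z r n = sl 2(\ z e -> z +:(-:(Co 0q *: Co 0q +: Co 1q *: e))=: z -: e)Re(seq(im z)n)r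
   k5 : ∀ r n -> seq(im(𝕚 * oq r))n ≡ r
   k5 r n = sl 1(\ e -> Co 0q *: Co 0q +: Co 1q *: e =: e)Re r
   rk : ∀ z r n -> seq(re(z + oq r))n ≡ seq(re z)n ++ r
   rk z r n = Re
   Nv : ∀ z n -> Nb z n ≡ seq(re z)n ** seq(re z)n ++ seq(im z)n ** seq(im z)n
   Nv z n = Re
 Ib : ∀ {z δ}r -> Im z δ -> Im(z + oq r)δ
 Ib{z} {δ}r(N , f)= N , \ n le -> sB(δ <=_)(sy(i6 z r n))(f n le)
 Iw : ∀ {z δ}r -> Im z δ -> Im(z - 𝕚 * oq r)(δ -q r)
 Iw{z} {δ}r(N , f)= N , \ n le -> sB(δ -q r <=_)(sy(jv z r n))(ml(-q r)(f n le))
 Ih : ∀ r -> Im(𝕚 * oq r)r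
 Ih r = 0 , \ n _ -> rl(sy(k5 r n))
 private
  Eh : ∀ {δ a b}->(∀ z -> Im z(½ ** δ)-> e z <| a)-> a ** a <= b -> ∀ z -> Im z δ -> e z <| b
  Eh{δ}h le z(N , f)= mo le(rp(!~ yY(eP _ _)~! en(sV 1(\ z -> # ½ :* z :+ # ½ :* z := z)rR z))(≼-* hz hz))
   where
   hz = h(oq ½ * z)(N , \ n p -> sB(½ ** δ <=_)(sy(ju ½ z n))(Mo{δ} {seq(im z)n} {½}(lZ ni)(f n p)))
  Er : ∀ δ a ->(h : 0q <= δ)-> 1q <= a **(1q ++ 6ℚ ** δ)-> ∀ z -> Im z δ -> e z <| a
  Er δ a h le z hz = mo(Ca{r = 1q ++ 6ℚ ** δ}p(!< rl(Iv p)<~ le <! rl(cD a _)))(eU h hz)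
   where p = 1+6δ>0 h
  aP : ∀ {a b}-> 0q <= b -q a -> a <= b
  aP = Nq
 opaque
  e5 : ∀ z -> Im z(q 3 19)-> e z <| q 12 24
  e5 = Eh{q 3 19} {q 20 28} {q 12 24}(Er(½ ** q 3 19)(q 20 28)(nN _)(aP(nN _)))(aP(nN _))
  E1 : ∀ z -> Im z(q 7 9)-> e z <| q 1 63
  E1 = Eh{q 7 9} {q 12464 99999} {q 1 63}(Eh{q 7 19} {q 35304 99999} {q 12464 99999}(Eh{q 7 39} {q 59417 99999} {q 35304 99999}(Eh{q 7 79} {q 77082 99999} {q 59417 99999}
   (Eh{q 7 159} {q 87796 99999} {q 77082 99999}(Eh{q 7 319} {q 93699 99999} {q 87796 99999}(Eh{q 7 639} {q 96798 99999} {q 93699 99999}(Eh{q 7 1279} {q 1280 1300} {q 96798 99999}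
    (Er(½ ** q 7 1279)(q 1280 1300)(nN _)(aP(nN _)))
    (aP(nN _)))(aP(nN _)))(aP(nN _)))(aP(nN _)))(aP(nN _)))(aP(nN _)))(aP(nN _)))(aP(nN _))
 Rd : ∀ K x -> -q ½ <= x -> x <= ι K -> ∃ \ n -> -q ½ <= x -q ι n × x -q ι n <= ½
 Rd z0 x lo hi = 0 , !< lo <! rl(sy(!= cO(\ t -> x -q t)nw =! ig x)), !< rl(!= cO(\ t -> x -q t)nw =! ig x)<~ hi <~ rl nw <!(lZ ni)
 Rd(sC K)x lo hi = go(Tt x ½)
  where
  go : x <= ½ ⊎ ½ <= x -> ∃ \ n -> -q ½ <= x -q ι n × x -q ι n <= ½
  go(iL le)= 0 , !< lo <! rl(sy(!= cO(\ t -> x -q t)nw =! ig x)), !< rl(!= cO(\ t -> x -q t)nw =! ig x)<! le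
  go(iR le)= let n , a , b = Rd K(x -q 1q)(!< rl Re <! ml(-q 1q)le)(!< ml(-q 1q)hi <! rl(!= cO(_-q 1q)(sa K)=! sl 1(\ k -> Co 1q +: k -: Co 1q =: k)Re(ι K))); eq = != cO(\ t -> x -q t)(sa n)=! sl 2(\ x n -> x -:(Co 1q +: n)=: x -: Co 1q -: n)Re x(ι n)
   in sC n , !< a <! rl(sy eq), !< rl eq <! b
 Nw : ℂ -> Set
 Nw z = Evt \ n -> seq(re z)n ** seq(re z)n <= q 51 99 ** q 51 99
 fF : ∀ z -> ∃ \ r -> e(z + oq r)≈ e z × Nw(z + oq r)
 fF z = go(Tt 0q x)
  where
  c = cauchy(re z)(q 1 99)(pi(q 1 99))
  N = pF c
  x = seq(re z)N
  fn : ∀ r -> -q ½ <= x ++ r -> x ++ r <= ½ -> Nw(z + oq r)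
  fn r lo hi = N , \ n le -> !< rl(cong₂ _**_(rk z r n)(rk z r n))<! aq{seq(re z)n ++ r} {q 51 99}(bo n le)
   where
   jw : ∀ {y a}-> -q a <= y -> y <= a -> Q.∣ y ∣ <= a
   jw{y} {a}p s = go(Tt 0q y)
    where
    go : 0q <= y ⊎ y <= 0q -> Q.∣ y ∣ <= a
    go(iL h)= !< rl(np h)<! s
    go(iR h)= !< rl(!= sy(pa y)=! np(nt h))<~ nt p <! rl(sl 1(\ a -> -:(-: a)=: a)Re a)
   bo : ∀ n -> N ≤n n -> Q.∣ seq(re z)n ++ r ∣ <= q 51 99
   bo n le = !< rl(cO Q.∣_∣(sl 3(\ a x r -> a +: r =:(a -: x)+:(x +: r))Re(seq(re z)n)x r))<~
    pb(seq(re z)n -q x)(x ++ r)<~ mi(lZ(pS c n N le Rf))(jw lo hi)<! rl Re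
  K = ar x
   where ar = An
  Kf = An(-q x)
  go : 0q <= x ⊎ x <= 0q -> ∃ \ r -> e(z + oq r)≈ e z × Nw(z + oq r)
  go(iL h)= let n , a , b = Rd(pF K)x(!<(By ½(lZ ni)Re)<! h)(lZ(pS K))in
   -q ι n , !~ en(Cn(oe(ι n)))~! Ei z n , fn(-q ι n)a b
  go(iR h)= let n , a , b = Rd(pF Kf)(-q x)(!<(By ½(lZ ni)Re)<! nt h)(lZ(pS Kf)); eq = sl 2(\ x n -> x +: n =: -:(-: x -: n))Re x(ι n)in
   ι n , !~ eP z(oa n)~~ co(Eo n)~! In(e z),
    fn(ι n)(!< rl Re <~ nt b <! rl(sy eq))(!< rl eq <~ nt a <! rl Re)
 fG : ∀ {z}-> Im z(q 7 9)-> Nw z ->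
  Im z(q 17 19)⊎ ∃ \ za -> z * za ≈ - 1# × Im za(q 17 19)
 fG{z}hz hx = go(Tt(q 855 999)y)
  where
  c = cauchy(im z)(q 5 999)(pi(q 5 999))
  N = pF c
  y = seq(im z)N
  up : ∀ n -> N ≤n n -> seq(im z)n -q y <= q 5 999
  up n le = !<(pp _)<!(lZ(pS c n N le Rf))
  dn : ∀ n -> N ≤n n -> y -q seq(im z)n <= q 5 999
  dn n le = !<(pp _)<!(lZ(pS c N n Rf le))
  go : q 855 999 <= y ⊎ y <= q 855 999 -> Im z(q 17 19)⊎ ∃ \ za -> z * za ≈ - 1# × Im za(q 17 19)
  go(iL h)= iL(N , \ n le -> !< rl{q 17 19} {q 855 999 -q q 5 999}Re <~ mi h(nt(dn n le))<! rl(sl 2(\ y a -> y -:(y -: a)=: a)Re y(seq(im z)n)))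
  go(iR h)= iR(- rc z(q 7 9)7/10>0 lb , !~(sV 2(\ z r -> z :*(:- r):= :-(r :* z))rR z _)~! cc(Rc z(q 7 9)7/10>0 lb), rm z(q 7 9)7/10>0 lb(q 17 19)(nN(q 17 19))ev)
   where
   7/10>0 : 0q << q 7 9
   7/10>0 = pi(q 7 9)
   lb : z |> q 7 9
   lb = pF hz , \ n le -> !< sn(lZ 7/10>0)(pS hz n le)<~ By(seq(re z)n ** seq(re z)n)(nq(seq(re z)n))(cw(seq(re z)n ** seq(re z)n)_)<! rl(sy(Nv z n))
   jx : ∀ X Y -> X <= q 51 99 ** q 51 99 -> q 7 9 <= Y -> Y <= q 86 99 -> q 17 19 **(X ++ Y ** Y)<= Y
   jx X Y hX lo hi = Nq(sB(0q <=_)(sy eq)(N0(N0(N0(n0(nN(q 17 19))(p0 hX))(n0(nN(q 17 19))(n0(p0 lo)(p0 hi))))(n0(nN(q 326 999))(p0 hi)))(nN k)))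
    where
    k : ℚ
    k = q 17 19 **(q 7 9 ** q 86 99) -q q 326 999 ** q 86 99 -q q 17 19 **(q 51 99 ** q 51 99)
    eq : Y -q q 17 19 **(X ++ Y ** Y)≡ q 17 19 **(q 51 99 ** q 51 99 -q X)++ q 17 19 **((Y -q q 7 9)**(q 86 99 -q Y))++ q 326 999 **(q 86 99 -q Y)++ k
    eq = sl 2(\ X Y -> Y -: Co(q 17 19)*:(X +: Y *: Y)=: Co(q 17 19)*:(Co(q 51 99 ** q 51 99) -: X)+: Co(q 17 19)*:((Y -: Co(q 7 9))*:(Co(q 86 99) -: Y))+: Co(q 326 999)*:(Co(q 86 99) -: Y)+: Co k)Re X Y
   ev : Evt(\ n -> q 17 19 ** Nb z n <= seq(im z)n)
   ev = pF hz ℕ.⊔(pF hx ℕ.⊔ N), \ n le -> !< rl(cO(q 17 19 **_)(Nv z n))<!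
    jx(seq(re z)n ** seq(re z)n)(seq(im z)n)(pS hx n(Mm(pF hx)N(md(pF hz)_ le)))(pS hz n(Mm(pF hz)_ le))
     (!< rl(sl 2(\ y a -> a =:(a -: y)+: y)Re y(seq(im z)n))<~ mi(up n(md(pF hx)N(md(pF hz)_ le)))h <! rl Re)
module Van where
 open Region public
 open CSolve
 private
  q : ℕ -> ℕ -> ℚ
  q a b =(+ a)// sC b
 Hg : ℂ -> Set
 Hg z = Im z(q 7 9)
 Hi : ∀ {z}-> Hg z -> Hp z
 Hi h = q 7 9 , pi(q 7 9), h
 po :(ℕ -> ℂ)-> ℕ -> ℕ -> ℂ
 po a z0 = 1ₛ
 po a(sC n)= a *s po a n
 private
  60ℚ κ : ℚ
  60ℚ = ι 60
  κ = q 61 63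
  0≤60 : 0q <= 60ℚ
  0≤60 = nc 60
  nu : κ << 1q
  nu = bf(q 3 63)(pi(q 3 63))Re
  0≤κ : 0q <= κ
  0≤κ = nN κ
  opaque
   r6 : ∀ n ->(60ℚ **(1q ++ q 1 59))^^ n ** q 1 63 ^^ n ≡ κ ^^ n
   r6 n = != sy(dt(60ℚ **(1q ++ q 1 59))(q 1 63)n)=! cO(_^^ n)(!= cO(\ t -> t **(1q ++ q 1 59)** q 1 63)(dJ 60)=! Re)
  G6 : ∀ {a}n -> Gr 60ℚ a -> Gr 60ℚ(po a n)
  G6 z0 g = Gc 0≤60 1#
  G6{a}(sC n)g = Ga 0≤60{a} {po a n}g(G6 n g)
  G1 : ∀ {a}-> Gr 1q a -> Gr 60ℚ a
  G1 g δ hH = let C , hC , d = g δ hH in C , hC , \ n -> mo(Mo{_} {_} {C}hC(mu n(n0 n1(p hH))(ma{1q} {60ℚ} {1q ++ δ}(p hH)(1≤ι 59))))(d n)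
   where
   p : ∀ {δ}-> 0q << δ -> 0q <= 1q ++ δ
   p h = N0 n1(lZ h)
  D6 :(ℕ -> ℂ)-> Set
  D6 a = ∃ \ C -> 0q <= C ×(∀ z -> Hg z -> ∀ n -> a n * e z ^ n <| C ** κ ^^ n)
  G0 : ∀ {a}-> Gr 60ℚ a -> D6 a
  G0{a}g = let C , hC , d = g(q 1 59)(pi(q 1 59))in C , hC , \ z hz n ->
   mo(rl(!= ac C((60ℚ **(1q ++ q 1 59))^^ n)(q 1 63 ^^ n)=! cO(C **_)(r6 n)))(≼-*(d n)(≼-^ n(E1 z hz)))
  DG : ∀ {a z}-> D6 a -> Hg z -> Go(\ n -> a n * e z ^ n)
  DG{a} {z}(C , hC , d)hz = gy C κ hC 0≤κ nu(d z hz)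
  Dv : ∀ {a z}-> D6 a -> Hg z -> ∃(va a z)
  Dv{a} {z}d hz = gm{\ n -> a n * e z ^ n}(DG{a} {z}d hz), gu{\ n -> a n * e z ^ n}(DG{a} {z}d hz)
  V6 : ∀ {a b z A B}-> Gr 60ℚ a -> Gr 60ℚ b -> Hg z -> va a z A -> va b z B -> va(a *s b)z(A * B)
  V6{a} {b} {z}ga gb hz hA hB = Su{(\ i -> a i * e z ^ i)*s(\ i -> b i * e z ^ i)} {\ n ->(a *s b)n * e z ^ n}(pg a b(e z))rR
   (Sx{\ i -> a i * e z ^ i} {\ i -> b i * e z ^ i}(DG{a} {z}(G0 ga)hz)(DG{b} {z}(G0 gb)hz)hA hB)
  Vp : ∀ {a z A}n -> Gr 60ℚ a -> Hg z -> va a z A -> va(po a n)z(A ^ n)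
  Vp{a} {z}z0 g hz hA = Vc 1# z
  Vp{a} {z} {A}(sC n)g hz hA = V6{a} {po a n} {z} {A} {A ^ n}g(G6 n g)hz hA(Vp{a} {z} {A}n g hz hA)
 si : ℕ ->(ℕ -> ℂ)-> ℕ -> ℂ
 si z0 a n = a n
 si(sC k)a z0 = 0#
 si(sC k)a(sC n)= si k a n
 Vs : ∀ k{a z A}-> va a z A -> va(si k a)z(e z ^ k * A)
 Vs z0{a} {z} {A}h = Vr{a} {a} {z} {z}(mk \ _ -> rR)rR(yY(ie A))h
 Vs(sC k) {a} {z} {A}h = Su{\ n -> s n} {\ n -> si(sC k)a n * e z ^ n}(\ { z0 -> yY(ze _); (sC n)-> sV 3(\ x c y -> x :*(c :* y):= c :*(x :* y))rR(e z)(si k a n)(e z ^ n) })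
  (sV 3(\ x y A -> # 0q :+ x :*(y :* A):= x :* y :* A)rR(e z)(e z ^ k)A)
  (Sg{s}(Sd{\ n -> si k a n * e z ^ n}(e z)(Vs k{a} {z} {A}h)))
  where
  s : ℕ -> ℂ
  s z0 = 0#
  s(sC n)= e z *(si k a n * e z ^ n)
 private
  Dx : ∀ k{a}-> D6 a -> D6(si k a)
  Dx k{a}(C , hC , d)= C , hC , go k
   where
   go : ∀ k z -> Hg z -> ∀ n -> si k a n * e z ^ n <| C ** κ ^^ n
   go z0 z hz n = d z hz n
   go(sC k)z hz z0 = mo(n0 hC n1)(Zo(ze _))
   go(sC k)z hz(sC n)= mo(!< ma{q 1 63} {κ} {C ** κ ^^ n}(n0 hC(nf n 0≤κ))(By(q 60 63)(nN(q 60 63))Re)<! rl(sl 3(\ k C p -> k *:(C *: p)=: C *:(k *: p))Re κ C(κ ^^ n)))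
    (rp(sV 3(\ x c y -> x :*(c :* y):= c :*(x :* y))rR(e z)(si k a n)(e z ^ n))(≼-*(E1 z hz)(go k z hz n)))
 vr : ∀ m{f z A}->(∀ n -> n <n m -> f n ≈ 0#)-> va f z A -> ∃ \ G -> va(\ n -> f(m +n n))z G × A ≈ e z ^ m * G
 vr z0{f} {z} {A}h hA = A , hA , yY(ie A)
 vr(sC m) {f} {z} {A}h hA =
  let B , eB , vB = Vt{f} {z} {A}hA(h 0(ss zn));G , vG , eq = vr m{tl f} {z} {B}(\ n lt -> h(sC n)(ss lt))vB
  in G , vG , !~ yY eB ~~ co eq ~! yY(ao _ _ G)
 gp : ∀ m{f}-> Gr 1q f -> Gr 1q(\ n -> f(m +n n))
 gp z0 g = g
 gp(sC m) {f}g = gp m{tl f}(Gq{f}g)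
 private
  opaque
   unfolding fq _+ℝ_ _*ℝ_ -ℝ_
   NB : ∀ z n -> Nb(z * z)n ≡ Nb z n ** Nb z n
   NB z n = sl 2(\ a b ->(a *: a -: b *: b)*:(a *: a -: b *: b)+:(a *: b +: b *: a)*:(a *: b +: b *: a)=:(a *: a +: b *: b)*:(a *: a +: b *: b))Re(seq(re z)n)(seq(im z)n)
 bS : ∀ {z}-> z * z ≈ 0# -> z ≈ 0#
 bS{z}h = ny(rp(sV 1(\ z -> z := z :- # 0q)rR z)(mv ra \ p hp -> let N , f = bd(Zo h)(p ** p)(nD hp hp)in
  N , \ n le -> sK(nq p)(!< rl(sy(NB z n))<! f n le)))
 pz : ∀ {z}n -> z ^ sC n ≈ 0# -> z ≈ 0#
 pz{z}z0 h = !~ yY(In z)~! h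
 pz{z}(sC n)h = pz n(bS(!~ sV 2(\ z p ->(z :* p):*(z :* p):=(z :*(z :* p)):* p)rR z(z ^ n)~~ cn h ~!(ze _)))
 private
  Gj : Gr 60ℚ uj
  Gj = G1(Gf{1q}n1{tl(ta Dc)}_(Gq{ta Dc}(gr Mi)))
  Gv : Gr 60ℚ vj
  Gv δ hH = 1q , n1 , \ n -> mo(!< mu n 0≤60(!< rl(sy(ii 60ℚ))<! Mo{1q} {1q ++ δ} {60ℚ}0≤60(By δ(lZ hH)Re))<! rl(sy(iy _)))(vi n)
 1728⁻¹ : oq(q 1 1727)* oq((+ 1728)// 1)≈ 1#
 1728⁻¹ = sV 0(#(q 1 1727):* #((+ 1728)// 1):= # 1q)rR
 private
  jy = 1728⁻¹
  DX : ∀ {s sJ D x u}-> sJ * s ≈ 1# -> D ≈ x * u -> D ≈ s *(x *(sJ * u))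
  DX{s} {sJ} {D} {x} {u}h e = !~ e ~! yY(!~ sV 4(\ s r x u -> s :*(x :*(r :* u)):=(r :* s):*(x :* u))rR s sJ x u ~~ cn h ~!(ie _))
  i7 : ∀ {s sJ D x i U V}-> sJ * s ≈ 1# -> x * i ≈ 1# -> U * V ≈ 1# -> D ≈ s *(x * U)-> sJ *(i * V)* D ≈ 1#
  i7{s} {sJ} {D} {x} {i} {U} {V}h xi UV e = !~ co e ~~ sV 6(\ r i V s x U -> r :*(i :* V):*(s :*(x :* U)):=(r :* s):*((x :* i):*(U :* V)))rR sJ i V s x U ~~
   cd h(cd xi UV)~~(ie _)~!(ie _)
  Lk : ∀ {x U V G D F A s w k m n}-> D ≈ s *(x * U)-> U * V ≈ 1# -> F ≈ x ^ k *(G ^ n * V ^ w)-> A ≈ x ^ m * G -> n *n m ≡ w +n k -> F * D ^ w ≈ A ^ n * s ^ w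
  Lk{x} {U} {V} {G} {D} {F} {A} {s} {w} {k} {m} {n}DR UV Fa Av nm = !~ cd Fa(!~ ck w DR ~~ di s(x * U)w ~! co(di x U w))~~
   sV 6(\ a G V s b U -> a :*(G :* V):*(s :*(b :* U)):=(b :* a):* G :*(U :* V):* s)rR(x ^ k)(G ^ n)(V ^ w)(s ^ w)(x ^ w)(U ^ w)~!
   cn(!~ cd(cn(yY(xo x w k)))(!~ yY(di U V w)~~ ck w UV ~! 1^ w)~~
    (In _)~~ cn(!~ rx(cO(x ^_)(sy nm))~! yY(^-* x m n))~~ yY(di(x ^ m)G n)~! ck n(yY Av))
 module VK {w m k′ NC : ℕ} {f : ℕ -> ℂ} (mP : MF (sC NC) (ta Dc)) (mf : MF w f) (oF : ∀ n -> n <n m -> f n ≈ 0#) (Nm : sC NC *n m ≡ w +n sC k′) where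
  private
   k = sC k′
   N = sC NC
   g Fc c : ℕ -> ℂ
   g n = f(m +n n)
   Fc = po g N *s po vj w
   c = si k Fc
   GD : Gr 60ℚ g
   GD = G1(gp m{f}(gr mf))
   GF : Gr 60ℚ Fc
   GF = Ga 0≤60{po g N} {po vj w}(G6 N GD)(G6 w Gv)
   Dm : D6 c
   Dm = Dx k{Fc}(G0 GF)
   Lx : ℂ -> ℂ -> Set
   Lx z F = ∃ \ A -> ∃ \ D -> ∃ \ DT -> va f z A × va(ta Dc)z D × DT * D ≈ 1# × F * D ^ w ≈ A ^ N * oq((+ 1728)// 1)^ w
   module Lx {z F : ℂ} (l : Lx z F) where
    A D DT : ℂ
    A = pF l
    D = pF(pS l)
    DT = pF(pS(pS l))
    vA : va f z A
    vA = pF(pS(pS(pS l)))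
    vD : va(ta Dc)z D
    vD = pF(pS(pS(pS(pS l))))
    DY : DT * D ≈ 1#
    DY = pF(pS(pS(pS(pS(pS l)))))
    lE : F * D ^ w ≈ A ^ N * oq((+ 1728)// 1)^ w
    lE = pS(pS(pS(pS(pS(pS l)))))
   module Mk {z F : ℂ} (hz : Hg z) (hF : va c z F) where
    x = e z
    VA = Vl{f} {z}(gr mf)(Hi{z}hz)
    A = pF VA
    vA = pS VA
    vy = Vl{ta Dc} {z}(gr Mi)(Hi{z}hz)
    D = pF vy
    vD = pS vy
    gd = vr m{f} {z} {A}oF vA
    G = pF gd
    vG = pF(pS gd)
    ud = Vt{ta Dc} {z} {D}vD rR
    Ua = pF ud
    U = oq(q 1 1727)* Ua
    vU : va uj z U
    vU = Vb{tl(ta Dc)} {z} {Ua}(oq(q 1 1727))(pS(pS ud))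
    vv = Dv{vj} {z}(G0 Gv)hz
    V = pF vv
    UV : U * V ≈ 1#
    UV = Va{uj *s vj} {z}(V6{uj} {vj} {z} {U} {V}Gj Gv hz vU(pS vv))(Vr{1ₛ} {uj *s vj} {z} {z}(mk \ n -> yY(at uv n))rR rR(Vc 1# z))
    s sJ : ℂ
    s = oq((+ 1728)// 1)
    sJ = oq(q 1 1727)
    DR : D ≈ s *(x * U)
    DR = DX{s} {sJ}jy(yY(pF(pS ud)))
    Fa : F ≈ x ^ k *(G ^ N * V ^ w)
    Fa = Va{c} {z}hF(Vs k{Fc} {z}(V6{po g N} {po vj w} {z}(G6 N GD)(G6 w Gv)hz(Vp{g} {z}N GD hz vG)(Vp{vj} {z}w Gv hz(pS vv))))
    inv : sJ *(e(- z)* V)* D ≈ 1#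
    inv = i7{s} {sJ}jy(eR z)UV DR
    o9 : F * D ^ w ≈ A ^ N * s ^ w
    o9 = Lk{x} {U} {V} {G} {D} {F} {A} {s} {w} {k} {m} {N}DR UV Fa(pS(pS gd))Nm
   mL : ∀ {z F}-> Hg z -> va c z F -> Lx z F
   mL{z} {F}hz hF = A , D , sJ *(e(- z)* V), vA , vD , inv , o9
    where open Mk{z} {F}hz hF
   Pv : ∀ {x y}n -> x * y ≈ 1# -> x ^ n * y ^ n ≈ 1#
   Pv{x} {y}n h = !~ yY(di x y n)~~ ck n h ~! 1^ n
   cancel : ∀ {x y a b}-> b * a ≈ 1# -> x * a ≈ y * a -> x ≈ y
   cancel{x} {y} {a} {b}ba h = !~ yY(In x)~~ co(yY ba)~~ sV 3(\ x b a -> x :*(b :* a):=(x :* a):* b)rR x b a ~~ cn h ~~ sV 3(\ y a b -> y :* a :* b := y :*(b :* a))rR y a b ~~ co ba ~! In y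
   iS : ∀ {z za F Fb}-> Hg z -> Hg za -> z * za ≈ - 1# -> va c z F -> va c za Fb -> F ≈ Fb
   iS{z} {za} {F} {Fb}hz Hz zz hF HF = cancel{F} {Fb} {La.D ^ w} {La.DT ^ w}(Pv w La.DY)(!~ co Dw ~~ sV 3(\ F z d -> F :*(z :* d):= z :*(F :* d))rR F(z ^(w *n N))(L.D ^ w)~~
    co L.lE ~! yY(!~ La.lE ~~ cn(!~ ck N(Sl mf(Hi{z}hz)(Hi{za}Hz)zz L.vA La.vA)~~ di(z ^ w)L.A N ~! cn(!~(^-* z w N)~! rx(cO(z ^_)(cJ N w))))~!(ao _ _ _)))
    where
    module L = Lx {z} {F} (mL {z} {F} hz hF)
    module La = Lx {za} {Fb} (mL {za} {Fb} Hz HF)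
    Dw : La.D ^ w ≈ z ^(w *n N)* L.D ^ w
    Dw = !~ ck w(Sl mP(Hi{z}hz)(Hi{za}Hz)zz L.vD La.vD)~~ di(z ^ N)L.D w ~! cn(^-* z N w)
   ϑ : ℚ
   ϑ = q 12 12
   cR : ∀ {b}-> 0q <= b ->(∀ z F -> Hg z -> va c z F -> F <| b)-> ∀ z F -> Im z(q 17 19)-> va c z F -> F <| b ** ϑ
   cR{b}hb hyp z F hz hF = rp(sV 2(\ F y -> F :- # 0q :* y := F)rR F(e z ^ 0))
    (⟶-≼{\ N -> ∑ N(tl t)}(n0 hb(nN ϑ))(SB{t}hF)(0 , \ N _ -> mo(rl tM)(ge{tl t} {b ** q 12 24} {q 12 24}N 13/25>0(n0 hb(nN(q 12 24)))(nN(q 12 24))Ec)))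
    where
    t : ℕ -> ℂ
    t n = c n * e z ^ n
    13/25>0 : 0q << 1q -q q 12 24
    13/25>0 = pi(q 13 24)
    zc = z - 𝕚 * oq(q 3 19)
    ρ = e(𝕚 * oq(q 3 19))
    h6 : Hg zc
    h6 = sB(Im zc) {q 17 19 -q q 3 19}Re(Iw{z}(q 3 19)hz)
    zf : e z ≈ e zc * ρ
    zf = !~ en(sV 2(\ z y -> z := z :- y :+ y)rR z(𝕚 * oq(q 3 19)))~!(eP zc _)
    hU : ∀ r j -> Hg(zc + oq(½^ r)* oa j)
    hU r j = fH(Ib{zc} {q 7 9}(½^ r ** ι j)h6)
     where
     opaque
      unfolding fq _+ℝ_ _*ℝ_ -ℝ_
      fH : Hg(zc + oq(½^ r ** ι j))-> Hg(zc + oq(½^ r)* oa j)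
      fH(N , f)= N , \ n le -> !< f n le <! rl(cO(seq(im zc)n ++_)(sl 2(\ a b -> Co 0q =: a *: Co 0q +: Co 0q *: b)Re(½^ r)(ι j)))
    ce : ∀ l -> c l * e zc ^ l <| b
    ce = CH.Cy{c} {zc} {pF Dm} {κ} {b}(pF(pS Dm))0≤κ nu hb(pS(pS Dm)zc h6)\ r j ->
     let v = Dv{c} {zc + oq(½^ r)* oa j}Dm(hU r j)in pF v , pS v , hyp(zc + oq(½^ r)* oa j)(pF v)(hU r j)(pS v)
    Ec : ∀ n -> tl t n <|(b ** q 12 24)** q 12 24 ^^ n
    Ec n = mo(rl(sy(ac b(q 12 24)(q 12 24 ^^ n))))(rp(yY(!~ co(!~ ck(sC n)zf ~! di(e zc)ρ(sC n))~! yY(ao _ _ _)))(≼-*(ce(sC n))(≼-^(sC n)(e5 _(Ih(q 3 19))))))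
    tM :(b ** q 12 24)** iv(1q -q q 12 24)13/25>0 ≡ b ** ϑ
    tM = !=(ac b(q 12 24)_)=! cO(b **_)(!= cO(_** iv(1q -q q 12 24)13/25>0) {q 12 24} {ϑ **(1q -q q 12 24)}Re =~ ac ϑ(1q -q q 12 24)(iv(1q -q q 12 24)13/25>0)=~ cO(ϑ **_)(Iv 13/25>0)=! ii ϑ)
   i8 : ∀ {b}-> 0q <= b ->(∀ z F -> Hg z -> va c z F -> F <| b)-> ∀ z F -> Hg z -> va c z F -> F <| b ** ϑ
   i8{b}hb hyp z F hz hF = go(fG{zb}hP(pS(pS ct)))
    where
    ct = fF z
    zb = z + oq(pF ct)
    hP : Hg zb
    hP = Ib{z} {q 7 9}(pF ct)hz
    h8 : va c zb F
    h8 = Su{\ n -> c n * e z ^ n} {\ n -> c n * e zb ^ n}(\ n -> co{c n}(ck n(yY(pF(pS ct)))))rR hF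
    go : Im zb(q 17 19)⊎(∃ \ za -> zb * za ≈ - 1# × Im za(q 17 19))-> F <| b ** ϑ
    go(iL h)= cR hb hyp zb F h h8
    go(iR(za , zz , h))= rp(yY(iS{zb} {za}hP Hz zz h8(pS v)))(cR hb hyp za(pF v)h(pS v))
     where
     Hz : Hg za
     Hz = pF h , \ n le -> !< By(q 3 19)(nN(q 3 19))Re <! pS h n le
     v = Dv{c} {za}Dm Hz
   opaque
    bT : ∃ \ b -> 0q <= b ×(∀ z F -> Hg z -> va c z F -> F <| b)
    bT = pF Dm ** iv(1q -q κ)xh , n0(pF(pS Dm))(lZ(i0 xh)), \ z F hz hF ->
     ⟶-≼(n0(pF(pS Dm))(lZ(i0 xh)))hF(0 , \ n _ -> ge{\ n -> c n * e z ^ n} {pF Dm} {κ}n xh(pF(pS Dm))0≤κ(pS(pS Dm)z hz))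
     where
     xh : 0q << 1q -q κ
     xh = Pp nu
   bC : ℚ
   bC = pF bT
   0≤b₀ : 0q <= bC
   0≤b₀ = pF(pS bT)
   0≤ϑ : 0q <= ϑ
   0≤ϑ = nN ϑ
   aj : ∀ a b t -> a ** b ** t ≡ a **(t ** b)
   aj a b t = != ac a b t =! cO(a **_)(cD b t)
   f4 : ∀ i z F -> Hg z -> va c z F -> F <| bC ** ϑ ^^ i
   f4 z0 z F hz hF = sB(F <|_)(sy(ii bC))(pS(pS bT)z F hz hF)
   f4(sC i)z F hz hF = sB(F <|_)(aj bC(ϑ ^^ i)ϑ)(i8{bC ** ϑ ^^ i}(n0 0≤b₀(nf i 0≤ϑ))(f4 i)z F hz hF)
   zF : ∀ z F -> Hg z -> va c z F -> F ≈ 0#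
   zF z F hz hF = xl \ ε hL -> let N , h = pu bC 0≤b₀(nN ϑ)(bf(q 1 12)(pi(q 1 12))Re)ε hL in
    mo(h N Rf)(rp(sV 1(\ z -> z := z :- # 0q)rR F)(f4 N z F hz hF))
  vn : ∀ n -> f n ≈ 0#
  vn = identity{f}(gr mf)\ {z} {A}hz hA ->
   let Hz : Hg z;Hz = pF hz , \ n le -> !< By(q 3 9)(nN(q 3 9))Re <! pS hz n le;vF = Dv{c} {z}Dm Hz;L = mL{z} {pF vF}Hz(pS vF)
   in pz NC(!~ ck N(Va{f} {z}hA(Lx.vA{z} {pF vF}L))~! cancel{_} {0#}(Pv w 1728⁻¹)(!~ yY(Lx.lE{z} {pF vF}L)~~ cn(zF z(pF vF)Hz(pS vF))~~(ze _)~! yY(ze _)))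
 Mv : ∀ {w f}m -> MF w f ->(∀ n -> n <n m -> f n ≈ 0#)-> w <n 12 *n m -> ∀ n -> f n ≈ 0#
 Mv{w} {f}m mf oF lt = VK.vn{w} {m} {12 *n m -n sC w} {11} {f}Mi mf oF(sy(!=(su w _)=! mm lt))
module Span where
 open Van public hiding (Δ;sq)
 open import Data.Nat.Tactic.RingSolver using (solve-∀)
 open CSolve
 module SR = CommutativeRing sR
 Sy : ∀ {a b}-> a ~s b -> b ~s a
 Sy = SR.sym
 E F Δ : ℕ -> ℂ
 E = ta e4
 F = ta e6
 Δ = oq((+ 1)// 1728)^s ta Dc
 data Ll : ℕ ->(ℕ -> ℂ)-> Set where
  zl : ∀ {k}-> Ll k 0ₛ
  On : Ll 0 1ₛ
  Ek_ : ∀ {k a}-> Ll k a -> Ll(2 +n k)(E *s a)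
  Fd_ : ∀ {k a}-> Ll k a -> Ll(3 +n k)(F *s a)
  _⊕_ : ∀ {k a b}-> Ll k a -> Ll k b -> Ll k(a +s b)
  _⊙_ : ∀ {k a}x -> Ll k a -> Ll k(x ^s a)
  Rp : ∀ {k a b}-> a ~s b -> Ll k a -> Ll k b
 cm : ∀ {x a b}-> a ~s b -> x ^s a ~s x ^s b
 cm h = mk \ n -> co(at h n)
 Lv : ∀ {k a}-> Ll k a -> MF(2 *n k)a
 Lv{k}zl = M0(2 *n k)
 Lv On = Mg
 Lv(Ek_{k} {a}l)= sB(\ w -> MF w(E *s a))(sy(Di 2 2 k))(Mb Me(Lv l))
 Lv(Fd_{k} {a}l)= sB(\ w -> MF w(F *s a))(sy(Di 2 3 k))(Mb M6(Lv l))
 Lv(l ⊕ lB)= Mf(Lv l)(Lv lB)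
 Lv(x ⊙ l)= mF x(Lv l)
 Lv(Rp h l)= Mr h(Lv l)
 private
  ·-+ : ∀ x a b -> x ^s(a +s b)~s x ^s a +s x ^s b
  ·-+ x a b = mk \ n -> dr x(a n)(b n)
 *-·ₛ : ∀ x a b -> a *s(x ^s b)~s x ^s(a *s b)
 *-·ₛ x a b = SR.trans(SR.*-comm a(x ^s b))(SR.trans(·-*ₛ x b a)(cm(SR.*-comm b a)))
 L1 : ∀ {k l a b}-> Ll k a -> Ll l b -> Ll(k +n l)(a *s b)
 L1 zl h = Rp(Sy(SR.zeroˡ _))zl
 L1 On h = Rp(Sy(SR.*-identityˡ _))h
 L1(Ek f)h = Rp(Sy(SR.*-assoc _ _ _))(Ek L1 f h)
 L1(Fd f)h = Rp(Sy(SR.*-assoc _ _ _))(Fd L1 f h)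
 L1(f ⊕ g)h = Rp(Sy(SR.distribʳ _ _ _))(L1 f h ⊕ L1 g h)
 L1(x ⊙ f)h = Rp(Sy(·-*ₛ x _ _))(x ⊙ L1 f h)
 L1(Rp e f)h = Rp(SR.*-congʳ e)(L1 f h)
 Le : ℕ ->(ℕ -> ℂ)-> ℂ -> Set
 Le m a x =(∀ n -> n <n m -> a n ≈ 0#)× a m ≈ x
 Lr : ∀ {m a b x}-> a ~s b -> Le m a x -> Le m b x
 Lr h(p , r)=(\ n lt -> !~ yY(at h n)~! p n lt), !~ yY(at h _)~! r
 Lb : ∀ m n{a b x y}-> Le m a x -> Le n b y -> Le(m +n n)(a *s b)(x * y)
 Lb m n{a} {b}= go m n a b
  where
  St : ∀ {p a b z}-> a 0 ≈ 0# -> Le p(tl a *s b)z -> Le(sC p)(a *s b)z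
  St{p} {a} {b}a0(h , r)=(\ { z0 _ -> !~ cn a0 ~!(ze _); (sC n)(ss lt)-> !~ jW n ~! h n lt }), !~ jW p ~! r
   where
   jW : ∀ n ->(a *s b)(sC n)≈(tl a *s b)n
   jW n = !~ Cg(!~ cn a0 ~!(ze _))~!(Ii _)
  tL : ∀ {m a x}-> Le(sC m)a x -> a 0 ≈ 0# × Le m(tl a)x
  tL(h , r)= h 0(ss zn),(\ n lt -> h(sC n)(ss lt)), r
  go : ∀ m n a b{x y}-> Le m a x -> Le n b y -> Le(m +n n)(a *s b)(x * y)
  go(sC m)n a b ha hb = St{m +n n} {a} {b}(pF(tL{m} {a}ha))(go m n(tl a)b(pS(tL{m} {a}ha))hb)
  go z0 z0 a b(_ , ha)(_ , hb)=(\ _()), cd ha hb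
  go z0(sC n)a b ha hb = Lr(SR.*-comm b a)(St{n} {b} {a}(pF(tL{n} {b}hb))(Lr(SR.*-comm a(tl b))(go z0 n a(tl b)ha(pS(tL{n} {b}hb)))))
 1·1 : 1# * 1# ≈ 1#
 1·1 = ie 1#
 ui : ∀ r -> r ≢ 1 -> ∃ \ a -> Ll r a × a 0 ≈ 1#
 ui z0 _ = 1ₛ , On , rR
 ui(sC z0)h with()← h Re
 ui(sC(sC z0))_ = E *s 1ₛ , Ek On , 1·1
 ui(sC(sC(sC z0)))_ = F *s 1ₛ , Fd On , 1·1
 ui(sC(sC(sC(sC r))))_ = let a , l , h = ui(sC(sC r))\ ()in E *s a , Ek l , !~ co{E 0}h ~! 1·1
 l1 : Ll 6 Δ
 l1 = Rp(mk \ n -> co{oq((+ 1)// 1728)}(yY(!~ at Td n ~! ca(at qg n)(!~ sV 1(\ x -> :- x := #(-q 1q):* x)rR((F *s F)n)~! co{oq(-q 1q)}(at qh n)))))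
  (oq((+ 1)// 1728)⊙((Ek Ek Ek On)⊕(oq(-q 1q)⊙(Fd Fd On))))
  where
  qg : E *s(E *s E)~s E *s(E *s(E *s 1ₛ))
  qg = SR.*-congˡ(SR.*-congˡ(Sy(SR.*-identityʳ E)))
  qh : F *s F ~s F *s(F *s 1ₛ)
  qh = SR.*-congˡ(Sy(SR.*-identityʳ F))
 Lw : Le 1 Δ 1#
 Lw =(\ { z0 _ -> sV 0(#((+ 1)// 1728):* # 0q := # 0q)rR; (sC n)(ss()) }), ug
 xr : ℕ -> ℕ -> ℂ
 xr = po Δ
 lv : ∀ m -> Ll(m *n 6)(xr m)
 lv z0 = On
 lv(sC m)= L1 l1(lv m)
 Ld : ∀ m -> Le m(xr m)1#
 Ld z0 =(\ _()), rR
 Ld(sC m)= pF l , !~ pS l ~! 1·1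
  where l = Lb 1 m Lw(Ld m)
 Bs : ∀ m r -> r ≢ 1 -> ∃ \ a -> Ll(m *n 6 +n r)a × Le m a 1#
 Bs m r h = let a , l , a0 = ui r h; ld = Lb m 0{xr m} {a}(Ld m)((\ _()), a0)
  in xr m *s a , L1(lv m)l , sB(\ k -> Le k(xr m *s a)1#)(Iy m)(pF ld , !~ pS ld ~! 1·1)
 nO :(ℕ -> ℂ)-> ℕ -> ℂ
 nO a = oq(-q 1q)^s a
 module _ {k : ℕ} {f : ℕ -> ℂ} (mf : MF (2 *n k) f) where
  Rh : ℕ -> Set
  Rh m = ∃ \ g -> Ll k g ×(∀ n -> n <n m ->(f +s nO g)n ≈ 0#)
  Ki : ∀ m r -> m *n 6 +n r ≡ k -> r ≢ 1 -> Rh m -> Rh(sC m)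
  Ki m r eq R1(g , l , h)= g +s x ^s b , l ⊕(x ⊙ sB(\ k -> Ll k b)eq lb), \ n lt -> go n(M1 lt)
   where
   b = pF(Bs m r R1)
   lb = pF(pS(Bs m r R1))
   ld = pS(pS(Bs m r R1))
   x =(f +s nO g)m
   split : ∀ n ->(f +s nO(g +s x ^s b))n ≈(f +s nO g)n - x * b n
   split n = sV 4(\ f g x b -> f :+ #(-q 1q):*(g :+ x :* b):=(f :+ #(-q 1q):* g):- x :* b)rR(f n)(g n)x(b n)
   go : ∀ n -> n <n m ⊎ n ≡ m ->(f +s nO(g +s x ^s b))n ≈ 0#
   go n(iL lt)= !~ split n ~~ sb(h n lt)(co(pF ld n lt))~! sV 1(\ x -> # 0q :- x :* # 0q := # 0q)rR x
   go n(iR Re)= !~ split n ~~ Cn(cc(co(pS ld)))~! sV 1(\ x -> x :- x :* # 1q := # 0q)rR x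
  ki : ∀ m r -> m *n 6 +n r ≡ k -> r ≢ 1 -> Rh(sC m)
  ki m r eq R1 = go m r eq R1
   where
   go : ∀ m r -> m *n 6 +n r ≡ k -> r ≢ 1 -> Rh(sC m)
   go z0 r eq h = Ki z0 r eq h(0ₛ , zl , \ _())
   go(sC m)r eq h = Ki(sC m)r eq h(go m(6 +n r)(!= ee m r =! eq)\ ())
    where
    ee : ∀ m r -> m *n 6 +n(6 +n r)≡ 6 +n m *n 6 +n r
    ee = solve-∀
  MR : ∀ {g}-> Ll k g -> MF(2 *n k)(f +s nO g)
  MR l = Mf mf(mF _(Lv l))
  fo : ∀ {g}-> Ll k g ->(∀ n ->(f +s nO g)n ≈ 0#)-> Ll k f
  fo{g}l h = Rp(mk \ n -> !~ sV 2(\ f g -> g := f :-(f :+ #(-q 1q):* g))rR(f n)(g n)~~ Cn(cc(h n))~! sV 1(\ f -> f :- # 0q := f)rR(f n))l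
  bD : ∀ m r -> m *n 6 +n r ≡ k -> r ≢ 1 -> r <n 6 -> Ll k f
  bD m r eq R1 R6 = let g , l , h = ki m r eq R1 in fo l(Mv(sC m)(MR l)h(sB(\ k -> 2 *n k <n 12 *n sC m)eq(bo R6)))
   where
   ee : ∀ m -> 2 *n(m *n 6 +n 6)≡ 12 *n sC m
   ee = solve-∀
   bo : ∀ {r}-> r <n 6 -> 2 *n(m *n 6 +n r)<n 12 *n sC m
   bo lt = Ta(mD 2(mM(m *n 6)lt))(ri(ee m))
 wi : ∀ {m h}-> MF(2 *n(m *n 6 +n 1))h ->(∀ n -> n <n m -> h n ≈ 0#)-> ∀ n -> h n ≈ 0#
 wi{m} {h}mf oF = at(CE qi)
  where
  x = h m
  qj : Le m h x
  qj = oF , rR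
  mQ : ∀ {w b r}c -> MF w b -> Le 0 b 1# -> Ll r c -> c 0 ≈ 1# -> 2 *n(m *n 6 +n 1)+n w ≡ 2 *n(m *n 6 +n r)-> r <n 6 -> h *s b ~s x ^s(xr m *s c)
  mQ{w} {b} {r}c mb lb lc c0 eq R6 = mk \ n -> !~ sV 2(\ a b -> a :=(a :+ #(-q 1q):* b):+ b)rR((h *s b)n)((x ^s(xr m *s c))n)~~ Cg(Mv(sC m)qk od(bo R6)n)~!(Ii _)
   where
   d =(h *s b)+s nO(x ^s(xr m *s c))
   qk : MF(2 *n(m *n 6 +n r))d
   qk = Mf(sB(\ w -> MF w(h *s b))eq(Mb mf mb))(mF _(mF x(Lv(L1(lv m)lc))))
   l₁ = Lb m 0{h} {b}qj lb
   l₂ = Lb m 0{xr m} {c}(Ld m)((\ _()), c0)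
   m2 = Iy m
   od : ∀ n -> n <n sC m -> d n ≈ 0#
   od n lt = go n(M1 lt)
    where
    go : ∀ n -> n <n m ⊎ n ≡ m -> d n ≈ 0#
    go n(iL lt)= !~ ca(pF l₁ n(sB(n <n_)(sy m2)lt))(co{oq(-q 1q)}(co{x}(pF l₂ n(sB(n <n_)(sy m2)lt))))~! sV 1(\ x -> # 0q :+ #(-q 1q):*(x :* # 0q):= # 0q)rR x
    go n(iR Re)= !~ ca(sB(\ k ->(h *s b)k ≈ x * 1#)m2(pS l₁))(co{oq(-q 1q)}(co{x}(sB(\ k ->(xr m *s c)k ≈ 1# * 1#)m2(pS l₂))))~! sV 1(\ x -> x :* # 1q :+ #(-q 1q):*(x :*(# 1q :* # 1q)):= # 0q)rR x
   ee : ∀ m -> 2 *n(m *n 6 +n 6)≡ 12 *n sC m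
   ee = solve-∀
   bo : ∀ {r}-> r <n 6 -> 2 *n(m *n 6 +n r)<n 12 *n sC m
   bo lt = Ta(mD 2(mM(m *n 6)lt))(ri(ee m))
  w4 : ∀ m -> 2 *n(m *n 6 +n 1)+n 4 ≡ 2 *n(m *n 6 +n 3)
  w4 = solve-∀
  w6 : ∀ m -> 2 *n(m *n 6 +n 1)+n 6 ≡ 2 *n(m *n 6 +n 4)
  w6 = solve-∀
  hE : h *s E ~s x ^s(xr m *s(F *s 1ₛ))
  hE = mQ(F *s 1ₛ)Me((\ _()), rR)(Fd On)1·1(w4 m)(ss(ss(ss(ss zn))))
  hF : h *s F ~s x ^s(xr m *s(E *s(E *s 1ₛ)))
  hF = mQ(E *s(E *s 1ₛ))M6((\ _()), rR)(Ek Ek On)(!~ co{E 0}1·1 ~! 1·1)(w6 m)(ss(ss(ss(ss(ss zn)))))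
  jX : ∀ c b ->(x ^s(xr m *s c))*s b ~s x ^s(xr m *s(c *s b))
  jX c b = SR.trans(·-*ₛ x _ _)(cm(SR.*-assoc _ _ _))
  k6 : x ^s(xr m *s(F *s F))~s x ^s(xr m *s(E *s(E *s E)))
  k6 = SR.trans(cm(SR.*-congˡ(SR.*-congʳ(Sy(SR.*-identityʳ F)))))(SR.trans(Sy(jX(F *s 1ₛ)F))(SR.trans(SR.*-congʳ(Sy hE))
   (SR.trans(SR.*-assoc h E F)(SR.trans(SR.*-congˡ(SR.*-comm E F))(SR.trans(Sy(SR.*-assoc h F E))(SR.trans(SR.*-congʳ hF)(SR.trans(jX(E *s(E *s 1ₛ))E)
    (cm(SR.*-congˡ(SR.trans(SR.*-assoc E _ E)(SR.*-congˡ(SR.*-congʳ(SR.*-identityʳ E)))))))))))))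
  x1 : ∀ n -> x *(xr(sC m))n ≈ 0#
  x1 n = !~ co{x}(at(SR.trans(SR.*-comm Δ(xr m))(SR.trans(*-·ₛ _(xr m)(ta Dc))(cm(SR.trans(SR.*-congˡ Td)(SR.distribˡ(xr m)_ _)))))n)~~
   sV 4(\ x s a b -> x :*(s :*(a :+ b)):= s :*(x :* a :+ x :* b))rR x(oq((+ 1)// 1728))((xr m *s(E *s(E *s E)))n)((xr m *s(-s(F *s F)))n)~~
    co{oq((+ 1)// 1728)}(!~ ca(yY(at k6 n))(co{x}(at jn n))~! sV 2(\ x a -> x :* a :+ x :*(#(-q 1q):* a):= # 0q)rR x((xr m *s(F *s F))n))~!(zr _)
   where
   jn : xr m *s(-s(F *s F))~s nO(xr m *s(F *s F))
   jn = SR.trans(SR.*-congˡ{xr m}(mk \ n -> sV 1(\ x -> :- x := #(-q 1q):* x)rR((F *s F)n)))(*-·ₛ _ _ _)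
  X0 : x ≈ 0#
  X0 = !~ yY(In x)~~ co{x}(yY(pS(Ld(sC m))))~! x1(sC m)
  qi : h *s E ~s 0ₛ
  qi = SR.trans hE(mk \ n -> !~ cn X0 ~!(ze _))
  CE : h *s E ~s 0ₛ -> h ~s 0ₛ
  CE z = SR.trans(Sy(SR.*-identityʳ h))(SR.trans(SR.*-congˡ{h}(Sy(I.iF rR)))(SR.trans(Sy(SR.*-assoc h E I.il))(SR.trans(SR.*-congʳ z)(SR.zeroˡ I.il))))
   where module I = Inverse E
 k7 : ∀ k{f}-> MF(2 *n k)f -> Ll k f
 k7 k{f}mf = go(k DM.% 6)(DM.m%n<n k 6)(!=(Cm _(k DM.% 6))=! sy(DM.m≡m%n+[m/n]*n k 6))
  where
  import Data.Nat.DivMod as DM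
  go : ∀ r -> r <n 6 ->(k DM./ 6)*n 6 +n r ≡ k -> Ll k f
  Oe : ∀ m -> m *n 6 +n 1 ≡ k -> Ll k f
  Oe z0 eq = fo mf zl(\ n -> Az eq n)
   where
   Az : 1 ≡ k -> ∀ n ->(f +s nO 0ₛ)n ≈ 0#
   Az Re n = wi{0} {f +s nO 0ₛ}(MR{1} {f}mf zl)(\ _())n
  Oe(sC m)eq = let g , l , h = ki mf m 7(!= ee m =! eq)(\ ())in fo mf l(fn l h eq)
   where
   ee : ∀ m -> m *n 6 +n 7 ≡ 6 +n m *n 6 +n 1
   ee = solve-∀
   fn : ∀ {g}-> Ll k g ->(∀ n -> n <n sC m ->(f +s nO g)n ≈ 0#)-> sC m *n 6 +n 1 ≡ k -> ∀ n ->(f +s nO g)n ≈ 0#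
   fn{g}l h eq = wi{sC m} {f +s nO g}(sB(\ k -> MF(2 *n k)(f +s nO g))(sy eq)(MR mf l))h
  go 1 _ eq = Oe(k DM./ 6)eq
  go 0 lt eq = bD mf(k DM./ 6)0 eq(\ ())lt
  go(sC(sC r))lt eq = bD mf(k DM./ 6)(sC(sC r))eq(\ ())lt
infixr 6 _~&_ _&!_
infix 5 !&_
data Pg(x z : ℕ -> ℂ): Set where
 _&!_ : ∀ {y}-> x Span.~s y -> y Span.~s z -> Pg x z
 _~&_ : ∀ {y}-> x Span.~s y -> Pg y z -> Pg x z
!&_ : ∀ {x z}-> Pg x z -> x Span.~s z
!&(p &! q)= Span.SR.trans p q
!&(p ~& q)= Span.SR.trans p(!& q)
open Span.SR using () renaming (*-congˡ to cf;+-cong to cj;refl to Rl;+-congˡ to cq;*-congʳ to cv;+-identityʳ to io;*-assoc to Ac;zeroʳ to Zr;distribˡ to Dr;distribʳ to dg;*-cong to cI;*-identityˡ to iG;-‿cong to cL;zeroˡ to zh;+-congʳ to fT;trans to tX;+-identityˡ to j7;*-comm to qy;*-identityʳ to qU;-‿inverseʳ to qV)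
module Norm where
 open Span public
 open import Relation.Nullary using (¬_;yes;no;Dec)
 open import Relation.Nullary.Decidable using (toWitness;decidable-stable)
 open CSolve
 Do : ∀ a b ->(∀ n ->(a Z.*s b)n ≡ 0ℤ)-> ∀ n -> a n ≢ 0ℤ -> ∀ m -> b m ≡ 0ℤ
 Do a b h z0 a0 m = go m m Rf
  where
  T0 : ∀ (a b : ℕ -> ℤ)m ->(∀ i -> i ≤n m -> b i ≡ 0ℤ)->(a Z.*s b)m ≡ 0ℤ
  T0 a b z0 hb = != cO(a 0 *z_)(hb 0 zn)=! Ze(a 0)
  T0 a b(sC m)hb = cong₂ _+z_(!= cO(a 0 *z_)(hb(sC m)Rf)=! Ze(a 0))(T0(Z.tl a)b m \ i le -> hb i(m1 le))
  kl : ∀ x -> a 0 *z x ≡ 0ℤ -> x ≡ 0ℤ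
  kl x e = Pk(qK(a 0)e)
   where
   Pk : a 0 ≡ 0ℤ ⊎ x ≡ 0ℤ -> x ≡ 0ℤ
   Pk(iL e)= ⊥-elim(a0 e)
   Pk(iR e)= e
  go : ∀ N m -> m ≤n N -> b m ≡ 0ℤ
  go N z0 _ = kl(b 0)(h 0)
  go(sC N)(sC m)(ss le)= kl(b(sC m))(!= sy(iu _)=~ cO(\ t -> a 0 *z b(sC m)+z t)(sy(T0(Z.tl a)b m \ i iK -> go N i(iK ≤~ le)))=! h(sC m))
 Do a b h(sC n)an m with a 0 ℤₚ.≟ 0ℤ
 ... | no a0 = Do a b h z0 a0 m
 ... | yes a0 = Do(Z.tl a)b(\ k -> != sy(!= cO(_+z(Z.tl a Z.*s b)k)(!= cO(_*z b(sC k))a0 =! zt(b(sC k)))=!(qL _))=! h(sC k))n an m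
 Db Al :(ℕ -> ℤ)-> ℕ -> ℤ
 Db a z0 = a 0
 Db a(sC z0)= 0ℤ
 Db a(sC(sC n))= Db(Z.tl a)n
 Al a z0 = a 0
 Al a(sC n)= -z Al(Z.tl a)n
 A0 : ∀ a n -> Al a n ≡ 0ℤ -> a n ≡ 0ℤ
 A0 a z0 h = h
 A0 a(sC n)h = A0(Z.tl a)n(!= sy(a7 _)=!(cO -z_ h))
 Vd : ∀ {a z A}-> va(ta a)(z + z)A -> va(ta(Db a))z A
 Vd{a} {z} {A}h ε na = let N , f = h ε na in N +n N , \ n le -> rp(Cg(yY(pQ(py n))))(f ℕ.⌈ n /2⌉(ri(sy(Hf N))≤~ qM le))
  where
  Hf : ∀ N -> ℕ.⌈ N +n N /2⌉ ≡ N
  Hf z0 = Re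
  Hf(sC N)= != cO(\ k -> ℕ.⌈ sC k /2⌉)(su N N)=! cO sC(Hf N)
  x = e z
  P :(ℕ -> ℤ)-> ℕ -> ℂ
  P a n = ∑ n(\ i -> ta(Db a)i * x ^ i)
  xT : e(z + z)≈ x * x
  xT = eP z z
  St : ∀ a n -> P a(sC(sC n))≈ ta a 0 * 1# + x * x * P(Z.tl a)n
  St a n = Cn{ta a 0 * 1#}(!~ Cg(ze _)~~(Ii _)~~(ch n \ i -> sV 3(\ c x y -> c :*(x :*(x :* y)):= x :* x :*(c :* y))rR(ta(Db(Z.tl a))i)x(x ^ i))~!(∑-* n(x * x)_))
  R :(ℕ -> ℤ)-> ℕ -> ℂ
  R a n = ∑ n(\ i -> ta a i *(x * x)^ i)
  Rj : ∀ a n -> R a(sC n)≈ ta a 0 * 1# + x * x * R(Z.tl a)n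
  Rj a n = Cn{ta a 0 * 1#}(!~(ch n \ i -> sV 3(\ c x y -> c :*(x :* y):= x :*(c :* y))rR(ta a(sC i))(x * x)((x * x)^ i))~!(∑-* n(x * x)_))
  go : ∀ a n -> P a n ≈ R a ℕ.⌈ n /2⌉
  go a z0 = rR
  go a(sC z0)= rR
  go a(sC(sC n))= !~ St a n ~~ Cn{ta a 0 * 1#}(co{x * x}(go(Z.tl a)n))~! yY(Rj a ℕ.⌈ n /2⌉)
  pQ : ∀ {n}-> Pa n -> P a n ≈ ∑ ℕ.⌈ n /2⌉(\ i -> ta a i * e(z + z)^ i)
  pQ{n}_ = !~ go a n ~!(ch ℕ.⌈ n /2⌉ \ i -> co{ta a i}(ck i(yY xT)))
 vt : ∀ {a z A}-> va(ta a)(z + oq ½)A -> va(ta(Al a))z A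
 vt{a} {z}h = Su{\ n -> ta a n * e(z + oq ½)^ n} {\ n -> ta(Al a)n * e z ^ n}(go a)rR h
  where
  jn : e(z + oq ½)≈ - e z
  jn = !~ eP z(oq ½)~~ co{e z}fw ~! sV 1(\ x -> x :*(:- # 1q):= :- x)rR(e z)
  go : ∀ a n -> ta a n * e(z + oq ½)^ n ≈ ta(Al a)n * e z ^ n
  go a z0 = rR
  go a(sC n)= !~ co{ta a(sC n)}(cn jn)~~ sV 3(\ c x y -> c :*((:- x):* y):= :-(x :*(c :* y)))rR(ta a(sC n))(e z)(e(z + oq ½)^ n)~~ cc(co(go(Z.tl a)n))~~
   sV 3(\ c x y -> :-(x :*(c :* y)):=(:- c):*(x :* y))rR(ta(Al(Z.tl a))n)(e z)(e z ^ n)~! cn(yY(og(Al(Z.tl a)n)))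
 Gd : ∀ {a}-> Gr 1q(ta a)-> Gr 1q(ta(Db a))
 Gd{a}g = Gs n1{dH 1(ta a)}(mk \ n -> go a n(py n))(Gi 1{ta a}g)
  where
  *2 : ∀ n -> n *n 2 ≡ n +n n
  *2 n = != cJ n 2 =! cO(n +n_)(Iy n)
  dy : ∀ a n -> Db a(n +n n)≡ a n
  dy a z0 = Re
  dy a(sC n)= != cO(Db a)(cO sC(su n n))=! dy(Z.tl a)n
  dB : ∀ a n -> Db a(sC(n +n n))≡ 0ℤ
  dB a z0 = Re
  dB a(sC n)= != cO(\ k -> Db a(sC(sC k)))(su n n)=! dB(Z.tl a)n
  import Data.Nat.DivMod as DM
  go : ∀ a n -> Pa n -> dH 1(ta a)n ≈ ta(Db a)n
  go a _(fE n)= !~ sB(\ k -> dH 1(ta a)k ≈ ta a n)(*2 n)(Dy 1(ta a)n)~! rx(cO oz(sy(dy a n)))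
  go a _(oE n)= !~ dK 1(ta a)(sC(n +n n))(sB(\ k -> sC k DM.% 2 ≢ 0)(*2 n)\ e -> Od(!= sy(DM.[m+kn]%n≡m%n 1 n 2)=! e))~! rx(cO oz(sy(dB a n)))
   where
   Od : 1 ≢ 0
   Od()
 Gt : ∀ {a}-> Gr 1q(ta a)-> Gr 1q(ta(Al a))
 Gt{a}= Gk(\ n r -> go a n)
  where
  go : ∀ a n{r}-> ta a n <| r -> ta(Al a)n <| r
  go a z0 h = h
  go a(sC n)h = rp(yY(og(Al(Z.tl a)n)))(Ne(go(Z.tl a)n h))
 data Aq : Set where
  ea eb ed Eb : Aq
 wt : Aq -> ℕ
 wt ea = 4
 wt eb = 6
 wt ed = 4
 wt Eb = 6
 data Ph : ℕ -> Set where
  ae : ∀ x -> Ph(wt x)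
  _⊗_ : ∀ {v w}-> Ph v -> Ph w -> Ph(v +n w)
  _⊞_ : ∀ {w}-> Ph w -> Ph w -> Ph w
  _⊡_ : ∀ {w}-> ℤ -> Ph w -> Ph w
 el : ∀ {w}->(Aq -> ℕ -> ℤ)-> Ph w -> ℕ -> ℤ
 el ρ(ae x)= ρ x
 el ρ(p ⊗ r)= el ρ p Z.*s el ρ r
 el ρ(p ⊞ r)= el ρ p Z.+s el ρ r
 el ρ(c ⊡ p)= c Z.^s el ρ p
 EC : ∀ {w}->(Aq -> ℂ)-> Ph w -> ℂ
 EC ρ(ae x)= ρ x
 EC ρ(p ⊗ r)= EC ρ p * EC ρ r
 EC ρ(p ⊞ r)= EC ρ p + EC ρ r
 EC ρ(c ⊡ p)= oz c * EC ρ p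
 eC : ∀ {w ρ σ}(p : Ph w)->(∀ x -> ρ x ≈ σ x)-> EC ρ p ≈ EC σ p
 eC(ae x)h = h x
 eC(p ⊗ r)h = cd(eC p h)(eC r h)
 eC(p ⊞ r)h = ca(eC p h)(eC r h)
 eC(c ⊡ p)h = co{oz c}(eC p h)
 Ea : ∀ {w ρ σ}c(p : Ph w)->(∀ x -> σ x ≈ c ^ wt x * ρ x)-> EC σ p ≈ c ^ w * EC ρ p
 Ea c(ae x)h = h x
 Ea{ρ = ρ}c(_⊗_{v} {w}p r)h = !~ cd(Ea c p h)(Ea c r h)~~ sV 4(\ x A y B -> x :* A :*(y :* B):= x :* y :*(A :* B))rR(c ^ v)(EC ρ p)(c ^ w)(EC ρ r)~! cn(yY(xo c v w))
 Ea c(p ⊞ r)h = !~ ca(Ea c p h)(Ea c r h)~! yY(dr _ _ _)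
 Ea{w} {ρ}c(k ⊡ p)h = !~ co{oz k}(Ea c p h)~! sV 3(\ k x A -> k :*(x :* A):= x :*(k :* A))rR(oz k)(c ^ w)(EC ρ p)
 Ge : ∀ {w ρ}(p : Ph w)->(∀ x -> Gr 1q(ta(ρ x)))-> Gr 1q(ta(el ρ p))
 Ge(ae x)g = g x
 Ge{ρ = ρ}(p ⊗ r)g = Gs n1(Sy(th(el ρ p)(el ρ r)))(Ga n1{ta(el ρ p)} {ta(el ρ r)}(Ge p g)(Ge r g))
 Ge{ρ = ρ}(p ⊞ r)g = Gs n1(Sy(tx(el ρ p)(el ρ r)))(Gw n1{ta(el ρ p)} {ta(el ρ r)}(Ge p g)(Ge r g))
 Ge{ρ = ρ}(c ⊡ p)g = Gs n1(Sy(tg c(el ρ p)))(Gf n1{ta(el ρ p)}(oz c)(Ge p g))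
 Ve : ∀ {w ρ z σ}(p : Ph w)->(∀ x -> Gr 1q(ta(ρ x)))-> Hp z ->(∀ x -> va(ta(ρ x))z(σ x))-> va(ta(el ρ p))z(EC σ p)
 Ve(ae x)g hz h = h x
 Ve{ρ = ρ} {z} {σ}(p ⊗ r)g hz h = Vr{ta(el ρ p)*s ta(el ρ r)} {_} {z} {z}(Sy(th(el ρ p)(el ρ r)))rR rR
  (Vh{ta(el ρ p)} {ta(el ρ r)} {z}(Ge p g)(Ge r g)hz(Ve{σ = σ}p g hz h)(Ve{σ = σ}r g hz h))
 Ve{ρ = ρ} {z} {σ}(p ⊞ r)g hz h = Vr{ta(el ρ p)+s ta(el ρ r)} {_} {z} {z}(Sy(tx(el ρ p)(el ρ r)))rR rR
  (Vg{ta(el ρ p)} {ta(el ρ r)} {z}(Ve{σ = σ}p g hz h)(Ve{σ = σ}r g hz h))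
 Ve{ρ = ρ} {z} {σ}(c ⊡ p)g hz h = Vr{oz c ^s ta(el ρ p)} {_} {z} {z}(Sy(tg c(el ρ p)))rR rR(Vb{ta(el ρ p)} {z}(oz c)(Ve{σ = σ}p g hz h))
module Norm2 where
 open Norm public
 open import Relation.Nullary using (¬_;yes;no;Dec)
 open import Relation.Nullary.Decidable using (toWitness;decidable-stable)
 open CSolve
 opaque
  jY_ : ∀ {x}-> Hp x -> ∃ \ x′ -> x * x′ ≈ - 1# × Hp x′
  jY_{x}(δ , hH , N , f)= go(ei x)
   where
   lb : x |> δ
   lb = N , \ n le -> !< sn(lZ hH)(f n le)<! iN x n
   sZ : ∀ Bk ->(hB : 0q << Bk)-> Evt(\ n -> Nb x n <= Bk)-> Hp(- rc x δ hH lb)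
   sZ Bk hB(M , g)= xa , nk , rm x δ hH lb xa(lZ nk)(N ℕ.⊔ M , \ n le ->
    !< Mo{Nb x n} {Bk} {xa}(lZ nk)(g n(md N M le))<~
     rl(!= ac δ(iv Bk hB)Bk =~ cO(δ **_)(iz hB)=! ii δ)<! f n(Mm N M le))
    where
    xa : ℚ
    xa = δ ** iv Bk hB
    nk : 0q << xa
    nk = nD hH(i0 hB)
   go : ∃(x <|_)-> ∃ \ x′ -> x * x′ ≈ - 1# × Hp x′
   go(b , hb)= - rc x δ hH lb , !~ sV 2(\ z r -> z :*(:- r):= :-(r :* z))rR x(rc x δ hH lb)~! cc(Rc x δ hH lb), sZ((b ++ 1q)**(b ++ 1q))(nD B1 B1)(bd hb(b ++ 1q)(bf 1q nl Re))
    where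
    B1 : 0q << b ++ 1q
    B1 = sB(0q <<_)(cw 1q b)(nG nl(nn hb))
 private
  tN : oa 2 ≈ oq n2
  tN = !~ os 1 ~~ Cn(!~ os 0 ~~ Cn o0 ~! Ie 1#)~! sV 0(# 1q :+ # 1q := # n2)rR
  Ag : ∀ u -> oq n2 *(u + oq(-q ½))≈ u + u - 1#
  Ag = sV 1(\ u -> # n2 :*(u :+ #(-q ½)):= u :+ u :- # 1q)rR
  av : ∀ {s u z}->(u - 1#)* s ≈ - 1# -> z ≈ u + u - 1# ->(s - oa 2)*(u - 1#)≈ - z
  av{s} {u} {z}h zf = !~ cn(Cn(cc tN))~~ sV 2(\ s u ->(s :- # n2):*(u :- # 1q):=(u :- # 1q):* s :- # n2 :*(u :- # 1q))rR s u ~~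
   Cg h ~~ sV 1(\ u ->(:- # 1q):- # n2 :*(u :- # 1q):= :-(u :+ u :- # 1q))rR u ~! cc(yY zf)
  aw : ∀ {s aS x z u i}-> x * s ≈ - 1# -> z * i ≈ - 1# -> aS * x ≈ - z -> z * u ≈ x -> aS * u ≈ - 1#
  aw{s} {aS} {x} {z} {u} {i}xs zi aX zu = !~ yY(l(aS * u))~~ co(!~ sV 4(\ s x z u -> s :* u :*(x :* z):=(s :* x):*(z :* u))rR aS x z u ~~ cd aX zu ~! sV 2(\ z x ->(:- z):* x :=(:- # 1q):*(x :* z))rR z x)~! l(- 1#)
   where
   l : ∀ t -> s * i *(t *(x * z))≈ t
   l t = !~ sV 5(\ s i t x z -> s :* i :*(t :*(x :* z)):=(x :* s):*(z :* i):* t)rR s i t x z ~~ cn(cd xs zi)~! sV 1(\ t ->(:- # 1q):*(:- # 1q):* t := t)rR t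
 Vj : ∀ {c u ua A}-> e u ≈ e ua -> va c u A -> va c ua A
 Vj{c} {u} {ua} {A}eq h = Su{\ n -> c n * e u ^ n} {\ n -> c n * e ua ^ n} {A} {A}(\ n -> co{c n} {e u ^ n} {e ua ^ n}(ck n eq))rR h
 module Vx {w : ℕ} {c : ℕ -> ℂ} (mf : MF w c) where
  opaque
   v : ∀ u -> Hp u -> ℂ
   v u h = pF(Vl{c} {u}(gr mf)h)
   vV : ∀ u(h : Hp u)-> va c u(v u h)
   vV u h = pS(Vl{c} {u}(gr mf)h)
  vk : ∀ u ua(h : Hp u)(hg : Hp ua)-> e u ≈ e ua -> v u h ≈ v ua hg
  vk u ua h hg eq = Va{c} {ua} {v u h} {v ua hg}(Vj{c} {u} {ua} {v u h}eq(vV u h))(vV ua hg)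
  vS : ∀ u ua(h : Hp u)(hg : Hp ua)-> u * ua ≈ - 1# -> v ua hg ≈ u ^ w * v u h
  vS u ua h hg Uu = Sl mf{u} {ua}h hg Uu(vV u h)(vV ua hg)
  private
   jA : ∀ u ua s z(h : Hp u)(hg : Hp ua)(hV : Hp(u - 1#))(hO : Hp s)(hn : Hp(s - oa 2))-> e(u - 1#)≈ e u ->(u - 1#)* s ≈ - 1# ->(s - oa 2)*(u - 1#)≈ - z ->(s - oa 2)* ua ≈ - 1# -> v ua hg ≈(- z)^ w * v u h
   jA u ua s z h hg hV hO hn eu oM oN oO = !~ vS(s - oa 2)ua hn hg oO ~~ co{(s - oa 2)^ w}(!~ vk(s - oa 2)s hn hO(Ei s 2)~~ vS(u - 1#)s hV hO oM ~! co{(u - 1#)^ w}(vk(u - 1#)u hV h eu))~~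
    yY(ao((s - oa 2)^ w)((u - 1#)^ w)(v u h))~! cn{v u h}(!~ yY(di(s - oa 2)(u - 1#)w)~! ck w oN)
  vE : ∀ u ua z(h : Hp u)(hg : Hp ua)-> z ≈ u + u - 1# -> z * ua ≈ u - 1# -> v ua hg ≈(- z)^ w * v u h
  vE u ua z h hg zf γ = go(jY_{u - 1#}hV)(jY_{z}hz)
   where
   hV : Hp(u - 1#)
   hV = He{u + oq(-q 1q)} {u - 1#}(Cn(oe 1q))(Hb{u}(-q 1q)h)
   eu : e(u - 1#)≈ e u
   eu = !~ yY(bM(u - 1#))~! en(sV 1(\ u -> u :- # 1q :+ # 1q := u)rR u)
   hz : Hp z
   hz = He{oq n2 *(u + oq(-q ½))} {z}(!~ Ag u ~! yY zf)(Hc{u + oq(-q ½)} {n2}(nG nl n1)(Hb{u}(-q ½)h))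
   go :(∃ \ s ->(u - 1#)* s ≈ - 1# × Hp s)->(∃ \ i -> z * i ≈ - 1# × Hp i)-> v ua hg ≈(- z)^ w * v u h
   go(s , us , hs)(i , zi , _)= jA u ua s z h hg hV hs(He{s + oq(-q ι 2)} {s - oa 2}(Cn(oe(ι 2)))(Hb{s}(-q ι 2)hs))eu us aX(aw{s} {s - oa 2} {u - 1#} {z} {ua} {i}us zi aX γ)
    where
    aX :(s - oa 2)*(u - 1#)≈ - z
    aX = av{s} {u} {z}us zf
 module VL = Vx Me
 module VM = Vx M6
 16ℂ 64ℂ : ℂ
 16ℂ = oz(+ 16)
 64ℂ = oz(+ 64)
 En eZ EZ er : Aq -> ℕ -> ℤ
 En ea = Db e4
 En eb = Db e6
 En ed = + 16 Z.^s Db(Db e4)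
 En Eb = + 64 Z.^s Db(Db e6)
 eZ ea = Db e4
 eZ eb = Db e6
 eZ ed = e4
 eZ Eb = e6
 EZ ea = Db e4
 EZ eb = Db e6
 EZ ed = Al e4
 EZ Eb = Al e6
 er ea = e4
 er eb = e6
 er ed = + 16 Z.^s Db e4
 er Eb = + 64 Z.^s Db e6
 private
  opaque
   g4 : Gr 1q(ta e4)
   g4 = gr Me
   g6 : Gr 1q(ta e6)
   g6 = gr M6
  gD : ∀ k{c}-> Gr 1q(ta c)-> Gr 1q(ta(k Z.^s Db c))
  gD k{c}g = Gs n1{oz k ^s ta(Db c)} {ta(k Z.^s Db c)}(Sy(tg k(Db c)))(Gf n1{ta(Db c)}(oz k)(Gd{c}g))
  vp : ∀ k{c u A}-> va(ta c)(u + u)A -> va(ta(k Z.^s Db c))u(oz k * A)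
  vp k{c} {u} {A}h = Vr{oz k ^s ta(Db c)} {ta(k Z.^s Db c)} {u} {u} {oz k * A} {oz k * A}(Sy(tg k(Db c)))rR rR(Vb{ta(Db c)} {u}(oz k)(Vd{c} {u}h))
 gZ : ∀ x -> Gr 1q(ta(En x))
 gZ ea = Gd{e4}g4
 gZ eb = Gd{e6}g6
 gZ ed = gD(+ 16) {Db e4}(Gd{e4}g4)
 gZ Eb = gD(+ 64) {Db e6}(Gd{e6}g6)
 GZ : ∀ x -> Gr 1q(ta(eZ x))
 GZ ea = Gd{e4}g4
 GZ eb = Gd{e6}g6
 GZ ed = g4
 GZ Eb = g6
 gf : ∀ x -> Gr 1q(ta(EZ x))
 gf ea = Gd{e4}g4
 gf eb = Gd{e6}g6
 gf ed = Gt{e4}g4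
 gf Eb = Gt{e6}g6
 j6 : ∀ x -> Gr 1q(ta(er x))
 j6 ea = g4
 j6 eb = g6
 j6 ed = gD(+ 16) {e4}g4
 j6 Eb = gD(+ 64) {e6}g6
 Hk : ∀ {t}-> Hp t -> Hp(t + t)
 Hk{t}h = He{oq n2 * t} {t + t}(sV 1(\ t -> # n2 :* t := t :+ t)rR t)(Hc{t} {n2}(nG nl n1)h)
 module At (t : ℂ) (h : Hp t) where
  hQ : Hp(t + oq ½)
  hQ = Hb{t}½ h
  hn : Hp(t + t)
  hn = Hk{t}h
  hJ : Hp((t + t)+(t + t))
  hJ = Hk{t + t}hn
  eg ek ew : Aq -> ℂ
  eg ea = VL.v(t + t)hn
  eg eb = VM.v(t + t)hn
  eg ed = 16ℂ * VL.v((t + t)+(t + t))hJ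
  eg Eb = 64ℂ * VM.v((t + t)+(t + t))hJ
  ek ea = VL.v(t + t)hn
  ek eb = VM.v(t + t)hn
  ek ed = VL.v t h
  ek Eb = VM.v t h
  ew ea = VL.v(t + t)hn
  ew eb = VM.v(t + t)hn
  ew ed = VL.v(t + oq ½)hQ
  ew Eb = VM.v(t + oq ½)hQ
  vc : ∀ x -> va(ta(En x))t(eg x)
  vc ea = Vd{e4} {t}(VL.vV(t + t)hn)
  vc eb = Vd{e6} {t}(VM.vV(t + t)hn)
  vc ed = vp(+ 16) {Db e4} {t}(Vd{e4} {t + t}(VL.vV((t + t)+(t + t))hJ))
  vc Eb = vp(+ 64) {Db e6} {t}(Vd{e6} {t + t}(VM.vV((t + t)+(t + t))hJ))
  ve : ∀ x -> va(ta(eZ x))t(ek x)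
  ve ea = Vd{e4} {t}(VL.vV(t + t)hn)
  ve eb = Vd{e6} {t}(VM.vV(t + t)hn)
  ve ed = VL.vV t h
  ve Eb = VM.vV t h
  vf : ∀ x -> va(ta(EZ x))t(ew x)
  vf ea = Vd{e4} {t}(VL.vV(t + t)hn)
  vf eb = Vd{e6} {t}(VM.vV(t + t)hn)
  vf ed = vt{e4} {t}(VL.vV(t + oq ½)hQ)
  vf Eb = vt{e6} {t}(VM.vV(t + oq ½)hQ)
  vw : ∀ x -> va(ta(er x))(t + t)(eg x)
  vw ea = VL.vV(t + t)hn
  vw eb = VM.vV(t + t)hn
  vw ed = vp(+ 16) {e4} {t + t}(VL.vV((t + t)+(t + t))hJ)
  vw Eb = vp(+ 64) {e6} {t + t}(VM.vV((t + t)+(t + t))hJ)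
 module T (t : ℂ) (h : Hp t) where
  tb : ℂ
  tb = t + oq ½
  module P = At t h
  module PV = At tb P.hQ
  private
   dN : e(tb + tb)≈ e(t + t)
   dN = !~ en(sV 1(\ t ->(t :+ # ½):+(t :+ # ½):=(t :+ t):+ # 1q)rR t)~! bM(t + t)
   jZ : e((tb + tb)+(tb + tb))≈ e((t + t)+(t + t))
   jZ = !~ eP(tb + tb)(tb + tb)~~ cd dN dN ~! yY(eP(t + t)(t + t))
   fI : e(tb + oq ½)≈ e t
   fI = !~ en(sV 1(\ t ->(t :+ # ½):+ # ½ := t :+ # 1q)rR t)~! bM t
  ∞ : ∀ x -> PV.eg x ≈ P.eg x
  ∞ ea = VL.vk(tb + tb)(t + t)PV.hn P.hn dN
  ∞ eb = VM.vk(tb + tb)(t + t)PV.hn P.hn dN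
  ∞ ed = co{16ℂ}(VL.vk((tb + tb)+(tb + tb))((t + t)+(t + t))PV.hJ P.hJ jZ)
  ∞ Eb = co{64ℂ}(VM.vk((tb + tb)+(tb + tb))((t + t)+(t + t))PV.hJ P.hJ jZ)
  0→1 : ∀ x -> PV.ek x ≈ P.ew x
  0→1 ea = VL.vk(tb + tb)(t + t)PV.hn P.hn dN
  0→1 eb = VM.vk(tb + tb)(t + t)PV.hn P.hn dN
  0→1 ed = rR
  0→1 Eb = rR
  1→0 : ∀ x -> PV.ew x ≈ P.ek x
  1→0 ea = VL.vk(tb + tb)(t + t)PV.hn P.hn dN
  1→0 eb = VM.vk(tb + tb)(t + t)PV.hn P.hn dN
  1→0 ed = VL.vk(tb + oq ½)t PV.hQ h fI
  1→0 Eb = VM.vk(tb + oq ½)t PV.hQ h fI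
 module S (t tf : ℂ) (h : Hp t) (hg : Hp tf) (zz : (t + t) * (tf + tf) ≈ - 1#) where
  module P = At t h
  module P′ = At tf hg
  z za : ℂ
  z = t + t
  za = tf + tf
  private
   p : ∀ c k -> c ≈ oq(n2 ^^ k)-> ∀ x -> c * x ^ k ≈(x + x)^ k
   p c k h x = !~ cn{x ^ k}(!~ h ~! ol n2 k)~~ yY(di(oq n2)x k)~! ck k(sV 1(\ x -> # n2 :* x := x :+ x)rR x)
   p4 : ∀ x -> 16ℂ * x ^ 4 ≈(x + x)^ 4
   p4 = p 16ℂ 4(rx(cO oq{(+ 16)// 1} {n2 ^^ 4}Re))
   p6 : ∀ x -> 64ℂ * x ^ 6 ≈(x + x)^ 6
   p6 = p 64ℂ 6(rx(cO oq{(+ 64)// 1} {n2 ^^ 6}Re))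
   tO : t *((tf + tf)+(tf + tf))≈ - 1#
   tO = !~ sV 2(\ t s -> t :*((s :+ s):+(s :+ s)):=(t :+ t):*(s :+ s))rR t tf ~! zz
   4tt′ :(z + z)* tf ≈ - 1#
   4tt′ = !~ sV 2(\ t s ->((t :+ t):+(t :+ t)):* s :=(t :+ t):*(s :+ s))rR t tf ~! zz
   n4 :(- z)^ 4 ≈ z ^ 4
   n4 = Ee z 2
   n6 :(- z)^ 6 ≈ z ^ 6
   n6 = Ee z 3
   zp : z ≈(t + oq ½)+(t + oq ½) - 1#
   zp = sV 1(\ t -> t :+ t :=(t :+ # ½):+(t :+ # ½):- # 1q)rR t
   γ : z *(tf + oq ½)≈(t + oq ½) - 1#
   γ = !~ sV 2(\ t s ->(t :+ t):*(s :+ # ½):= # ½ :*((t :+ t):*(s :+ s)):+ t)rR t tf ~~ Cg(co{oq ½}zz)~! sV 1(\ t -> # ½ :*(:- # 1q):+ t :=(t :+ # ½):- # 1q)rR t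
   sI : ∀ c y v k -> c * y ^ k ≈(y + y)^ k -> c *(y ^ k * v)≈(y + y)^ k * v
   sI c y v k e = !~ yY(ao c(y ^ k)v)~! cn{v}e
   ul : ∀ c y v k -> c * y ^ k ≈(y + y)^ k ->(y + y)^ k * v ≈ y ^ k *(c * v)
   ul c y v k e = !~ cn{v}(yY e)~! sV 3(\ c y v -> c :* y :* v := y :*(c :* v))rR c(y ^ k)v
  ∞ : ∀ x -> P′.eg x ≈ z ^ wt x * P.ek x
  ∞ ea = VL.vS z za P.hn P′.hn zz
  ∞ eb = VM.vS z za P.hn P′.hn zz
  ∞ ed = !~ co{16ℂ}(VL.vS t(za + za)h P′.hJ tO)~! sI 16ℂ t(VL.v t h)4(p4 t)
  ∞ Eb = !~ co{64ℂ}(VM.vS t(za + za)h P′.hJ tO)~! sI 64ℂ t(VM.v t h)6(p6 t)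
  0→∞ : ∀ x -> P′.ek x ≈ z ^ wt x * P.eg x
  0→∞ ea = VL.vS z za P.hn P′.hn zz
  0→∞ eb = VM.vS z za P.hn P′.hn zz
  0→∞ ed = !~ VL.vS(z + z)tf P.hJ hg 4tt′ ~! ul 16ℂ z(VL.v(z + z)P.hJ)4(p4 z)
  0→∞ Eb = !~ VM.vS(z + z)tf P.hJ hg 4tt′ ~! ul 64ℂ z(VM.v(z + z)P.hJ)6(p6 z)
  1→1 : ∀ x -> P′.ew x ≈ z ^ wt x * P.ew x
  1→1 ea = VL.vS z za P.hn P′.hn zz
  1→1 eb = VM.vS z za P.hn P′.hn zz
  1→1 ed = !~ VL.vE(t + oq ½)(tf + oq ½)z P.hQ P′.hQ zp γ ~! cn{VL.v(t + oq ½)P.hQ}n4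
  1→1 Eb = !~ VM.vE(t + oq ½)(tf + oq ½)z P.hQ P′.hQ zp γ ~! cn{VM.v(t + oq ½)P.hQ}n6
module Norm3 where
 open Norm2 public
 open import Relation.Nullary using (¬_;yes;no;Dec)
 open import Relation.Nullary.Decidable using (toWitness;decidable-stable)
 open CSolve
 private
  Ad : ∀ a k -> Db a k ≡ Al(Db a)k
  Ad a z0 = Re
  Ad a(sC z0)= Re
  Ad a(sC(sC k))= != Ad(Z.tl a)k =! sy(a7 _)
  aY : ∀ a b k -> Al(\ i -> a i +z b i)k ≡ Al a k +z Al b k
  aY a b z0 = Re
  aY a b(sC k)= !=(cO -z_(aY(Z.tl a)(Z.tl b)k))=! Nd(Al(Z.tl a)k)(Al(Z.tl b)k)
  ak : ∀ c b k -> Al(\ i -> c *z b i)k ≡ c *z Al b k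
  ak c b z0 = Re
  ak c b(sC k)= !=(cO -z_(ak c(Z.tl b)k))=! a5 c(Al(Z.tl b)k)
  Nl : ∀ a b k ->((\ i -> -z a i)Z.*s b)k ≡ -z(a Z.*s b)k
  Nl a b z0 = sy(a6(a 0)(b 0))
  Nl a b(sC k)= !=(cong₂ _+z_(sy(a6(a 0)(b(sC k))))(Nl(Z.tl a)b k))=! sy(Nd(a 0 *z b(sC k))((Z.tl a Z.*s b)k))
  bU : ∀ a b k ->(Al a Z.*s Al b)k ≡ Al(a Z.*s b)k
  bU a b z0 = Re
  bU a b(sC k)= != cO(\ t -> a 0 *z Al b(sC k)+z t)(!= Nl(Al(Z.tl a))(Al b)k =!(cO -z_(bU(Z.tl a)b k)))=!
   sy(!=(cO -z_(!= aY(\ i -> a 0 *z b(sC i))(Z.tl a Z.*s b)k =! cO(_+z Al(Z.tl a Z.*s b)k)(ak(a 0)(Z.tl b)k)))=~(Nd(a 0 *z Al(Z.tl b)k)_)=! cO(_+z -z Al(Z.tl a Z.*s b)k)(a5(a 0)(Al(Z.tl b)k)))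
  am : ∀ {w}(p : Ph w)k -> el EZ p k ≡ Al(el eZ p)k
  am(ae ea)k = Ad e4 k
  am(ae eb)k = Ad e6 k
  am(ae ed)k = Re
  am(ae Eb)k = Re
  am(p ⊗ r)k = != Z.af{el EZ p} {Al(el eZ p)}k(\ i _ -> am p i)(\ i _ -> am r i)=! bU(el eZ p)(el eZ r)k
  am(p ⊞ r)k = !=(cong₂ _+z_(am p k)(am r k))=! sy(aY(el eZ p)(el eZ r)k)
  am(c ⊡ p)k = != cO(c *z_)(am p k)=! sy(ak c(el eZ p)k)
 c3 : ∀ {w}-> Ph w -> ℕ -> ℤ
 c3 p = el En p Z.*s(el eZ p Z.*s el EZ p)
 module CI {w : ℕ} (p : Ph w) (3w<48 : w +n (w +n w) <n 48) (m3 : ∀ {n} -> n <n 8 -> c3 p n ≡ 0ℤ) where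
  xj xg xm : ℕ -> ℤ
  xj = el En p
  xg = el eZ p
  xm = el EZ p
  private
   C : ℕ -> ℂ
   C = ta(c3 p)
   n : ℕ -> ℂ
   n k = C(2 *n k)
   gI : Gr 1q(ta xj)
   gI = Ge{w} {En}p gZ
   gx : Gr 1q(ta xg)
   gx = Ge{w} {eZ}p GZ
   gJ : Gr 1q(ta xm)
   gJ = Ge{w} {EZ}p gf
   CD : C ~s ta xj *s(ta xg *s ta xm)
   CD = !& th xj(xg Z.*s xm)&! cf{ta xj}(th xg xm)
   gC : Gr 1q C
   gC = Gs n1{ta xj *s(ta xg *s ta xm)} {C}(Sy CD)(Ga n1{ta xj} {ta xg *s ta xm}gI(Ga n1{ta xg} {ta xm}gx gJ))
   Vf Vv Vw P : ∀ t -> Hp t -> ℂ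
   Vf t h = EC(At.eg t h)p
   Vv t h = EC(At.ek t h)p
   Vw t h = EC(At.ew t h)p
   P t h = Vf t h *(Vv t h * Vw t h)
   VC : ∀ t h -> va C t(P t h)
   VC t h = Vr{ta xj *s(ta xg *s ta xm)} {C} {t} {t}(Sy CD)rR rR
    (Vh{ta xj} {ta xg *s ta xm} {t} {Vf t h} {Vv t h * Vw t h}gI(Ga n1{ta xg} {ta xm}gx gJ)h(Ve{w} {En} {t} {At.eg t h}p gZ h(At.vc t h))
     (Vh{ta xg} {ta xm} {t} {Vv t h} {Vw t h}gx gJ h(Ve{w} {eZ} {t} {At.ek t h}p GZ h(At.ve t h))(Ve{w} {EZ} {t} {At.ew t h}p gf h(At.vf t h))))
   PO : ∀ t h -> P(t + oq ½)(At.hQ t h)≈ P t h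
   PO t h = !~ cd(eC p(T.∞ t h))(cd(eC p(T.0→1 t h))(eC p(T.1→0 t h)))~! co{Vf t h}(cp(Vw t h)(Vv t h))
   Vy : ∀ t h -> va n(t + t)(P t h)
   Vy t h = Su{\ k -> oq ½ * s k} {\ k -> n k * e(t + t)^ k}Ec(!~ co{oq ½}(Cn{P t h}(PO t h))~! sV 1(\ x -> # ½ :*(x :+ x):= x)rR(P t h))
    (Sd{s}(oq ½)(SA{\ k -> C k * e t ^ k + C k * y ^ k}(Sk{\ k -> C k * e t ^ k} {\ k -> C k * y ^ k}(VC t h)(VC(t + oq ½)(At.hQ t h)))))
    where
    y = e(t + oq ½)
    s : ℕ -> ℂ
    s k =(C(2 *n k)* e t ^(2 *n k)+ C(2 *n k)* y ^(2 *n k))+(C(sC(2 *n k))* e t ^ sC(2 *n k)+ C(sC(2 *n k))* y ^ sC(2 *n k))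
    yf : y ≈ - e t
    yf = !~ eP t(oq ½)~~ co{e t}fw ~! sV 1(\ x -> x :*(:- # 1q):= :- x)rR(e t)
    ev : ∀ k -> y ^(2 *n k)≈ e t ^(2 *n k)
    ev k = sB(\ m -> y ^ m ≈ e t ^ m)(cO(k +n_)(sy(Iy k)))(!~ ck(k +n k)yf ~! Ee(e t)k)
    sq : ∀ k -> e t ^(2 *n k)≈ e(t + t)^ k
    sq k = !~ sB(\ m -> e t ^ m ≈(e t * e t)^ k)(cO(k +n_)(sy(Iy k)))(Du(e t)k)~! ck k(yY(eP t t))
    Ec : ∀ k -> oq ½ * s k ≈ n k * e(t + t)^ k
    Ec k = !~ co{oq ½}(ca(Cn{C(2 *n k)* e t ^(2 *n k)}(co{C(2 *n k)}(ev k)))(Cn{C(sC(2 *n k))* e t ^ sC(2 *n k)}(co{C(sC(2 *n k))}(cd yf(ev k)))))~~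
     sV 4(\ c x d z -> # ½ :*((c :* x :+ c :* x):+(d :*(z :* x):+ d :*((:- z):* x))):= c :* x)rR(C(2 *n k))(e t ^(2 *n k))(C(sC(2 *n k)))(e t)~! co{n k}(sq k)
   Hf : ∀ {z}-> Hp z -> Hp(oq ½ * z)
   Hf{z}= Hc{z} {½}ni
   dh : ∀ z -> oq ½ * z + oq ½ * z ≈ z
   dh = sV 1(\ z -> # ½ :* z :+ # ½ :* z := z)rR
   Vn : ∀ z h -> va n z(P(oq ½ * z)(Hf{z}h))
   Vn z h = Vj{n} {oq ½ * z + oq ½ * z} {z} {P(oq ½ * z)(Hf{z}h)}(en(dh z))(Vy(oq ½ * z)(Hf{z}h))
   PU : ∀ t tf h hg ->(t + t)*(tf + tf)≈ - 1# -> P tf hg ≈(t + t)^(w +n(w +n w))* P t h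
   PU t tf h hg zz = !~ cd(Ea(t + t)p(S.∞ t tf h hg zz))(cd(Ea(t + t)p(S.0→∞ t tf h hg zz))(Ea(t + t)p(S.1→1 t tf h hg zz)))~~
    sV 4(\ z a b c -> z :* b :*(z :* a :*(z :* c)):= z :*(z :* z):*(a :*(b :* c)))rR((t + t)^ w)(Vf t h)(Vv t h)(Vw t h)~!
     cn{P t h}(yY(!~ xo(t + t)w(w +n w)~! co{(t + t)^ w}(xo(t + t)w w)))
   Mj : MF(w +n(w +n w))n
   Mj = record { gr = gn ; Sl = \ {z} {za} {A} {A′}hz Hz zz hA HA -> !~ Va{n} {za} {A′} {P(oq ½ * za)(Hf{za}Hz)}HA(Vn za Hz)~~
    PU(oq ½ * z)(oq ½ * za)(Hf{z}hz)(Hf{za}Hz)(!~ cd(dh z)(dh za)~! zz)~!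
     cd(ck(w +n(w +n w))(dh z))(Va{n} {z} {P(oq ½ * z)(Hf{z}hz)} {A}(Vn z hz)hA) }
    where
    gn : Gr 1q n
    gn δ hH = let xa , hg , le = Hv δ hH; K , hK , d = gC xa hg; b = 1q **(1q ++ xa); b0 : 0q <= b; b0 = n0 n1(N0 n1(lZ hg)); bb : b ** b <= 1q **(1q ++ δ); bb = !< rl(sl 1(\ d ->(Co 1q *: d)*:(Co 1q *: d)=: d *: d)Re(1q ++ xa))<~ le <! rl(sy(iy(1q ++ δ)))
     in K , hK , \ k -> mo(Mo{b ^^(2 *n k)} {(1q **(1q ++ δ))^^ k} {K}hK
      (!< rl(!= cO(b ^^_)(cO(k +n_)(Iy k))=! sy(Qb b k))<! mu k(nq b)bb))(d(2 *n k))
   jB : ∀ k -> n k ≈ 0#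
   jB = Mv{w +n(w +n w)} {n}4 Mj(\ k lt -> rx(cO oz(m3{2 *n k}(Ta(mD 2 lt)Rf))))3w<48
   V0 : ∀ {c z A}->(∀ k -> c k ≈ 0#)-> va c z A -> A ≈ 0#
   V0{c} {z} {A}h v = Ss{\ k -> c k * e z ^ k} {A} {0#}v(\ ε hL -> 0 , \ N _ -> mo(lZ hL)(nj(nB N \ i _ -> !~ cn{e z ^ i}(h i)~! ze(e z ^ i))))
   fJ : ∀ k -> c3 p k ≡ 0ℤ
   fJ k = O0(c3 p k)(identity{C}gC(\ {z} {A}hz v -> !~ Va{C} {z} {A} {P z(IH{z}hz)}v(VC z(IH{z}hz))~! V0{n} {z + z}jB(Vy z(IH{z}hz)))k)
   vo :(∀ k -> xg k ≡ 0ℤ)-> ∀ t h -> Vf t h ≈ 0#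
   vo h0 t h = go(jY_{t + t}(Hk{t}h))
    where
    go :(∃ \ za ->(t + t)* za ≈ - 1# × Hp za)-> Vf t h ≈ 0#
    go(za , zz , Hz)= !~ Ea((oq ½ * za)+(oq ½ * za))p(S.∞(oq ½ * za)t(Hf{za}Hz)h(!~ cn{t + t}(dh za)~~ cp za(t + t)~! zz))~~
     co{((oq ½ * za)+(oq ½ * za))^ w}(V0{ta xg} {oq ½ * za}(\ k -> rx(cO oz(h0 k)))(Ve{w} {eZ} {oq ½ * za} {At.ek(oq ½ * za)(Hf{za}Hz)}p GZ(Hf{za}Hz)(At.ve(oq ½ * za)(Hf{za}Hz))))~!(zr _)
   bV : ∀ k -> xj k ≡ 0ℤ
   bV k = decidable-stable(xj k ℤₚ.≟ 0ℤ)\ ne -> ne(O0(xj k)(identity{ta xj}gI(\ {z} {A}hz v -> let h = IH{z}hz in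
    !~ Va{ta xj} {z} {A} {Vf z h}v(Ve{w} {En} {z} {At.eg z h}p gZ h(At.vc z h))~! vo(bW ne)z h)k))
    where
    bW : xj k ≢ 0ℤ -> ∀ m -> xg m ≡ 0ℤ
    bW ne m = decidable-stable(xg m ℤₚ.≟ 0ℤ)\ jC -> jC(A0 xg m(!= sy(am p m)=! Do xg xm(Do xj(xg Z.*s xm)fJ k ne)m jC m))
  Ri : ∀ k -> el er p k ≡ 0ℤ
  Ri k = O0(el er p k)(identity{ta(el er p)}(Ge{w} {er}p j6)(\ {z} {A}hz v -> let h = Hf{z}(IH{z}hz); t = oq ½ * z in
   !~ Va{ta(el er p)} {z} {A} {Vf t h}v(Vj{ta(el er p)} {t + t} {z} {Vf t h}(en(dh z))(Ve{w} {er} {t + t} {At.eg t h}p j6(Hk{t}h)(At.vw t h)))~!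
    V0{ta xj} {t}(\ k -> rx(cO oz(bV k)))(Ve{w} {En} {t} {At.eg t h}p gZ h(At.vc t h)))k)
 xD : Ph 10
 xD =(ae Eb ⊗(ae ed ⊞((-z(+ 11))⊡ ae ea)))⊞(ae eb ⊗(((-z(+ 22))⊡ ae ed)⊞((+ 32)⊡ ae ea)))
 xE : Ph 12
 xE =((((+ 4)⊡ ae ea)⊞ ae ed)⊗((ae ed ⊞((-z(+ 11))⊡ ae ea))⊗(ae ed ⊞((-z(+ 11))⊡ ae ea))))⊞((-z(+ 500))⊡(ae eb ⊗ ae eb))
 opaque
  rC : ∀ k -> el er xD k ≡ 0ℤ
  rC = CI.Ri xD(toWitness{a? = 30 ℕₚ.<? 48}tt)(toWitness{a? = aU(\ n -> c3 xD n ℤₚ.≟ 0ℤ)8}tt)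
  rD : ∀ k -> el er xE k ≡ 0ℤ
  rD = CI.Ri xE(toWitness{a? = 36 ℕₚ.<? 48}tt)(toWitness{a? = aU(\ n -> c3 xE n ℤₚ.≟ 0ℤ)8}tt)
module LTwo where
 open CSolve
 open Norm3 public
 open import Data.Maybe.Base using (Maybe;just;nothing)
 open import Relation.Nullary using (yes;no)
 import Algebra.Solver.Ring
 import Algebra.Solver.Ring.AlmostCommutativeRing as ACR
 import Data.Rational.Properties as ℚₚ
 private
  q : ℕ -> ℕ -> ℚ
  q a b =(+ a)// sC b
 ka : ℚ -> ℕ -> ℂ
 ka r = Cs(oq r)
 kb : ∀ r a -> ka r *s a ~s oq r ^s a
 kb r a = c4(oq r)a
 private
  l5 : ∀ a b -> ka(a ++ b)~s ka a +s ka b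
  l5 a b = mk \ { z0 -> oc a b; (sC n)-> yY(Ii 0#) }
  l6 : ∀ a b -> ka(a ** b)~s ka a *s ka b
  l6 a b = mk \ { z0 -> ob a b; (sC n)-> yY(!~ at(kb a(ka b))(sC n)~! zr(oq a)) }
  kn : ∀ a -> ka(-q a)~s -s ka a
  kn a = mk \ { z0 -> oe a; (sC n)-> sV 0(# 0q := :- # 0q)rR }
  l7 : ka 0q ~s 0ₛ
  l7 = mk \ { z0 -> rR; (sC n)-> rR }
  K1 : ka 1q ~s 1ₛ
  K1 = mk \ { z0 -> rR; (sC n)-> rR }
 module G = Alg2.Ov sR ka l5 l6 kn l7 K1
 Cc : ∀ m{a b x y}-> Le m a x -> x * y ≈ 1# -> a *s b ~s 0ₛ -> b ~s 0ₛ
 Cc z0{a} {b} {x} {y}(_ , ax)xy h = !& Sy(iG b)~& cv{b}(Sy inv)~&(!& Ac(y ^s a)I.il b &! G.xx(y ^s a)I.il b)~&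
  cf{I.il}(!&(·-*ₛ y a b)~& cm h &!(mk \ n -> zr y))&! Zr I.il
  where
  module I = Inverse (y ^s a)
  inv :(y ^s a)*s I.il ~s 1ₛ
  inv = I.iF(!~ co{y}ax ~~ cp y x ~! xy)
 Cc(sC m) {a} {b}(la , ax)xy h = Cc m{tl a} {b}((\ n lt -> la(sC n)(ss lt)), ax)xy(mk \ n -> !~ yY(!~ Cg(!~ cn(la 0(ss zn))~!(ze _))~!(Ii _))~! at h(sC n))
 dl al eE :(ℕ -> ℂ)-> ℕ -> ℂ
 dl a z0 = a 0
 dl a(sC z0)= 0#
 dl a(sC(sC n))= dl(tl a)n
 al a z0 = a 0
 al a(sC n)= - al(tl a)n
 eE a n = a(n +n n)
 dz : ∀ {a b}-> a ~s b -> dl a ~s dl b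
 dz h = mk \ n -> go h n
  where
  go : ∀ {a b}-> a ~s b -> ∀ n -> dl a n ≈ dl b n
  go h z0 = at h 0
  go h(sC z0)= rR
  go h(sC(sC n))= go(mk \ i -> at h(sC i))n
 Dl : ∀ a b -> dl(a +s b)~s dl a +s dl b
 Dl a b = mk \ n -> go a b n
  where
  go : ∀ a b n -> dl(a +s b)n ≈ dl a n + dl b n
  go a b z0 = rR
  go a b(sC z0)= yY(Ie 0#)
  go a b(sC(sC n))= go(tl a)(tl b)n
 dO : ∀ x a -> dl(x ^s a)~s x ^s dl a
 dO x a = mk \ n -> go a n
  where
  go : ∀ a n -> dl(x ^s a)n ≈ x * dl a n
  go a z0 = rR
  go a(sC z0)= yY(zr x)
  go a(sC(sC n))= go(tl a)n
 dC : ∀ a b -> dl(a *s b)~s dl a *s dl b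
 dC a b = mk \ n -> go a b n
  where
  go : ∀ a b n -> dl(a *s b)n ≈(dl a *s dl b)n
  go a b z0 = rR
  go a b(sC z0)= sV 2(\ a b -> # 0q := a :* # 0q :+ # 0q :* b)rR(a 0)(b 0)
  go a b(sC(sC n))= !~ at(Dl(a 0 ^s tl b)(tl a *s b))n ~! ca(at(dO(a 0)(tl b))n)(!~ go(tl a)b n ~! yY(!~ Cg(ze(dl b(sC n)))~!(Ii _)))
 dk : ∀ x -> dl(Cs x)~s Cs x
 dk x = mk go
  where
  z : ∀ n -> dl(\ _ -> 0#)n ≈ 0#
  z z0 = rR
  z(sC z0)= rR
  z(sC(sC n))= z n
  go : ∀ n -> dl(Cs x)n ≈ Cs x n
  go z0 = rR
  go(sC z0)= rR
  go(sC(sC n))= z n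
 DC : ∀ a -> dl(ta a)~s ta(Db a)
 DC a = mk \ n -> go a n
  where
  go : ∀ a n -> dl(ta a)n ≈ ta(Db a)n
  go a z0 = rR
  go a(sC z0)= rR
  go a(sC(sC n))= go(Z.tl a)n
 AC : ∀ {a b}-> a ~s b -> al a ~s al b
 AC h = mk \ n -> go h n
  where
  go : ∀ {a b}-> a ~s b -> ∀ n -> al a n ≈ al b n
  go h z0 = at h 0
  go h(sC n)= cc(go(mk \ i -> at h(sC i))n)
 private
  aK : ∀ a b n -> al(a +s b)n ≈ al a n + al b n
  aK a b z0 = rR
  aK a b(sC n)= !~ cc(aK(tl a)(tl b)n)~! sV 2(\ x y -> :-(x :+ y):= :- x :+ :- y)rR(al(tl a)n)(al(tl b)n)
  aC : ∀ x a n -> al(x ^s a)n ≈ x * al a n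
  aC x a z0 = rR
  aC x a(sC n)= !~ cc(aC x(tl a)n)~! sV 2(\ x y -> :-(x :* y):= x :*(:- y))rR x(al(tl a)n)
 fK : ∀ a b -> al(a *s b)~s al a *s al b
 fK a b = mk \ n -> go a b n
  where
  go : ∀ a b n -> al(a *s b)n ≈(al a *s al b)n
  go a b z0 = rR
  go a b(sC n)= !~ cc(!~ aK(a 0 ^s tl b)(tl a *s b)n ~! ca(aC(a 0)(tl b)n)(go(tl a)b n))~~ sV 3(\ x y z -> :-(x :* y :+ z):= x :*(:- y):+ :- z)rR(a 0)(al(tl b)n)((al(tl a)*s al b)n)~!
   Cn{a 0 * - al(tl b)n}(yY(!~ af{tl(al a)} { -s al(tl a)} {al b} {al b}n(\ _ _ -> rR)(\ _ _ -> rR)~! at(G.n7(al(tl a))(al b))n))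
 aZ : ∀ a -> al(dl a)~s dl a
 aZ a = mk \ n -> go a n
  where
  go : ∀ a n -> al(dl a)n ≈ dl a n
  go a z0 = rR
  go a(sC z0)= sV 0(:- # 0q := # 0q)rR
  go a(sC(sC n))= !~ sV 1(\ x -> :-(:- x):= x)rR(al(dl(tl a))n)~! go(tl a)n
 bX : ∀ a -> eE(al a)~s eE a
 bX a = mk \ n -> go a n
  where
  go : ∀ a n -> al a(n +n n)≈ a(n +n n)
  go a z0 = rR
  go a(sC n)= sB(\ k -> al a(sC k)≈ a(sC k))(sy(su n n))(!~ sV 1(\ x -> :-(:- x):= x)rR(al(tl(tl a))(n +n n))~! go(tl(tl a))n)
 eo : ∀ {a b}-> a ~s b -> eE a ~s eE b
 eo h = mk \ n -> at h(n +n n)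
 eA : ∀ a b -> eE(dl a *s b)~s a *s eE b
 eA a b = mk \ n -> go a n
  where
  go : ∀ a n ->(dl a *s b)(n +n n)≈(a *s eE b)n
  go a z0 = rR
  go a(sC n)= !~ rx(cO(dl a *s b)(cO sC(su n n)))~! ca(rx(cO(\ k -> a 0 * b k)(cO sC(sy(su n n)))))
   (!~ Cg(ze _)~~(Ii _)~! go(tl a)n)
 A B A′ B′ u P P′ g p : ℕ -> ℂ
 A = E
 B = F
 A′ = dl A
 B′ = dl B
 u = ka(q 1 4)*s(ka(q 16 0)*s A′ +s -s(ka(q 11 0)*s A))
 module Iu = Inverse u
 P = B *s Iu.il
 P′ = dl P
 g = ka(q 1 5)*s(P +s -s P′)
 p = ka(q 1 11)*s(A +s -s(P *s P))
 u0 : u 0 ≈ 1#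
 u0 = sV 0(#(q 1 4):*(#(q 16 0):* # 1q :+ :-(#(q 11 0):* # 1q)):= # 1q)rR
 uP : u *s P ~s B
 uP = !& G.xx u B Iu.il ~& cf{B}(Iu.iF u0)&! qU B
 Zl : ∀ {w}(φ : Ph w)->(∀ k -> el er φ k ≡ 0ℤ)-> ta(el er φ)~s 0ₛ
 Zl φ h = mk \ k -> rx(cO oz(h k))
 ES : ∀ {w}-> Ph w -> ℕ -> ℂ
 ES(ae ea)= A
 ES(ae eb)= B
 ES(ae ed)= ka(q 16 0)*s A′
 ES(ae Eb)= ka(q 64 0)*s B′
 ES(x ⊗ y)= ES x *s ES y
 ES(x ⊞ y)= ES x +s ES y
 ES(c ⊡ x)= ka(c // 1)*s ES x
 eS : ∀ {w}(φ : Ph w)-> ES φ ~s ta(el er φ)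
 eS(ae ea)= Rl
 eS(ae eb)= Rl
 eS(ae ed)= !&(kb _ A′)~& cm(DC e4)&! Sy(tg(+ 16)(Db e4))
 eS(ae Eb)= !&(kb _ B′)~& cm(DC e6)&! Sy(tg(+ 64)(Db e6))
 eS(x ⊗ y)= !& cI(eS x)(eS y)&! Sy(th(el er x)(el er y))
 eS(x ⊞ y)= !& cj(eS x)(eS y)&! Sy(tx(el er x)(el er y))
 eS(c ⊡ x)= !&(kb _(ES x))~& cm(eS x)&! Sy(tg c(el er x))
 r₁ : ES xD ~s 0ₛ
 r₁ = !& eS xD &! Zl xD rC
 r₂ : ES xE ~s 0ₛ
 r₂ = !& eS xE &! Zl xE rD
 cu : ∀ {x}-> u *s x ~s 0ₛ -> x ~s 0ₛ
 cu{x}= Cc 0{u} {x} {1#} {1#}((\ _()), u0)(ie 1#)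
 opaque
  Ae : A′ ~s ka(q 1 3)*s(ka(q 5 0)*s(P *s P)+s -s A)
  Ae = G.Ae{A} {B} {A′} {B′} {P} {u}Rl uP cu r₁ r₂
  Bg : B ~s P *s(ka(q 4 0)*s(P *s P)+s -s(ka(q 3 0)*s A))
  Bg = G.Bg{A} {B} {A′} {B′} {P} {u}Rl uP cu r₁ r₂
module LTwo2 where
 open CSolve
 open LTwo public
 private
  q : ℕ -> ℕ -> ℚ
  q a b =(+ a)// sC b
  kt : ∀ r a n ->(ka r *s a)n ≈ oq r * a n
  kt r a n = at(kb r a)n
 dI : ∀ a -> dl(-s a)~s -s dl a
 dI a = mk \ n -> go a n
  where
  go : ∀ a n -> dl(-s a)n ≈ - dl a n
  go a z0 = rR
  go a(sC z0)= sV 0(# 0q := :- # 0q)rR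
  go a(sC(sC n))= go(tl a)n
 Dk : ∀ r a -> dl(ka r *s a)~s ka r *s dl a
 Dk r a = !& dC(ka r)a &! cv{dl a}(dk(oq r))
 private
  Be : B′ ~s P′ *s(ka(q 4 0)*s(P′ *s P′)+s -s(ka(q 3 0)*s A′))
  Be = !& dz Bg ~&(dC P _)&! cf{P′}(!& Dl(ka(q 4 0)*s(P *s P))(-s(ka(q 3 0)*s A))&! cj(!& Dk(q 4 0)(P *s P)&! cf{ka(q 4 0)}(dC P P))(!& dI(ka(q 3 0)*s A)&! cL(Dk(q 3 0)A)))
  P0 : P 0 ≈ 1#
  P0 = ie 1#
  u1 : u 1 ≈ oq(-q q 528 0)
  u1 = !~ kt(q 1 4)(ka(q 16 0)*s A′ +s -s(ka(q 11 0)*s A))1 ~~ co{oq(q 1 4)}(ca(kt(q 16 0)A′ 1)(cc(kt(q 11 0)A 1)))~! sV 0(#(q 1 4):*(#(q 16 0):* # 0q :+ :-(#(q 11 0):* #(q 240 0))):= #(-q q 528 0))rR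
  P1 : P 1 ≈ oq(q 24 0)
  P1 = !~ Cg{B 1 * Iu.il 0}(co{B 0}(cc(cn{1#}u1)))~! sV 0(# 1q :*(:-(#(-q q 528 0):* # 1q)):+ #(-q q 504 0):* # 1q := #(q 24 0))rR
  c9 : ∀ {x}->(P +s ka(q 2 0)*s P′)*s x ~s 0ₛ -> x ~s 0ₛ
  c9{x}= Cc 0{P +s ka(q 2 0)*s P′} {x} {oq(q 3 0)} {oq(q 1 2)}((\ _()), !~ ca P0(!~ kt(q 2 0)P′ 0 ~! co{oq(q 2 0)}P0)~! sV 0(# 1q :+ #(q 2 0):* # 1q := #(q 3 0))rR)(sV 0(#(q 3 0):* #(q 1 2):= # 1q)rR)
 opaque
  gG : g *s g ~s dl p
  gG = !& G.gG{A} {B} {A′} {B′} {P} {u}Rl uP cu r₁ r₂{P′}Be c9 &! Sy(!&(Dk(q 1 11)_)&! cf{ka(q 1 11)}(!& Dl A(-s(P *s P))&! cq{A′}(!& dI(P *s P)&! cL(dC P P))))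
  pX : p ~s(P′ +s ka(q 2 0)*s g)*s(ka(q 4 0)*s g)
  pX = G.pX{A} {B} {A′} {B′} {P} {u}Rl uP cu r₁ r₂{P′}Be c9
  Aj : A ~s P *s P +s ka(q 12 0)*s p
  Aj = G.Aj{A} {B} {A′} {B′} {P} {u}Rl uP cu r₁ r₂{p}Rl
  AP : A′ ~s P *s P +s ka(-q q 3 0)*s p
  AP = G.AP{A} {B} {A′} {B′} {P} {u}Rl uP cu r₁ r₂{p}Rl
  bP : B ~s P *s(P *s P)+s ka(-q q 36 0)*s(P *s p)
  bP = G.bP{A} {B} {A′} {B′} {P} {u}Rl uP cu r₁ r₂{p}Rl
  BP : B′ ~s P *s(P *s P)+s ka(-q q 9 1)*s(P *s p)
  BP = G.BP{A} {B} {A′} {B′} {P} {u}Rl uP cu r₁ r₂{p}Rl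
 gK : ∀ n -> g n ≈ oq(q 1 5)*(P n - P′ n)
 gK n = kt(q 1 5)(P +s -s P′)n
 PK : P ~s P′ +s oq(q 6 0)^s g
 PK = mk \ n -> !~ sV 2(\ p r -> p := r :+ #(q 6 0):*(#(q 1 5):*(p :- r)))rR(P n)(P′ n)~! Cn{P′ n}(co{oq(q 6 0)}(yY(gK n)))
 lP : Le 0 P 1#
 lP =(\ _()), P0
 Lg : Le 1 g(oq(q 4 0))
 Lg =(\ { z0 _ -> !~ gK 0 ~~ co{oq(q 1 5)}(ir(P 0))~! zr(oq(q 1 5)); (sC n)(ss()) }),
  !~ gK 1 ~~ co{oq(q 1 5)}(Cg{(- 0#)}P1)~! sV 0(#(q 1 5):*(#(q 24 0):- # 0q):= #(q 4 0))rR
 Lq : Le 1 p(oq(q 16 0))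
 Lq = Lr(Sy pX)(pF l , !~ pS l ~! sV 0(# 1q :* #(q 16 0):= #(q 16 0))rR)
  where
  g0 = pF Lg 0(ss zn)
  lK : Le 0(P′ +s ka(q 2 0)*s g)1#
  lK =(\ _()), !~ ca P0(!~ kt(q 2 0)g 0 ~! co{oq(q 2 0)}g0)~! sV 0(# 1q :+ #(q 2 0):* # 0q := # 1q)rR
  lL : Le 1(ka(q 4 0)*s g)(oq(q 16 0))
  lL =(\ { z0 _ -> !~ kt(q 4 0)g 0 ~~ co{oq(q 4 0)}g0 ~! zr(oq(q 4 0)); (sC n)(ss()) }), !~ kt(q 4 0)g 1 ~~ co{oq(q 4 0)}(pS Lg)~! sV 0(#(q 4 0):* #(q 4 0):= #(q 16 0))rR
  l = Lb 0 1 lK lL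
 gv : eE g ~s 0ₛ
 gv = mk \ n -> !~ sV 1(\ x -> x := # ½ :*(x :+ x))rR(eE g n)~~ co{oq ½}(!~ Cg{eE g n}(yY(at(bX g)n))~! at s0(n +n n))~! zr(oq ½)
  where
  s d : ℕ -> ℂ
  s = al g +s g
  d = al g +s -s g
  ds : d *s s ~s 0ₛ
  ds = !& G.dU(al g)g ~& fT{(-s(g *s g))}(!& Sy(fK g g)~& AC gG ~& aZ p &! Sy gG)&! qV(g *s g)
  s0 : s ~s 0ₛ
  s0 = Cc 1{d} {s} {oq(-q q 8 0)} {oq(-q q 1 7)}((\ { z0 _ -> ir(g 0); (sC n)(ss()) }), !~ ca(cc(pS Lg))(cc(pS Lg))~! sV 0((:- #(q 4 0)):+(:- #(q 4 0)):= #(-q q 8 0))rR)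
   (sV 0(#(-q q 8 0):* #(-q q 1 7):= # 1q)rR)ds
 eD : ∀ a -> eE(dl a)~s a
 eD a = mk \ n -> go a n
  where
  go : ∀ a n -> dl a(n +n n)≈ a n
  go a z0 = rR
  go a(sC n)= sB(\ k -> dl a(sC k)≈ a(sC n))(sy(su n n))(go(tl a)n)
 Lf : ℕ ->(ℕ -> ℕ -> ℂ)->(ℕ -> ℂ)-> ℕ -> ℂ
 Lf n m c i = ∑ n(\ j -> c j * m j i)
 Lc : ∀ n{m m′ c cF}->(∀ j -> m j ~s m′ j)->(∀ j -> c j ≈ cF j)-> Lf n m c ~s Lf n m′ cF
 Lc n h hc = mk \ i -> ch n \ j -> cd(hc j)(at(h j)i)
 Lh : ∀ n x m c -> x *s Lf n m c ~s Lf n(\ j -> x *s m j)c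
 Lh z0 x m c = mk \ i -> at(Zr x)i
 Lh(sC n)x m c = !& Dr x(c 0 ^s m 0)(Lf n(\ j -> m(sC j))(tl c))&! cj(*-·ₛ(c 0)x(m 0))(Lh n x(\ j -> m(sC j))(tl c))
 Li : ∀ n m x c -> Lf n m(x ^s c)~s x ^s Lf n m c
 Li n m x c = mk \ i -> !~(ch n \ j -> ao x(c j)(m j i))~!(∑-* n x(\ j -> c j * m j i))
 Ln : ∀ n m c d -> Lf n m(c +s d)~s Lf n m c +s Lf n m d
 Ln n m c d = mk \ i -> !~(ch n \ j -> dv(m j i)(c j)(d j))~!(∑-+ n(\ j -> c j * m j i)(\ j -> d j * m j i))
 V ec :(ℕ -> ℂ)->(ℕ -> ℂ)-> ℕ -> ℕ -> ℕ -> ℂ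
 V a b k z0 = po a k
 V a b z0(sC j)= 0ₛ
 V a b(sC k)(sC j)= b *s V a b k j
 ec x y k z0 = po x k
 ec x y z0(sC s)= 0ₛ
 ec x y(sC z0)(sC s)= 0ₛ
 ec x y(sC(sC k))(sC s)= y *s ec x y k s
 Hj :(ℕ -> ℂ)->(ℕ -> ℂ)-> ℕ ->(ℕ -> ℂ)-> ℕ -> ℂ
 Hj a b k = Lf(sC k)(V a b k)
 Es :(ℕ -> ℂ)->(ℕ -> ℂ)-> ℕ ->(ℕ -> ℂ)-> ℕ -> ℂ
 Es x y k = Lf(sC ⌊ k /2⌋)(ec x y k)
 Ho : ∀ a b k c -> Hj a b(sC k)c ~s c 0 ^s po a(sC k)+s b *s Hj a b k(tl c)
 Ho a b k c = cq{c 0 ^s po a(sC k)}(Sy(Lh(sC k)b(V a b k)(tl c)))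
 Eu : ∀ x y k c -> Es x y(sC(sC k))c ~s c 0 ^s po x(sC(sC k))+s y *s Es x y k(tl c)
 Eu x y k c = cq{c 0 ^s po x(sC(sC k))}(Sy(Lh(sC ⌊ k /2⌋)y(ec x y k)(tl c)))
 fL : ∀ a b -> eE(a +s b)~s eE a +s eE b
 fL a b = mk \ n -> rR
 module EG {x y g : ℕ -> ℂ} (gG : g *s g ~s dl y) (oE : eE g ~s 0ₛ) where
  Pd : ∀ k -> po(dl x)k ~s dl(po x k)
  Pd z0 = Sy(dk 1#)
  Pd(sC k)= !& cf{dl x}(Pd k)&! Sy(dC x(po x k))
  private
   Ew : ∀ r k -> eE(r ^s po(dl x)k)~s r ^s po x k
   Ew r k = mk \ n -> co{r}(at(!& eo(Pd k)&! eD(po x k))n)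
   j0 : ∀ r k -> eE(g *s(r ^s po(dl x)k))~s 0ₛ
   j0 r k = !& eo(!&(*-·ₛ r g(po(dl x)k))&! cm(!& cf{g}(Pd k)&! qy g(dl(po x k))))&!(mk \ n -> !~ co{r}(!~ at(eA(po x k)g)n ~! at(!& cf{po x k}oE &! Zr(po x k))n)~! zr r)
   ot : ∀ (m : ℕ -> ℕ -> ℂ)c -> Lf 1 m c ~s c 0 ^s m 0
   ot m c = mk \ i -> Ie(c 0 * m 0 i)
  EH : ∀ k c -> eE(Hj(dl x)g k c)~s Es x y k(\ s -> c(s +n s))
  EH z0 c = !& eo(ot(V(dl x)g 0)c)~& Ew(c 0)0 &! Sy(ot(ec x y 0)(\ s -> c(s +n s)))
  EH(sC z0)c = !& eo(Ho(dl x)g 0 c)~& cj(Ew(c 0)1)(!& eo(cf{g}(ot(V(dl x)g 0)(tl c)))&! j0(c 1)0)~&(io _)&! Sy(ot(ec x y 1)(\ s -> c(s +n s)))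
  EH(sC(sC k))c = !& eo(!& Ho(dl x)g(sC k)c &! cq{c 0 ^s po(dl x)(sC(sC k))}(!& cf{g}(Ho(dl x)g k(tl c))&! Dr g(c 1 ^s po(dl x)(sC k))(g *s Hj(dl x)g k(tl(tl c)))))~&
   cj(Ew(c 0)(sC(sC k)))(!& cj(j0(c 1)(sC k))(!& eo(!& Sy(Ac g g(Hj(dl x)g k(tl(tl c))))&! cv{Hj(dl x)g k(tl(tl c))}gG)~&(eA y _)&! cf{y}(EH k(tl(tl c))))&!(j7 _))~&
    cq{c 0 ^s po x(sC(sC k))}(cf{y}(Lc(sC ⌊ k /2⌋) {ec x y k}(\ _ -> Rl)\ s -> rx(cO c(cO sC(sy(su s s))))))&! Sy(Eu x y k(\ s -> c(s +n s)))
module Tra where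
 open CSolve
 open LTwo2 public
 private
  q : ℕ -> ℕ -> ℚ
  q a b =(+ a)// sC b
 sh :(ℕ -> ℂ)-> ℕ -> ℂ
 sh = si 1
 DA : ℕ ->(ℕ -> ℂ)-> Set
 DA k c = ∀ j -> k <n j -> c j ≈ 0#
 Dh : ∀ {k c}-> DA k c -> DA(sC k)(sh c)
 Dh h(sC j)(ss lt)= h j lt
 Dd : ∀ {k c}-> DA k c -> DA(sC k)c
 Dd h j lt = h j(tZ(Nn _)lt)
 Dq : ∀ {k c}x -> DA k c -> DA k(x ^s c)
 Dq x h j lt = !~ co{x}(h j lt)~! zr x
 Dz : ∀ {k c d}-> DA k c -> DA k d -> DA k(c +s d)
 Dz h hg j lt = !~ ca(h j lt)(hg j lt)~! Ie 0#
 DF : ∀ {k c}-> DA(sC k)c -> DA k(tl c)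
 DF h j lt = h(sC j)(ss lt)
 private
  0·+ : ∀ (a b : ℕ -> ℂ)-> 0# ^s a +s b ~s b
  0·+ a b = mk \ n -> !~ Cg(ze(a n))~! Ii(b n)
  ql : ∀ x(a : ℕ -> ℂ)-> a *s(x ^s 1ₛ)~s x ^s(a *s 1ₛ)
  ql x a = *-·ₛ x a 1ₛ
  ot : ∀ (m : ℕ -> ℕ -> ℂ)c -> Lf 1 m c ~s c 0 ^s m 0
  ot m c = mk \ i -> Ie(c 0 * m 0 i)
 module _ (a b : ℕ -> ℂ) where
  Hn : ∀ k c -> Hj a b(sC k)(sh c)~s b *s Hj a b k c
  Hn k c = !& Ho a b k(sh c)&! 0·+(po a(sC k))(b *s Hj a b k c)
  Hm : ∀ k c -> DA k c -> Hj a b(sC k)c ~s a *s Hj a b k c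
  Hm z0 c h = !& Ho a b 0 c ~& cq{c 0 ^s po a 1}(!& cf{b}(!& ot(V a b 0)(tl c)&!(mk \ n -> !~ cn{1ₛ n}(h 1(ss zn))~! ze(1ₛ n)))&! Zr b)~&
   io(c 0 ^s po a 1)~& Sy(ql(c 0)a)&! cf{a}(Sy(ot(V a b 0)c))
  Hm(sC k)c h = !& Ho a b(sC k)c ~& cj(Sy(*-·ₛ(c 0)a(po a(sC k))))(!& cf{b}(Hm k(tl c)(DF h))&! G.xx b a(Hj a b k(tl c)))~&
   Sy(Dr a(c 0 ^s po a(sC k))(b *s Hj a b k(tl c)))&! cf{a}(Sy(Ho a b k c))
  HE : ∀ k y c -> DA k c -> Hj a b(sC k)(c +s y ^s sh c)~s(a +s y ^s b)*s Hj a b k c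
  HE k y c h = !& Ln(sC(sC k))(V a b(sC k))c(y ^s sh c)~& cj(Hm k c h)(!& Li(sC(sC k))(V a b(sC k))y(sh c)~& cm(Hn k c)&! Sy(·-*ₛ y b(Hj a b k c)))&! Sy(dg(Hj a b k c)a(y ^s b))
 Bn : ℂ -> ℕ -> ℕ -> ℂ
 Bn y z0 = 1ₛ
 Bn y(sC k)= Bn y k +s y ^s sh(Bn y k)
 DB : ∀ y k -> DA k(Bn y k)
 DB y z0(sC j)_ = rR
 DB y(sC k)= Dz{sC k} {Bn y k} {y ^s sh(Bn y k)}(Dd{k} {Bn y k}(DB y k))(Dq{sC k} {sh(Bn y k)}y(Dh{k} {Bn y k}(DB y k)))
 HB : ∀ a b y k -> po(a +s y ^s b)k ~s Hj a b k(Bn y k)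
 HB a b y z0 = !&(mk \ n -> yY(ie(1ₛ n)))&! Sy(ot(V a b 0)1ₛ)
 HB a b y(sC k)= !& cf{a +s y ^s b}(HB a b y k)&! Sy(HE a b k y(Bn y k)(DB y k))
 NE NV : ℕ -> ℕ -> ℕ -> ℂ
 NE k z0 = Bn 1# k
 NE z0(sC l)= 0ₛ
 NE(sC z0)(sC l)= 0ₛ
 NE(sC(sC k))(sC l)= sh(NE k l)
 NV k z0 = Bn(oq n2)k
 NV z0(sC j)= 0ₛ
 NV(sC k)(sC j)= oq(q 4 0)^s sh(NV k j)
 DN : ∀ k l -> DA k(NE k l)
 DN k z0 = DB 1# k
 DN z0(sC l)j _ = rR
 DN(sC z0)(sC l)j _ = rR
 DN(sC(sC k))(sC l)= Dd{sC k} {sh(NE k l)}(Dh{k} {NE k l}(DN k l))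
 Hy : ∀ a b k -> 0ₛ ~s Hj a b k 0ₛ
 Hy a b k = mk \ i -> yY(nB(sC k)\ j _ -> ze(V a b k j i))
 module _ {x y a b : ℕ -> ℂ} (xY : x ~s a +s 1# ^s b) (yf : y ~s b *s a) where
  pc : ∀ {x z}k -> x ~s z -> po x k ~s po z k
  pc z0 h = Rl
  pc(sC k)h = cI h(pc k h)
  eH : ∀ k l -> ec x y k l ~s Hj a b k(NE k l)
  eH k z0 = !& pc k xY &! HB a b 1# k
  eH z0(sC l)= Hy a b 0
  eH(sC z0)(sC l)= Hy a b 1
  eH(sC(sC k))(sC l)= !& cI yf(eH k l)~& Ac b a(Hj a b k(NE k l))&! Sy(!& Hn a b(sC k)(NE k l)&! cf{b}(Hm a b k(NE k l)(DN k l)))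
 VH : ∀ x g k j -> V(x +s oq n2 ^s g)(oq(q 4 0)^s g)k j ~s Hj x g k(NV k j)
 VH x g k z0 = HB x g(oq n2)k
 VH x g z0(sC j)= Hy x g 0
 VH x g(sC k)(sC j)= !&(·-*ₛ(oq(q 4 0))g(V(x +s oq n2 ^s g)(oq(q 4 0)^s g)k j))~& cm(!& cf{g}(VH x g k j)&! Sy(Hn x g k(NV k j)))&! Sy(Li(sC(sC k))(V x g(sC k))(oq(q 4 0))(sh(NV k j)))
 uC : ℕ -> ℕ -> ℕ -> ℂ
 uC k l s = ∑(sC k)(\ j -> NE k l j * NV k j(s +n s))
 module Ev = EG {P} {p} {g} gG gv
 private
  a b : ℕ -> ℂ
  a = P′ +s oq n2 ^s g
  b = oq(q 4 0)^s g
  PP : P ~s a +s 1# ^s b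
  PP = tX{P} {P′ +s oq(q 6 0)^s g} {a +s 1# ^s b}PK(mk \ n -> sV 2(\ r g -> r :+ #(q 6 0):* g :=(r :+ # n2 :* g):+ # 1q :*(#(q 4 0):* g))rR(P′ n)(g n))
  k8 : p ~s b *s a
  k8 = !& pX ~& cI(cq{P′}(kb(q 2 0)g))(kb(q 4 0)g)&! qy a b
 Ue : ∀ k l -> eE(ec P p k l)~s Es P p k(uC k l)
 Ue k l = tX{eE(ec P p k l)} {eE(Hj a b k(NE k l))} {Es P p k(uC k l)}(eo(eH{P} {p} {a} {b}PP k8 k l))(tX{Lf(sC k)(\ j -> eE(V a b k j))(NE k l)} {Lf(sC k)(\ j -> Es P p k(\ s -> NV k j(s +n s)))(NE k l)} {Es P p k(uC k l)}(Lc(sC k) {\ j -> eE(V a b k j)} {\ j -> Es P p k(\ s -> NV k j(s +n s))} {NE k l} {NE k l}(\ j -> !& eo(VH P′ g k j)&! Ev.EH k(NV k j))(\ _ -> rR))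
  (mk \ i -> !~(ch(sC k)\ j -> yY(∑-*(sC ⌊ k /2⌋)(NE k l j)(\ s -> NV k j(s +n s)* ec P p k s i)))~~ Sw(sC k)(sC ⌊ k /2⌋)(\ j s -> NE k l j *(NV k j(s +n s)* ec P p k s i))~!
   (ch(sC ⌊ k /2⌋)\ s -> !~(ch(sC k)\ j -> yY(ao(NE k l j)(NV k j(s +n s))(ec P p k s i)))~!(∑-*ʳ(sC k)(ec P p k s i)(\ j -> NE k l j * NV k j(s +n s))))))
 X 1+X : ℕ -> ℂ
 X = sh 1ₛ
 1+X = 1ₛ +s 1# ^s X
 private
  Xe : ∀ c -> X *s c ~s sh c
  Xe c = mk \ { z0 -> ze(c 0); (sC n)-> !~ Cg(ze(c(sC n)))~~(Ii _)~! at(iG c)n }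
  Xf : X *s X ~s dl X
  Xf = !& Xe X &!(mk \ { z0 -> rR; (sC z0)-> rR; (sC(sC n))-> yY(at(dk 1#)n) })
  Xo : eE X ~s 0ₛ
  Xo = mk \ { z0 -> rR; (sC n)-> sB(\ k -> X(sC k)≈ 0#)(sy(su n n))rR }
  module Ex = EG {1+X} {X} {X} Xf Xo
  pB : ∀ k -> po 1+X k ~s Bn 1# k
  pB z0 = Rl
  pB(sC k)= !& cf{1+X}(pB k)~& dg(Bn 1# k)1ₛ(1# ^s X)&! cj(iG(Bn 1# k))(!&(·-*ₛ 1# X(Bn 1# k))&! cm(Xe(Bn 1# k)))
  eN : ∀ k l -> ec 1+X X k l ~s NE k l
  eN k z0 = pB k
  eN z0(sC l)= Rl
  eN(sC z0)(sC l)= Rl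
  eN(sC(sC k))(sC l)= !& cf{X}(eN k l)&! Xe(NE k l)
  ya : ℕ -> ℂ
  ya = dl 1+X +s oq n2 ^s X
  ye : ya ~s 1+X *s 1+X
  ye = mk \
   { z0 -> sV 0((# 1q :+ # 1q :* # 0q):+ # n2 :* # 0q :=(# 1q :+ # 1q :* # 0q):*(# 1q :+ # 1q :* # 0q))rR
   ; (sC n)-> yY(!~ at sq(sC n)~! go n) }
   where
   sq : 1+X *s 1+X ~s 1+X +s sh 1+X
   sq = !& dg 1+X 1ₛ(1# ^s X)&! cj(iG 1+X)(!&(·-*ₛ 1# X 1+X)~& cm(Xe 1+X)&!(mk \ n -> ie(sh 1+X n)))
   z : ∀ n -> dl(\ i -> 0# + 1# * 0#)n ≈ 0#
   z z0 = sV 0(# 0q :+ # 1q :* # 0q := # 0q)rR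
   z(sC z0)= rR
   z(sC(sC n))= z n
   go : ∀ n ->(1+X +s sh 1+X)(sC n)≈ ya(sC n)
   go z0 = sV 0((# 0q :+ # 1q :* # 1q):+(# 1q :+ # 1q :* # 0q):= # 0q :+ # n2 :* # 1q)rR
   go(sC z0)= sV 0((# 0q :+ # 1q :* # 0q):+(# 0q :+ # 1q :* # 1q):=(# 0q :+ # 1q :* # 1q):+ # n2 :* # 0q)rR
   go(sC(sC z0))= sV 0((# 0q :+ # 1q :* # 0q):+(# 0q :+ # 1q :* # 0q):= # 0q :+ # n2 :* # 0q)rR
   go(sC(sC(sC n)))= !~ sV 0((# 0q :+ # 1q :* # 0q):+(# 0q :+ # 1q :* # 0q):= # 0q :+ # n2 :* # 0q)rR ~! Cg{oq n2 * 0#}(yY(z n))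
  Py : ∀ n -> po ya n ~s Bn 1#(n +n n)
  Py n = !& go n &! pB(n +n n)
   where
   go : ∀ n -> po ya n ~s po 1+X(n +n n)
   go z0 = Rl
   go(sC n)= !& cI ye(go n)~& Ac 1+X 1+X(po 1+X(n +n n))&! sB(\ m -> 1+X *s(1+X *s po 1+X(n +n n))~s 1+X *s po 1+X m)(sy(su n n))Rl
  VD : ∀ k j m -> j ≤n k -> V ya(oq(q 4 0)^s X)k j(j +n m)≈ oq(q 4 0)^ j * Bn 1#((k -n j)+n(k -n j))m
  VD k z0 m _ = !~ at(Py k)m ~! yY(ie _)
  VD(sC k)(sC j)m(ss le)= !~ at(!&(·-*ₛ(oq(q 4 0))X(V ya(oq(q 4 0)^s X)k j))&! cm(Xe(V ya(oq(q 4 0)^s X)k j)))(sC(j +n m))~~ co{oq(q 4 0)}(VD k j m le)~! yY(ao _ _ _)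
 TU : ∀ k -> ∑(sC ⌊ k /2⌋)(\ l -> uC k l l)≈ ∑(sC k)(\ j -> oq(q 4 0)^ j * Bn 1#((k -n j)+n(k -n j))j)
 TU k = !~ Sw(sC ⌊ k /2⌋)(sC k)(\ l j -> NE k l j * NV k j(l +n l))~! cy(sC k)d
  where
  d : ∀ j -> j <n sC k -> ∑(sC ⌊ k /2⌋)(\ l -> NE k l j * NV k j(l +n l))≈ oq(q 4 0)^ j * Bn 1#((k -n j)+n(k -n j))j
  d j(ss le)= !~(ch(sC ⌊ k /2⌋)\ l -> !~ cp(NE k l j)(NV k j(l +n l))~! co{NV k j(l +n l)}(yY(at(eN k l)j)))~~
   yY(at(Ex.EH k(NV k j))j)~~ at(eo(Sy(VH(dl 1+X)X k j)))j ~! VD k j j le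
module Tra2 where
 open CSolve
 open Tra public
 private
  q : ℕ -> ℕ -> ℚ
  q a b =(+ a)// sC b
  ¼ : ℂ
  ¼ = oq(q 1 3)
 dE : ℕ ->(ℕ -> ℂ)-> Set
 dE k = DA ⌊ k /2⌋
 module _ (x y : ℕ -> ℂ) where
  Ez : ∀ k c -> Es x y(2 +n k)(sh c)~s y *s Es x y k c
  Ez k c = !& Eu x y k(sh c)&!(mk \ n -> !~ Cg(ze(po x(2 +n k)n))~!(Ii _))
  Et : ∀ k c -> dE k c -> Es x y(sC k)c ~s x *s Es x y k c
  Et z0 c h = bY c
   where
   bY : ∀ c -> Lf 1(ec x y 1)c ~s x *s Lf 1(ec x y 0)c
   bY c = Sy(Lh 1 x(ec x y 0)c)
  Et(sC z0)c h = !& Eu x y 0 c ~& cq{c 0 ^s po x 2}(!& cf{y}(mk \ i -> !~(Ie _)~~ cn{1ₛ i}(h 1(ss zn))~! ze(1ₛ i))&! Zr y)~&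
   io(c 0 ^s po x 2)~&(mk \ i -> yY(Ie(c 0 * po x 2 i)))&! Sy(Lh 1 x(\ _ -> po x 1)c)
  Et(sC(sC k))c h = !& Eu x y(sC k)c ~& cj(Sy(*-·ₛ(c 0)x(po x(sC(sC k)))))(!& cf{y}(Et k(tl c)(DF h))&! G.xx y x(Es x y k(tl c)))~&
   Sy(Dr x(c 0 ^s po x(sC(sC k)))(y *s Es x y k(tl c)))&! cf{x}(Sy(Eu x y k c))
 DE : ∀ k{c}-> dE k c -> dE(sC k)c
 DE k h j lt = h j(tA(qN(N1 k))lt)
 Ey : ℕ ->(ℕ -> ℂ)-> ℕ -> ℂ
 Ey k c = c +s oq(q 12 0)^s sh c
 Fp : ℕ ->(ℕ -> ℂ)-> ℕ -> ℂ
 Fp k c = c +s oq(-q q 36 0)^s sh c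
 module _ {x y A B : ℕ -> ℂ} (Av : A ~s x *s x +s oq (q 12 0) ^s y) (Bm : B ~s x *s (x *s x) +s oq (-q q 36 0) ^s (x *s y)) where
  ED : ∀ k c -> dE k c -> A *s Es x y k c ~s Es x y(2 +n k)(Ey k c)
  ED k c h = !& cv{Es x y k c}Av ~& dg(Es x y k c)(x *s x)(oq(q 12 0)^s y)~& cj(!& Ac x x(Es x y k c)~& cf{x}(Sy(Et x y k c h))&! Sy(Et x y(sC k)c(DE k h)))
   (!&(·-*ₛ(oq(q 12 0))y(Es x y k c))~& cm(Sy(Ez x y k c))&! Sy(Li(sC ⌊ 2 +n k /2⌋)(ec x y(2 +n k))(oq(q 12 0))(sh c)))&! Sy(Ln(sC ⌊ 2 +n k /2⌋)(ec x y(2 +n k))c(oq(q 12 0)^s sh c))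
  Ft : ∀ k c -> dE k c -> B *s Es x y k c ~s Es x y(3 +n k)(Fp k c)
  Ft k c h = !& cv{Es x y k c}Bm ~& dg(Es x y k c)(x *s(x *s x))(oq(-q q 36 0)^s(x *s y))~& cj
   (!& Ac x(x *s x)(Es x y k c)~& cf{x}(!& Ac x x(Es x y k c)~& cf{x}(Sy(Et x y k c h))&! Sy(Et x y(sC k)c(DE k h)))&! Sy(Et x y(2 +n k)c(DE(sC k)(DE k h))))
   (!&(·-*ₛ(oq(-q q 36 0))(x *s y)(Es x y k c))~& cm(!& Ac x y(Es x y k c)~& cf{x}(Sy(Ez x y k c))&! Sy(Et x y(2 +n k)(sh c)(Dh{⌊ k /2⌋} {c}h)))&! Sy(Li(sC ⌊ 3 +n k /2⌋)(ec x y(3 +n k))(oq(-q q 36 0))(sh c)))&!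
   Sy(Ln(sC ⌊ 3 +n k /2⌋)(ec x y(3 +n k))c(oq(-q q 36 0)^s sh c))
 Pb pj : ℕ -> ℂ
 Pb = -s P
 pj = ¼ ^s(P *s P)+s -s p
 2^ : ℕ -> ℂ
 2^ k = oq n2 ^ k
 private
  4A′ : 2^ 2 ^s A′ ~s Pb *s Pb +s oq(q 12 0)^s pj
  4A′ = mk \ n -> !~ co{2^ 2}(!~ at AP n ~! Cn{(P *s P)n}(at(kb(-q q 3 0)p)n))~~
   sV 2(\ s p ->(# n2 :*(# n2 :* # 1q)):*(s :+ #(-q q 3 0):* p):= s :+ #(q 12 0):*(#(q 1 3):* s :+ :- p))rR((P *s P)n)(p n)~! Cg{oq(q 12 0)* pj n}(yY(at(G.ay P P)n))
  8B′ : 2^ 3 ^s B′ ~s Pb *s(Pb *s Pb)+s oq(-q q 36 0)^s(Pb *s pj)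
  8B′ = mk \ n -> !~ co{2^ 3}(!~ at BP n ~! Cn{(P *s(P *s P))n}(at(kb(-q q 9 1)(P *s p))n))~~
   sV 2(\ s t ->(# n2 :*(# n2 :*(# n2 :* # 1q))):*(s :+ #(-q q 9 1):* t):=(:- s):+ #(-q q 36 0):*(:-(#(q 1 3):* s :+ :- t)))rR((P *s(P *s P))n)((P *s p)n)~!
    ca(yY(at(!& cf{Pb}(G.ay P P)&! G.n7 P(P *s P))n))(co{oq(-q q 36 0)}(yY(at(!& G.n7 P pj &! cL(!& Dr P(¼ ^s(P *s P))(-s p)&! cj(*-·ₛ ¼ P(P *s P))(G.gP P p)))n)))
  Ak : A ~s P *s P +s oq(q 12 0)^s p
  Ak = !& Aj &! cq{P *s P}(kb(q 12 0)p)
  Bf : B ~s P *s(P *s P)+s oq(-q q 36 0)^s(P *s p)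
  Bf = !& bP &! cq{P *s(P *s P)}(kb(-q q 36 0)(P *s p))
 Ry : ℕ ->(ℕ -> ℂ)-> Set
 Ry k f = ∃ \ c -> dE k c × f ~s Es P p k c × 2^ k ^s dl f ~s Es Pb pj k c
 private
  DU : ∀ k c -> dE k c -> dE(2 +n k)(Ey k c)
  DU k c h = Dz{sC ⌊ k /2⌋} {c} {oq(q 12 0)^s sh c}(Dd{⌊ k /2⌋} {c}h)(Dq{sC ⌊ k /2⌋} {sh c}(oq(q 12 0))(Dh{⌊ k /2⌋} {c}h))
  DV : ∀ k c -> dE k c -> dE(3 +n k)(Fp k c)
  DV k c h = DE(2 +n k) {Fp k c}(Dz{sC ⌊ k /2⌋} {c} {oq(-q q 36 0)^s sh c}(Dd{⌊ k /2⌋} {c}h)(Dq{sC ⌊ k /2⌋} {sh c}(oq(-q q 36 0))(Dh{⌊ k /2⌋} {c}h)))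
  tP : ∀ j k(a f : ℕ -> ℂ)-> 2^(j +n k)^s dl(a *s f)~s(2^ j ^s dl a)*s(2^ k ^s dl f)
  tP j k a f = !&(mk \ n -> !~ cd(xo(oq n2)j k)(at(dC a f)n)~! ao(2^ j)(2^ k)((dl a *s dl f)n))&! Sy(!&(·-*ₛ(2^ j)(dl a)(2^ k ^s dl f))&! cm(*-·ₛ(2^ k)(dl a)(dl f)))
  EE : ∀ x y k -> 0ₛ ~s Es x y k 0ₛ
  EE x y k = mk \ i -> yY(nB(sC ⌊ k /2⌋)\ j _ -> ze(ec x y k j i))
 rr : ∀ {k f}-> Ll k f -> Ry k f
 rr{k}zl = 0ₛ ,(\ _ _ -> rR), EE P p k , !&(mk \ n -> !~ co{2^ k}(z n)~! zr(2^ k))&! EE Pb pj k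
  where
  z : ∀ n -> dl 0ₛ n ≈ 0#
  z z0 = rR
  z(sC z0)= rR
  z(sC(sC n))= z n
 rr On = 1ₛ ,(\ { (sC j)_ -> rR }), mk(\ n -> yY(!~(Ie _)~! ie(1ₛ n))), mk \ n -> !~ co{1#}(at(dk 1#)n)~! yY(Ie _)
 rr(Ek_{k} {f}l)= let c , d , h , hg = rr l in Ey k c , DU k c d , !& cf{A}h &! ED Ak Bf k c d , !& tP 2 k A f ~& cf{2^ 2 ^s A′}hg &! ED 4A′ 8B′ k c d
 rr(Fd_{k} {f}l)= let c , d , h , hg = rr l in Fp k c , DV k c d , !& cf{B}h &! Ft Ak Bf k c d , !& tP 3 k B f ~& cf{2^ 3 ^s B′}hg &! Ft 4A′ 8B′ k c d
 rr(_⊕_{k} {f} {g}l lB)=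
  let c , d , h , hg = rr l;cl , fI , hO , h9 = rr lB
  in c +s cl , Dz{⌊ k /2⌋} {c} {cl}d fI , !& cj h hO &! Sy(Ln(sC ⌊ k /2⌋)(ec P p k)c cl), !&(mk \ n -> !~ co{2^ k}(at(Dl f g)n)~! dr(2^ k)(dl f n)(dl g n))~& cj hg h9 &! Sy(Ln(sC ⌊ k /2⌋)(ec Pb pj k)c cl)
 rr(_⊙_{k} {f}x l)= let c , d , h , hg = rr l in x ^s c , Dq{⌊ k /2⌋} {c}x d , !& cm h &! Sy(Li(sC ⌊ k /2⌋)(ec P p k)x c),
  !&(mk \ n -> !~ co{2^ k}(at(dO x f)n)~! sV 3(\ t x d -> t :*(x :* d):= x :*(t :* d))rR(2^ k)x(dl f n))~& cm hg &! Sy(Li(sC ⌊ k /2⌋)(ec Pb pj k)x c)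
 rr{k}(Rp e l)= let c , d , h , hg = rr l in c , d , !& Sy e &! h , !& cm(dz(Sy e))&! hg
 EA : ∀ k c -> Es P p k c ~s 0ₛ -> ∀ s -> s ≤n ⌊ k /2⌋ -> c s ≈ 0#
 EA k c h = go k c h
  where
  pO : ∀ k -> po P k 0 ≈ 1#
  pO z0 = rR
  pO(sC k)= !~ cd(pS lP)(pO k)~! 1·1
  first : ∀ k c -> Lf 1(ec P p k)c ~s 0ₛ -> c 0 ≈ 0#
  first k c h = !~ yY(!~(Ie _)~~ co{c 0}(pO k)~! In(c 0))~! at h 0
  go : ∀ k c -> Es P p k c ~s 0ₛ -> ∀ s -> s ≤n ⌊ k /2⌋ -> c s ≈ 0#
  go z0 c h z0 _ = first 0 c h
  go(sC z0)c h z0 _ = first 1 c h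
  go(sC(sC k))c h s le = Pk s le
   where
   hO : c 0 ^s po P(2 +n k)+s p *s Es P p k(tl c)~s 0ₛ
   hO = !& Sy(Eu P p k c)&! h
   c0 : c 0 ≈ 0#
   c0 = !~ yY(!~ ca(!~ co{c 0}(pO(2 +n k))~! In(c 0))(!~ cn{Es P p k(tl c)0}(pF Lq 0(ss zn))~! ze(Es P p k(tl c)0))~! Ie(c 0))~! at hO 0
   rw : Es P p k(tl c)~s 0ₛ
   rw = Cc 1{p} {Es P p k(tl c)} {oq(q 16 0)} {oq(q 1 15)}Lq(sV 0(#(q 16 0):* #(q 1 15):= # 1q)rR)(!&(mk \ n -> yY(!~ Cg(!~ cn{po P(2 +n k)n}c0 ~! ze(po P(2 +n k)n))~!(Ii _)))&! hO)
   Pk : ∀ s -> s ≤n sC ⌊ k /2⌋ -> c s ≈ 0#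
   Pk z0 _ = c0
   Pk(sC s)(ss le)= go k(tl c)rw s le
 wC : ℕ -> ℕ -> ℕ -> ℂ
 wC z0 z0 = 1ₛ
 wC(sC k)z0 = -s wC k z0
 wC z0(sC l)= 0ₛ
 wC(sC z0)(sC l)= 0ₛ
 wC(sC(sC k))(sC l)= ¼ ^s wC k l +s -s sh(wC k l)
 wh : ∀ k l s -> l <n s -> wC k l s ≈ 0#
 wh z0 z0(sC s)_ = rR
 wh(sC k)z0 s lt = !~ cc(wh k z0 s lt)~! sV 0(:- # 0q := # 0q)rR
 wh z0(sC l)s _ = rR
 wh(sC z0)(sC l)s _ = rR
 wh(sC(sC k))(sC l)(sC s)(ss lt)= !~ ca(co{¼}(wh k l(sC s)(tZ lt(Nn s))))(cc(wh k l s lt))~! sV 0(#(q 1 3):* # 0q :+ :- # 0q := # 0q)rR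
 Dg : ∀ k l -> dE k(wC k l)
 Dg k z0 j lt = wh k z0 j(tA zn lt)
 Dg z0(sC l)j _ = rR
 Dg(sC z0)(sC l)j _ = rR
 Dg(sC(sC k))(sC l)= Dz{sC ⌊ k /2⌋} {¼ ^s wC k l} { -s sh(wC k l)}(Dq{sC ⌊ k /2⌋} {wC k l}¼(Dd{⌊ k /2⌋} {wC k l}(Dg k l)))(\ j lt -> !~ cc(Dh{⌊ k /2⌋} {wC k l}(Dg k l)j lt)~! sV 0(:- # 0q := # 0q)rR)
 private
  Lj : ∀ n m c -> Lf n m(-s c)~s -s Lf n m c
  Lj n m c = mk \ i -> !~(ch n \ j -> sV 2(\ c m ->(:- c):* m := :-(c :* m))rR(c j)(m j i))~! Ng n(\ j -> c j * m j i)
 Wa : ∀ k l -> ec Pb pj k l ~s Es P p k(wC k l)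
 Wa z0 z0 = mk \ n -> yY(!~(Ie _)~! ie(1ₛ n))
 Wa(sC k)z0 = !& cf{Pb}(Wa k z0)~& G.n7 P(Es P p k(wC k z0))~& cL(Sy(Et P p k(wC k z0)(Dg k z0)))&! Sy(Lj(sC ⌊ sC k /2⌋)(ec P p(sC k))(wC k z0))
 Wa z0(sC l)= EE P p 0
 Wa(sC z0)(sC l)= EE P p 1
 Wa(sC(sC k))(sC l)= !& cf{pj}(Wa k l)~& dg w(¼ ^s(P *s P))(-s p)~& cj
  (!&(·-*ₛ ¼(P *s P)w)~& cm(!& Ac P P w ~& cf{P}(Sy(Et P p k(wC k l)(Dg k l)))&! Sy(Et P p(sC k)(wC k l)(DE k(Dg k l))))&! Sy(Li n m ¼(wC k l)))
  (!& G.n7 p w ~& cL(Sy(Ez P p k(wC k l)))&! Sy(Lj n m(sh(wC k l))))&!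
  Sy(Ln n m(¼ ^s wC k l)(-s sh(wC k l)))
  where
  w = Es P p k(wC k l)
  n = sC ⌊ 2 +n k /2⌋
  m = ec P p(2 +n k)
 t5 : ℕ -> ℂ
 t5 k = ∑(sC ⌊ k /2⌋)(\ l -> wC k l l)
 TW : ∀ k -> t5(2 +n k)≈ wC k z0 0 - t5 k
 TW k = ca(sV 1(\ x -> :-(:- x):= x)rR(wC k z0 0))(!~(ch(sC ⌊ k /2⌋)\ l -> !~ Cg{(- wC k l l)}(!~ co{¼}(wh k l(sC l)(Nn l))~!(zr ¼))~! Ii(- wC k l l))~! Ng(sC ⌊ k /2⌋)(\ l -> wC k l l))
module Dec where
 open CSolve
 open Tra2 public
 private
  q : ℕ -> ℕ -> ℚ
  q a b =(+ a)// sC b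
  S : Set
  S = ℕ -> ℂ
  2k k9 3k 4k ⅓ -⅓ oP : S
  2k = ka(q 2 0)
  k9 = ka(-q q 2 0)
  3k = ka(q 3 0)
  4k = ka(q 4 0)
  ⅓ = ka(q 1 2)
  -⅓ = ka(-q q 1 2)
  oP = ka ½
 kL : ∀ {k a}r -> Ll k a -> Ll k(ka r *s a)
 kL{k} {a}r l = Rp(Sy(kb r a))(oq r ⊙ l)
 Qe Qc : S -> S -> S -> S
 Qe x y z = dl x +s(dl y *s P +s dl z *s(P *s P))
 Qc x y z = x +s(k9 *s(y *s P)+s 4k *s(z *s(P *s P)))
 Dec : ℕ -> S -> S -> Set
 Dec k f v = ∃ \ x -> ∃ \ y -> ∃ \ z ->(f ~s Qe x y z × v ~s Qc x y z)× Ll k x ×(Ll(1 +n k)(A *s y)× Ll(2 +n k)(B *s y))× Ll k(A *s z)× Ll(1 +n k)(B *s z)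
 private
  sI : ∀ a x y z -> dl a *s Qe x y z ~s Qe(a *s x)(a *s y)(a *s z)
  sI a x y z = !& G.qs Aj AP bP BP(dl a)(dl x)(dl y)(dl z)&! Sy(cj(dC a x)(cj(cv{P}(dC a y))(cv{P *s P}(dC a z))))
  +L : ∀ {k}a x y -> Ll k(a *s x)-> Ll k(a *s y)-> Ll k(a *s(x +s y))
  +L a x y l lB = Rp(Sy(Dr a x y))(l ⊕ lB)
  SL : ∀ {k}a b x -> Ll k(a *s(b *s x))-> Ll k(b *s(a *s x))
  SL a b x = Rp(G.xx a b x)
  ks : ∀ {k}r a b x -> Ll k(a *s(b *s x))-> Ll k(a *s(ka r *s(b *s x)))
  ks r a b x l = Rp(G.xx(ka r)a(b *s x))(kL r l)
 Dp : ∀ {k f f′ v vb}-> f ~s f′ -> v ~s vb -> Dec k f v -> Dec k f′ vb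
 Dp h hg(x , y , z ,(e , ej), s)= x , y , z ,(!& Sy h &! e , !& Sy hg &! ej), s
 DZ : ∀ {k f f′ v vb}-> Dec k f v -> Dec k f′ vb -> Dec k(f +s f′)(v +s vb)
 DZ(x , y , z ,(e , ej), lx ,(ly , Ly), lz , Lz)(xH , yb , zb ,(ee , f5), lS ,(lT , lC), lU , lD)= x +s xH , y +s yb , z +s zb ,
  (!& cj e ee ~& G.Qd Aj AP bP BP(dl x)(dl y)(dl z)(dl xH)(dl yb)(dl zb)&! Sy(cj(Dl x xH)(cj(cv{P}(Dl y yb))(cv{P *s P}(Dl z zb)))),
   !& cj ej f5 &! G.Qa Aj AP bP BP x y z xH yb zb),
  (lx ⊕ lS),(+L A y yb ly lT , +L B y yb Ly lC), +L A z zb lz lU , +L B z zb Lz lD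
 DK : ∀ {k f v}r -> Dec k f v -> Dec k(ka r *s f)(ka r *s v)
 DK r(x , y , z ,(e , ej), lx ,(ly , Ly), lz , Lz)= ka r *s x , ka r *s y , ka r *s z ,
  (!& cI(Sy(dk(oq r)))e &! sI(ka r)x y z , !& cf{ka r}ej &! G.qd Aj AP bP BP(ka r)x y z),
  kL r lx ,(SL(ka r)A y(kL r ly), SL(ka r)B y(kL r Ly)), SL(ka r)A z(kL r lz), SL(ka r)B z(kL r Lz)
 D2 : ∀ {k f v}-> Dec k f v -> Dec(2 +n k)(A′ *s f)(A *s v)
 D2(x , y , z ,(e , ej), lx ,(ly , Ly), lz , Lz)= A *s x , A *s y , A *s z ,
  (!& cf{A′}e &! sI A x y z , !& cf{A}ej &! G.qd Aj AP bP BP A x y z),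
  (Ek lx),((Ek ly), SL A B y(Ek Ly)),(Ek lz), SL A B z(Ek Lz)
 DP : ∀ {k f v}-> Dec k f v -> Dec(1 +n k)(P *s f)(2k *s(Pb *s v))
 DP(x , y , z ,(e , ej), lx ,(ly , Ly), lz , Lz)= xH , yb , y ,
  (!& cf{P}e ~& G.PD Aj AP bP BP(dl x)(dl y)(dl z)&! Sy(cj(fM(-q q 2 0)B z)(fT{dl y *s(P *s P)}(cv{P}(!& Dl x(3k *s(A *s z))&! cq{dl x}(fM(q 3 0)A z))))),
   !& cf{2k}(cf{Pb}ej)&! G.Pu Aj AP bP BP x y z),
  kL(-q q 2 0)Lz ,(+L A x(3k *s(A *s z))(Ek lx)(ks(q 3 0)A A z(Ek lz)), +L B x(3k *s(A *s z))(Fd lx)(ks(q 3 0)B A z(Fd lz))), ly , Ly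
  where
  xH = k9 *s(B *s z)
  yb = x +s 3k *s(A *s z)
  fM : ∀ r a b -> dl(ka r *s(a *s b))~s ka r *s(dl a *s dl b)
  fM r a b = !& Dk r(a *s b)&! cf{ka r}(dC a b)
 D3 : ∀ {k f v}-> Dec k f v -> Dec(2 +n k)(p *s f)(4k *s(pj *s v))
 D3{k} {f} {v}d = Dp(Sy(G.pY Aj AP bP BP f))(!& Sy(G.pI Aj AP bP BP v)&! cf{4k}(cv{v}(fT{ -s p}(kb(q 1 3)(P *s P)))))
  (DZ(DK(q 1 2)(DP(DP d)))(DK(-q q 1 2)(D2 d)))
 D1 : Dec 0 1ₛ 1ₛ
 D1 = 1ₛ , 0ₛ , 0ₛ ,(Sy(!& cj(dk 1#)(!& cj(!& cv{P}d0 &! zh P)(!& cv{P *s P}d0 &! zh(P *s P))&! io 0ₛ)&! io 1ₛ),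
  Sy(!& cq{1ₛ}(!& cj(!& cf{ k9}(zh P)&! Zr k9)(!& cf{4k}(zh(P *s P))&! Zr 4k)&! io 0ₛ)&! io 1ₛ)),
  On ,(z A , z B), z A , z B
  where
  d0 : dl 0ₛ ~s 0ₛ
  d0 = mk go
   where
   go : ∀ n -> dl 0ₛ n ≈ 0#
   go z0 = rR
   go(sC z0)= rR
   go(sC(sC n))= go n
  z : ∀ {k}a -> Ll k(a *s 0ₛ)
  z a = Rp(Sy(Zr a))zl
 private
  tG : ∀ k f -> 2k *s(Pb *s(2^ k ^s f))~s 2^(sC k)^s(Pb *s f)
  tG k f = !& kb(q 2 0)(Pb *s(2^ k ^s f))~& cm(*-·ₛ(2^ k)Pb f)&!(mk \ n -> !~ yY(ao(oq(q 2 0))(2^ k)_)~! cn{(Pb *s f)n}(cn{2^ k}rR))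
  fp : ∀ k f -> 4k *s(pj *s(2^ k ^s f))~s 2^(2 +n k)^s(pj *s f)
  fp k f = !& kb(q 4 0)(pj *s(2^ k ^s f))~& cm(*-·ₛ(2^ k)pj f)&!(mk \ n -> sV 2(\ t x -> #(q 4 0):*(t :* x):=(# n2 :*(# n2 :* t)):* x)rR(2^ k)((pj *s f)n))
 DW : ∀ {k f v}-> Dec k f v -> Dec k 0ₛ(2^ k ^s 0ₛ)
 DW{k} {f} {v}d = Dp(z f)(!& z v &!(mk \ n -> yY(zr(2^ k))))(DK 0q d)
  where
  z : ∀ f -> ka 0q *s f ~s 0ₛ
  z f = !& kb 0q f &!(mk \ n -> ze(f n))
 De : ∀ k l -> Dec k(ec P p k l)(2^ k ^s ec Pb pj k l)
 De z0 z0 = Dp Rl(mk \ n -> yY(ie(1ₛ n)))D1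
 De(sC k)z0 = Dp Rl(tG k(po Pb k))(DP(De k z0))
 De z0(sC l)= DW D1
 De(sC z0)(sC l)= DW(DP D1)
 De(sC(sC k))(sC l)= Dp Rl(fp k(ec Pb pj k l))(D3(De k l))
 private
  jD : eE P ~s P
  jD = !& eo PK &!(mk \ n -> !~ ca(at(eD P)n)(!~ co{oq(q 6 0)}(at gv n)~! zr(oq(q 6 0)))~! Ie(P n))
  EP : eE(P *s P)~s P *s P +s ka(q 36 0)*s p
  EP = !& eo(!& cI PF PF &! G.aN P′ g(dl p)gG)~& cj(!& eo(Sy(dC P P))&! eD(P *s P))(cj
   (mk \ n -> !~ at(kb(q 12 0)(P′ *s g))(n +n n)~~ co{oq(q 12 0)}(at(!& eA P g ~& cf{P}gv &! Zr P)n)~! zr(oq(q 12 0)))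
   (mk \ n -> !~ at(kb(q 36 0)(dl p))(n +n n)~~ co{oq(q 36 0)}(at(eD p)n)~! yY(at(kb(q 36 0)p)n)))&!
   cq{P *s P}(j7(ka(q 36 0)*s p))
   where
   PF : P ~s P′ +s ka(q 6 0)*s g
   PF = !& PK &! cq{P′}(Sy(kb(q 6 0)g))
 D4 : ∀ {k f v}-> Dec k f v -> Ll k(eE f +s oP *s v)
 D4(x , y , z ,(e , ej), lx , _ , lz , _)= Rp(Sy(!& cj(!& eo e ~& fL(dl x)(dl y *s P +s dl z *s(P *s P))&! cj(eD x)(!& fL(dl y *s P)(dl z *s(P *s P))&!
  cj(!& eA y P &! cf{y}jD)(!& eA z(P *s P)&! cf{z}EP)))(cf{oP}ej)&! G.qm Aj AP bP BP x y z))
  (kL(q 3 1)lx ⊕ kL(q 3 0)lz)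
 Ye : ∀ k l -> Ll k(Es P p k(uC k l +s(oq ½ * 2^ k)^s wC k l))
 Ye k l = Rp(!& cj(Ue k l)(!&(kb ½(2^ k ^s ec Pb pj k l))~&(mk \ n -> yY(ao(oq ½)(2^ k)(ec Pb pj k l n)))~& cm(Wa k l)&! Sy(Li(sC ⌊ k /2⌋)(ec P p k)(oq ½ * 2^ k)(wC k l)))&!
  Sy(Ln(sC ⌊ k /2⌋)(ec P p k)(uC k l)((oq ½ * 2^ k)^s wC k l)))(D4(De k l))
module Hol where
 open CSolve
 open Dec public
 mI : ∀ a b -> 0q << a -> 0q << b -> ∃ \ m -> 0q << m × m <= a × m <= b
 mI a b ha hb = go(Tt a b)
  where
  go : a <= b ⊎ b <= a -> ∃ \ m -> 0q << m × m <= a × m <= b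
  go(iL h)= a , ha , ra , h
  go(iR h)= b , hb , h , ra
 Hh :(z : ℍ)-> Hp(pF z)
 Hh(z , h)= R._<_.gap h , R._<_.gap>0 h , Em(\ n lt -> !< rl(!= sy(iB(R._<_.gap h))=! cO(_++ R._<_.gap h)(sy(sF 0q n)))<!(lZ lt))(R._<_.separated h)
  where
  opaque
   unfolding fq
   sF : ∀ q n -> seq(fq q)n ≡ q
   sF q n = Re
 Hd : ∀ z -> Hp z -> ℍ
 Hd z(δ , fl , h)= z , record { gap = ½ ** δ ; gap>0 = Ha fl ; separated = Em(\ n le -> Tn(m3 n)le)h }
  where
  opaque
   unfolding fq
   m3 : ∀ n -> seq R.0# n ++ ½ ** δ << δ
   m3 n = bf(½ ** δ)(Ha fl)(sl 1(\ d -> d =:(Co 0q +: Co ½ *: d)+: Co ½ *: d)Re δ)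
 s : ℂ -> ℕ -> ℂ
 s x z0 = 0#
 s x(sC n)=(1# + x)* s x n + oa n
 f6 : ∀ x n ->(1# + x)^ n ≈ 1# + oa n * x + x * x * s x n
 f6 x z0 = !~ sV 1(\ x -> # 1q := # 1q :+ # 0q :* x :+ x :* x :* # 0q)rR x ~! Cg(Cn(cn(yY o0)))
 f6 x(sC n)= !~ co{1# + x}(f6 x n)~~ sV 3(\ x i s ->(# 1q :+ x):*(# 1q :+ i :* x :+ x :* x :* s):= # 1q :+(# 1q :+ i):* x :+ x :* x :*((# 1q :+ x):* s :+ i))rR x(oa n)(s x n)~! Cg(Cn(cn(yY(os n))))
 ov : ∀ n -> oa n <| ι n
 ov n = sB(oa n <|_)(np(nc n))(Of(ι n))
 jE : ∀ {x ξ}(h : 0q << ξ)-> x <| ξ -> ∀ n -> s x n <| iv ξ h ** iv ξ h **(1q ++ ξ)^^ n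
 jE{x} {ξ}h hx n = mo(By(i ** i **(1q ++ ι n ** ξ))(n0(n0 iE iE)(N0 n1(n0(nc n)(lZ h))))(sl 3(\ i p t -> i *: i *: p =: i *: i *:(p -: t)+: i *: i *: t)Re i((1q ++ ξ)^^ n)(1q ++ ι n ** ξ)))(go n)
  where
  i = iv ξ h
  iE = lZ(i0 h)
  xI : ℕ -> ℚ
  xI n = i ** i **((1q ++ ξ)^^ n -q(1q ++ ι n ** ξ))
  oD : i ** i **(ξ ** ξ)≡ 1q
  oD = != sl 2(\ i x -> i *: i *:(x *: x)=:(x *: i)*:(x *: i))Re i ξ =~(cong₂ _**_(Iv h)(Iv h))=! iy 1q
  s8 : ∀ n ->(1q ++ ξ)** xI n ++ ι n ≡ xI(sC n)
  s8 n = != cO((1q ++ ξ)** xI n ++_)(!= sy(iy(ι n))=! cO(_** ι n)(sy oD))=~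
   sl 4(\ i x p n ->(Co 1q +: x)*:(i *: i *:(p -:(Co 1q +: n *: x)))+: i *: i *:(x *: x)*: n =: i *: i *:((Co 1q +: x)*: p -:(Co 1q +:(Co 1q +: n)*: x)))Re i ξ((1q ++ ξ)^^ n)(ι n)=!
    cO(\ t -> i ** i **((1q ++ ξ)**(1q ++ ξ)^^ n -q(1q ++ t ** ξ)))(sy(sa n))
  fN : 0q ≡ xI 0
  fN = != sl 2(\ i x -> Co 0q =: i *: i *:(Co 1q -:(Co 1q +: Co 0q *: x)))Re i ξ =! cO(\ t -> i ** i **(1q -q(1q ++ t ** ξ)))(sy nw)
  go : ∀ n -> s x n <| xI n
  go z0 = sB(s x z0 <|_)fN(Of 0q)
  go(sC n)= sB(s x(sC n)<|_)(s8 n)(≼-+(≼-*(≼-+(Of 1q)hx)(go n))(ov n))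
 private
  2π⁺ : ℚ
  2π⁺ = n2 ** xc
 module _ {c : ℕ -> ℂ} (gr : Gr 1q c) where
  module NI (z : ℂ) (hz : Hp z) where
   d = pF hz
   xF = 6ℚ ** d
   aL : 0q << xF
   aL = nD 0<6(pF(pS hz))
   1+D>0 : 0q << 1q ++ xF
   1+D>0 = 1+6δ>0(lZ(pF(pS hz)))
   ρ : ℚ
   ρ = iv(1q ++ xF)1+D>0
   jS : e z <| ρ
   jS = eU{z} {d}(lZ(pF(pS hz)))(pS(pS hz))
   hv = Hv(½ ** xF)(Ha aL)
   ξ = pF hv
   nZ = pF(pS hv)
   b : ℚ
   b = 1q ++ ξ
   b0 : 0q <= b
   b0 = N0 n1(lZ nZ)
   κ : ℚ
   κ = b ** b ** ρ
   0≤κ : 0q <= κ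
   0≤κ = n0(n0 b0 b0)(lZ(i0 1+D>0))
   nu : κ << 1q
   nu = Tr(ma{b ** b} {1q ++ ½ ** xF} {ρ}(lZ(i0 1+D>0))(pS(pS hv)))
    (bf(½ ** xF ** ρ)(nD(Ha aL)(i0 1+D>0))(!= sy(Iv 1+D>0)=! sl 2(\ d r ->(Co 1q +: d)*: r =:(Co 1q +: Co ½ *: d)*: r +: Co ½ *: d *: r)Re xF ρ))
   i : ℚ
   i = iv ξ nZ
   iE : 0q <= i
   iE = lZ(i0 nZ)
   Ck = pF(gr ξ nZ)
   Cw = pF(pS(gr ξ nZ))
   module _ {y E x : ℂ} {Y W : ℚ} (hy : y <| Y) (hE : E <| W) (hx : x <| ξ) where
    Tk : ℕ -> ℂ
    Tk n = c n * e z ^ n *(y * y * s x n + E * oa n)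
    K : ℚ
    K = Y ** Y **(i ** i)++ W **(1q ++ i)
    jF : ∀ n -> y * y * s x n + E * oa n <| K ** b ^^ n
    jF n = sB(y * y * s x n + E * oa n <|_)(sl 4(\ Y W i p -> Y *: Y *:(i *: i *: p)+: W *:((Co 1q +: i)*: p)=:(Y *: Y *:(i *: i)+: W *:(Co 1q +: i))*: p)Re Y W i(b ^^ n))
     (≼-+(≼-*(≼-* hy hy)(jE nZ hx n))(≼-* hE(mo(!< mg(N1 n)<! li ξ nZ n)(ov n))))
    gE : Go Tk
    gE = gy(Ck ** K)κ(n0 Cw(N0(n0(n0(nn hy)(nn hy))(n0 iE iE))(n0(nn hE)(N0 n1 iE))))0≤κ nu \ n ->
     sB(Tk n <|_)(eq n)(≼-*(≼-*(pS(pS(gr ξ nZ))n)(≼-^ n jS))(jF n))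
     where
     eq : ∀ n -> Ck **(1q ** b)^^ n ** ρ ^^ n **(K ** b ^^ n)≡ Ck ** K ** κ ^^ n
     eq n = != cO(\ t -> Ck ** t ^^ n ** ρ ^^ n **(K ** b ^^ n))(iy b)=~ sl 4(\ C K p r -> C *: p *: r *:(K *: p)=: C *: K *:(p *: p *: r))Re Ck K(b ^^ n)(ρ ^^ n)=!
      cO(Ck ** K **_)(!= cO(_** ρ ^^ n)(sy(dt b b n))=! sy(dt(b ** b)ρ n))
   Bd = pF(ty 2π⁺(nn 2πi-≼))
   hB = pS(ty 2π⁺(nn 2πi-≼))
   tM : ℚ
   tM = Go.Tl(gE{0#} {0#} {0#} {2π⁺ ** Bd} {2π⁺ ** 2π⁺ ** Bd}(mo Y0(Of 0q))(mo W0(Of 0q))(mo(lZ nZ)(Of 0q)))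
    where
    Bh = nn(hB 0 0#(mo(nn 2πi-≼)(Of 0q)))
    Y0 = n0(nn 2πi-≼)Bh
    W0 = n0(n0(nn 2πi-≼)(nn 2πi-≼))Bh
   vH : 0q << 1q ++ 2π⁺ ** Bd
   vH = nG nl(n0(nn 2πi-≼)(nn(hB 0 0#(mo(nn 2πi-≼)(Of 0q)))))
   v : ℚ
   v = iv(1q ++ 2π⁺ ** Bd)vH
   dc = \ n -> 2πi *(oa n * c n)
   GB : Gr 1q dc
   GB = Gf n1 2πi(Gy n1 gr)
   D : ℂ
   D = pF(Vl{dc} {z}GB hz)
   qt : ∀ {h A A₁}-> h <| 1q -> h <| ξ ** v -> va c z A -> va c(z + h)A₁ -> ∃ \ M -> M <| tM × A₁ - A - D * h ≈ h *(h * M)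
   qt{h} {A} {A₁}h1 hh vA vI = gm gL , gq gL , eq
    where
    t = 2πi * h
    ht : t <| 2π⁺
    ht = sB(t <|_)(ii 2π⁺)(≼-* 2πi-≼ h1)
    R₁ = tR 1 t
    R₂ = tR 2 t
    y = 2πi * R₁
    Ej = 2πi * 2πi * R₂
    x = h * y
    hy : y <| 2π⁺ ** Bd
    hy = ≼-* 2πi-≼(hB 1 t ht)
    hE : Ej <| 2π⁺ ** 2π⁺ ** Bd
    hE = ≼-*(≼-* 2πi-≼ 2πi-≼)(hB 2 t ht)
    hx : x <| ξ
    hx = mo(By(ξ ** v)(n0(lZ nZ)(lZ(i0 vH)))(!= sy(ii ξ)=~ cO(ξ **_)(sy(Iv vH))=! sl 3(\ x b v -> x *:((Co 1q +: b)*: v)=: x *: v *: b +: x *: v)Re ξ(2π⁺ ** Bd)v))(≼-* hh hy)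
    gL = gE{y} {Ej} {x}hy hE hx
    Rb : R₁ ≈ 1# + t * R₂
    Rb = !~ te 1 t ~! Cg(rx(cO oq i9))
     where
     i9 : ia 1 ≡ 1q
     i9 = != sy(iy(ia 1))=~ cO(_** ia 1)(!= sy(ig 1q)=~ cO(1q ++_)(sy nw)=! sy(sa 0))=~ Is 0 =! iT
    eh : e h ≈ 1# + x
    eh = !~ Ed h ~~ yY(TR t)~~ te 0 t ~! ca(rx(cO oq iT))(sV 3(\ p h r ->(p :* h):* r := h :*(p :* r))rR 2πi h R₁)
    Xq : x ≈ 2πi * h + h * h * Ej
    Xq = !~ co{h}(co{2πi}Rb)~! sV 3(\ p h r -> h :*(p :*(# 1q :+(p :* h):* r)):= p :* h :+ h :* h :*(p :* p :* r))rR 2πi h R₂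
    Ec : ∀ n -> c n * e(z + h)^ n - c n * e z ^ n -(dc n * e z ^ n)* h ≈ h *(h * Tk hy hE hx n)
    Ec n = !~ Cg{ -((dc n * e z ^ n)* h)}(Cg{ -(c n * e z ^ n)}(co{c n}(!~ ck n(eP z h)~~ df(e z)(e h)n ~! co{e z ^ n}(!~ ck n eh ~! f6 x n))))~~
     sV 7(\ c q i x s p h -> c :*(q :*(# 1q :+ i :* x :+ x :* x :* s)):- c :* q :-(p :*(i :* c):* q):* h := c :* q :*(i :*(x :- p :* h)):+ c :* q :*(x :* x :* s))rR(c n)(e z ^ n)(oa n)x(s x n)2πi h ~~
      Cg{c n * e z ^ n *(x * x * s x n)}(co{c n * e z ^ n}(co{oa n}(Cg{ -(2πi * h)}Xq)))~!
       sV 7(\ k i p h E y s -> k :*(i :*(p :* h :+ h :* h :* E :- p :* h)):+ k :*((h :* y):*(h :* y):* s):= h :*(h :*(k :*(y :* y :* s :+ E :* i))))rR(c n * e z ^ n)(oa n)2πi h Ej y(s x n)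
     where
     df : ∀ a b n ->(a * b)^ n ≈ a ^ n * b ^ n
     df a b z0 = yY(ie 1#)
     df a b(sC n)= !~ co{a * b}(df a b n)~! sV 4(\ a b x y -> a :* b :*(x :* y):= a :* x :*(b :* y))rR a b(a ^ n)(b ^ n)
    SC : ∀ {a : ℕ -> ℂ} {S}-> Sa a S -> Sa(\ n -> - a n)(- S)
    SC{a} {S}h = Su{\ n -> - 1# * a n} {\ n -> - a n} { - 1# * S} { - S}(\ n -> m(a n))(m S)(Sd{a}(- 1#)h)
     where
     m : ∀ x -> - 1# * x ≈ - x
     m x = sV 1(\ x ->(:- # 1q):* x := :- x)rR x
    vD : Sa(\ n -> dc n * e z ^ n * h)(D * h)
    vD = Su{\ n -> h *(dc n * e z ^ n)}(\ n -> cp h _)(cp h D)(Sd{\ n -> dc n * e z ^ n}h(pS(Vl{dc} {z}GB hz)))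
    eq : A₁ - A - D * h ≈ h *(h * gm gL)
    eq = Ss{\ n -> h *(h * Tk hy hE hx n)}(Su{\ n -> c n * e(z + h)^ n - c n * e z ^ n - dc n * e z ^ n * h}Ec rR(Sk{\ n -> c n * e(z + h)^ n - c n * e z ^ n} { \ n -> -(dc n * e z ^ n * h)}(Sk{\ n -> c n * e(z + h)^ n} {\ n -> -(c n * e z ^ n)}vI(SC vA))(SC{\ n -> dc n * e z ^ n * h}vD)))
     (Sd{\ n -> h * Tk hy hE hx n}h(Sd{Tk hy hE hx}h(gu gL)))
  Df : ℂ -> Set
  Df z = ∃ \ D -> ∃ \ K -> ∃ \ η -> 0q << η × 0q <= K ×(∀ {h A A₁}-> h <| η -> va c z A -> va c(z + h)A₁ -> ∃ \ M -> M <| K × A₁ - A - D * h ≈ h *(h * M))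
  opaque
   Dn : ∀ z -> Hp z -> Df z
   Dn z hz = N.D , N.tM , pF m , pF(pS m), nn(pF(pS(qo{0#}(mo(lZ(pF(pS m)))(Of 0q))vz(Vr{c} {c} {z} {z + 0#}Rl(yY(Ie z))rR vz)))), \ {h}-> qo{h}
    where
    module N = NI z hz
    vz : va c z(pF(Vl{c} {z}gr hz))
    vz = pS(Vl{c} {z}gr hz)
    m : ∃ \ m -> 0q << m × m <= 1q × m <= N.ξ ** N.v
    m = mI 1q(N.ξ ** N.v)nl(nD N.nZ(i0 N.vH))
    qo : ∀ {h A A₁}-> h <| pF m -> va c z A -> va c(z + h)A₁ -> ∃ \ M -> M <| N.tM × A₁ - A - N.D * h ≈ h *(h * M)
    qo{h}hm = N.qt{h}(mo(pF(pS(pS m)))hm)(mo(pS(pS(pS m)))hm)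
module Cusp where
 open CSolve
 open Hol public
 import Data.Integer.DivMod as ℤD
 open import Relation.Nullary using (¬_;yes;no)
 private
  opaque
   unfolding fq _+ℝ_ _*ℝ_ -ℝ_
   sk : ∀ z n -> seq ∣ z ∣² n ≡ Nb z n
   sk z n = Re
   a2 : ∀ r x n -> seq(fq r R.* x)n ≡ r ** seq x n
   a2 r x n = Re
   bZ : ∀ r n -> seq(fq r)n ≡ r
   bZ r n = Re
   ND : ∀ z w n -> Nb(z * w)n ≡ Nb z n ** Nb w n
   ND z w n = Nu(seq(re z)n)(seq(im z)n)(seq(re w)n)(seq(im w)n)
   Rn : ∀ z n -> seq(re(z * mkℂ(re z)(R.- im z)))n ≡ Nb z n
   Rn z n = sl 2(\ a b -> a *: a -: b *:(-: b)=: a *: a +: b *: b)Re(seq(re z)n)(seq(im z)n)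
   iV : ∀ y n -> seq(im(𝕚 * oq y))n ≡ y
   iV y n = sl 1(\ y -> Co 0q *: Co 0q +: Co 1q *: y =: y)Re y
   Cj : ∀ {z w}-> z ≈ w -> mkℂ(re z)(R.- im z)≈ mkℂ(re w)(R.- im w)
   Cj{z} {w}(h , g)= h , record { close = \ ε na -> Em(\ n -> sB(_<< ε)(!= sy(pa(seq(im z)n -q seq(im w)n))=!(cO Q.∣_∣(sl 2(\ a b -> -:(a -: b)=: -: a -:(-: b))Re(seq(im z)n)(seq(im w)n)))))(_≈ℝ_.close g ε na) }
 private
  Nk : ∀ {z w η}-> 0q << η -> z ≈ w -> Evt \ n -> Nb z n <= Nb w n ++ η
  Nk{z} {w} {η}oK h = Em(\ n lt -> !< By(η -q(Nb z n -q Nb w n))(p0(!< pp(Nb z n -q Nb w n)<!(lZ(sB(\ t -> Q.∣ t ∣ << η)(cong₂ _-q_(Rn z n)(Rn w n))lt))))Re <! rl(sl 3(\ a b e -> a +:(e -:(a -: b))=: b +: e)Re(Nb z n)(Nb w n)η))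
   (_≈ℝ_.close(pF(cd h(Cj h)))η oK)
  xw : ∀ {G h M ε}-> 0q << ε -> G ≈ h * M -> M <| ½ ** ε -> ∣ G ∣² R.≤ fq(ε ** ε)R.* ∣ h ∣²
  xw{G} {h} {M} {ε}hL eq hM lt = jJ Re(Tn(pF t)(pS t))
   where
   η = R._<_.gap lt
   ee = eI(R._<_.separated lt)(eI(Nk(R._<_.gap>0 lt)eq)(bd hM ε(bf(½ ** ε)(Ha hL)(sl 1(\ e -> e =: Co ½ *: e +: Co ½ *: e)Re ε))))
   n = pF ee
   a = pS ee n Rf
   Xc : ℚ
   Xc = ε ** ε ** Nb h n ++ η
   t : Xc << Nb G n × Nb G n <= Xc
   t = m5(cO(_++ η)(sy(!=(a2(ε ** ε)∣ h ∣² n)=! cO(ε ** ε **_)(sk h n))))(sy(sk G n))(pF a),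
    !< pF(pS a)<! ml η(!< rl(!= ND h M n =! cD(Nb h n)(Nb M n))<! ma{Nb M n} {ε ** ε} {Nb h n}(0≤N² h n)(pS(pS a)))
 vl : ∀ {c}-> Gr 1q c -> ℍ -> ℂ
 vl{c}gr z = pF(Vl{c} {pF z}gr(Hh z))
 vu : ∀ {c}(gr : Gr 1q c)z -> va c(pF z)(vl gr z)
 vu{c}gr z = pS(Vl{c} {pF z}gr(Hh z))
 lV : ∀ {c}(gr : Gr 1q c)-> IsHolomorphic(vl gr)
 lV{c}gr z = go(Dn gr(pF z)(Hh z))
  where
  go : Df gr(pF z)-> ∃(HasDerivativeAt(vl gr)z)
  go(D , K , η , nL , K0 , qo)= D , \ ε na -> n3 ε na(Sr{K} {½ ** ε}K0(Ha na))
   where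
   n3 : ∀ ε -> 0q << ε ->(∃ \ xG -> 0q << xG × K ** xG <= ½ ** ε)-> ∃ \ δ -> 0q << δ ×(∀ w -> let h = pF w - pF z in ∣ h ∣² R.< fq(δ ** δ)-> ∣ vl gr w - vl gr z - D * h ∣² R.≤ fq(ε ** ε)R.* ∣ h ∣²)
   n3 ε na(xG , f7 , le)= fn(mI η xG nL f7)
    where
    fn :(∃ \ m -> 0q << m × m <= η × m <= xG)-> ∃ \ δ -> 0q << δ ×(∀ w -> let h = pF w - pF z in ∣ h ∣² R.< fq(δ ** δ)-> ∣ vl gr w - vl gr z - D * h ∣² R.≤ fq(ε ** ε)R.* ∣ h ∣²)
    fn(m , oQ , mS , mK)= m , oQ , \ w lt -> jG w(b2 w lt)
     where
     b2 : ∀ w -> let h = pF w - pF z in ∣ h ∣² R.< fq(m ** m)-> h <| m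
     b2 w lt = mv(lZ oQ)\ p q -> Em(\ n s -> !<(!< rl(sy(sk(pF w - pF z)n))<~ By(R._<_.gap lt)(lZ(R._<_.gap>0 lt))Re <~(lZ s)<! rl(bZ(m ** m)n))<! sn(lZ oQ)(lZ q))(R._<_.separated lt)
     jG : ∀ w -> let h = pF w - pF z in h <| m -> ∣ vl gr w - vl gr z - D * h ∣² R.≤ fq(ε ** ε)R.* ∣ h ∣²
     jG w hm = Us(qo{pF w - pF z} {vl gr z} {vl gr w}(mo mS hm)(vu gr z)(Vr{c} {c} {pF w} {pF z +(pF w - pF z)}Rl(sV 2(\ z w -> w := z :+(w :- z))rR(pF z)(pF w))rR(vu gr w)))
      where
      Us :(∃ \ M -> M <| K × vl gr w - vl gr z - D *(pF w - pF z)≈(pF w - pF z)*((pF w - pF z)* M))-> ∣ vl gr w - vl gr z - D *(pF w - pF z)∣² R.≤ fq(ε ** ε)R.* ∣ pF w - pF z ∣²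
      Us(M , hM , eq)= xw na eq(mo(!< ma{m} {xG} {K}K0 mK <~ rl(cD xG K)<! le)(≼-* hm hM))
 eX : ∀ z a -> e(z + oz a)≈ e z
 eX z(+ n)= qn n z
  where
  qn : ∀ n z -> e(z + oz(+ n))≈ e z
  qn n z = !~ eP z(oz(+ n))~~ co{e z}(!~ en(ok n)~! Eo n)~! In(e z)
 eX z ℤ.-[1+ n ] = yY(!~ en eq ~~ eP(z + oz ℤ.-[1+ n ])(oa(sC n))~~ co{e(z + oz ℤ.-[1+ n ])}(Eo(sC n))~!(In _))
  where
  eq : z ≈ z + oz ℤ.-[1+ n ] + oa(sC n)
  eq = !~ sV 2(\ z a -> z := z :+(:- a):+ a)rR z(oa(sC n))~! Cg{oa(sC n)}(Cn{z}(yY(!~ og(+ sC n)~! cc(ok(sC n)))))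
 private
  df : ∀ a b n ->(a * b)^ n ≈ a ^ n * b ^ n
  df a b z0 = yY(ie 1#)
  df a b(sC n)= !~ co{a * b}(df a b n)~! sV 4(\ a b x y -> a :* b :*(x :* y):= a :* x :*(b :* y))rR a b(a ^ n)(b ^ n)
  b3 : ∀ k{x}-> x * x ≈ 1# -> x ^(2 *n k)≈ 1#
  b3 k{x}h = !~ rx(cO(x ^_)(cJ 2 k))~~ yY(^-* x 2 k)~~ ck k(!~ co{x}(In x)~! h)~! 1^ k
  Ut : ∀ a d -> a *z d ≡ 1ℤ -> d *z d ≡ 1ℤ
  Ut a d h = go d(qO ℤ.∣ a ∣ ℤ.∣ d ∣(!= sy(a4 a d)=!(cO ℤ.∣_∣ h)))
   where
   go : ∀ d -> ℤ.∣ d ∣ ≡ 1 -> d *z d ≡ 1ℤ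
   go(+ .1)Re = Re
   go ℤ.-[1+ .0 ] Re = Re
 module _ {k : ℕ} {c : ℕ -> ℂ} (mf : MF (2 *n k) c) where
  Md : ∀ n a b cl d -> a *z d -z b *z cl ≡ 1ℤ -> ℤ.∣ cl ∣ <n n -> ∀ {z zb A A₁}-> Hp z -> Hp zb ->(oz cl * z + oz d)* zb ≈ oz a * z + oz b ->
   va c z A -> va c zb A₁ -> A₁ ≈(oz cl * z + oz d)^(2 *n k)* A
  Md(sC n)a b cl d det lt{z} {zb} {Aa} {A₁}hz hP eq v vg with cl ℤₚ.≟ 0ℤ
  ... | yes Re = !~ Va{c} {zb}vg(Vj{c} {z} {zb} {Aa}(yY(!~ en a3 ~! eX z(d *z b)))v)~! yY(!~ cn{Aa}(!~ ck(2 *n k)j1 ~! b3 k dd)~! ie Aa)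
   where
   ad : a *z d ≡ 1ℤ
   ad = != sy(!= cO(\ t -> a *z d -z t)(Ze b)=! iu(a *z d))=! det
   dd : oz d * oz d ≈ 1#
   dd = !~ yY(oh d d)~! rx(cO oz(Ut a d ad))
   da : oz d * oz a ≈ 1#
   da = !~ yY(oh d a)~! rx(cO oz(!= jI d a =! ad))
   j1 : oz 0ℤ * z + oz d ≈ oz d
   j1 = !~ Cg(ze z)~! Ii(oz d)
   a3 : zb ≈ z + oz(d *z b)
   a3 = !~ yY(!~ yY(ao(oz d)(oz d)zb)~~ cn{zb}dd ~! ie zb)~~ co{oz d}(!~ cn{zb}(yY j1)~! eq)~~
    sV 4(\ d a z b -> d :*(a :* z :+ b):=(d :* a):* z :+ d :* b)rR(oz d)(oz a)z(oz b)~! ca(!~ cn{z}da ~! ie z)(yY(oh d b))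
  ... | no lW = !~ Md n(-z b′)a(-z(+ r))cl fO r< hY hP jH vC vg ~~ co{U ^(2 *n k)}(!~ Sl mf hx hY Xx vx vC ~! rR)~~
   yY(ao(U ^(2 *n k))(x ^(2 *n k))Aa)~! cn{Aa}(!~ yY(df U x(2 *n k))~! ck(2 *n k)Ux)
   where
   instance
    nz : ℤ.NonZero cl
    nz = NZ lW
   t = d ℤD./ cl
   r = d ℤD.% cl
   j2 : d ≡ + r +z t *z cl
   j2 = ℤD.a≡a%n+[a/n]*n d cl
   b′ = b -z t *z a
   r< : ℤ.∣ -z(+ r)∣ <n n
   r< = Ta(sB(_<n ℤ.∣ cl ∣)(sy(qP(+ r)))(ℤD.n%d<d d cl))(sL lt)
   fO :(-z b′)*z cl -z a *z(-z(+ r))≡ 1ℤ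
   fO = != jx a b cl(+ r)t =~ cO(\ d -> a *z d -z b *z cl)(sy j2)=! det
    where
    open import Data.Integer.Solver using (module +-*-Solver)
    module Zs = +-*-Solver
    jx : ∀ a b c r t ->(-z(b -z t *z a))*z c -z a *z(-z r)≡ a *z(r +z t *z c) -z b *z c
    jx = Zs.solve 5(\ a b c r t ->(Zs.:-(b Zs.:- t Zs.:* a))Zs.:* c Zs.:- a Zs.:*(Zs.:- r)Zs.:= a Zs.:*(r Zs.:+ t Zs.:* c)Zs.:- b Zs.:* c)Re
   x = z + oz t
   hx : Hp x
   hx = Hb{z}(t // 1)hz
   x′ = pF(jY_{x}hx)
   Xx : x * x′ ≈ - 1#
   Xx = pF(pS(jY_{x}hx))
   hY : Hp x′
   hY = pS(pS(jY_{x}hx))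
   vx : va c x Aa
   vx = Vj{c} {z} {x} {Aa}(yY(eX z t))v
   vC = pS(Vl{c} {x′}(gr mf)hY)
   U = oz(-z(+ r))* x′ + oz cl
   Ux : U * x ≈ oz cl * z + oz d
   Ux = !~ cn{x}(Cg{oz cl}(cn{x′}(og(+ r))))~~ sV 4(\ r x′ c x ->((:- r):* x′ :+ c):* x :=(:- r):*(x :* x′):+ c :* x)rR(oz(+ r))x′(oz cl)x ~~
    Cg{oz cl * x}(co{ - oz(+ r)}Xx)~~ sV 4(\ r c z t ->(:- r):*(:- # 1q):+ c :*(z :+ t):= c :* z :+(r :+ t :* c))rR(oz(+ r))(oz cl)z(oz t)~!
     Cn{oz cl * z}(yY(!~ rx(cO oz j2)~~ oi(+ r)(t *z cl)~! Cn{oz(+ r)}(oh t cl)))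
   ax :(oz(-z b′)* x′ + oz a)* x ≈ oz a * z + oz b
   ax = !~ cn{x}(Cg{oz a}(cn{x′}(!~ og b′ ~! cc(!~ oi b(-z(t *z a))~! Cn{oz b}(!~ og(t *z a)~! cc(oh t a))))))~~ sV 5(\ b t a x′ x ->((:-(b :+(:-(t :* a)))):* x′ :+ a):* x :=(t :* a :- b):*(x :* x′):+ a :* x)rR(oz b)(oz t)(oz a)x′ x ~~
    Cg{oz a * x}(co{oz t * oz a - oz b}Xx)~! sV 4(\ b t a z ->(t :* a :- b):*(:- # 1q):+ a :*(z :+ t):= a :* z :+ b)rR(oz b)(oz t)(oz a)z
   cX : ∀ {p r}-> p * x ≈ r * x -> p ≈ r
   cX{p} {r}h = !~ bk p ~~ cc(co{x′}h)~! yY(bk r)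
    where
    bk : ∀ p -> p ≈ -(x′ *(p * x))
    bk p = yY(!~ sV 3(\ p x y -> :-(y :*(p :* x)):= :-(p :*(x :* y)))rR p x x′ ~~ cc(co{p}Xx)~! sV 1(\ p -> :-(p :*(:- # 1q)):= p)rR p)
   jH : U * zb ≈ oz(-z b′)* x′ + oz a
   jH = cX(!~ sV 3(\ u z x -> u :* z :* x :=(u :* x):* z)rR U zb x ~~ cn{zb}Ux ~~ eq ~! yY ax)
  TC : c 0 ≈ 0# -> CuspForm(2 *n k)
  TC c0 = record
   { fun = vl(gr mf); coeff = c ; holomorphic = lV(gr mf)
   ; modular = \ γ z w im -> Md(sC ℤ.∣ SL₂ℤ.c γ ∣)(SL₂ℤ.a γ)(SL₂ℤ.b γ)(SL₂ℤ.c γ)(SL₂ℤ.d γ)(SL₂ℤ.det≡1 γ)Rf(Hh z)(Hh w)im(vu(gr mf)z)(vu(gr mf)w)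
   ; expansion = \ z q oR -> SH(Su{\ n -> c n * e(pF z)^ n} {\ n -> c n * q ^ n}(\ n -> co{c n}(ck n(yY(nV z oR))))rR(vu(gr mf)z))
   ; cuspidal = c0 }
 fu : ∀ {w}(f : CuspForm w)z -> va(coeff f)(pF z)(fun f z)
 fu f z = HS(CuspForm.expansion f z(e(pF z))(fh z))
 private
  tv : ∀ {a : ℕ -> ℂ} {S}-> Sa a S -> ∃ \ K -> 0q <= K ×(∀ n -> a n <| K)
  tv{a} {S}h = let K , hK , f = f8 N in K ++(1q ++ 1q), N0 hK 0≤2 , \ n -> go n K hK f(tu N n)
   where
   0≤2 : 0q <= 1q ++ 1q
   0≤2 = N0 n1 n1
   N = pF(h 1q nl)
   f8 : ∀ N -> ∃ \ K -> 0q <= K ×(∀ n -> n ≤n N -> a n <| K)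
   f8 z0 = let q , hq = ei(a 0)in q , nn hq , \ { z0 _ -> hq }
   f8(sC N)= let K , hK , f = f8 N; q , hq = ei(a(sC N))
    in K ++ q , N0 hK(nn hq), \ n le -> Pk n K q hK f hq(mH le)
    where
    Pk : ∀ n K q -> 0q <= K ->(∀ n -> n ≤n N -> a n <| K)-> a(sC N)<| q -> n <n sC N ⊎ n ≡ sC N -> a n <| K ++ q
    Pk n K q hK f hq(iL lt)= mo(By q(nn hq)Re)(f n(sL lt))
    Pk n K q hK f hq(iR Re)= mo(By K hK(cw K q))hq
   go : ∀ n K -> 0q <= K ->(∀ n -> n ≤n N -> a n <| K)-> N ≤n n ⊎ n ≤n N -> a n <| K ++(1q ++ 1q)
   go n K hK f(iR le)= mo(By(1q ++ 1q)0≤2 Re)(f n le)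
   go n K hK f(iL le)= mo(By K hK(cw K(1q ++ 1q)))(rp(!~ Cg(Ls n a)~! sV 2(\ s x ->(s :+ x):- s := x)rR(∑ n a)(a n))
    (tC{∑(sC n)a} {S} {∑ n a}(pS(h 1q nl)(sC n)(m1 le))(sG(pS(h 1q nl)n le))))
  n9 : ∀ δ -> 0q << δ -> ∃ \ z -> Hp z × e(- z)<| 1q ++ δ
  n9 δ hH = go(ty xv nE)
   where
   xv : ℚ
   xv = n2 ** xc
   nE : 0q <= xv
   nE = nn 2πi-≼
   go :(∃ \ B -> ∀ k t -> t <| xv -> tR k t <| B)-> ∃ \ z -> Hp z × e(- z)<| 1q ++ δ
   go(K , hK)= z ,(y , yi , 0 , \ n _ -> rl(sy(iV y n))), rp(yY eq)(≼-+(Of 1q)(mo le(≼-* ht(hK 1 t(mo(lX xv y nE y1)ht)))))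
    where
    K0 : 0q <= K
    K0 = nn(hK 0 0#(mo nE(Of 0q)))
    sS = Sr{xv ** K} {δ}(n0 nE K0)hH
    mn = mI 1q(pF sS)nl(pF(pS sS))
    y : ℚ
    y = pF mn
    yi : 0q << y
    yi = pF(pS mn)
    y1 = pF(pS(pS mn))
    yg = pS(pS(pS mn))
    z : ℂ
    z = 𝕚 * oq y
    t : ℂ
    t = 2πi * - z
    lX : ∀ a y -> 0q <= a -> y <= 1q -> a **(1q ** y)<= a
    lX a y ha le = !< Mo{1q ** y} {1q} {a}ha(!< rl(iy y)<! le)<! rl(ii a)
    ht : t <| xv **(1q ** y)
    ht = ≼-* 2πi-≼(Ne(≼-* xq(sB(oq y <|_)(np(lZ yi))(Of y))))
    le : xv **(1q ** y)** K <= δ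
    le = !< rl(sl 3(\ p y k -> p *:(Co 1q *: y)*: k =: p *: k *: y)Re xv y K)<~ Mo{y} {pF sS} {xv ** K}(n0 nE K0)yg <! pS(pS sS)
    eq : e(- z)≈ 1# + t * tR 1 t
    eq = !~ Ed(- z)~~ yY(TR t)~~ te 0 t ~! Cg{t * tR 1 t}(rx(cO oq iT))
 CG : ∀ {w}(f : CuspForm w)-> Gr 1q(coeff f)
 CG f δ hH =
  let z , hz , hq = n9 δ hH;K , hK , k1 = tv{\ n -> coeff f n * e z ^ n}(fu f(Hd z hz))
  in K , hK , \ n -> rp(!~ ao(coeff f n)(e z ^ n)(e(- z)^ n)~~ co{coeff f n}(!~ yY(df(e z)(e(- z))n)~~ ck n(eR z)~! 1^ n)~! In(coeff f n))
   (sB(\ t -> coeff f n * e z ^ n * e(- z)^ n <| K ** t ^^ n)(sy(iy(1q ++ δ)))(≼-*(k1 n)(≼-^ n hq)))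
 Cp : ∀ {w}(f : CuspForm w)-> MF w(coeff f)
 Cp{w}f = record { gr = CG f ; Sl = qp }
  where
  qp : ∀ {z za A A′}-> Hp z -> Hp za -> z * za ≈ - 1# -> va(coeff f)z A -> va(coeff f)za A′ -> A′ ≈ z ^ w * A
  qp{z} {za} {Aa} {A₁}hz Hz zz v vb = !~ Va{coeff f} {za}vb(fu f(Hd za Hz))~~ CuspForm.modular f γ(Hd z hz)(Hd za Hz)qq ~! cd(ck w j1)(Va{coeff f} {z}(fu f(Hd z hz))v)
   where
   γ : SL₂ℤ
   γ = record { a = 0ℤ ; b = -z 1ℤ ; c = 1ℤ ; d = 0ℤ ; det≡1 = Re }
   j1 : oz 1ℤ * z + oz 0ℤ ≈ z
   j1 = sV 1(\ z -> # 1q :* z :+ # 0q := z)rR z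
   qq :(oz 1ℤ * z + oz 0ℤ)* za ≈ oz 0ℤ * z + oz(-z 1ℤ)
   qq = !~ cn{za}j1 ~~ zz ~! yY(!~ ca(ze z)(og 1ℤ)~! Ii(- 1#))
 c1 : ∀ {k}(f : CuspForm(2 *n k))-> Ll k(coeff f)
 c1{k}f = k7 k(Cp f)
 Vk : ∀ {c}-> Gr 1q c ->(∀ z -> va c(pF z)0#)-> ∀ n -> c n ≈ 0#
 Vk{c}g h = identity g \ {z} {A}hz v -> Va{c} {z}v(h(Hd z(IH{z}hz)))
module Trace where
 open CSolve
 open Cusp public
 open import Data.Fin.Base as Fin using (Fin)
 open import Data.Nat.Divisibility using (_∣?_;divides)
 open import Data.Vec.Functional using (Vector)
 open import Relation.Nullary using (¬_;yes;no)
 So : ∀ {d} {f g : Vector ℂ d}->(∀ i -> f i ≈ g i)-> sum f ≈ sum g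
 So{z0}h = rR
 So{sC d}h = ca(h Fin.zero)(So \ i -> h(Fin.suc i))
 fP : ∀ {d}-> sum{d}(\ _ -> 0#)≈ 0#
 fP{z0}= rR
 fP{sC d}= !~(Ii _)~! fP{d}
 s9 : ∀ {d}x(f : Vector ℂ d)-> sum(\ i -> x * f i)≈ x * sum f
 s9{z0}x f = yY(zr x)
 s9{sC d}x f = !~ Cn{x * f Fin.zero}(s9 x(\ i -> f(Fin.suc i)))~! yY(dr x _ _)
 sH : ∀ {d}n(f : Fin d -> ℕ -> ℂ)-> sum(\ i -> ∑ n(f i))≈ ∑ n(\ j -> sum(\ i -> f i j))
 sH{z0}n f = yY(nB n \ _ _ -> rR)
 sH{sC d}n f = !~ Cn{∑ n(f Fin.zero)}(sH n(\ i -> f(Fin.suc i)))~! yY(∑-+ n(f Fin.zero)(\ j -> sum(\ i -> f(Fin.suc i)j)))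
 Vu : ∀ {d z} {c : Fin d -> ℕ -> ℂ} {v : Vector ℂ d}->(∀ i -> va(c i)z(v i))-> va(\ n -> sum(\ i -> c i n))z(sum v)
 Vu{z0} {z}h = Vr{Cs 0#} {\ _ -> 0#} {z} {z}(mk \ { z0 -> rR; (sC n)-> rR })rR rR(Vc 0# z)
 Vu{sC d} {z} {c}h = Vg{c Fin.zero} {\ n -> sum(\ i -> c(Fin.suc i)n)} {z}(h Fin.zero)(Vu{d} {z} {\ i -> c(Fin.suc i)}\ i -> h(Fin.suc i))
 Gh : ∀ {d} {c : Fin d -> ℕ -> ℂ}->(∀ i -> Gr 1q(c i))-> Gr 1q(\ n -> sum(\ i -> c i n))
 Gh{z0}h = Gs n1(mk \ { z0 -> rR; (sC n)-> rR })(Gc n1 0#)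
 Gh{sC d} {c}h = Gw n1(h Fin.zero)(Gh{d} {\ i -> c(Fin.suc i)}\ i -> h(Fin.suc i))
 module _ {w d : ℕ} (f : Vector (CuspForm w) d) where
  Cb : Vector ℂ d -> ℕ -> ℂ
  Cb a n = sum \ i -> a i * coeff(f i)n
  cV : ∀ a z -> va(Cb a)(pF z)(linComb a f z)
  cV a z = Vu{d} {pF z} {\ i n -> a i * coeff(f i)n}\ i -> Vb{coeff(f i)} {pF z}(a i)(fu(f i)z)
  c6 : ∀ a -> Gr 1q(Cb a)
  c6 a = Gh{d} {\ i n -> a i * coeff(f i)n}\ i -> Gf n1(a i)(CG(f i))
  Cf : ∀ (g : CuspForm w)a ->(∀ z -> fun g z ≈ linComb a f z)-> ∀ n -> coeff g n ≈ Cb a n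
  Cf g a h n = !~ sV 2(\ x y -> x :=(x :+(:- # 1q):* y):+ y)rR(coeff g n)(Cb a n)~~ Cg{Cb a n}(Vk{coeff g +s(- 1#)^s Cb a}(Gw n1(CG g)(Gf n1(- 1#)(c6 a)))
   (\ z -> Vr{coeff g +s(- 1#)^s Cb a} {coeff g +s(- 1#)^s Cb a} {pF z} {pF z}Rl rR(!~ Cg{(- 1#)* linComb a f z}(h z)~! sV 1(\ x -> x :+(:- # 1q):* x := # 0q)rR(linComb a f z))
    (Vg{coeff g} {(- 1#)^s Cb a} {pF z}(fu g z)(Vb{Cb a} {pF z}(- 1#)(cV a z))))n)~! Ii(Cb a n)
  Cz : ∀ a ->(∀ n -> Cb a n ≈ 0#)-> ∀ z -> linComb a f z ≈ 0#
  Cz a h z = Va{Cb a} {pF z}(cV a z)(Vr{Cs 0#} {Cb a} {pF z} {pF z}(mk \ { z0 -> yY(h 0); (sC n)-> yY(h(sC n)) })rR rR(Vc 0#(pF z)))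
 aH : ∀ c n -> atHalf c n ≈ dl c n
 aH c n with 2 ∣? n
 ... | yes(divides m eq)= !~ yY(at(eD c)m)~! rx(cO(dl c)(!=(!= cO(m +n_)(sy(Iy m))=! cJ 2 m)=! sy eq))
 ... | no ne = yY(go n c ne)
  where
  go : ∀ n c -> ¬(2 Data.Nat.Divisibility.∣ n)-> dl c n ≈ 0#
  go z0 c h = ⊥-elim(h(divides 0 Re))
  go(sC z0)c h = rR
  go(sC(sC n))c h = go n(tl c)\ { (divides m eq)-> h(divides(sC m)(cO(\ t -> sC(sC t))eq)) }
 2^2k-1 : ℕ -> ℂ
 2^2k-1 k = oq ½ *(2^ k * 2^ k)
 p2 : ∀ k -> oz(+ 2)^(2 *n sC k -n 1)≈ 2^2k-1(sC k)
 p2 k = !~ rx(cO(\ t -> oz(+ 2)^(k +n sC t))(Iy k))~~ xo(oz(+ 2))k(sC k)~! sV 1(\ x -> x :*(# n2 :* x):= # ½ :*((# n2 :* x):*(# n2 :* x)))rR(2^ k)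
 module _ (k : ℕ) where
  private
   N : ℕ
   N = sC ⌊ k /2⌋
   Ht : ℂ
   Ht = oq ½ * 2^ k
  yC : ℕ -> ℕ -> ℂ
  yC l = uC k l +s Ht ^s wC k l
  Y : ℕ -> ℕ -> ℂ
  Y l = Es P p k(yC l)
  Tp : ∀ {a c}-> a ~s Es P p k c -> 2^ k ^s dl a ~s Es Pb pj k c -> eE a +s 2^2k-1 k ^s dl a ~s Lf N Y c
  Tp{a} {c}h hg = !& cj
   (tX{eE a} {Lf N(\ l -> eE(ec P p k l))c} {Lf N(\ l -> Es P p k(uC k l))c}(eo h)(Lc N{\ l -> eE(ec P p k l)} {\ l -> Es P p k(uC k l)} {c} {c}(Ue k)(\ _ -> rR)))
   (!&(mk \ n -> sV 3(\ h t x ->(h :*(t :* t)):* x :=(h :* t):*(t :* x))rR(oq ½)(2^ k)(dl a n))~& cm hg &!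
    (mk \ n -> !~ yY(∑-* N Ht(\ l -> c l * ec Pb pj k l n))~!(ch N \ l -> !~ sV 3(\ h c x -> h :*(c :* x):= c :*(h :* x))rR Ht(c l)(ec Pb pj k l n)~! co{c l}(co{Ht}(at(Wa k l)n)))))&!
   (mk \ n -> !~ yY(∑-+ N(\ l -> c l * Es P p k(uC k l)n)(\ l -> c l *(Ht * Es P p k(wC k l)n)))~!(ch N \ l -> !~ yY(dr(c l)_ _)~! co{c l}(yY(!~ at(Ln N(ec P p k)(uC k l)(Ht ^s wC k l))n ~! Cn{Es P p k(uC k l)n}(at(Li N(ec P p k)Ht(wC k l))n)))))
 module TO (k : ℕ) {d : ℕ} (f : Vector (CuspForm (2 *n sC (sC k))) d) (M : Fin d -> Fin d -> ℂ) (lY : IsBasis f) (Mt : IsMatrixOfT₂ f M) where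
  private
   κ : ℕ
   κ = sC(sC k)
   N : ℕ
   N = sC ⌊ κ /2⌋
   un : ∃ \ a -> Ll κ a × a 0 ≈ 1#
   un = ui κ \ ()
   ν : ℕ -> ℂ
   ν = pF un
   rG : Ry κ ν
   rG = rr(pF(pS un))
   nC : ℕ -> ℂ
   nC = pF rG
   rf : ∀ i -> Ry κ(coeff(f i))
   rf i = rr(c1(f i))
   cC : Fin d -> ℕ -> ℂ
   cC i = pF(rf i)
   ε : ℕ -> ℂ
   ε l = Y κ l 0
   h : ℕ -> ℕ -> ℂ
   h l = Y κ l +s(- ε l)^s ν
   HL : ∀ l -> Ll κ(h l)
   HL l = Ye κ l ⊕((- ε l)⊙ pF(pS un))
   h0 : ∀ l -> h l 0 ≈ 0#
   h0 l = !~ Cn{ε l}(co{ - ε l}(pS(pS un)))~! sV 1(\ x -> x :+(:- x):* # 1q := # 0q)rR(ε l)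
   hF : ℕ -> CuspForm(2 *n κ)
   hF l = TC{κ} {h l}(Lv(HL l))(h0 l)
   β : ℕ -> Vector ℂ d
   β l = pF(pS lY(hF l))
   oS : ∀ l n -> h l n ≈ Cb f(β l)n
   oS l = Cf f(hF l)(β l)(pS(pS lY(hF l)))
   fm : ℕ -> ℕ -> ℂ
   fm l s = sum \ i -> β l i * cC i s
   b4 : ∀ l s -> s ≤n ⌊ κ /2⌋ -> fm l s ≈ yC κ l s - ε l * nC s
   b4 l s le = !~ sV 2(\ x y -> x := y :+(x :+(:- # 1q):* y))rR(fm l s)(yC κ l s - ε l * nC s)~~ Cn{yC κ l s - ε l * nC s}
    (!~ sV 4(\ x y e n -> x :+(:- # 1q):*(y :- e :* n):=(x :+(:- # 1q):* y):+ e :* n)rR(fm l s)(yC κ l s)(ε l)(nC s)~! EA κ δ zk s le)~!(Ie _)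
    where
    δ : ℕ -> ℂ
    δ =(fm l +s(- 1#)^s yC κ l)+s ε l ^s nC
    m = ec P p κ
    fs : Es P p κ(fm l)~s h l
    fs = mk \ n -> !~ yY(!~(So{d}\ i -> !~ co{β l i}(at(pF(pS(pS(rf i))))n)~~ yY(∑-* N(β l i)(\ s -> cC i s * m s n))~!(ch N \ s -> yY(ao(β l i)(cC i s)(m s n))))~~
     sH N(\ i s -> β l i * cC i s * m s n)~!(ch N \ s -> !~(So{d}\ i -> cp(β l i * cC i s)(m s n))~~ s9{d}(m s n)(\ i -> β l i * cC i s)~! cp(m s n)(fm l s)))~! yY(oS l n)
    zk : Es P p κ δ ~s 0ₛ
    zk = !& Ln N m(fm l +s(- 1#)^s yC κ l)(ε l ^s nC)~& cj(!& Ln N m(fm l)((- 1#)^s yC κ l)&! cj fs(Li N m(- 1#)(yC κ l)))(!& Li N m(ε l)nC &! cm(Sy(pF(pS(pS rG)))))&!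
     (mk \ n -> sV 3(\ y e v ->((y :+(:- e):* v):+(:- # 1q):* y):+ e :* v := # 0q)rR(Y κ l n)(ε l)(ν n))
   Tq : ∀ j -> eE(coeff(f j))+s 2^2k-1 κ ^s dl(coeff(f j))~s Lf N(Y κ)(cC j)
   Tq j = Tp κ{coeff(f j)} {cC j}(pF(pS(pS(rf j))))(pS(pS(pS(rf j))))
   gj : ∀ j n -> coeff(pF(Mt j))n ≈ Lf N(Y κ)(cC j)n
   gj j n = !~ pF(pS(Mt j))n ~~ ca(rx(cO(\ t -> coeff(f j)(n +n t))(Iy n)))(cd(p2(sC k))(aH(coeff(f j))n))~! at(Tq j)n
   c7 : ∀ j -> ∑ N(\ l -> cC j l * ε l)≈ 0#
   c7 j = !~ yY(gj j 0)~! CuspForm.cuspidal(pF(Mt j))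
   BA : Fin d -> Fin d -> ℂ
   BA i j = ∑ N(\ l -> cC j l * β l i)
   gF : ∀ j n -> coeff(pF(Mt j))n ≈ Cb f(\ i -> BA i j)n
   gF j n = !~ gj j n ~~(!~(ch N \ l -> sV 4(\ c y e v -> c :* y := c :*(y :+(:- e):* v):+ v :*(c :* e))rR(cC j l)(Y κ l n)(ε l)(ν n))~~(∑-+ N(\ l -> cC j l * h l n)(\ l -> ν n *(cC j l * ε l)))~~ Cn{∑ N(\ l -> cC j l * h l n)}(!~(∑-* N(ν n)(\ l -> cC j l * ε l))~~ co{ν n}(c7 j)~! zr(ν n))~!(Ie _))~~
    (ch N \ l -> !~ co{cC j l}(oS l n)~! yY(s9{d}(cC j l)(\ i -> β l i * coeff(f i)n)))~~ yY(sH N(\ i l -> cC j l *(β l i * coeff(f i)n)))~!(So{d}\ i -> !~(ch N \ l -> yY(ao(cC j l)(β l i)(coeff(f i)n)))~!(∑-*ʳ N(coeff(f i)n)(\ l -> cC j l * β l i)))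
   Mq : ∀ i j -> M i j ≈ BA i j
   Mq i j = !~ sV 2(\ x y -> x :=(x :+(:- # 1q):* y):+ y)rR(M i j)(BA i j)~~ Cg{BA i j}(pF lY(\ i -> M i j +(- 1#)* BA i j)(Cz f(\ i -> M i j +(- 1#)* BA i j)z)i)~! Ii(BA i j)
    where
    b5 : ∀ {d}(a b : Vector ℂ d)-> sum(\ i -> a i + b i)≈ sum a + sum b
    b5{z0}a b = yY(Ie 0#)
    b5{sC d}a b = !~ Cn{a Fin.zero + b Fin.zero}(b5(\ i -> a(Fin.suc i))(\ i -> b(Fin.suc i)))~! sV 4(\ a b s t ->(a :+ b):+(s :+ t):=(a :+ s):+(b :+ t))rR(a Fin.zero)(b Fin.zero)(sum(\ i -> a(Fin.suc i)))(sum(\ i -> b(Fin.suc i)))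
    z : ∀ n -> Cb f(\ i -> M i j +(- 1#)* BA i j)n ≈ 0#
    z n = !~(So{d}\ i -> sV 3(\ m b x ->(m :+(:- # 1q):* b):* x := m :* x :+(:- # 1q):*(b :* x))rR(M i j)(BA i j)(coeff(f i)n))~~ b5{d}(\ i -> M i j * coeff(f i)n)(\ i ->(- 1#)*(BA i j * coeff(f i)n))~~
     ca(yY(Cf f(pF(Mt j))(\ i -> M i j)(pS(pS(Mt j)))n))(!~ s9{d}(- 1#)(\ i -> BA i j * coeff(f i)n)~! co{ - 1#}(yY(gF j n)))~! sV 1(\ x -> x :+(:- # 1q):* x := # 0q)rR(coeff(pF(Mt j))n)
   cY : ∑ N(\ l -> nC l * ε l)≈ 1# + 2^2k-1 κ
   cY = !~ yY(at(Tp κ{ν} {nC}(pF(pS(pS rG)))(pS(pS(pS rG))))0)~! ca(pS(pS un))(!~ co{2^2k-1 κ}(pS(pS un))~! In(2^2k-1 κ))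
  tH : sum(\ i -> M i i)≈ ∑ N(\ l -> uC κ l l)+ oq ½ * 2^ κ * t5 κ -(1# + 2^2k-1 κ)
  tH = !~(So{d}\ i -> Mq i i)~~ sH N(\ i l -> cC i l * β l i)~~(cy N \ l lt -> !~(So{d}\ i -> cp(cC i l)(β l i))~! b4 l l(sL lt))~~
   (∑-+ N(\ l -> yC κ l l)(\ l -> -(ε l * nC l)))~! ca(!~(∑-+ N(\ l -> uC κ l l)(\ l -> oq ½ * 2^ κ * wC κ l l))~! Cn{∑ N(\ l -> uC κ l l)}(∑-* N(oq ½ * 2^ κ)(\ l -> wC κ l l)))
    (!~ Ng N(\ l -> ε l * nC l)~! cc(!~(ch N \ l -> cp(ε l)(nC l))~! cY))
open Trace public
open import Data.Fin.Base as Fin using (Fin)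
open import Data.Integer.Solver using (module +-*-Solver)
open import Function.Bundles using (_⇔_;mk⇔)
open import Relation.Nullary using (¬_;yes;no)
private
 module Zs = +-*-Solver
open CSolve
bin : ℕ -> ℕ -> ℤ
bin z0 z0 = 1ℤ
bin z0(sC j)= 0ℤ
bin(sC n)z0 = 1ℤ
bin(sC n)(sC j)= bin n(sC j)+z bin n j
fQ : ∀ n -> bin n 0 ≡ 1ℤ
fQ z0 = Re
fQ(sC n)= Re
Bi : ∀ n j -> Bn 1# n j ≈ oz(bin n j)
Bi z0 z0 = rR
Bi z0(sC j)= rR
Bi(sC n)z0 = !~ Cg{1# * 0#}(!~ Bi n z0 ~! rx(cO oz(fQ n)))~! sV 0(# 1q :+ # 1q :* # 0q := # 1q)rR
Bi(sC n)(sC j)= !~ ca(Bi n(sC j))(!~(ie _)~! Bi n j)~! yY(oi(bin n(sC j))(bin n j))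
Sb : ℕ -> ℕ -> ℕ
Sb w z0 = w
Sb z0(sC j)= 0
Sb(sC z0)(sC j)= 0
Sb(sC(sC w))(sC j)= Sb w j
sf : ∀ w j -> Sb(sC w)j ≡ sC(Sb w j)⊎(Sb(sC w)j ≡ 0 × Sb w j ≡ 0 × ∃ \ i -> j ≡ sC i)
sf w z0 = iL Re
sf z0(sC j)= iR(Re , Re , j , Re)
sf(sC z0)(sC z0)= iR(Re , Re , z0 , Re)
sf(sC z0)(sC(sC j))= iR(Re , Re , sC j , Re)
sf(sC(sC w))(sC j)= go(sf w j)
 where
 go : Sb(sC w)j ≡ sC(Sb w j)⊎(Sb(sC w)j ≡ 0 × Sb w j ≡ 0 × ∃ \ i -> j ≡ sC i)-> Sb(sC w)j ≡ sC(Sb w j)⊎(Sb(sC w)j ≡ 0 × Sb w j ≡ 0 × ∃ \ i -> sC j ≡ sC i)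
 go(iL e)= iL e
 go(iR(e , ej , _))= iR(e , ej , j , Re)
Se : ∀ k j -> j ≤n k ->(k -n j)+n(k -n j)≡ Sb(k +n k)j
Se k z0 _ = Re
Se(sC k)(sC j)(ss le)= != Se k j le =! cO(\ t -> Sb(sC t)(sC j))(sy(su k k))
tz : ℕ -> ℕ -> ℤ
tz w j =(+ 4)^z j *z bin(Sb w j)j
tQ : ∀ w j -> tz(3 +n w)(sC j)≡ tz(2 +n w)(sC j)+z + 4 *z tz w j
tQ w j = != cO((+ 4)^z sC j *z_)(Pl(sf w j))=! Zs.solve 3(\ p x y ->(Zs.con(+ 4)Zs.:* p)Zs.:*(x Zs.:+ y)Zs.:=(Zs.con(+ 4)Zs.:* p)Zs.:* x Zs.:+ Zs.con(+ 4)Zs.:*(p Zs.:* y))Re((+ 4)^z j)(bin(Sb w j)(sC j))(bin(Sb w j)j)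
 where
 Pl : Sb(sC w)j ≡ sC(Sb w j)⊎(Sb(sC w)j ≡ 0 × Sb w j ≡ 0 × ∃ \ i -> j ≡ sC i)-> bin(Sb(sC w)j)(sC j)≡ bin(Sb w j)(sC j)+z bin(Sb w j)j
 Pl(iL e)= cO(\ n -> bin n(sC j))e
 Pl(iR(e , ej , i , Re))= != cO(\ n -> bin n(sC(sC i)))e =! sy(cO(\ n -> bin n(sC(sC i))+z bin n(sC i))ej)
Vz sz : ℕ -> ℤ
Vz 0 = 1ℤ
Vz 1 = 1ℤ
Vz 2 = 1ℤ
Vz(sC(sC(sC w)))= Vz(sC(sC w))+z + 4 *z Vz w
sz 0 = 0ℤ
sz 1 = -z 1ℤ
sz(sC(sC w))= -z sz(sC w) -z + 2 *z sz w
Tz : ∀ w n -> w <n n +n n -> Z.∑ n(tz w)≡ Vz w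
Tz w z0()
Tz 0(sC n)_ = cO(\ t -> 1ℤ +z t)(Z.nB n \ j _ -> Ze((+ 4)^z sC j))
Tz 1(sC n)_ = cO(\ t -> 1ℤ +z t)(Z.nB n \ j _ -> Ze((+ 4)^z sC j))
Tz 2(sC n)_ = cO(\ t -> 1ℤ +z t)(Z.nB n \ { z0 _ -> Re; (sC j)_ -> Ze((+ 4)^z sC(sC j)) })
Tz(sC(sC(sC w)))(sC n)(ss lt)= != cO(\ t -> 1ℤ +z t)(!= Z.ch n(tQ w)=~(Z.∑-+ n(\ j -> tz(2 +n w)(sC j))(\ j -> + 4 *z tz w j))=! cO(\ t -> Z.∑ n(\ j -> tz(2 +n w)(sC j))+z t)(Z.∑-* n(+ 4)(tz w)))=~
 sy(au 1ℤ(Z.∑ n(\ j -> tz(2 +n w)(sC j)))(+ 4 *z Z.∑ n(tz w)))=! cong₂(\ x y -> x +z + 4 *z y)(Tz(sC(sC w))(sC n)(m1 lt))(Tz w n(qQ(((N1 _)≤~ lt)≤~ ri(su n n))))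
Vo : ∀ w -> Vz(sC w)≡(+ 2)^z w +z sz w
Vo 0 = Re
Vo 1 = Re
Vo 2 = Re
Vo(sC(sC(sC w)))= != cong₂(\ x y -> x +z + 4 *z y)(Vo(sC(sC w)))(Vo w)=! Zs.solve 3(\ p x y ->(Zs.con(+ 2)Zs.:*(Zs.con(+ 2)Zs.:* p)Zs.:+(Zs.:- x Zs.:- Zs.con(+ 2)Zs.:* y))Zs.:+ Zs.con(+ 4)Zs.:*(p Zs.:+ y)
 Zs.:= Zs.con(+ 2)Zs.:*(Zs.con(+ 2)Zs.:*(Zs.con(+ 2)Zs.:* p))Zs.:+(Zs.:-(Zs.:- x Zs.:- Zs.con(+ 2)Zs.:* y)Zs.:- Zs.con(+ 2)Zs.:* x))Re((+ 2)^z w)(sz(sC w))(sz w)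
f9 : ∀ i -> sz(i +n i)≡ Ar.u(i +n i)× sz(sC(i +n i))≡ -z Ar.u(sC(i +n i))
f9 z0 = Re , Re
f9(sC i)= sB(\ n -> sz(sC n)≡ Ar.u(sC n)× sz(sC(sC n))≡ -z Ar.u(sC(sC n)))(sy(su i i))(go(f9 i))
 where
 n = i +n i
 go : sz n ≡ Ar.u n × sz(sC n)≡ -z Ar.u(sC n)-> sz(sC(sC n))≡ Ar.u(sC(sC n))× sz(sC(sC(sC n)))≡ -z Ar.u(sC(sC(sC n)))
 go(e , ej)= != cong₂(\ x y -> -z x -z + 2 *z y)ej e =! fR(Ar.px n)(Ar.u n),
  != cong₂(\ x y -> -z(-z x -z + 2 *z y) -z + 2 *z x)ej e =! fS(Ar.px n)(Ar.u n)
  where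
  fR : ∀ x y -> -z(-z(x +z y)) -z + 2 *z y ≡ -z(+ 2 *z y)+z(x +z y)
  fR = Zs.solve 2(\ x y -> Zs.:-(Zs.:-(x Zs.:+ y))Zs.:- Zs.con(+ 2)Zs.:* y Zs.:= Zs.:-(Zs.con(+ 2)Zs.:* y)Zs.:+(x Zs.:+ y))Re
  fS : ∀ x y -> -z(-z(-z(x +z y)) -z + 2 *z y) -z + 2 *z(-z(x +z y))≡ -z(-z(+ 2 *z(x +z y))+z(-z(+ 2 *z y)+z(x +z y)))
  fS = Zs.solve 2(\ x y -> Zs.:-(Zs.:-(Zs.:-(x Zs.:+ y))Zs.:- Zs.con(+ 2)Zs.:* y)Zs.:- Zs.con(+ 2)Zs.:*(Zs.:-(x Zs.:+ y))Zs.:= Zs.:-(Zs.:-(Zs.con(+ 2)Zs.:*(x Zs.:+ y))Zs.:+(Zs.:-(Zs.con(+ 2)Zs.:* y)Zs.:+(x Zs.:+ y))))Re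
ou : ∀ b j -> oz(b ^z j)≈ oz b ^ j
ou b z0 = rR
ou b(sC j)= !~ oh b(b ^z j)~! co{oz b}(ou b j)
tU : ∀ k -> ∑(sC ⌊ k /2⌋)(\ l -> uC k l l)≈ oz(Vz(k +n k))
tU k = !~ TU k ~~(cy(sC k) {\ j -> oq((+ 4)// 1)^ j * Bn 1#((k -n j)+n(k -n j))j} {\ j -> oz(tz(k +n k)j)}\ j lt -> !~ cd(yY(ou(+ 4)j))(!~ Bi((k -n j)+n(k -n j))j ~! rx(cO(\ n -> oz(bin n j))(Se k j(sL lt))))~! yY(oh((+ 4)^z j)(bin(Sb(k +n k)j)j)))~~ yY(m4(sC k)(tz(k +n k)))~! rx(cO oz(Tz(k +n k)(sC k)(mJ(Nn k)(N1 k))))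
 where
 m4 : ∀ n f -> oz(Z.∑ n f)≈ ∑ n(\ i -> oz(f i))
 m4 z0 f = rR
 m4(sC n)f = !~ oi(f 0)(Z.∑ n(\ i -> f(sC i)))~! Cn{oz(f 0)}(m4 n(\ i -> f(sC i)))
tW : ∀ k -> t5(sC k)≈ oz(Ar.Si k)
tW 0 = sV 0((:- # 1q):+ # 0q := #(-q 1q))rR
tW 1 = !~ TW 0 ~! sV 0(# 1q :-(# 1q :+ # 0q):= # 0q)rR
tW 2 = !~ TW 1 ~! sV 0((:- # 1q):-((:- # 1q):+ # 0q):= # 0q)rR
tW 3 = !~ TW 2 ~~ Cn{wC 2 z0 0}(cc(tW 1))~! sV 0((:-(:- # 1q)):- # 0q := # 1q)rR
tW(sC(sC(sC(sC k))))= !~ TW(3 +n k)~~ Cn{wC(3 +n k)z0 0}(cc(TW(sC k)))~~ sV 2(\ w t ->(:-(:- w)):-(w :- t):= t)rR(wC(sC k)z0 0)(t5(sC k))~! tW k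
2^-ofℤ : ∀ k -> oz((+ 2)^z k)≈ 2^ k
2^-ofℤ k = !~ ou(+ 2)k ~! rR
tc : ∀ k t -> IsTraceT₂(2 *n sC(sC k))t -> t ≈ oz(Ar.a(sC k))
tc k t(d , f , M , lY , Mt , eq)= !~ eq ~~ tH ~~ Cg{ -(1# + 2^2k-1 κ)}(ca(!~ tU κ ~! VJ)(co{oq ½ * 2^ κ}(tW K)))~~ jx(2^ K)(oz(Ar.u j))(oz(Ar.Si K))~! yY l2
 where
 open TO k f M lY Mt
 K κ j : ℕ
 K = sC k
 κ = sC K
 j = sC(K +n K)
 VJ : oz(Vz(κ +n κ))≈ oq n2 *(2^ K * 2^ K)+ - oz(Ar.u j)
 VJ = !~ rx(cO oz(!= cO(\ n -> Vz(sC n))(su K K)=~ Vo j =! cO(\ t ->(+ 2)^z j +z t)(pS(f9 K))))~~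
  oi((+ 2)^z j)(-z Ar.u j)~! ca(!~ 2^-ofℤ j ~! co{oq n2}(xo(oq n2)K K))(og(Ar.u j))
 l2 : oz(Ar.a K)≈ - oz(Ar.u j)+ oz(Ar.Si K)* 2^ K + - 1#
 l2 = !~ rx(cO oz(Ar.Af K))~~ oi(-z Ar.u j +z Ar.Si K *z(+ 2)^z K)(-z 1ℤ)~! ca(!~ oi(-z Ar.u j)(Ar.Si K *z(+ 2)^z K)~! ca(og(Ar.u j))(!~ oh(Ar.Si K)((+ 2)^z K)~! co{oz(Ar.Si K)}(2^-ofℤ K)))(og 1ℤ)
 jx : ∀ p v s ->(oq n2 *(p * p)+ - v)+ oq ½ *(oq n2 * p)* s -(1# + oq ½ *((oq n2 * p)*(oq n2 * p)))≈ - v + s * p + - 1#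
 jx = sV 3(\ p v s ->(# n2 :*(p :* p):+ :- v):+ # ½ :*(# n2 :* p):* s :-(# 1q :+ # ½ :*((# n2 :* p):*(# n2 :* p))):= :- v :+ s :* p :+ :- # 1q)rR
private
 zo : ∀ k ->(Ar.a(sC k)≡ 0ℤ × sC(sC k)<n 6)⊎ 5 ≤n sC k
 zo 0 = iL(pF Ar.Am , xb 3 6 tt)
 zo 1 = iL(pF(pS Ar.Am), xb 4 6 tt)
 zo 2 = iL(pF(pS(pS Ar.Am)), xb 5 6 tt)
 zo 3 = iL(pS(pS(pS Ar.Am)), xb 6 6 tt)
 zo(sC(sC(sC(sC k))))= iR(me 5 k)
theorem1 :
 (∀ k k' -> 2 ≤n k -> 2 ≤n k' -> k ≢ k' ->
  ∀ t t' -> IsTraceT₂(2 *n k)t -> IsTraceT₂(2 *n k')t' -> t ≈ t' -> t ≈ 0#)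
 ×(∀ k -> 2 ≤n k -> ∀ t -> IsTraceT₂(2 *n k)t ->(t ≈ 0#)⇔(k <n 6 ⊎ k ≡ 7))
theorem1 = Dt , zm
 where
 Dt : ∀ k k' -> 2 ≤n k -> 2 ≤n k' -> k ≢ k' -> ∀ t t' -> IsTraceT₂(2 *n k)t -> IsTraceT₂(2 *n k')t' -> t ≈ t' -> t ≈ 0#
 Dt(sC(sC k))(sC(sC k'))(ss(ss _))(ss(ss _))ne t t' h h' eq = go(zo k)(zo k')
  where
  l3 : Ar.a(sC k)≡ Ar.a(sC k')
  l3 = Oi(!~ yY(tc k t h)~~ eq ~! tc k' t' h')
  go :(Ar.a(sC k)≡ 0ℤ × sC(sC k)<n 6)⊎ 5 ≤n sC k ->(Ar.a(sC k')≡ 0ℤ × sC(sC k')<n 6)⊎ 5 ≤n sC k' -> t ≈ 0#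
  go(iL(z , _))_ = !~ tc k t h ~! rx(cO oz z)
  go(iR _)(iL(z , _))= !~ eq ~~ tc k' t' h' ~! rx(cO oz z)
  go(iR l)(iR l')= ⊥-elim(ne(cO sC(Ar.ai(sC k)(sC k')l l' l3)))
 zm : ∀ k -> 2 ≤n k -> ∀ t -> IsTraceT₂(2 *n k)t ->(t ≈ 0#)⇔(k <n 6 ⊎ k ≡ 7)
 zm(sC(sC k))(ss(ss _))t h = mk⇔ to Fr
  where
  a0 : t ≈ 0# -> Ar.a(sC k)≡ 0ℤ
  a0 t0 = Oi(!~ yY(tc k t h)~! t0)
  to : t ≈ 0# -> sC(sC k)<n 6 ⊎ sC(sC k)≡ 7
  to t0 = go(zo k)
   where
   go :(Ar.a(sC k)≡ 0ℤ × sC(sC k)<n 6)⊎ 5 ≤n sC k -> sC(sC k)<n 6 ⊎ sC(sC k)≡ 7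
   go(iL(_ , lt))= iL lt
   go(iR l)= iR(cO sC(Ar.d4(sC k)l(a0 t0)))
  bk : sC(sC k)<n 6 ⊎ sC(sC k)≡ 7 -> Ar.a(sC k)≡ 0ℤ
  bk(iL lt)= go(zo k)
   where
   go :(Ar.a(sC k)≡ 0ℤ × sC(sC k)<n 6)⊎ 5 ≤n sC k -> Ar.a(sC k)≡ 0ℤ
   go(iL(z , _))= z
   go(iR l)= ⊥-elim(ℕₚ.<⇒≱ lt(ss l))
  bk(iR e)= != cO Ar.a(st e)=! Ar.A6
  Fr : sC(sC k)<n 6 ⊎ sC(sC k)≡ 7 -> t ≈ 0#
  Fr c = !~ tc k t h ~! rx(cO oz(bk c))
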